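{- There is an algorithm that solves the APSP problem correctly on every input consisting of a finite mixed graph $G=(V,E,A)$ with $n=|V|$ vertices and a weight function $c:E\cup A\to\mathbb{R}$, and that runs in time $O(2^{k_2}\cdot n^4)$ whenever every weak block of any strongly connected component of $G$ contains at most $k_2$ negative trees. The constant in the $O$ is absolute (independent of $G$, $c$, $k_2$, $n$).
   Context: A mixed graph $G=(V,E,A)$ has vertex set $V$, a set $E$ of undirected edges and a set $A$ of directed edges (arcs). Paths and cycles in $G$ may traverse undirected edges in either direction and arcs only in their direction; they have no repeated vertices (except that a cycle returns to its start), and a cycle does not use the same undirected edge twice. The weight function $c$ is conservative on $G$ if $G$ has no cycle with negative total weight. The APSP problem for the mixed graph $(G,c)$: first decide whether $c$ is conservative on $G$; if it is, then for every ordered pair $s\ne t$ of vertices determine the minimum total weight of a path from $s$ to $t$ ($+\infty$ if there is none). Each undirected edge of nonnegative weight may be replaced by two opposite arcs with the same weight, so every undirected edge may be assumed to have negative weight. The negative trees of a mixed graph are then the nontrivial (having at least one edge) connected components of the undirected graph formed by its undirected edges, that is, by the undirected edges of negative weight. It is supposed that this undirected graph is a forest (otherwise $c$ is not conservative and the algorithm stops with this answer). Strongly connected components of $G$ are the classes of the relation "there is a path from $s$ to $t$ and a path from $t$ to $s$", taken with the edges and arcs they span. The weak blocks of a mixed graph are the parts corresponding to the 2-connected blocks of its underlying undirected graph (arcs replaced by undirected edges). The negative trees contained in a weak block $B$ are the negative trees of $B$ regarded as a mixed graph itself. It is assumed that there are no loops and no parallel copies of superfluous arcs or edges, so the number of edges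 and arcs is $O(n^2)$. Running time counts elementary steps, an arithmetic operation or comparison on real weights counting as one step. -}

module Defs where

open import Algebra.Structures using (IsCommutativeRing)
open import Data.Bool using (Bool; true; false; if_then_else_; _∧_) renaming (not to ¬ᵇ_)
open import Data.Fin using (Fin; toℕ; fromℕ<; remQuot)
open import Data.Fin.Subset using (Subset; _∈_; _⊆_; Nonempty; _-_)
open import Data.List using (List; []; _∷_; _++_; length)
open import Data.List.Relation.Unary.All using (All)
open import Data.List.Relation.Unary.AllPairs using (AllPairs)
open import Data.List.Relation.Unary.Unique.Propositional using (Unique)
open import Data.Maybe using (Maybe; just; nothing; is-just; fromMaybe)
open import Data.Nat as ℕ using (ℕ; zero; suc)
open import Data.Product using (∃; ∃-syntax; _×_; _,_; proj₁; proj₂; uncurry)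
open import Data.Sum using (_⊎_)
open import Function using (_⇔_)
open import Relation.Binary.Construct.Closure.ReflexiveTransitive using (Star; ε; _◅_)
import Relation.Binary.Construct.NonStrictToStrict as NonStrictToStrict
open import Relation.Binary.PropositionalEquality using (_≡_; _≢_)
open import Relation.Binary.Structures using (IsDecTotalOrder)
open import Relation.Nullary using (¬_; Dec; yes; no; does)

-- The library has no real numbers, so they are given by their classical
-- axioms: a complete ordered field (unique up to isomorphism).  The order is
-- decidable because a real RAM compares reals in one step.
record Reals : Set₁ where
  infix  8 -_
  infixl 7 _*_
  infixl 6 _+_
  infix  4 _≤_
  field
    Carrier           : Set
    _+_ _*_           : Carrier → Carrier → Carrier
    -_ _⁻¹            : Carrier → Carrier
    0# 1#             : Carrier
    _≤_               : Carrier → Carrier → Set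
    isCommutativeRing : IsCommutativeRing _≡_ _+_ _*_ -_ 0# 1#
    0≢1               : 0# ≢ 1#
    *-inverseʳ        : ∀ {x} → x ≢ 0# → x * (x ⁻¹) ≡ 1#
    0⁻¹≡0             : 0# ⁻¹ ≡ 0#
    isDecTotalOrder   : IsDecTotalOrder _≡_ _≤_
    +-monoʳ-≤         : ∀ x {y z} → y ≤ z → x + y ≤ x + z
    *-nonneg          : ∀ {x y} → 0# ≤ x → 0# ≤ y → 0# ≤ x * y

  UpperBound : (Carrier → Set) → Carrier → Set
  UpperBound P b = ∀ {x} → P x → x ≤ b

  field
    supremum : (P : Carrier → Set) → ∃ P → ∃ (UpperBound P) →
               ∃[ s ] UpperBound P s × (∀ {b} → UpperBound P b → s ≤ b)

  open IsDecTotalOrder isDecTotalOrder public using (_≤?_)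
  open NonStrictToStrict _≡_ _≤_ public using (_<_)

-- A mixed graph on the vertex set Fin n together with its weight function:
-- `edge u v` (`arc u v`) is `just` the weight of the undirected edge {u,v}
-- (of the arc from u to v), or `nothing` if there is none.  So there are no
-- loops and no parallel copies, but an edge {u,v} and the arcs uv and vu may
-- all be present.
record MixedGraph (ℝ : Reals) (n : ℕ) : Set where
  open Reals ℝ
  field
    edge      : Fin n → Fin n → Maybe Carrier
    arc       : Fin n → Fin n → Maybe Carrier
    edge-sym  : ∀ u v → edge u v ≡ edge v u
    edge-loop : ∀ v → edge v v ≡ nothing
    arc-loop  : ∀ v → arc v v ≡ nothing

module _ {ℝ : Reals} {n : ℕ} (G : MixedGraph ℝ n) where
  open Reals ℝ
  open MixedGraph G

  data Step (u v : Fin n) : Set where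
    along-edge : ∀ w → edge u v ≡ just w → Step u v
    along-arc  : ∀ w → arc u v ≡ just w → Step u v

  Walk : Fin n → Fin n → Set
  Walk = Star Step

  stepWeight : ∀ {u v} → Step u v → Carrier
  stepWeight (along-edge w _) = w
  stepWeight (along-arc w _)  = w

  weight : ∀ {s t} → Walk s t → Carrier
  weight ε       = 0#
  weight (e ◅ p) = stepWeight e + weight p

  -- All vertices of the walk, in order, except the last one.
  initVertices : ∀ {s t} → Walk s t → List (Fin n)
  initVertices ε             = []
  initVertices (_◅_ {u} e p) = u ∷ initVertices p

  -- The traversals of undirected edges, each as (tail , head).
  edgeTraversals : ∀ {s t} → Walk s t → List (Fin n × Fin n)
  edgeTraversals ε                                = []
  edgeTraversals (_◅_ {u} {v} (along-edge _ _) p) = (u , v) ∷ edgeTraversals p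
  edgeTraversals (along-arc _ _ ◅ p)              = edgeTraversals p

  SameEdge : Fin n × Fin n → Fin n × Fin n → Set
  SameEdge (a , b) (c , d) = (a ≡ c × b ≡ d) ⊎ (a ≡ d × b ≡ c)

  IsPath : ∀ {s t} → Walk s t → Set
  IsPath {t = t} p = Unique (initVertices p ++ t ∷ [])

  IsCycle : ∀ {v} → Walk v v → Set
  IsCycle p = initVertices p ≢ []
            × Unique (initVertices p)
            × AllPairs (λ e f → ¬ SameEdge e f) (edgeTraversals p)

  Conservative : Set
  Conservative = ∀ {v} (p : Walk v v) → IsCycle p → ¬ (weight p < 0#)

  -- `nothing` stands for +∞.
  IsDistance : Fin n → Fin n → Maybe Carrier → Set
  IsDistance s t (just d) = (∃[ p ] IsPath {s} {t} p × weight p ≡ d)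
                          × (∀ (p : Walk s t) → IsPath p → d ≤ weight p)
  IsDistance s t nothing  = ∀ (p : Walk s t) → ¬ IsPath p

  Reachable : Fin n → Fin n → Set
  Reachable s t = ∃[ p ] IsPath {s} {t} p

  IsStrongComponent : Subset n → Set
  IsStrongComponent S =
    ∃[ s ] (∀ v → v ∈ S ⇔ (Reachable s v × Reachable v s))

  Adjacent : Fin n → Fin n → Set
  Adjacent u v = Step u v ⊎ Step v u

  NegAdjacent : Fin n → Fin n → Set
  NegAdjacent u v = ∃[ w ] edge u v ≡ just w × w < 0#

  -- A relation on vertices, restricted to pairs in X.
  Within : Subset n → (Fin n → Fin n → Set) → Fin n → Fin n → Set
  Within X R u v = u ∈ X × v ∈ X × R u v

  -- The empty set counts as connected.
  IsConnected : Subset n → Set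
  IsConnected X = ∀ {u v} → u ∈ X → v ∈ X → Star (Within X Adjacent) u v

  -- Connected and without a cut vertex; a single vertex and both ends of a
  -- bridge qualify.
  Is2Connected : Subset n → Set
  Is2Connected X =
    Nonempty X × IsConnected X × (∀ v → v ∈ X → IsConnected (X - v))

  -- B is the vertex set of a block of the subgraph spanned by S.  Blocks are
  -- induced subgraphs, so the vertex set determines the block.
  IsWeakBlockOf : Subset n → Subset n → Set
  IsWeakBlockOf S B =
      B ⊆ S × Is2Connected B
    × (∀ {X} → X ⊆ S → Is2Connected X → B ⊆ X → X ⊆ B)

  -- T is the vertex set of a nontrivial component of the graph formed by the
  -- negative undirected edges spanned by B.
  IsNegativeTreeOf : Subset n → Subset n → Set
  IsNegativeTreeOf B T =
    ∃[ r ] (∃[ u ] Within B NegAdjacent r u)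
         × (∀ v → v ∈ T ⇔ Star (Within B NegAdjacent) r v)

  WeakBlocksHaveAtMost_NegativeTrees : ℕ → Set
  WeakBlocksHaveAtMost_NegativeTrees k =
    ∀ {S B} → IsStrongComponent S → IsWeakBlockOf S B →
    ∀ Ts → Unique Ts → All (IsNegativeTreeOf B) Ts → length Ts ℕ.≤ k

-- Memory consists of arrays of natural numbers and arrays of reals, both
-- indexed by ℕ.  Array names are literals of the program, so a program uses
-- finitely many arrays; scalar variables are cells with a literal index.
-- Unit-cost multiplication of naturals is deliberately missing: with it, a
-- unit-cost machine could do massively parallel work on huge numbers.
-- Reals have no conversion to naturals, and the only real literals are 0 and 1.
-- Subtraction of naturals is truncated, and a real divided by 0 is 0.

infixl 6 _⊕_ _⊖_
infix  9 _[_]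

data NatExp : Set where
  lit     : ℕ → NatExp
  _[_]    : ℕ → NatExp → NatExp
  _⊕_ _⊖_ : NatExp → NatExp → NatExp

data RealExp : Set where
  zeroʳ oneʳ          : RealExp
  _[_]ʳ               : ℕ → NatExp → RealExp
  _⊕ʳ_ _⊖ʳ_ _⊗ʳ_ _⊘ʳ_ : RealExp → RealExp → RealExp

data Test : Set where
  _≤ⁿ_ : NatExp → NatExp → Test
  _≤ʳ_ : RealExp → RealExp → Test
  notᵗ : Test → Test

infix  3 _[_]≔_ _[_]≔ʳ_
infixr 2 _⨾_

data Program : Set where
  skip        : Program
  _[_]≔_      : ℕ → NatExp → NatExp → Program
  _[_]≔ʳ_     : ℕ → NatExp → RealExp → Program
  _⨾_         : Program → Program → Program
  ifᵖ         : Test → Program → Program → Program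
  while       : Test → Program → Program

-- Every operation, memory access and literal in an expression takes one step.

costⁿ : NatExp → ℕ
costⁿ (lit _)   = 1
costⁿ (_ [ i ]) = suc (costⁿ i)
costⁿ (d ⊕ e)   = suc (costⁿ d ℕ.+ costⁿ e)
costⁿ (d ⊖ e)   = suc (costⁿ d ℕ.+ costⁿ e)

costʳ : RealExp → ℕ
costʳ zeroʳ      = 1
costʳ oneʳ       = 1
costʳ (_ [ i ]ʳ) = suc (costⁿ i)
costʳ (d ⊕ʳ e)   = suc (costʳ d ℕ.+ costʳ e)
costʳ (d ⊖ʳ e)   = suc (costʳ d ℕ.+ costʳ e)
costʳ (d ⊗ʳ e)   = suc (costʳ d ℕ.+ costʳ e)
costʳ (d ⊘ʳ e)   = suc (costʳ d ℕ.+ costʳ e)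

costᵗ : Test → ℕ
costᵗ (d ≤ⁿ e) = suc (costⁿ d ℕ.+ costⁿ e)
costᵗ (d ≤ʳ e) = suc (costʳ d ℕ.+ costʳ e)
costᵗ (notᵗ b) = suc (costᵗ b)

Memory : Set → Set
Memory A = ℕ → ℕ → A

update : {A : Set} → Memory A → ℕ → ℕ → A → Memory A
update m a i x b j = if does (a ℕ.≟ b) ∧ does (i ℕ.≟ j) then x else m b j

module _ (ℝ : Reals) where
  open Reals ℝ

  record State : Set where
    constructor ⟨_,_⟩
    field
      nats  : Memory ℕ
      reals : Memory Carrier

module _ {ℝ : Reals} where
  open Reals ℝ
  open State

  evalⁿ : State ℝ → NatExp → ℕ
  evalⁿ σ (lit k)   = k
  evalⁿ σ (a [ i ]) = nats σ a (evalⁿ σ i)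
  evalⁿ σ (d ⊕ e)   = evalⁿ σ d ℕ.+ evalⁿ σ e
  evalⁿ σ (d ⊖ e)   = evalⁿ σ d ℕ.∸ evalⁿ σ e

  evalʳ : State ℝ → RealExp → Carrier
  evalʳ σ zeroʳ      = 0#
  evalʳ σ oneʳ       = 1#
  evalʳ σ (a [ i ]ʳ) = reals σ a (evalⁿ σ i)
  evalʳ σ (d ⊕ʳ e)   = evalʳ σ d + evalʳ σ e
  evalʳ σ (d ⊖ʳ e)   = evalʳ σ d + - evalʳ σ e
  evalʳ σ (d ⊗ʳ e)   = evalʳ σ d * evalʳ σ e
  evalʳ σ (d ⊘ʳ e)   = evalʳ σ d * (evalʳ σ e ⁻¹)

  evalᵗ : State ℝ → Test → Bool
  evalᵗ σ (d ≤ⁿ e) = does (evalⁿ σ d ℕ.≤? evalⁿ σ e)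
  evalᵗ σ (d ≤ʳ e) = does (evalʳ σ d ≤? evalʳ σ e)
  evalᵗ σ (notᵗ b) = ¬ᵇ evalᵗ σ b

  -- Run p σ τ t: started in state σ, the program p halts in state τ after
  -- t steps.
  data Run : Program → State ℝ → State ℝ → ℕ → Set where
    run-skip : ∀ {σ} → Run skip σ σ 1
    run-nat  : ∀ {σ a i e} →
      Run (a [ i ]≔ e) σ
          ⟨ update (nats σ) a (evalⁿ σ i) (evalⁿ σ e) , reals σ ⟩
          (suc (costⁿ i ℕ.+ costⁿ e))
    run-real : ∀ {σ a i e} →
      Run (a [ i ]≔ʳ e) σ
          ⟨ nats σ , update (reals σ) a (evalⁿ σ i) (evalʳ σ e) ⟩
          (suc (costⁿ i ℕ.+ costʳ e))
    run-seq  : ∀ {p q ρ σ τ s t} →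
      Run p ρ σ s → Run q σ τ t → Run (p ⨾ q) ρ τ (s ℕ.+ t)
    run-if-true : ∀ {b p q σ τ t} → evalᵗ σ b ≡ true →
      Run p σ τ t → Run (ifᵖ b p q) σ τ (suc (costᵗ b ℕ.+ t))
    run-if-false : ∀ {b p q σ τ t} → evalᵗ σ b ≡ false →
      Run q σ τ t → Run (ifᵖ b p q) σ τ (suc (costᵗ b ℕ.+ t))
    run-while-true : ∀ {b p ρ σ τ s t} → evalᵗ ρ b ≡ true →
      Run p ρ σ s → Run (while b p) σ τ t →
      Run (while b p) ρ τ (suc (costᵗ b ℕ.+ (s ℕ.+ t)))
    run-while-false : ∀ {b p σ} → evalᵗ σ b ≡ false →
      Run (while b p) σ σ (suc (costᵗ b))

-- n × n matrices are stored row by row: entry (u , v) at index n * u + v.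

matrixCell : ∀ {n} {A : Set} → (Fin n → Fin n → Maybe A) → ℕ → Maybe A
matrixCell {n} M i with i ℕ.<? n ℕ.* n
... | yes i<n² = uncurry M (remQuot n (fromℕ< i<n²))
... | no  _    = nothing

module _ {ℝ : Reals} {n : ℕ} (G : MixedGraph ℝ n) where
  open Reals ℝ
  open MixedGraph G
  open State

  presence : Maybe Carrier → ℕ
  presence m = if is-just m then 1 else 0

  -- Natural array 0 holds n in cell 0; natural arrays 1 and 2 tell which
  -- edges and arcs are present, real arrays 0 and 1 give their weights.
  -- All other cells are 0.
  inputNats : Memory ℕ
  inputNats 0 0 = n
  inputNats 1 i = presence (matrixCell edge i)
  inputNats 2 i = presence (matrixCell arc i)
  inputNats _ _ = 0

  inputReals : Memory Carrier
  inputReals 0 i = fromMaybe 0# (matrixCell edge i)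
  inputReals 1 i = fromMaybe 0# (matrixCell arc i)
  inputReals _ _ = 0#

  input : State ℝ
  input = ⟨ inputNats , inputReals ⟩

  -- Cell 0 of natural array 3: 1 for "conservative", 0 for "not
  -- conservative".
  verdict : State ℝ → ℕ
  verdict τ = nats τ 3 0

  -- Natural array 4: 0 for +∞, any other value for a finite distance, which
  -- is then found in real array 2.
  outputDistance : State ℝ → Fin n → Fin n → Maybe Carrier
  outputDistance τ s t with nats τ 4 (n ℕ.* toℕ s ℕ.+ toℕ t)
  ... | zero  = nothing
  ... | suc _ = just (reals τ 2 (n ℕ.* toℕ s ℕ.+ toℕ t))

  SolvesAPSP : State ℝ → Set
  SolvesAPSP τ =
      (verdict τ ≡ 1 × Conservative G
        × (∀ s t → s ≢ t → IsDistance G s t (outputDistance τ s t)))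
    ⊎ (verdict τ ≡ 0 × ¬ Conservative G)

-- Two vertices are inseparable if they lie in one strong component and no third
-- vertex separates them in its underlying graph.  A weak block is a maximal set
-- of pairwise inseparable vertices, and a path between two inseparable vertices
-- stays in their block.  The negative trees of the blocks are coloured so that
-- trees of the same block differ, which takes at most k₂ colours.
--
-- If c is conservative, a walk that uses every negative edge at most once
-- contains a path of no larger weight, since it only has to be freed of cycles.
-- Such walks are combined from paths without negative edges and from tree paths
-- of distinct colours, and a dynamic program over the sets of colours finds the
-- least weights of these combinations.  Conversely, let no closed combination
-- be negative.  Then a path inside a block weighs at least as much as some
-- combination: consider its part between two vertices of a tree.  An excursion
-- from the tree that starts in x and ends in y weighs at least minus the weight
-- of the tree path from x to y; since a closed walk in a forest passes each edge
-- in both directions, the part weighs at least as much as the tree path.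
-- As each cycle lies inside a block, looking for negative closed combinations
-- decides whether c is conservative.
--
-- Distances inside a strong component are sums of distances between separating
-- vertices.  An arc from one component to another lies on no cycle, so these arcs
-- can be added one by one, each being used at most once.
module Submission where

open import Defs
open import Algebra.Structures using (IsCommutativeRing)
open import Relation.Binary.Structures using (IsDecTotalOrder)
open import Data.Bool using (Bool; true; false; if_then_else_; _∧_; _∨_; _xor_; not; T)
open import Data.Empty using (⊥; ⊥-elim)
open import Data.Unit using (⊤; tt)
open import Data.Bool.Properties using (not-involutive)
open import Data.Fin using (Fin; zero; suc; toℕ; fromℕ<; remQuot; combine)
open import Data.Fin.Properties using (toℕ<n; toℕ-injective; toℕ-fromℕ<)
open import Data.List using (List; []; _∷_; _++_; length; map) renaming (lookup to lookupˡ)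
open import Data.List.Properties using (++-assoc; ++-identityʳ; length-map)
open import Data.Maybe.Properties using (just-injective)
open import Data.List.Membership.Propositional using () renaming (_∈_ to _∈ˡ_)
open import Data.List.Relation.Unary.All using (All; []; _∷_)
open import Data.List.Relation.Unary.Any using (here; there; any?)
open import Data.List.Relation.Unary.AllPairs using (AllPairs; []; _∷_)
open import Data.List.Relation.Unary.Unique.Propositional using (Unique)
open import Data.Maybe using (Maybe; just; fromMaybe)
open import Data.Nat using (ℕ; zero; suc; _≤_; _<_; z≤n; s≤s; _+_; _*_; _∸_; _^_; _≤?_; _≟_; _≡ᵇ_; _≤ᵇ_; _⊔_; NonZero; >-nonZero; ⌊_/2⌋; _<?_)
open import Data.Product using (Σ; ∃-syntax; _×_; _,_; proj₁; proj₂; uncurry)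
open import Data.Sum using (_⊎_; inj₁; inj₂; [_,_]′)
open import Function using (id; mk⇔; case_of_)
open import Relation.Binary.Construct.Closure.ReflexiveTransitive using (Star; ε; _◅_; _◅◅_)
open import Relation.Binary.PropositionalEquality
  using (_≡_; _≢_; refl; sym; trans; cong; cong₂; subst; subst₂)
open import Relation.Binary.Definitions using (tri<; tri≈; tri>)
open import Relation.Nullary using (¬_; Dec; yes; no; does)
open import Relation.Nullary.Decidable using (dec-true; dec-false; _×-dec_; _⊎-dec_)
open import Data.Product.Properties using (≡-dec)
open import Data.List.Membership.Propositional.Properties using (∈-++⁺ˡ; ∈-++⁺ʳ; ∈-++⁻; ∈-∃++)
open import Data.Fin.Subset using (Subset; _∈_; _⊆_; _-_; ⁅_⁆)
open import Data.Fin.Subset.Properties using (p─q⊆p; x∈p∧x≢y⇒x∈p-y; _∈?_)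
open import Data.Vec using (tabulate) renaming (_∷_ to _∷ᵛ_; there to there[]=)
open import Data.Vec.Properties using (lookup∘tabulate; lookup⇒[]=; []=⇒lookup)
import Data.List.Relation.Unary.AllPairs
module AllPairs′ = Data.List.Relation.Unary.AllPairs
import Data.List.Relation.Unary.All
import Data.List.Relation.Unary.All.Properties
import Data.List.Relation.Unary.AllPairs.Properties
import Data.Fin.Properties
import Data.Nat.Properties
module All′ = Data.List.Relation.Unary.All
module Allₚ = Data.List.Relation.Unary.All.Properties
module AllPairsₚ = Data.List.Relation.Unary.AllPairs.Properties
module Finₚ = Data.Fin.Properties
module ℕₚ = Data.Nat.Properties

-- Programs whose loops are bounded by the number of vertices, of colours, or of
-- sets of colours (masks)

-- Lower bounds cannot rest on conservativity, which is still unknown while the tables are filled.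
-- They are derived from the nonnegativity of closed combinations alone, and this forces one
-- induction for two statements: excursions are bounded by combinations for shorter walks, and
-- combinations need the minimality of tree paths, which depends on the excursions. Upper bounds, in
-- turn, are claimed only under the hypothesis that the weights are conservative.
--
-- Blocks are never built as data. A pair of distinct inseparable vertices determines its block, and
-- if both lie in one tree it also determines a negative tree of that block; so colours are attached
-- to pairs. A new tree gets the largest colour of its block plus one. Hence no colour is skipped,
-- and a block in which the last colour occurs has at least as many trees as there are colours.
--
-- The time bound is read off the nesting of the loops. The matrix operations for one mask take n³
-- steps; the fourth power of n comes from work without masks: connectivity after the deletion of
-- each vertex, merging of trees, colouring of pairs, and arcs between components.

-- Arrays of naturals: 0 to 4 as the input and the output prescribe; flags of
-- the tables 5 to 9 (see present); 10 and 11 multiples of n and n²; 12 pairs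
-- that are not inseparable; 13 labels of the trees; 14 colours; 15 bits of the
-- current mask; 16 the numbers 2^j n²; 17 and 18 numbers of colours and masks;
-- 19 offset of the current mask; 20 n²; 21 set if not conservative;
-- 23 to 27 auxiliary; 30 to 35 loop counters.
-- Tables: 5 distances without negative edges, 6 reachability, 7 connectivity
-- without a vertex, 8 and 9 the dynamic program, and the result, with flags 4
-- and values 2.  Array 22 of reals holds the weights of the tree paths.
data Size : Set where
  vertices colours masks : Size

sizeCell : Size → ℕ
sizeCell vertices = 0
sizeCell colours  = 17
sizeCell masks    = 18

data Command : Set where
  nop  : Command
  setN : ℕ → NatExp → NatExp → Command
  setR : ℕ → NatExp → RealExp → Command
  _⨟_  : Command → Command → Command
  cond : Test → Command → Command → Command
  for  : ℕ → Size → Command → Command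

infixr 2 _⨟_

infix 30 #_
#_ : ℕ → NatExp
# a = a [ lit 0 ]

forTest : ℕ → Size → Test
forTest i b = (# i ⊕ lit 1) ≤ⁿ # sizeCell b

compile : Command → Program
compile nop          = skip
compile (setN a i e) = a [ i ]≔ e
compile (setR a i e) = a [ i ]≔ʳ e
compile (p ⨟ q)      = compile p ⨾ compile q
compile (cond t p q) = ifᵖ t (compile p) (compile q)
compile (for i b p)  = (i [ lit 0 ]≔ lit 0) ⨾ while (forTest i b) (compile p ⨾ (i [ lit 0 ]≔ # i ⊕ lit 1))

writesN : ℕ → Command → Bool
writesN a nop          = false
writesN a (setN b _ _) = b ≡ᵇ a
writesN a (setR _ _ _) = false
writesN a (p ⨟ q)      = writesN a p ∨ writesN a q
writesN a (cond _ p q) = writesN a p ∨ writesN a q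
writesN a (for i _ p)  = (i ≡ᵇ a) ∨ writesN a p

writesR : ℕ → Command → Bool
writesR a nop          = false
writesR a (setN _ _ _) = false
writesR a (setR b _ _) = b ≡ᵇ a
writesR a (p ⨟ q)      = writesR a p ∨ writesR a q
writesR a (cond _ p q) = writesR a p ∨ writesR a q
writesR a (for _ _ p)  = writesR a p

-- A body that leaves the counter and the bound of its loop alone makes the number of rounds equal
-- to the initial value of the bound. For a concrete program the condition computes, so it is proved
-- by `refl`.
wellFormed : Command → Bool
wellFormed nop          = true
wellFormed (setN _ _ _) = true
wellFormed (setR _ _ _) = true
wellFormed (p ⨟ q)      = wellFormed p ∧ wellFormed q
wellFormed (cond _ p q) = wellFormed p ∧ wellFormed q
wellFormed (for i b p)  = (not (i ≡ᵇ sizeCell b) ∧ not (writesN i p)) ∧ (not (writesN (sizeCell b) p) ∧ wellFormed p)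

∨-falseˡ : ∀ {x y} → (x ∨ y) ≡ false → x ≡ false
∨-falseˡ {false} _ = refl
∨-falseʳ : ∀ {x y} → (x ∨ y) ≡ false → y ≡ false
∨-falseʳ {false} e = e
∧-trueˡ : ∀ {x y} → (x ∧ y) ≡ true → x ≡ true
∧-trueˡ {true} _ = refl
∧-trueʳ : ∀ {x y} → (x ∧ y) ≡ true → y ≡ true
∧-trueʳ {true} e = e
not-true : ∀ {x} → not x ≡ true → x ≡ false
not-true {false} _ = refl

≡ᵇ-refl : ∀ a → (a ≡ᵇ a) ≡ true
≡ᵇ-refl zero    = refl
≡ᵇ-refl (suc a) = ≡ᵇ-refl a

≢⇒≡ᵇ-false : ∀ {i j} → i ≢ j → (i ≡ᵇ j) ≡ false
≢⇒≡ᵇ-false {i} {j} ne with i ≡ᵇ j in eq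
... | true  = ⊥-elim (ne (ℕₚ.≡ᵇ⇒≡ i j (subst T (sym eq) tt)))
... | false = refl

update-same : ∀ {A : Set} (m : Memory A) a i x → update m a i x a i ≡ x
update-same m a i x rewrite ≡ᵇ-refl a | ≡ᵇ-refl i = refl

update-array : ∀ {A : Set} (m : Memory A) a i x b j → (a ≡ᵇ b) ≡ false → update m a i x b j ≡ m b j
update-array m a i x b j e rewrite e = refl

update-cell : ∀ {A : Set} (m : Memory A) a i x j → i ≢ j → update m a i x a j ≡ m a j
update-cell m a i x j ne rewrite ≡ᵇ-refl a | ≢⇒≡ᵇ-false ne = refl

update-case : ∀ {A : Set} (m : Memory A) a i x j →
              (i ≡ j × update m a i x a j ≡ x) ⊎ (update m a i x a j ≡ m a j)
update-case m a i x j with i ≟ j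
... | yes refl = inj₁ (refl , update-same m a i x)
... | no ne    = inj₂ (update-cell m a i x j ne)

uses : Size → Command → Bool
uses z nop          = false
uses z (setN _ _ _) = false
uses z (setR _ _ _) = false
uses z (p ⨟ q)      = uses z p ∨ uses z q
uses z (cond _ p q) = uses z p ∨ uses z q
uses z (for _ b p)  = (sizeCell b ≡ᵇ sizeCell z) ∨ uses z p

bound : (Size → ℕ) → Command → ℕ
bound v nop          = 1
bound v (setN a i e) = suc (costⁿ i + costⁿ e)
bound v (setR a i e) = suc (costⁿ i + costʳ e)
bound v (p ⨟ q)      = bound v p + bound v q
bound v (cond t p q) = suc (costᵗ t) + (bound v p + bound v q)
-- Setting the counter takes 3 steps, each test with the step of `while` takes 8, and each increment
-- 6. There is one test more than there are rounds, so the constants are 11 = 3 + 8 and 14 = 8 + 6.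
bound v (for i b p)  = 11 + v b * (14 + bound v p)

degree : Size → Command → ℕ
degree z nop          = 0
degree z (setN _ _ _) = 0
degree z (setR _ _ _) = 0
degree z (p ⨟ q)      = degree z p ⊔ degree z q
degree z (cond _ p q) = degree z p ⊔ degree z q
degree z (for _ b p)  = (if sizeCell b ≡ᵇ sizeCell z then 1 else 0) + degree z p

coefficient : Command → ℕ
coefficient nop          = 1
coefficient (setN a i e) = suc (costⁿ i + costⁿ e)
coefficient (setR a i e) = suc (costⁿ i + costʳ e)
coefficient (p ⨟ q)      = coefficient p + coefficient q
coefficient (cond t p q) = suc (costᵗ t) + (coefficient p + coefficient q)
-- 25 = 11 + 14: as every size is at least 1, the 11 outside the product is absorbed into it.
coefficient (for i b p)  = 25 + coefficient p

module _ (v : Size → ℕ) (1≤v : ∀ z → 1 ≤ v z) where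
  monomial : ℕ → ℕ → ℕ → ℕ
  monomial a b c = v vertices ^ a * (v colours ^ b * v masks ^ c)

  monomialOf : Command → ℕ
  monomialOf p = monomial (degree vertices p) (degree colours p) (degree masks p)

  private
    instance
      nz : ∀ {z} → NonZero (v z)
      nz {z} = >-nonZero (1≤v z)

  monomial-mono : ∀ {a b c a' b' c'} → a ≤ a' → b ≤ b' → c ≤ c' → monomial a b c ≤ monomial a' b' c'
  monomial-mono p q r = ℕₚ.*-mono-≤ (ℕₚ.^-monoʳ-≤ (v vertices) p)
    (ℕₚ.*-mono-≤ (ℕₚ.^-monoʳ-≤ (v colours) q) (ℕₚ.^-monoʳ-≤ (v masks) r))

  1≤monomial : ∀ a b c → 1 ≤ monomial a b c
  1≤monomial a b c = monomial-mono {0} {0} {0} {a} {b} {c} z≤n z≤n z≤n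

  private
    const-≤ : ∀ k {m} → 1 ≤ m → k ≤ k * m
    const-≤ k {m} le = subst (_≤ k * m) (ℕₚ.*-identityʳ k) (ℕₚ.*-monoʳ-≤ k {1} {m} le)

    seq-≤ : ∀ p q → monomialOf p ≤ monomialOf (p ⨟ q) × monomialOf q ≤ monomialOf (p ⨟ q)
    seq-≤ p q = monomial-mono {degree vertices p} {degree colours p} {degree masks p}
                  (ℕₚ.m≤m⊔n _ _) (ℕₚ.m≤m⊔n _ _) (ℕₚ.m≤m⊔n _ _)
              , monomial-mono {degree vertices q} {degree colours q} {degree masks q}
                  (ℕₚ.m≤n⊔m (degree vertices p) _) (ℕₚ.m≤n⊔m (degree colours p) _) (ℕₚ.m≤n⊔m (degree masks p) _)

    both-≤ : ∀ p q → bound v p ≤ coefficient p * monomialOf p → bound v q ≤ coefficient q * monomialOf q →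
             bound v p + bound v q ≤ (coefficient p + coefficient q) * monomialOf (p ⨟ q)
    both-≤ p q bp bq = ℕₚ.≤-trans
      (ℕₚ.+-mono-≤ (ℕₚ.≤-trans bp (ℕₚ.*-monoʳ-≤ (coefficient p) (proj₁ (seq-≤ p q))))
                   (ℕₚ.≤-trans bq (ℕₚ.*-monoʳ-≤ (coefficient q) (proj₂ (seq-≤ p q)))))
      (ℕₚ.≤-reflexive (sym (ℕₚ.*-distribʳ-+ (monomialOf (p ⨟ q)) (coefficient p) (coefficient q))))

    for-monomial : ∀ i z p → v z * monomialOf p ≡ monomialOf (for i z p)
    for-monomial i vertices p = sym (ℕₚ.*-assoc (v vertices) (v vertices ^ degree vertices p) _)
    for-monomial i colours p = trans (x*yz (v colours) (v vertices ^ degree vertices p) _)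
      (cong (v vertices ^ degree vertices p *_) (sym (ℕₚ.*-assoc (v colours) (v colours ^ degree colours p) _)))
      where x*yz : ∀ x y z → x * (y * z) ≡ y * (x * z)
            x*yz x y z = trans (sym (ℕₚ.*-assoc x y z)) (trans (cong (_* z) (ℕₚ.*-comm x y)) (ℕₚ.*-assoc y x z))
    for-monomial i masks p = trans (x*yz (v masks) (v vertices ^ degree vertices p) _)
      (cong (v vertices ^ degree vertices p *_) (x*yz (v masks) (v colours ^ degree colours p) _))
      where x*yz : ∀ x y z → x * (y * z) ≡ y * (x * z)
            x*yz x y z = trans (sym (ℕₚ.*-assoc x y z)) (trans (cong (_* z) (ℕₚ.*-comm x y)) (ℕₚ.*-assoc y x z))

  bound-≤ : ∀ p → bound v p ≤ coefficient p * monomialOf p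
  bound-≤ nop          = const-≤ 1 (1≤monomial 0 0 0)
  bound-≤ (setN a i e) = const-≤ _ (1≤monomial 0 0 0)
  bound-≤ (setR a i e) = const-≤ _ (1≤monomial 0 0 0)
  bound-≤ (p ⨟ q)      = both-≤ p q (bound-≤ p) (bound-≤ q)
  bound-≤ (cond t p q) = ℕₚ.≤-trans
    (ℕₚ.+-mono-≤ (const-≤ (suc (costᵗ t)) (1≤monomial (degree vertices (p ⨟ q)) (degree colours (p ⨟ q)) (degree masks (p ⨟ q))))
      (both-≤ p q (bound-≤ p) (bound-≤ q)))
    (ℕₚ.≤-reflexive (sym (ℕₚ.*-distribʳ-+ (monomialOf (p ⨟ q)) (suc (costᵗ t)) (coefficient p + coefficient q))))
  bound-≤ (for i z p)  = begin
    11 + v z * (14 + bound v p)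
      ≤⟨ ℕₚ.+-mono-≤ (const-≤ 11 (1≤v z)) (ℕₚ.*-monoʳ-≤ (v z) (ℕₚ.+-monoʳ-≤ 14 (bound-≤ p))) ⟩
    11 * v z + v z * (14 + coefficient p * m)
      ≤⟨ ℕₚ.+-mono-≤ (ℕₚ.*-monoʳ-≤ 11 (const-≤ (v z) 1≤m)) (ℕₚ.*-monoʳ-≤ (v z)
           (ℕₚ.+-monoˡ-≤ (coefficient p * m) (const-≤ 14 1≤m))) ⟩
    11 * (v z * m) + v z * (14 * m + coefficient p * m)
      ≡⟨ cong (λ x → 11 * (v z * m) + v z * x) (sym (ℕₚ.*-distribʳ-+ m 14 (coefficient p))) ⟩
    11 * (v z * m) + v z * ((14 + coefficient p) * m)
      ≡⟨ cong (11 * (v z * m) +_) (trans (sym (ℕₚ.*-assoc (v z) (14 + coefficient p) m))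
           (trans (cong (_* m) (ℕₚ.*-comm (v z) (14 + coefficient p))) (ℕₚ.*-assoc (14 + coefficient p) (v z) m))) ⟩
    11 * (v z * m) + (14 + coefficient p) * (v z * m)
      ≡⟨ sym (ℕₚ.*-distribʳ-+ (v z * m) 11 (14 + coefficient p)) ⟩
    (25 + coefficient p) * (v z * m)
      ≡⟨ cong ((25 + coefficient p) *_) (for-monomial i z p) ⟩
    (25 + coefficient p) * monomialOf (for i z p) ∎
    where open ℕₚ.≤-Reasoning
          m = monomialOf p
          1≤m = 1≤monomial (degree vertices p) (degree colours p) (degree masks p)

-- Execution and cost of bounded programs

module _ {ℝ : Reals} where
  open State

  setCounter : ℕ → ℕ → State ℝ → State ℝ
  setCounter i k σ = ⟨ update (nats σ) i 0 k , reals σ ⟩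

  increment : ℕ → State ℝ → State ℝ
  increment i σ = setCounter i (nats σ i 0 + 1) σ

  loop : ℕ → (State ℝ → State ℝ) → ℕ → State ℝ → State ℝ
  loop i f zero    σ = σ
  loop i f (suc k) σ = loop i f k (increment i (f σ))

  -- Bounded loops make execution a total function, so correctness can be proved about `exec` alone;
  -- `run` links it to the relation `Run`.
  exec : Command → State ℝ → State ℝ
  exec nop          σ = σ
  exec (setN a i e) σ = ⟨ update (nats σ) a (evalⁿ σ i) (evalⁿ σ e) , reals σ ⟩
  exec (setR a i e) σ = ⟨ nats σ , update (reals σ) a (evalⁿ σ i) (evalʳ σ e) ⟩
  exec (p ⨟ q)      σ = exec q (exec p σ)
  exec (cond t p q) σ = if evalᵗ σ t then exec p σ else exec q σ
  exec (for i b p)  σ = loop i (exec p) (nats σ (sizeCell b) 0) (setCounter i 0 σ)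

  -- The second state is arbitrary instead of `exec p σ`, so that the states in the middle of a loop
  -- qualify too. What a program writes is decided syntactically, hence the premises compute.
  record Frame (p : Command) (σ τ : State ℝ) : Set where
    constructor frm
    field
      frameN : ∀ a → writesN a p ≡ false → ∀ j → nats τ a j ≡ nats σ a j
      frameR : ∀ a → writesR a p ≡ false → ∀ j → reals τ a j ≡ reals σ a j
  open Frame public

  frame-refl : ∀ {p σ} → Frame p σ σ
  frame-refl = frm (λ _ _ _ → refl) (λ _ _ _ → refl)

  frame-trans : ∀ {p ρ σ τ} → Frame p ρ σ → Frame p σ τ → Frame p ρ τ
  frame-trans f g = frm (λ a w j → trans (frameN g a w j) (frameN f a w j))
                        (λ a w j → trans (frameR g a w j) (frameR f a w j))

  frame-setCounter : ∀ {i b p σ} k → Frame (for i b p) σ (setCounter i k σ)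
  frame-setCounter {i} {σ = σ} k = frm
    (λ a w j → update-array (nats σ) i 0 k a j (∨-falseˡ w)) (λ _ _ _ → refl)

  frame-body : ∀ {i b p σ τ} → Frame p σ τ → Frame (for i b p) σ τ
  frame-body {i} f = frm (λ a w → frameN f a (∨-falseʳ {i ≡ᵇ a} w)) (frameR f)

  frame-step : ∀ {i b p σ τ} → Frame p σ τ → Frame (for i b p) σ (increment i τ)
  frame-step {i} {τ = τ} f = frame-trans (frame-body f) (frame-setCounter (nats τ i 0 + 1))

  frame-loop : ∀ {i b p} → (∀ σ → Frame p σ (exec p σ)) → ∀ k σ → Frame (for i b p) σ (loop i (exec p) k σ)
  frame-loop f zero    σ = frame-refl
  frame-loop {i} {b} f (suc k) σ = frame-trans (frame-step {i} {b} (f σ)) (frame-loop f k _)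

  frame : ∀ p σ → Frame p σ (exec p σ)
  frame nop          σ = frame-refl
  frame (setN a i e) σ = frm (λ b w j → update-array (nats σ) a (evalⁿ σ i) _ b j w) (λ _ _ _ → refl)
  frame (setR a i e) σ = frm (λ _ _ _ → refl) (λ b w j → update-array (reals σ) a (evalⁿ σ i) _ b j w)
  frame (p ⨟ q)      σ = frm
    (λ a w j → trans (frameN (frame q _) a (∨-falseʳ {writesN a p} w) j) (frameN (frame p σ) a (∨-falseˡ w) j))
    (λ a w j → trans (frameR (frame q _) a (∨-falseʳ {writesR a p} w) j) (frameR (frame p σ) a (∨-falseˡ w) j))
  frame (cond t p q) σ with evalᵗ σ t
  ... | true  = frm (λ a w → frameN (frame p σ) a (∨-falseˡ w)) (λ a w → frameR (frame p σ) a (∨-falseˡ w))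
  ... | false = frm (λ a w → frameN (frame q σ) a (∨-falseʳ {writesN a p} w))
                    (λ a w → frameR (frame q σ) a (∨-falseʳ {writesR a p} w))
  frame (for i b p)  σ = frame-trans (frame-setCounter 0) (frame-loop (frame p) (nats σ (sizeCell b) 0) _)

  -- The step receives the frame of the whole loop, so that everything that
  -- the loop does not write is known to be as before the loop.
  for-rule : ∀ {i b p} (σ₀ : State ℝ) N → nats σ₀ (sizeCell b) 0 ≡ N → wellFormed (for i b p) ≡ true →
             (Inv : ℕ → State ℝ → Set) → Inv 0 (setCounter i 0 σ₀) →
             (∀ k σ → k < N → nats σ i 0 ≡ k → Frame (for i b p) σ₀ σ → Inv k σ →
                Inv (suc k) (increment i (exec p σ))) →
             Inv N (exec (for i b p) σ₀)
  for-rule {i} {b} {p} σ₀ N refl wf Inv base step =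
    go N 0 (setCounter i 0 σ₀) (ℕₚ.+-identityʳ N) (update-same (nats σ₀) i 0 0) (frame-setCounter 0) base
    where
    wi : writesN i p ≡ false
    wi = not-true (∧-trueʳ {not (i ≡ᵇ sizeCell b)} (∧-trueˡ wf))
    go : ∀ f k σ → f + k ≡ N → nats σ i 0 ≡ k → Frame (for i b p) σ₀ σ → Inv k σ → Inv N (loop i (exec p) f σ)
    go zero    k σ refl c fr inv = inv
    go (suc f) k σ e    c fr inv =
      go f (suc k) _ (trans (ℕₚ.+-suc f k) e)
         (trans (update-same (nats (exec p σ)) i 0 _) (trans (ℕₚ.+-comm _ 1)
           (cong suc (trans (frameN (frame p σ) i wi 0) c))))
         (frame-trans fr (frame-step (frame p σ)))
         (step k σ (subst (k <_) e (s≤s (ℕₚ.m≤n+m k f))) c fr inv)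

  private
    forBody : ℕ → Command → Program
    forBody i p = compile p ⨾ (i [ lit 0 ]≔ # i ⊕ lit 1)

  cost : Command → State ℝ → ℕ
  costLoop : Command → ℕ → ℕ → State ℝ → ℕ
  cost nop          σ = 1
  cost (setN a i e) σ = suc (costⁿ i + costⁿ e)
  cost (setR a i e) σ = suc (costⁿ i + costʳ e)
  cost (p ⨟ q)      σ = cost p σ + cost q (exec p σ)
  cost (cond t p q) σ = suc (costᵗ t + (if evalᵗ σ t then cost p σ else cost q σ))
  cost (for i b p)  σ = 3 + costLoop p i (nats σ (sizeCell b) 0) (setCounter i 0 σ)
  costLoop p i zero    σ = 8
  costLoop p i (suc k) σ = 8 + ((cost p σ + 6) + costLoop p i k (increment i (exec p σ)))

  run : ∀ p → wellFormed p ≡ true → ∀ σ → Run (compile p) σ (exec p σ) (cost p σ)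
  run nop          wf σ = run-skip
  run (setN a i e) wf σ = run-nat
  run (setR a i e) wf σ = run-real
  run (p ⨟ q)      wf σ = run-seq (run p (∧-trueˡ wf) σ) (run q (∧-trueʳ {wellFormed p} wf) _)
  run (cond t p q) wf σ with evalᵗ σ t in eq
  ... | true  = run-if-true eq (run p (∧-trueˡ wf) σ)
  ... | false = run-if-false eq (run q (∧-trueʳ {wellFormed p} wf) σ)
  run (for i b p)  wf σ =
    run-seq run-nat (go (nats σ (sizeCell b) 0) 0 (setCounter i 0 σ) (ℕₚ.+-identityʳ _)
      (update-same (nats σ) i 0 0) (update-array (nats σ) i 0 0 (sizeCell b) 0 (not-true (∧-trueˡ (∧-trueˡ wf)))))
    where
    wi : writesN i p ≡ false
    wi = not-true (∧-trueʳ {not (i ≡ᵇ sizeCell b)} (∧-trueˡ wf))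
    wb : writesN (sizeCell b) p ≡ false
    wb = not-true (∧-trueˡ (∧-trueʳ {not (i ≡ᵇ sizeCell b) ∧ not (writesN i p)} wf))
    wp : wellFormed p ≡ true
    wp = ∧-trueʳ {not (writesN (sizeCell b) p)} (∧-trueʳ {not (i ≡ᵇ sizeCell b) ∧ not (writesN i p)} wf)
    N = nats σ (sizeCell b) 0
    go : ∀ f k ρ → f + k ≡ N → nats ρ i 0 ≡ k → nats ρ (sizeCell b) 0 ≡ N →
         Run (while (forTest i b) (forBody i p)) ρ (loop i (exec p) f ρ) (costLoop p i f ρ)
    go zero k ρ e c d = run-while-false (dec-false (_ ≤? _) λ le →
      ℕₚ.<-irrefl (trans c e) (subst₂ _≤_ (ℕₚ.+-comm (nats ρ i 0) 1) d le))
    go (suc f) k ρ e c d = run-while-true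
      (dec-true (_ ≤? _) (subst₂ _≤_ (trans (cong suc (sym c)) (ℕₚ.+-comm 1 _)) (sym d)
        (subst (k <_) e (s≤s (ℕₚ.m≤n+m k f)))))
      (run-seq (run p wp ρ) run-nat)
      (go f (suc k) _ (trans (ℕₚ.+-suc f k) e)
        (trans (update-same (nats (exec p ρ)) i 0 _) (trans (ℕₚ.+-comm _ 1)
          (cong suc (trans (frameN (frame p ρ) i wi 0) c))))
        (trans (update-array (nats (exec p ρ)) i 0 _ (sizeCell b) 0 (not-true (∧-trueˡ (∧-trueˡ wf))))
          (trans (frameN (frame p ρ) (sizeCell b) wb 0) d)))

  -- Since the size cells are not written, a bound on their initial contents is still valid at every
  -- later loop.
  Bounded : (Size → ℕ) → Command → State ℝ → Set
  Bounded v p σ = ∀ z → uses z p ≡ true → writesN (sizeCell z) p ≡ false × nats σ (sizeCell z) 0 ≤ v z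

  private
    ∨-trueˡ : ∀ {x y} → x ≡ true → (x ∨ y) ≡ true
    ∨-trueˡ refl = refl
    ∨-trueʳ : ∀ {x y} → y ≡ true → (x ∨ y) ≡ true
    ∨-trueʳ {false} refl = refl
    ∨-trueʳ {true}  refl = refl

  cost-≤ : ∀ v p σ → Bounded v p σ → cost p σ ≤ bound v p
  cost-≤ v nop          σ h = ℕₚ.≤-refl
  cost-≤ v (setN a i e) σ h = ℕₚ.≤-refl
  cost-≤ v (setR a i e) σ h = ℕₚ.≤-refl
  cost-≤ v (p ⨟ q)      σ h = ℕₚ.+-mono-≤
    (cost-≤ v p σ λ z u → let (w , le) = h z (∨-trueˡ u) in ∨-falseˡ w , le)
    (cost-≤ v q (exec p σ) λ z u → let (w , le) = h z (∨-trueʳ {uses z p} u) in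
      ∨-falseʳ {writesN (sizeCell z) p} w ,
      subst (_≤ v z) (sym (frameN (frame p σ) (sizeCell z) (∨-falseˡ w) 0)) le)
  cost-≤ v (cond t p q) σ h with evalᵗ σ t
  ... | true  = s≤s (ℕₚ.+-monoʳ-≤ (costᵗ t) (ℕₚ.≤-trans
                  (cost-≤ v p σ λ z u → let (w , le) = h z (∨-trueˡ u) in ∨-falseˡ w , le)
                  (ℕₚ.m≤m+n _ _)))
  ... | false = s≤s (ℕₚ.+-monoʳ-≤ (costᵗ t) (ℕₚ.≤-trans
                  (cost-≤ v q σ λ z u → let (w , le) = h z (∨-trueʳ {uses z p} u) in
                     ∨-falseʳ {writesN (sizeCell z) p} w , le)
                  (ℕₚ.m≤n+m _ _)))
  cost-≤ v (for i b p)  σ h = s≤s (s≤s (s≤s (ℕₚ.≤-trans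
      (go (nats σ (sizeCell b) 0) (setCounter i 0 σ)
        λ z u → let (w , le) = h z (∨-trueʳ {sizeCell b ≡ᵇ sizeCell z} u) in
          ∨-falseʳ {i ≡ᵇ sizeCell z} w ,
          subst (_≤ v z) (sym (update-array (nats σ) i 0 0 (sizeCell z) 0 (∨-falseˡ w))) le)
      (ℕₚ.+-monoʳ-≤ 8 (ℕₚ.*-monoˡ-≤ (14 + bound v p) (proj₂ (h b (∨-trueˡ (≡ᵇ-refl (sizeCell b))))))))))
    where
    go : ∀ k ρ → Bounded v p ρ → costLoop p i k ρ ≤ 8 + k * (14 + bound v p)
    go zero    ρ g = ℕₚ.≤-refl
    go (suc k) ρ g = begin
      8 + ((cost p ρ + 6) + costLoop p i k (increment i (exec p ρ)))
        ≤⟨ ℕₚ.+-monoʳ-≤ 8 (ℕₚ.+-mono-≤ (ℕₚ.+-monoˡ-≤ 6 (cost-≤ v p ρ g))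
             (go k _ λ z u → let (w , le) = g z u in w ,
               subst (_≤ v z) (sym (trans
                 (update-array (nats (exec p ρ)) i 0 _ (sizeCell z) 0
                   (∨-falseˡ (proj₁ (h z (∨-trueʳ {sizeCell b ≡ᵇ sizeCell z} u)))))
                 (frameN (frame p ρ) (sizeCell z) w 0))) le)) ⟩
      8 + ((B + 6) + (8 + k * (14 + B)))
        ≡⟨ cong (8 +_) (trans (sym (ℕₚ.+-assoc (B + 6) 8 _)) (cong (_+ k * (14 + B))
             (trans (ℕₚ.+-assoc B 6 8) (ℕₚ.+-comm B 14)))) ⟩
      8 + (14 + B + k * (14 + B)) ∎
      where open ℕₚ.≤-Reasoning
            B = bound v p

-- Addition and order of the reals

module Real (ℝ : Reals) where
  open Reals ℝ public using (0#; 1#; isDecTotalOrder; isCommutativeRing; Carrier)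
    renaming (_+_ to _+ᵣ_; -_ to -ᵣ_; _≤_ to _≤ᵣ_; _<_ to _<ᵣ_; _≤?_ to _≤ᵣ?_; +-monoʳ-≤ to +ᵣ-monoʳ-≤)
  open IsCommutativeRing isCommutativeRing public using ()
    renaming (+-assoc to +ᵣ-assoc; +-comm to +ᵣ-comm; +-identityˡ to +ᵣ-identityˡ; +-identityʳ to +ᵣ-identityʳ;
              -‿inverseˡ to -ᵣ-inverseˡ; -‿inverseʳ to -ᵣ-inverseʳ)
  open IsDecTotalOrder isDecTotalOrder public using ()
    renaming (refl to ≤ᵣ-refl; trans to ≤ᵣ-trans; antisym to ≤ᵣ-antisym; total to ≤ᵣ-total; reflexive to ≤ᵣ-reflexive)


  +ᵣ-monoˡ-≤ : ∀ x {y z} → y ≤ᵣ z → y +ᵣ x ≤ᵣ z +ᵣ x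
  +ᵣ-monoˡ-≤ x {y} {z} le = subst₂ _≤ᵣ_ (+ᵣ-comm x y) (+ᵣ-comm x z) (+ᵣ-monoʳ-≤ x le)

  +ᵣ-mono-≤ : ∀ {a b c d} → a ≤ᵣ b → c ≤ᵣ d → a +ᵣ c ≤ᵣ b +ᵣ d
  +ᵣ-mono-≤ {b = b} {c} p q = ≤ᵣ-trans (+ᵣ-monoˡ-≤ c p) (+ᵣ-monoʳ-≤ b q)

  +ᵣ-cancelˡ-≤ : ∀ x {y z} → x +ᵣ y ≤ᵣ x +ᵣ z → y ≤ᵣ z
  +ᵣ-cancelˡ-≤ x {y} {z} le = subst₂ _≤ᵣ_ (fix y) (fix z) (+ᵣ-monoʳ-≤ (-ᵣ x) le)
    where fix : ∀ u → -ᵣ x +ᵣ (x +ᵣ u) ≡ u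
          fix u = trans (sym (+ᵣ-assoc (-ᵣ x) x u)) (trans (cong (_+ᵣ u) (-ᵣ-inverseˡ x)) (+ᵣ-identityˡ u))

  ≤ᵣ-dropˡ : ∀ {x y z} → 0# ≤ᵣ x → x +ᵣ y ≤ᵣ z → y ≤ᵣ z
  ≤ᵣ-dropˡ {x} {y} p q = ≤ᵣ-trans (subst (_≤ᵣ x +ᵣ y) (+ᵣ-identityˡ y) (+ᵣ-monoˡ-≤ y p)) q

  +ᵣ-nonneg : ∀ {x y} → 0# ≤ᵣ x → 0# ≤ᵣ y → 0# ≤ᵣ x +ᵣ y
  +ᵣ-nonneg {x} {y} p q = ≤ᵣ-trans q (≤ᵣ-dropˡ p ≤ᵣ-refl)

  neg-≤ : ∀ {x y} → 0# ≤ᵣ x +ᵣ y → -ᵣ x ≤ᵣ y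
  neg-≤ {x} {y} p = +ᵣ-cancelˡ-≤ x (subst (_≤ᵣ x +ᵣ y) (sym (-ᵣ-inverseʳ x)) p)

  neg-nonneg : ∀ {x} → x ≤ᵣ 0# → 0# ≤ᵣ -ᵣ x
  neg-nonneg {x} p = +ᵣ-cancelˡ-≤ x (subst₂ _≤ᵣ_ (sym (+ᵣ-identityʳ x)) (sym (-ᵣ-inverseʳ x)) p)

  neg-zero : -ᵣ 0# ≡ 0#
  neg-zero = trans (sym (+ᵣ-identityʳ _)) (-ᵣ-inverseˡ 0#)

  neg-unique : ∀ {x y} → x +ᵣ y ≡ 0# → y ≡ -ᵣ x
  neg-unique {x} {y} e = trans (sym (+ᵣ-identityˡ y)) (trans (cong (_+ᵣ y) (sym (-ᵣ-inverseˡ x)))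
    (trans (+ᵣ-assoc (-ᵣ x) x y) (trans (cong (-ᵣ x +ᵣ_) e) (+ᵣ-identityʳ _))))

  neg-involutive : ∀ x → -ᵣ (-ᵣ x) ≡ x
  neg-involutive x = sym (neg-unique (-ᵣ-inverseˡ x))

  +ᵣ-interchange : ∀ a b c d → (a +ᵣ b) +ᵣ (c +ᵣ d) ≡ (a +ᵣ c) +ᵣ (b +ᵣ d)
  +ᵣ-interchange a b c d = trans (+ᵣ-assoc a b (c +ᵣ d)) (trans (cong (a +ᵣ_)
    (trans (sym (+ᵣ-assoc b c d)) (trans (cong (_+ᵣ d) (+ᵣ-comm b c)) (+ᵣ-assoc c b d))))
    (sym (+ᵣ-assoc a c (b +ᵣ d))))

  neg-+ : ∀ x y → -ᵣ (x +ᵣ y) ≡ -ᵣ x +ᵣ -ᵣ y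
  neg-+ x y = sym (neg-unique (trans (+ᵣ-interchange x y (-ᵣ x) (-ᵣ y))
    (trans (cong₂ _+ᵣ_ (-ᵣ-inverseʳ x) (-ᵣ-inverseʳ y)) (+ᵣ-identityˡ 0#))))

  <ᵣ⇒≱ : ∀ {x} → x <ᵣ 0# → ¬ 0# ≤ᵣ x
  <ᵣ⇒≱ (le , ne) ge = ne (≤ᵣ-antisym le ge)

  ≱⇒<ᵣ : ∀ {x} → ¬ 0# ≤ᵣ x → x <ᵣ 0#
  ≱⇒<ᵣ {x} nge = [ (λ le → le) , (λ ge → ⊥-elim (nge ge)) ]′ (≤ᵣ-total x 0#) , λ e → nge (≤ᵣ-reflexive (sym e))

  ≮⇒≥ᵣ : ∀ {x} → ¬ x <ᵣ 0# → 0# ≤ᵣ x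
  ≮⇒≥ᵣ {x} h with 0# ≤ᵣ? x
  ... | yes p = p
  ... | no np = ⊥-elim (h (≱⇒<ᵣ np))

  ≰ᵣ⇒≥ : ∀ {x y} → ¬ x ≤ᵣ y → y ≤ᵣ x
  ≰ᵣ⇒≥ {x} {y} nle = [ (λ le → ⊥-elim (nle le)) , id ]′ (≤ᵣ-total x y)

-- Guarded commands and tables of least weights

whenAll : List Test → Command → Command
whenAll []       p = p
whenAll (t ∷ ts) p = cond t (whenAll ts p) nop

-- The only comparison is `≤`; two numbers agree when both truncated differences vanish.
sameᵗ : NatExp → NatExp → Test
sameᵗ d e = ((d ⊖ e) ⊕ (e ⊖ d)) ≤ⁿ lit 0

present : ℕ → NatExp → Test
present f i = lit 1 ≤ⁿ (f [ i ])

-- The pair of arrays f (of naturals) and r (of reals) is a table with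
-- entries in ℝ ∪ {∞}; an entry is ∞ if its cell of f is 0.
relax : ℕ → ℕ → NatExp → RealExp → Command
relax f r i e = cond (present f i) (cond ((r [ i ]ʳ) ≤ʳ e) nop (setR r i e)) (setR r i e ⨟ setN f i (lit 1))

relaxWhen : ℕ → ℕ → List Test → NatExp → RealExp → Command
relaxWhen f r ts i e = whenAll ts (relax f r i e)

for2 : ℕ → ℕ → Command → Command
for2 i j p = for i vertices (for j vertices p)

for3 : ℕ → ℕ → ℕ → Command → Command
for3 i j l p = for i vertices (for2 j l p)

module Relax {ℝ : Reals} where
  open State
  open Real ℝ

  ⟦_⟧ : Test → State ℝ → Set
  ⟦ d ≤ⁿ e ⟧ σ = evalⁿ σ d ≤ evalⁿ σ e
  ⟦ d ≤ʳ e ⟧ σ = evalʳ σ d ≤ᵣ evalʳ σ e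
  ⟦ notᵗ t ⟧ σ = ¬ ⟦ t ⟧ σ

  test-correct : ∀ t σ → (⟦ t ⟧ σ × evalᵗ σ t ≡ true) ⊎ (¬ ⟦ t ⟧ σ × evalᵗ σ t ≡ false)
  test-correct (d ≤ⁿ e) σ with evalⁿ σ d ≤? evalⁿ σ e
  ... | yes p = inj₁ (p , dec-true (_ ≤? _) p)
  ... | no np = inj₂ (np , dec-false (_ ≤? _) np)
  test-correct (d ≤ʳ e) σ with evalʳ σ d ≤ᵣ? evalʳ σ e
  ... | yes p = inj₁ (p , refl)
  ... | no np = inj₂ (np , refl)
  test-correct (notᵗ t) σ with test-correct t σ
  ... | inj₁ (p , e)  = inj₂ ((λ np → np p) , cong not e)
  ... | inj₂ (np , e) = inj₁ (np , cong not e)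

  cond-rule : ∀ t p q (P : State ℝ → Set) σ → (⟦ t ⟧ σ → P (exec p σ)) → (¬ ⟦ t ⟧ σ → P (exec q σ)) →
              P (exec (cond t p q) σ)
  cond-rule t p q P σ yep nope with test-correct t σ
  ... | inj₁ (h , e) rewrite e = yep h
  ... | inj₂ (h , e) rewrite e = nope h

  Holds : List Test → State ℝ → Set
  Holds ts σ = All (λ t → ⟦ t ⟧ σ) ts

  whenAll-rule : ∀ ts p (P : State ℝ → Set) σ → (Holds ts σ → P (exec p σ)) → (¬ Holds ts σ → P σ) →
                 P (exec (whenAll ts p) σ)
  whenAll-rule []       p P σ yep nope = yep []
  whenAll-rule (t ∷ ts) p P σ yep nope = cond-rule t (whenAll ts p) nop P σ
    (λ h → whenAll-rule ts p P σ (λ hs → yep (h ∷ hs)) (λ nhs → nope λ { (_ ∷ hs) → nhs hs }))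
    (λ nh → nope λ { (h ∷ _) → nh h })

  sameᵗ-sound : ∀ d e σ → ⟦ sameᵗ d e ⟧ σ → evalⁿ σ d ≡ evalⁿ σ e
  sameᵗ-sound d e σ h = ℕₚ.≤-antisym (ℕₚ.m∸n≡0⇒m≤n (ℕₚ.m+n≡0⇒m≡0 _ (ℕₚ.n≤0⇒n≡0 h)))
                                     (ℕₚ.m∸n≡0⇒m≤n (ℕₚ.m+n≡0⇒n≡0 (evalⁿ σ d ∸ evalⁿ σ e) (ℕₚ.n≤0⇒n≡0 h)))

  sameᵗ-complete : ∀ d e σ → evalⁿ σ d ≡ evalⁿ σ e → ⟦ sameᵗ d e ⟧ σ
  sameᵗ-complete d e σ h rewrite h | ℕₚ.n∸n≡0 (evalⁿ σ e) = z≤n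

  -- In `relax` the value is stored before the flag, so the index is evaluated again after a write
  -- to the reals. Natural expressions never read reals, so it is the same index.
  evalⁿ-reals : ∀ {ν : Memory ℕ} {ρ ρ' : Memory Carrier} e → evalⁿ {ℝ} ⟨ ν , ρ ⟩ e ≡ evalⁿ {ℝ} ⟨ ν , ρ' ⟩ e
  evalⁿ-reals (lit _)   = refl
  evalⁿ-reals {ν} (a [ e ]) = cong (ν a) (evalⁿ-reals e)
  evalⁿ-reals (d ⊕ e)   = cong₂ _+_ (evalⁿ-reals d) (evalⁿ-reals e)
  evalⁿ-reals (d ⊖ e)   = cong₂ _∸_ (evalⁿ-reals d) (evalⁿ-reals e)

  module Table (f r : ℕ) where

    record AtMost (σ : State ℝ) (j : ℕ) (x : Carrier) : Set where
      constructor _,_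
      field
        finite : 1 ≤ nats σ f j
        below  : reals σ r j ≤ᵣ x

    -- Upper bounds serve instead of the entries themselves: this treats ∞ without a case
    -- distinction.
    record Decreasing (σ τ : State ℝ) : Set where
      constructor decr
      field preserve : ∀ j x → AtMost σ j x → AtMost τ j x
    open Decreasing public

    record Sound (S : ℕ → Carrier → Set) (σ : State ℝ) : Set where
      constructor snd
      field entry : ∀ j → 1 ≤ nats σ f j → S j (reals σ r j)
    open Sound public

    AtMost-weaken : ∀ {σ j x y} → x ≤ᵣ y → AtMost σ j x → AtMost σ j y
    AtMost-weaken le (p , q) = p , ≤ᵣ-trans q le

    decreasing-refl : ∀ {σ} → Decreasing σ σ
    decreasing-refl = decr λ j x h → h

    decreasing-trans : ∀ {ρ σ τ} → Decreasing ρ σ → Decreasing σ τ → Decreasing ρ τ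
    decreasing-trans g h = decr λ j x a → preserve h j x (preserve g j x a)

    same-table : ∀ {σ τ} → (∀ j → nats τ f j ≡ nats σ f j) → (∀ j → reals τ r j ≡ reals σ r j) → Decreasing σ τ
    same-table en er = decr λ { j x (p , q) → subst (1 ≤_) (sym (en j)) p , subst (_≤ᵣ x) (sym (er j)) q }

    same-sound : ∀ {S σ τ} → (∀ j → nats τ f j ≡ nats σ f j) → (∀ j → reals τ r j ≡ reals σ r j) → Sound S σ → Sound S τ
    same-sound {S} en er s = snd λ j p → subst (S j) (sym (er j)) (entry s j (subst (1 ≤_) (en j) p))

    decreasing-frame : ∀ p {σ τ} → Frame p σ τ → writesN f p ≡ false → writesR r p ≡ false → Decreasing σ τ
    decreasing-frame p fr wn wr = same-table (frameN fr f wn) (frameR fr r wr)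

    sound-frame : ∀ {S} p {σ τ} → Frame p σ τ → writesN f p ≡ false → writesR r p ≡ false → Sound S σ → Sound S τ
    sound-frame p fr wn wr = same-sound (frameN fr f wn) (frameR fr r wr)

    private
      store : NatExp → RealExp → Command
      store i e = setR r i e ⨟ setN f i (lit 1)

      stored : NatExp → RealExp → State ℝ → State ℝ
      stored i e σ = ⟨ update (nats σ) f (evalⁿ σ i) 1 , update (reals σ) r (evalⁿ σ i) (evalʳ σ e) ⟩

      via-stored : ∀ {P : State ℝ → Set} i e σ → P (stored i e σ) → P (exec (store i e) σ)
      via-stored {P} i e σ = subst (λ z → P ⟨ update (nats σ) f z 1 , update (reals σ) r (evalⁿ σ i) (evalʳ σ e) ⟩)
        (evalⁿ-reals i)

      improve : NatExp → RealExp → Command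
      improve i e = cond ((r [ i ]ʳ) ≤ʳ e) nop (setR r i e)

      setN-flag : ∀ (m : Memory ℕ) i j → 1 ≤ m f j → 1 ≤ update m f i 1 f j
      setN-flag m i j p with update-case m f i 1 j
      ... | inj₁ (_ , u) = subst (1 ≤_) (sym u) ℕₚ.≤-refl
      ... | inj₂ u       = subst (1 ≤_) (sym u) p

      setR-below : ∀ (m : Memory Carrier) i v j x → (i ≡ j → v ≤ᵣ x) → m r j ≤ᵣ x → update m r i v r j ≤ᵣ x
      setR-below m i v j x h q with update-case m r i v j
      ... | inj₁ (e , u) = subst (_≤ᵣ x) (sym u) (h e)
      ... | inj₂ u       = subst (_≤ᵣ x) (sym u) q

    relax-decreasing : ∀ i e σ → Decreasing σ (exec (relax f r i e) σ)
    relax-decreasing i e σ = cond-rule (present f i) (improve i e) (store i e) (Decreasing σ) σ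
      (λ _ → cond-rule ((r [ i ]ʳ) ≤ʳ e) nop (setR r i e) (Decreasing σ) σ (λ _ → decreasing-refl)
        (λ nle → decr λ { j x (p , q) → p , setR-below (reals σ) (evalⁿ σ i) (evalʳ σ e) j x (λ { refl → ≤ᵣ-trans (≰ᵣ⇒≥ nle) q }) q }))
      (λ np → via-stored {Decreasing σ} i e σ (decr λ { j x (p , q) → setN-flag (nats σ) (evalⁿ σ i) j p ,
         setR-below (reals σ) (evalⁿ σ i) (evalʳ σ e) j x (λ { refl → ⊥-elim (np p) }) q }))

    relax-hit : ∀ i e σ → AtMost (exec (relax f r i e) σ) (evalⁿ σ i) (evalʳ σ e)
    relax-hit i e σ = cond-rule (present f i) (improve i e) (store i e) P σ
      (λ p → cond-rule ((r [ i ]ʳ) ≤ʳ e) nop (setR r i e) P σ (λ le → p , le)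
        (λ nle → p , ≤ᵣ-reflexive (update-same (reals σ) r (evalⁿ σ i) (evalʳ σ e))))
      (λ np → via-stored {P} i e σ (subst (1 ≤_) (sym (update-same (nats σ) f (evalⁿ σ i) 1)) ℕₚ.≤-refl ,
              ≤ᵣ-reflexive (update-same (reals σ) r (evalⁿ σ i) (evalʳ σ e))))
      where P : State ℝ → Set
            P τ = AtMost τ (evalⁿ σ i) (evalʳ σ e)

    relax-sound : ∀ S i e σ → S (evalⁿ σ i) (evalʳ σ e) → Sound S σ → Sound S (exec (relax f r i e) σ)
    relax-sound S i e σ new old = cond-rule (present f i) (improve i e) (store i e) (Sound S) σ
      (λ p → cond-rule ((r [ i ]ʳ) ≤ʳ e) nop (setR r i e) (Sound S) σ
        (λ le → old)
        (λ nle → snd λ j q → value j (λ _ → entry old j q)))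
      (λ np → via-stored {Sound S} i e σ (snd λ j q → value j (λ ne → entry old j (subst (1 ≤_) (update-cell (nats σ) f (evalⁿ σ i) 1 j ne) q))))
      where
      value : ∀ j → (evalⁿ σ i ≢ j → S j (reals σ r j)) → S j (update (reals σ) r (evalⁿ σ i) (evalʳ σ e) r j)
      value j h with evalⁿ σ i ≟ j
      ... | yes refl = subst (S _) (sym (update-same (reals σ) r (evalⁿ σ i) (evalʳ σ e))) new
      ... | no ne    = subst (S j) (sym (update-cell (reals σ) r (evalⁿ σ i) (evalʳ σ e) j ne)) (h ne)

    relaxWhen-decreasing : ∀ ts i e σ → Decreasing σ (exec (relaxWhen f r ts i e) σ)
    relaxWhen-decreasing ts i e σ = whenAll-rule ts (relax f r i e) (Decreasing σ) σ
      (λ _ → relax-decreasing i e σ) (λ _ → decreasing-refl)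

    relaxWhen-sound : ∀ S ts i e σ → (Holds ts σ → S (evalⁿ σ i) (evalʳ σ e)) → Sound S σ →
                      Sound S (exec (relaxWhen f r ts i e) σ)
    relaxWhen-sound S ts i e σ new old = whenAll-rule ts (relax f r i e) (Sound S) σ
      (λ h → relax-sound S i e σ (new h) old) (λ _ → old)

    relaxWhen-hit : ∀ ts i e σ {j x} → Holds ts σ → evalⁿ σ i ≡ j → evalʳ σ e ≤ᵣ x →
                    AtMost (exec (relaxWhen f r ts i e) σ) j x
    relaxWhen-hit ts i e σ {j} {x} h refl le = whenAll-rule ts (relax f r i e) (λ τ → AtMost τ (evalⁿ σ i) x) σ
      (λ _ → AtMost-weaken le (relax-hit i e σ)) (λ nh → ⊥-elim (nh h))

    record Grown (S : ℕ → Carrier → Set) (p : Command) (σ τ : State ℝ) : Set where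
      constructor grown
      field
        framed     : Frame p σ τ
        decreasing : Decreasing σ τ
        sound      : Sound S τ

    Grows : (ℕ → Carrier → Set) → Command → State ℝ → Set
    Grows S p σ = Decreasing σ (exec p σ) × Sound S (exec p σ)

    -- Entries only decrease, so a bound reached in round `k` survives to the end of the loop.
    -- Completeness therefore needs a look at one round only, started in any state that can occur
    -- there.
    for-relax : ∀ {i b p} S σ₀ N → nats σ₀ (sizeCell b) 0 ≡ N → wellFormed (for i b p) ≡ true → (i ≡ᵇ f) ≡ false →
      Sound S σ₀ →
      (∀ k σ → k < N → nats σ i 0 ≡ k → Grown S (for i b p) σ₀ σ → Grows S p σ) →
      Grows S (for i b p) σ₀ ×
      (∀ k → k < N → ∀ j x →
        (∀ σ → nats σ i 0 ≡ k → Grown S (for i b p) σ₀ σ → AtMost (exec p σ) j x) →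
        AtMost (exec (for i b p) σ₀) j x)
    for-relax {i} {b} {p} S σ₀ N eN wf i≢f s₀ step =
      let (d , s , h) = for-rule {i = i} {b} {p} σ₀ N eN wf Inv
                          (counter-decreasing σ₀ 0 , counter-sound σ₀ 0 s₀ , λ _ ()) keep
      in (d , s) , h
      where
      Hit : ℕ → ℕ → Carrier → Set
      Hit k j x = ∀ σ → nats σ i 0 ≡ k → Grown S (for i b p) σ₀ σ → AtMost (exec p σ) j x
      Inv : ℕ → State ℝ → Set
      Inv k σ = Decreasing σ₀ σ × Sound S σ × (∀ k' → k' < k → ∀ j x → Hit k' j x → AtMost σ j x)
      counter-decreasing : ∀ σ k → Decreasing σ (setCounter i k σ)
      counter-decreasing σ k = same-table (λ j → update-array (nats σ) i 0 k f j i≢f) (λ _ → refl)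
      counter-sound : ∀ σ k → Sound S σ → Sound S (setCounter i k σ)
      counter-sound σ k = same-sound (λ j → update-array (nats σ) i 0 k f j i≢f) (λ _ → refl)
      keep : ∀ k σ → k < N → nats σ i 0 ≡ k → Frame (for i b p) σ₀ σ → Inv k σ → Inv (suc k) (increment i (exec p σ))
      keep k σ k<N c fr (d , s , h) =
          decreasing-trans d (decreasing-trans (proj₁ g) cd) , counter-sound _ _ (proj₂ g) , hits
        where
        g = step k σ k<N c (grown fr d s)
        cd = counter-decreasing (exec p σ) (nats (exec p σ) i 0 + 1)
        hits : ∀ k' → k' < suc k → ∀ j x → Hit k' j x → AtMost (increment i (exec p σ)) j x
        hits k' (s≤s k'≤k) j x hit with ℕₚ.m≤n⇒m<n∨m≡n k'≤k
        ... | inj₁ k'<k = preserve cd j x (preserve (proj₁ g) j x (h k' k'<k j x hit))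
        ... | inj₂ refl = preserve cd j x (hit σ c (grown fr d s))

    Counter : ℕ → ℕ → State ℝ → Set
    Counter i k σ = nats σ i 0 ≡ k

    private
      grown-inside : ∀ {S i b p ρ σ τ} → Grown S (for i b p) ρ σ → Grown S p σ τ → Grown S (for i b p) ρ τ
      grown-inside (grown f d s) (grown g e t) = grown (frame-trans f (frame-body g)) (decreasing-trans d e) t

      outer-written : ∀ {i b p} → wellFormed (for i b p) ≡ true → writesN i p ≡ false × writesN (sizeCell b) p ≡ false × wellFormed p ≡ true
      outer-written {i} {b} {p} wf =
        not-true (∧-trueʳ {not (i ≡ᵇ sizeCell b)} (∧-trueˡ wf)) ,
        not-true (∧-trueˡ (∧-trueʳ {not (i ≡ᵇ sizeCell b) ∧ not (writesN i p)} wf)) ,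
        ∧-trueʳ {not (writesN (sizeCell b) p)} (∧-trueʳ {not (i ≡ᵇ sizeCell b) ∧ not (writesN i p)} wf)

      bound-kept : ∀ {i b p} → wellFormed (for i b p) ≡ true → writesN (sizeCell b) (for i b p) ≡ false
      bound-kept {i} {b} {p} wf rewrite not-true (∧-trueˡ {not (i ≡ᵇ sizeCell b)} (∧-trueˡ wf)) = proj₁ (proj₂ (outer-written {i} {b} {p} wf))

    for-vertices : ∀ {i p n} S σ₀ → nats σ₀ 0 0 ≡ n → wellFormed (for i vertices p) ≡ true → (i ≡ᵇ f) ≡ false →
      Sound S σ₀ →
      (∀ (s : Fin n) σ → Counter i (toℕ s) σ → Grown S (for i vertices p) σ₀ σ → Grows S p σ) →
      Grows S (for i vertices p) σ₀ ×
      (∀ (s : Fin n) j x → (∀ σ → Counter i (toℕ s) σ → Grown S (for i vertices p) σ₀ σ → AtMost (exec p σ) j x) →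
        AtMost (exec (for i vertices p) σ₀) j x)
    for-vertices {i} {p} {n} S σ₀ en wf i≢f s₀ step =
      let (g , h) = for-relax {i} {vertices} {p} S σ₀ n en wf i≢f s₀
                      (λ k σ k<n c gr → step (fromℕ< k<n) σ (trans c (sym (toℕ-fromℕ< k<n))) gr)
      in g , λ s j x hit → h (toℕ s) (toℕ<n s) j x hit

    for2-relax : ∀ {i j p n} S σ₀ → nats σ₀ 0 0 ≡ n → wellFormed (for2 i j p) ≡ true →
      (i ≡ᵇ f) ≡ false → (j ≡ᵇ f) ≡ false → Sound S σ₀ →
      (∀ (s t : Fin n) σ → Counter i (toℕ s) σ → Counter j (toℕ t) σ → Grown S (for2 i j p) σ₀ σ → Grows S p σ) →
      Grows S (for2 i j p) σ₀ ×
      (∀ (s t : Fin n) m x →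
        (∀ σ → Counter i (toℕ s) σ → Counter j (toℕ t) σ → Grown S (for2 i j p) σ₀ σ → AtMost (exec p σ) m x) →
        AtMost (exec (for2 i j p) σ₀) m x)
    for2-relax {i} {j} {p} {n} S σ₀ en wf i≢f j≢f s₀ step =
      let (g , h) = for-vertices {i} {for j vertices p} S σ₀ en wf i≢f s₀ (λ s σ c gr → proj₁ (inner s σ c gr))
      in g , λ s t m x hit → h s m x λ σ c gr → proj₂ (inner s σ c gr) t m x λ σ' c' gr' →
           hit σ' (trans (frameN (Grown.framed gr') i wi 0) c) c' (grown-inside gr gr')
      where
      wi = proj₁ (outer-written {i} {vertices} {for j vertices p} wf)
      wp = proj₂ (proj₂ (outer-written {i} {vertices} {for j vertices p} wf))
      inner : ∀ (s : Fin n) σ → Counter i (toℕ s) σ → Grown S (for2 i j p) σ₀ σ →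
        Grows S (for j vertices p) σ ×
        (∀ (t : Fin n) m x → (∀ σ' → Counter j (toℕ t) σ' → Grown S (for j vertices p) σ σ' → AtMost (exec p σ') m x) →
          AtMost (exec (for j vertices p) σ) m x)
      inner s σ c gr = for-vertices {j} {p} S σ
        (trans (frameN (Grown.framed gr) 0 (bound-kept {i} {vertices} {for j vertices p} wf) 0) en) wp j≢f (Grown.sound gr)
        (λ t σ' c' gr' → step s t σ' (trans (frameN (Grown.framed gr') i wi 0) c) c' (grown-inside gr gr'))

    for3-relax : ∀ {i j l p n} S σ₀ → nats σ₀ 0 0 ≡ n → wellFormed (for3 i j l p) ≡ true →
      (i ≡ᵇ f) ≡ false → (j ≡ᵇ f) ≡ false → (l ≡ᵇ f) ≡ false → Sound S σ₀ →
      (∀ (s t u : Fin n) σ → Counter i (toℕ s) σ → Counter j (toℕ t) σ → Counter l (toℕ u) σ →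
        Grown S (for3 i j l p) σ₀ σ → Grows S p σ) →
      Grows S (for3 i j l p) σ₀ ×
      (∀ (s t u : Fin n) m x →
        (∀ σ → Counter i (toℕ s) σ → Counter j (toℕ t) σ → Counter l (toℕ u) σ → Grown S (for3 i j l p) σ₀ σ →
          AtMost (exec p σ) m x) →
        AtMost (exec (for3 i j l p) σ₀) m x)
    for3-relax {i} {j} {l} {p} {n} S σ₀ en wf i≢f j≢f l≢f s₀ step =
      let (g , h) = for-vertices {i} {for2 j l p} S σ₀ en wf i≢f s₀ (λ s σ c gr → proj₁ (inner s σ c gr))
      in g , λ s t u m x hit → h s m x λ σ c gr → proj₂ (inner s σ c gr) t u m x λ σ' c' c'' gr' →
           hit σ' (trans (frameN (Grown.framed gr') i wi 0) c) c' c'' (grown-inside gr gr')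
      where
      wi = proj₁ (outer-written {i} {vertices} {for2 j l p} wf)
      wp = proj₂ (proj₂ (outer-written {i} {vertices} {for2 j l p} wf))
      inner : ∀ (s : Fin n) σ → Counter i (toℕ s) σ → Grown S (for3 i j l p) σ₀ σ →
        Grows S (for2 j l p) σ ×
        (∀ (t u : Fin n) m x → (∀ σ' → Counter j (toℕ t) σ' → Counter l (toℕ u) σ' → Grown S (for2 j l p) σ σ' →
            AtMost (exec p σ') m x) → AtMost (exec (for2 j l p) σ) m x)
      inner s σ c gr = for2-relax {j} {l} {p} S σ
        (trans (frameN (Grown.framed gr) 0 (bound-kept {i} {vertices} {for2 j l p} wf) 0) en) wp j≢f l≢f (Grown.sound gr)
        (λ t u σ' c' c'' gr' → step s t u σ' (trans (frameN (Grown.framed gr') i wi 0) c) c' c'' (grown-inside gr gr'))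

-- Walks, paths and inseparable vertices

module Walks {ℝ : Reals} {n : ℕ} (G : MixedGraph ℝ n) where
  open Real ℝ
  open MixedGraph G

  V : Set
  V = Fin n

  infix 4 _⟶*_
  _⟶*_ : V → V → Set
  _⟶*_ = Walk G

  inits : ∀ {s t} → s ⟶* t → List V
  inits = initVertices G

  vs : ∀ {s t} → s ⟶* t → List V
  vs {t = t} p = inits p ++ t ∷ []

  wt : ∀ {s t} → s ⟶* t → Carrier
  wt = weight G

  edges : ∀ {s t} → s ⟶* t → List (V × V)
  edges = edgeTraversals G

  len : ∀ {s t} → s ⟶* t → ℕ
  len ε       = 0
  len (_ ◅ p) = suc (len p)

  wt-++ : ∀ {s t u} (p : s ⟶* t) (q : t ⟶* u) → wt (p ◅◅ q) ≡ wt p +ᵣ wt q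
  wt-++ ε       q = sym (+ᵣ-identityˡ _)
  wt-++ (e ◅ p) q = trans (cong (stepWeight G e +ᵣ_) (wt-++ p q)) (sym (+ᵣ-assoc _ _ _))

  len-++ : ∀ {s t u} (p : s ⟶* t) (q : t ⟶* u) → len (p ◅◅ q) ≡ len p + len q
  len-++ ε       q = refl
  len-++ (e ◅ p) q = cong suc (len-++ p q)

  inits⊆vs : ∀ {s t x} (p : s ⟶* t) → x ∈ˡ inits p → x ∈ˡ vs p
  inits⊆vs p = ∈-++⁺ˡ

  start∈vs : ∀ {s t} (p : s ⟶* t) → s ∈ˡ vs p
  start∈vs ε       = here refl
  start∈vs (e ◅ p) = here refl

  end∈vs : ∀ {s t} (p : s ⟶* t) → t ∈ˡ vs p
  end∈vs p = ∈-++⁺ʳ (inits p) (here refl)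

  vs-++ : ∀ {s t u} (p : s ⟶* t) (q : t ⟶* u) → vs (p ◅◅ q) ≡ inits p ++ vs q
  vs-++ ε       q = refl
  vs-++ (e ◅ p) q = cong (_ ∷_) (vs-++ p q)

  vs-∈ˡ : ∀ {s t u x} (p : s ⟶* t) (q : t ⟶* u) → x ∈ˡ vs p → x ∈ˡ vs (p ◅◅ q)
  vs-∈ˡ ε       q (here refl) = start∈vs q
  vs-∈ˡ (e ◅ p) q (here refl) = here refl
  vs-∈ˡ (e ◅ p) q (there m)   = there (vs-∈ˡ p q m)

  vs-∈ʳ : ∀ {s t u x} (p : s ⟶* t) (q : t ⟶* u) → x ∈ˡ vs q → x ∈ˡ vs (p ◅◅ q)
  vs-∈ʳ ε       q m = m
  vs-∈ʳ (e ◅ p) q m = there (vs-∈ʳ p q m)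

  Path : ∀ {s t} → s ⟶* t → Set
  Path = IsPath G

  path-split : ∀ {s t u} (p : s ⟶* t) (q : t ⟶* u) → Path (p ◅◅ q) →
               Path p × Path q × (∀ {x} → x ∈ˡ inits p → ¬ x ∈ˡ vs q)
  path-split ε       q h = [] ∷ [] , h , λ ()
  path-split (e ◅ p) q (hd ∷ h) =
    let (a , b , c) = path-split p q h
    in All′.tabulate (λ m → All′.lookup hd (vs-∈ˡ p q m)) ∷ a , b ,
       λ { (here refl) m → All′.lookup hd (vs-∈ʳ p q m) refl ; (there k) m → c k m }

  path-join : ∀ {s t u} (p : s ⟶* t) (q : t ⟶* u) → Path p → Path q →
              (∀ {x} → x ∈ˡ inits p → ¬ x ∈ˡ vs q) → Path (p ◅◅ q)
  path-join ε       q hp hq d = hq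
  path-join (e ◅ p) q (h ∷ hp) hq d = All′.tabulate fresh ∷ path-join p q hp hq (λ m → d (there m))
    where
    fresh : ∀ {x} → x ∈ˡ vs (p ◅◅ q) → _ ≢ x
    fresh {x} m refl with ∈-++⁻ (inits p) (subst (x ∈ˡ_) (vs-++ p q) m)
    ... | inj₁ k = All′.lookup h (inits⊆vs p k) refl
    ... | inj₂ k = d (here refl) k

  record FirstAt (P : V → Set) {s t} (p : s ⟶* t) : Set where
    constructor first
    field
      {mid}  : V
      before : s ⟶* mid
      after  : mid ⟶* t
      joined : p ≡ before ◅◅ after
      at     : P mid
      none   : All (λ x → ¬ P x) (inits before)

  splitFirst : ∀ {P : V → Set} → (∀ x → Dec (P x)) → ∀ {s t} (p : s ⟶* t) → FirstAt P p ⊎ All (λ x → ¬ P x) (vs p)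
  splitFirst P? {s} ε with P? s
  ... | yes h = inj₁ (first ε ε refl h [])
  ... | no nh = inj₂ (nh ∷ [])
  splitFirst P? {s} (e ◅ p) with P? s
  ... | yes h = inj₁ (first ε (e ◅ p) refl h [])
  ... | no nh with splitFirst P? p
  ...   | inj₁ (first a b eq h f) = inj₁ (first (e ◅ a) b (cong (e ◅_) eq) h (nh ∷ f))
  ...   | inj₂ h = inj₂ (nh ∷ h)

  splitAtVertex : ∀ {s t x} (p : s ⟶* t) → x ∈ˡ vs p →
                  Σ (s ⟶* x) λ a → Σ (x ⟶* t) λ b → p ≡ a ◅◅ b × All (λ y → ¬ x ≡ y) (inits a)
  splitAtVertex {x = x} p m with splitFirst (x Finₚ.≟_) p
  ... | inj₁ (first a b eq refl f) = a , b , eq , f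
  ... | inj₂ h = ⊥-elim (All′.lookup h m refl)

  -- An undirected edge of nonnegative weight behaves like two opposite arcs and may be used twice,
  -- so only the traversals of negative edges are recorded.
  negStep : ∀ {u v} → Step G u v → List (V × V)
  negStep {u} {v} (along-edge w _) = if does (0# ≤ᵣ? w) then [] else (u , v) ∷ []
  negStep (along-arc _ _)          = []

  negs : ∀ {s t} → s ⟶* t → List (V × V)
  negs ε       = []
  negs (e ◅ p) = negStep e ++ negs p

  NegAdj : V → V → Set
  NegAdj = NegAdjacent G

  data NegView {u v} : Step G u v → List (V × V) → Set where
    is-neg  : ∀ {w} (eq : edge u v ≡ just w) → w <ᵣ 0# → NegView (along-edge w eq) ((u , v) ∷ [])
    non-neg : ∀ {e} → negStep e ≡ [] → NegView e []

  negView : ∀ {u v} (e : Step G u v) → NegView e (negStep e)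
  negView (along-arc w eq) = non-neg refl
  negView (along-edge w eq) with 0# ≤ᵣ? w in d
  ... | yes h = non-neg (cong (λ b → if does b then [] else _ ∷ []) d)
  ... | no nh = is-neg eq (≱⇒<ᵣ nh)

  negs-++ : ∀ {s t u} (p : s ⟶* t) (q : t ⟶* u) → negs (p ◅◅ q) ≡ negs p ++ negs q
  negs-++ ε       q = refl
  negs-++ (e ◅ p) q = trans (cong (negStep e ++_) (negs-++ p q)) (sym (++-assoc (negStep e) (negs p) (negs q)))

  infix 4 _~ᵉ_
  _~ᵉ_ : V × V → V × V → Set
  _~ᵉ_ = SameEdge G

  Distinct : List (V × V) → Set
  Distinct = AllPairs (λ e f → ¬ e ~ᵉ f)

  NegSimple : ∀ {s t} → s ⟶* t → Set
  NegSimple p = Distinct (negs p)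

  negs-ends : ∀ {s t x y} (p : s ⟶* t) → (x , y) ∈ˡ negs p → x ∈ˡ inits p × y ∈ˡ vs p × NegAdj x y
  negs-ends (e ◅ p) m with ∈-++⁻ (negStep e) m
  ... | inj₂ k = let (a , b , c) = negs-ends p k in there a , there b , c
  ... | inj₁ k with negStep e | negView e
  negs-ends (_ ◅ p) m | inj₁ (here refl) | _ | is-neg eq w<0 = here refl , there (start∈vs p) , _ , eq , w<0

  edges-ends : ∀ {s t x y} (p : s ⟶* t) → (x , y) ∈ˡ edges p → x ∈ˡ inits p × y ∈ˡ vs p
  edges-ends (along-edge w eq ◅ p) (here refl) = here refl , there (start∈vs p)
  edges-ends (along-edge w eq ◅ p) (there m)   = let (a , b) = edges-ends p m in there a , there b
  edges-ends (along-arc w eq ◅ p)  m           = let (a , b) = edges-ends p m in there a , there b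

  fresh-edge : ∀ {s t u v f} (p : s ⟶* t) → All (u ≢_) (vs p) → (proj₁ f ∈ˡ vs p) → (proj₂ f ∈ˡ vs p) → ¬ (u , v) ~ᵉ f
  fresh-edge p h a b (inj₁ (refl , _)) = All′.lookup h a refl
  fresh-edge p h a b (inj₂ (refl , _)) = All′.lookup h b refl

  path-edges : ∀ {s t} (p : s ⟶* t) → Path p → Distinct (edges p)
  path-edges ε                      h        = []
  path-edges (along-edge w eq ◅ p) (hd ∷ h) =
    All′.tabulate (λ {f} m → let (a , b) = edges-ends p m in fresh-edge {f = f} p hd (inits⊆vs p a) b) ∷ path-edges p h
  path-edges (along-arc w eq ◅ p)  (hd ∷ h) = path-edges p h

  path-negSimple : ∀ {s t} (p : s ⟶* t) → Path p → NegSimple p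
  path-negSimple ε       h        = []
  path-negSimple (e ◅ p) (hd ∷ h) with negStep e | negView e
  ... | _ | non-neg _  = path-negSimple p h
  ... | _ | is-neg _ _ = All′.tabulate (λ {f} m → let (a , b , _) = negs-ends p m in
                           fresh-edge {f = f} p hd (inits⊆vs p a) b) ∷ path-negSimple p h

  no-loop-step : ∀ {v} → ¬ Step G v v
  no-loop-step {v} (along-edge w eq) = case trans (sym (edge-loop v)) eq of λ ()
  no-loop-step {v} (along-arc w eq)  = case trans (sym (arc-loop v)) eq of λ ()

  edge-weight-sym : ∀ {u v w w'} → edge u v ≡ just w → edge v u ≡ just w' → w ≡ w'
  edge-weight-sym {u} {v} a b = just-injective (trans (sym a) (trans (edge-sym u v) b))

  private
    -- On the closed walk, `u` is met again only at the very end and `v` only at the start of the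
    -- remaining path. A second use of the edge `uv` would be a single step from `v` to `u`, which
    -- is excluded because at least two steps remain.
    back : ∀ {s t u v x y} (e : Step G v s) (p : s ⟶* t) → t ≡ u → Path (e ◅ p) → All (λ z → ¬ u ≡ z) (v ∷ inits p) →
           (0 < len p) → (x , y) ∈ˡ edges (e ◅ p) → ¬ (u , v) ~ᵉ (x , y)
    back e p refl h nu l m (inj₁ (refl , _)) = All′.lookup nu (proj₁ (edges-ends (e ◅ p) m)) refl
    back (along-edge w eq) p@(_ ◅ _) refl h nu l (here refl) (inj₂ (refl , _)) = All′.lookup nu (there (here refl)) refl
    back (along-edge w eq) p@(_ ◅ _) refl (hd ∷ h) nu l (there m) (inj₂ (refl , refl)) =
      All′.lookup hd (inits⊆vs p (proj₁ (edges-ends p m))) refl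
    back (along-arc w eq)  p@(_ ◅ _) refl (hd ∷ h) nu l m (inj₂ (refl , refl)) =
      All′.lookup hd (inits⊆vs p (proj₁ (edges-ends p m))) refl

  -- The only closed walk with distinct vertices that is not a cycle goes back
  -- and forth along an edge.
  closed-nonneg : Conservative G → ∀ {u v} (e : Step G u v) (p : v ⟶* u) → Path p →
                  All (λ z → ¬ u ≡ z) (inits p) → NegSimple (e ◅ p) → 0# ≤ᵣ stepWeight G e +ᵣ wt p
  closed-nonneg cons e ε h nu s = ⊥-elim (no-loop-step e)
  closed-nonneg cons e@(along-edge w eq) (along-edge w' eq' ◅ ε) h nu s
    with edge-weight-sym eq eq' | 0# ≤ᵣ? w
  ... | refl | yes w≥0 = +ᵣ-nonneg w≥0 (+ᵣ-nonneg w≥0 ≤ᵣ-refl)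
  ... | refl | no w≱0 with 0# ≤ᵣ? w | s
  ...   | yes w≥0 | _ = ⊥-elim (w≱0 w≥0)
  ...   | no _ | ((ne ∷ _) ∷ _) = ⊥-elim (ne (inj₂ (refl , refl)))
  closed-nonneg cons e@(along-arc w eq) p@(along-edge w' eq' ◅ ε) h nu s =
    ≮⇒≥ᵣ (cons (e ◅ p) ((λ ()) , (nu ∷ ([] ∷ [])) , [] ∷ []))
  closed-nonneg cons e@(along-edge w eq) p@(along-arc w' eq' ◅ ε) h nu s =
    ≮⇒≥ᵣ (cons (e ◅ p) ((λ ()) , (nu ∷ ([] ∷ [])) , [] ∷ []))
  closed-nonneg cons e@(along-arc w eq) p@(along-arc w' eq' ◅ ε) h nu s =
    ≮⇒≥ᵣ (cons (e ◅ p) ((λ ()) , (nu ∷ ([] ∷ [])) , []))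
  closed-nonneg cons e p@(g ◅ q@(_ ◅ _)) h nu s =
    ≮⇒≥ᵣ (cons (e ◅ p) ((λ ()) , (nu ∷ unique-inits p h) , distinct e))
    where
    unique-inits : ∀ {s t} (p : s ⟶* t) → Path p → Unique (inits p)
    unique-inits ε       _        = []
    unique-inits (e ◅ p) (hd ∷ h) = All′.tabulate (λ m → All′.lookup hd (inits⊆vs p m)) ∷ unique-inits p h
    distinct : ∀ e → Distinct (edges (e ◅ p))
    distinct (along-edge w eq) = All′.tabulate (λ m → back g q refl h nu (s≤s z≤n) m) ∷ path-edges p h
    distinct (along-arc w eq)  = path-edges p h

  end∉inits : ∀ {s t} (p : s ⟶* t) → Path p → ¬ t ∈ˡ inits p
  end∉inits (e ◅ p) (hd ∷ _) (here refl) = All′.lookup hd (end∈vs p) refl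
  end∉inits (e ◅ p) (_ ∷ h)  (there m)   = end∉inits p h m

  negs-⊆ˡ : ∀ {s t u} (p : s ⟶* t) (q : t ⟶* u) {e} → e ∈ˡ negs p → e ∈ˡ negs (p ◅◅ q)
  negs-⊆ˡ p q m = subst (_ ∈ˡ_) (sym (negs-++ p q)) (∈-++⁺ˡ m)

  negs-⊆ʳ : ∀ {s t u} (p : s ⟶* t) (q : t ⟶* u) {e} → e ∈ˡ negs q → e ∈ˡ negs (p ◅◅ q)
  negs-⊆ʳ p q m = subst (_ ∈ˡ_) (sym (negs-++ p q)) (∈-++⁺ʳ (negs p) m)

  negSimple-cons : ∀ {s t u v r} (e : Step G u v) (q : s ⟶* t) (p : v ⟶* r) → NegSimple q →
                   (∀ {f} → f ∈ˡ negs q → f ∈ˡ negs p) → NegSimple (e ◅ p) → Distinct (negStep e ++ negs q)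
  negSimple-cons e q p sq sub s with negStep e | negView e
  ... | _ | non-neg _ = sq
  negSimple-cons e q p sq sub (hd ∷ _) | _ | is-neg _ _ = All′.tabulate (λ m → All′.lookup hd (sub m)) ∷ sq

  negSimple-tail : ∀ {s t u} (e : Step G s t) (p : t ⟶* u) → NegSimple (e ◅ p) → NegSimple p
  negSimple-tail e p s with negStep e | negView e
  ... | _ | non-neg _ = s
  negSimple-tail e p (_ ∷ s) | _ | is-neg _ _ = s

  -- A walk is cut down to a path by removing closed walks, which have
  -- nonnegative weight because they use each negative edge at most once.
  reduce : Conservative G → ∀ {s t} (p : s ⟶* t) → NegSimple p →
           Σ (s ⟶* t) λ q → Path q × wt q ≤ᵣ wt p × (∀ {e} → e ∈ˡ negs q → e ∈ˡ negs p)
  reduce cons ε       s = ε , [] ∷ [] , ≤ᵣ-refl , λ ()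
  reduce cons {u} (e ◅ p) s with reduce cons p (negSimple-tail e p s)
  ... | q , hq , le , sub with splitFirst (u Finₚ.≟_) q
  ...   | inj₂ h = e ◅ q , h ∷ hq , +ᵣ-monoʳ-≤ _ le , λ m →
          [ (λ k → ∈-++⁺ˡ k) , (λ k → ∈-++⁺ʳ (negStep e) (sub k)) ]′ (∈-++⁻ (negStep e) m)
  ...   | inj₁ (first a b refl refl none) with path-split a b hq
  ...     | ha , hb , _ = b , hb ,
            ≤ᵣ-dropˡ (closed-nonneg cons e a ha none
                (negSimple-cons e a p (path-negSimple a ha) (λ m → sub (negs-⊆ˡ a b m)) s))
              (≤ᵣ-trans (≤ᵣ-reflexive (trans (+ᵣ-assoc _ _ _) (cong (stepWeight G e +ᵣ_) (sym (wt-++ a b)))))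
                (+ᵣ-monoʳ-≤ _ le)) ,
            λ m → ∈-++⁺ʳ (negStep e) (sub (negs-⊆ʳ a b m))

  path-closed : ∀ {u} (p : u ⟶* u) → Path p → wt p ≡ 0#
  path-closed ε       h        = refl
  path-closed (e ◅ p) (hd ∷ h) = ⊥-elim (All′.lookup hd (end∈vs p) refl)

  reversed : ∀ {u v} → NegAdj u v → NegAdj v u
  reversed {u} {v} (w , eq , w<0) = w , trans (edge-sym v u) eq , w<0

  -- H is the underlying undirected graph of the strong components.

  infix 4 _≋_
  _≋_ : V → V → Set
  u ≋ v = (u ⟶* v) × (v ⟶* u)

  ≋-sym : ∀ {u v} → u ≋ v → v ≋ u
  ≋-sym (a , b) = b , a

  ≋-trans : ∀ {u v w} → u ≋ v → v ≋ w → u ≋ w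
  ≋-trans (a , b) (c , d) = a ◅◅ c , d ◅◅ b

  HStep : V → V → V → Set
  HStep c u v = u ≢ c × v ≢ c × u ≋ v × Adjacent G u v

  Conn : V → V → V → Set
  Conn c = Star (HStep c)

  conn-sym : ∀ {c x y} → Conn c x y → Conn c y x
  conn-sym ε = ε
  conn-sym ((a , b , e , f) ◅ p) = conn-sym p ◅◅ ((b , a , ≋-sym e , [ inj₂ , inj₁ ]′ f) ◅ ε)

  record Insep (x y : V) : Set where
    constructor insep
    field
      strong : x ≋ y
      conn   : ∀ c → c ≢ x → c ≢ y → Conn c x y
  open Insep public

  insep-refl : ∀ {x} → Insep x x
  insep-refl = insep (ε , ε) (λ _ _ _ → ε)

  insep-sym : ∀ {x y} → Insep x y → Insep y x
  insep-sym (insep e f) = insep (≋-sym e) (λ c a b → conn-sym (f c b a))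

  insep-step : ∀ {x y} → x ≋ y → Adjacent G x y → Insep x y
  insep-step e a = insep e (λ c cx cy → ((λ q → cx (sym q)) , (λ q → cy (sym q)) , e , a) ◅ ε)

  -- A vertex `c` differs from `a` or from `b`, and the connection goes through that one. This is
  -- why two distinct vertices determine a block.
  insep-join : ∀ {a b x y} → a ≢ b → Insep x a → Insep x b → Insep a y → Insep b y → Insep x y
  insep-join {a} {b} {x} {y} a≢b xa xb ay by = insep (≋-trans (strong xa) (strong ay)) go
    where
    go : ∀ c → c ≢ x → c ≢ y → Conn c x y
    go c cx cy with c Finₚ.≟ a
    ... | no ca    = conn xa c cx ca ◅◅ conn ay c ca cy
    ... | yes refl = conn xb c cx a≢b ◅◅ conn by c a≢b cy

  step-≋ : ∀ {u v} → Step G u v → v ⟶* u → u ≋ v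
  step-≋ e p = e ◅ ε , p

  -- The return walk keeps all of `p` in one strong component. It may itself pass through `c`, since
  -- it only witnesses the component.
  conn-walk : ∀ {c a b} (p : a ⟶* b) → All (c ≢_) (vs p) → b ⟶* a → Conn c a b
  conn-walk ε h r = ε
  conn-walk (e ◅ p) (c≢u ∷ h) r =
    ((λ q → c≢u (sym q)) , (λ q → All′.lookup h (start∈vs p) (sym q)) , step-≋ e (p ◅◅ r) , inj₁ e) ◅
    conn-walk p h (r ◅◅ (e ◅ ε))

  ∈vs? : ∀ {s t} c (p : s ⟶* t) → c ∈ˡ vs p ⊎ All (c ≢_) (vs p)
  ∈vs? c p with splitFirst (c Finₚ.≟_) p
  ... | inj₁ (first a b refl refl _) = inj₁ (vs-∈ʳ a b (start∈vs b))
  ... | inj₂ h = inj₂ h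

  -- If `c` lies on the part of the path between `s` and `x`, then the part from `x` to `t` avoids
  -- it, and inseparability leads from `t` back to `s`; symmetrically for the other part.
  path-insep : ∀ {s t} (p : s ⟶* t) → Path p → Insep s t → ∀ {x} → x ∈ˡ vs p → Insep x s × Insep x t
  path-insep {s} {t} p hp st {x} m with splitAtVertex p m
  ... | a , b , refl , none with path-split a b hp
  ...   | ha , hb , disj = insep (b ◅◅ r , a) toS , insep (b , r ◅◅ a) toT
    where
    r = proj₂ (strong st)
    -- c is not on both parts of the path, unless it is x.
    toS : ∀ c → c ≢ x → c ≢ s → Conn c x s
    toS c cx cs with ∈vs? c a
    ... | inj₂ h = conn-sym (conn-walk a h (b ◅◅ r))
    ... | inj₁ k with ∈vs? c b
    ...   | inj₂ h = conn-walk b h (r ◅◅ a) ◅◅ conn-sym (conn st c cs (λ e → All′.lookup h (end∈vs b) e))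
    ...   | inj₁ k' with ∈-++⁻ (inits a) k
    ...     | inj₁ k'' = ⊥-elim (disj k'' k')
    ...     | inj₂ (here e) = ⊥-elim (cx e)
    toT : ∀ c → c ≢ x → c ≢ t → Conn c x t
    toT c cx ct with ∈vs? c b
    ... | inj₂ h = conn-walk b h (r ◅◅ a)
    ... | inj₁ k with ∈vs? c a
    ...   | inj₂ h = conn-sym (conn-walk a h (b ◅◅ r)) ◅◅ conn st c (λ e → All′.lookup h (start∈vs a) e) ct
    ...   | inj₁ k' with ∈-++⁻ (inits a) k'
    ...     | inj₁ k'' = ⊥-elim (disj k'' k)
    ...     | inj₂ (here e) = ⊥-elim (cx e)

-- Sets of colours and negative forests

module Bits where
  odd : ℕ → Bool
  odd zero    = false
  odd (suc m) = not (odd m)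

  bit : ℕ → ℕ → Bool
  bit m zero    = odd m
  bit m (suc i) = bit ⌊ m /2⌋ i

  -- Written so that `2 ^ suc j` unfolds to `double (2 ^ j)`.
  double : ℕ → ℕ
  double p = p + (p + 0)

  double-suc : ∀ p → double (suc p) ≡ suc (suc (double p))
  double-suc p = cong suc (ℕₚ.+-suc p (p + 0))

  half-step : ∀ m → ⌊ suc m /2⌋ ≡ (if odd m then suc ⌊ m /2⌋ else ⌊ m /2⌋)
  half-step zero = refl
  half-step (suc zero) = refl
  half-step (suc (suc m)) rewrite half-step m | not-involutive (odd m) with odd m
  ... | true  = refl
  ... | false = refl

  half-double : ∀ m p → ⌊ m + double p /2⌋ ≡ ⌊ m /2⌋ + p
  half-double m zero    = trans (cong ⌊_/2⌋ (ℕₚ.+-identityʳ m)) (sym (ℕₚ.+-identityʳ _))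
  half-double m (suc p) = trans (cong ⌊_/2⌋ (trans (cong (m +_) (double-suc p))
      (trans (ℕₚ.+-suc m _) (cong suc (ℕₚ.+-suc m _)))))
    (trans (cong suc (half-double m p)) (sym (ℕₚ.+-suc _ p)))

  odd-double : ∀ m p → odd (m + double p) ≡ odd m
  odd-double m zero    = cong odd (ℕₚ.+-identityʳ m)
  odd-double m (suc p) = trans (cong odd (trans (cong (m +_) (double-suc p))
      (trans (ℕₚ.+-suc m _) (cong suc (ℕₚ.+-suc m _)))))
    (trans (not-involutive _) (odd-double m p))

  bit-zero : ∀ i → bit 0 i ≡ false
  bit-zero zero    = refl
  bit-zero (suc i) = bit-zero i

  -- With digit `j` equal to 0 the addition causes no carry, so adding `2 ^ j` means adding the
  -- element `j` to a set.
  bit-add : ∀ j m i → bit m j ≡ false → bit (m + 2 ^ j) i ≡ (if i ≡ᵇ j then true else bit m i)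
  bit-add zero    m zero    h = trans (cong odd (ℕₚ.+-comm m 1)) (cong not h)
  bit-add zero    m (suc i) h = cong (λ x → bit x i) (trans (cong ⌊_/2⌋ (ℕₚ.+-comm m 1))
                                  (trans (half-step m) (cong (λ b → if b then suc ⌊ m /2⌋ else ⌊ m /2⌋) h)))
  bit-add (suc j) m zero    h = odd-double m (2 ^ j)
  bit-add (suc j) m (suc i) h = trans (cong (λ x → bit x i) (half-double m (2 ^ j))) (bit-add j ⌊ m /2⌋ i h)

  parity : ∀ m → m ≡ (if odd m then 1 else 0) + double ⌊ m /2⌋
  parity zero = refl
  parity (suc zero) = refl
  parity (suc (suc m)) rewrite not-involutive (odd m) =
    trans (cong (λ x → suc (suc x)) (parity m))
      (trans (sym (trans (ℕₚ.+-suc (if odd m then 1 else 0) _) (cong suc (ℕₚ.+-suc (if odd m then 1 else 0) _))))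
        (cong ((if odd m then 1 else 0) +_) (sym (double-suc ⌊ m /2⌋))))

  half-< : ∀ m p → m < double p → ⌊ m /2⌋ < p
  half-< m p h with ⌊ m /2⌋ <? p
  ... | yes q = q
  ... | no nq = ⊥-elim (ℕₚ.<-irrefl refl (ℕₚ.<-≤-trans h (ℕₚ.≤-trans
      (ℕₚ.+-mono-≤ p≤h (ℕₚ.+-monoˡ-≤ 0 p≤h))
      (subst (double ⌊ m /2⌋ ≤_) (sym (parity m)) (ℕₚ.m≤n+m _ (if odd m then 1 else 0))))))
    where p≤h = ℕₚ.≮⇒≥ nq

  private
    below-double : ∀ b h p → h < p → (if b then 1 else 0) + double h < double p
    below-double b h p h<p = ℕₚ.<-≤-trans (s≤s (lem b))
      (ℕₚ.≤-trans (ℕₚ.≤-reflexive (sym (double-suc h))) (ℕₚ.+-mono-≤ h<p (ℕₚ.+-monoˡ-≤ 0 h<p)))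
      where lem : ∀ b → (if b then 1 else 0) + double h ≤ suc (double h)
            lem true  = ℕₚ.≤-refl
            lem false = ℕₚ.n≤1+n _

  -- Setting one of the first `k` digits creates no new digit. This keeps all sets of colours within
  -- the `2 ^ K` masks.
  add-bit-< : ∀ j k m → bit m j ≡ false → j < k → m < 2 ^ k → m + 2 ^ j < 2 ^ k
  add-bit-< zero    (suc k) m h _ m< = subst (_< 2 ^ suc k)
    (trans (cong suc (sym (trans (parity m) (cong (λ b → (if b then 1 else 0) + double ⌊ m /2⌋) h)))) (ℕₚ.+-comm 1 m))
    (below-double true ⌊ m /2⌋ (2 ^ k) (half-< m (2 ^ k) m<))
  add-bit-< (suc j) (suc k) m h (s≤s j<k) m< = subst (_< 2 ^ suc k) eq
    (below-double (odd m) (⌊ m /2⌋ + 2 ^ j) (2 ^ k) (add-bit-< j k ⌊ m /2⌋ h j<k (half-< m (2 ^ k) m<)))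
    where
    dbl+ : ∀ a b → double (a + b) ≡ double a + double b
    dbl+ a b rewrite ℕₚ.+-identityʳ (a + b) | ℕₚ.+-identityʳ a | ℕₚ.+-identityʳ b = +-interchange a b a b
      where +-interchange : ∀ a b c d → (a + b) + (c + d) ≡ (a + c) + (b + d)
            +-interchange a b c d = trans (ℕₚ.+-assoc a b (c + d)) (trans (cong (a +_)
              (trans (sym (ℕₚ.+-assoc b c d)) (trans (cong (_+ d) (ℕₚ.+-comm b c)) (ℕₚ.+-assoc c b d))))
              (sym (ℕₚ.+-assoc a c (b + d))))
    eq : (if odd m then 1 else 0) + double (⌊ m /2⌋ + 2 ^ j) ≡ m + 2 ^ suc j
    eq = trans (cong ((if odd m then 1 else 0) +_) (dbl+ ⌊ m /2⌋ (2 ^ j)))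
           (trans (sym (ℕₚ.+-assoc (if odd m then 1 else 0) (double ⌊ m /2⌋) _)) (cong (_+ 2 ^ suc j) (sym (parity m))))

module Forests {ℝ : Reals} {n : ℕ} (G : MixedGraph ℝ n) where
  open Real ℝ
  open MixedGraph G
  open Walks G
  open Bits

  AllNeg : ∀ {s t} → s ⟶* t → Set
  AllNeg ε = ⊤
  AllNeg (_◅_ {u} {v} e p) = negStep e ≡ (u , v) ∷ [] × AllNeg p

  record Forest : Set where
    field
      lab    : V → ℕ
      W      : V → V → Carrier
      W-sym  : ∀ {u v} → lab u ≡ lab v → W u v ≡ W v u
      tree   : ∀ {u v} → lab u ≡ lab v → Σ (u ⟶* v) λ p → Path p × AllNeg p × wt p ≡ W u v
      negLab : ∀ {u v} → NegAdj u v → lab u ≡ lab v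
      -- The sides of the tree edge ab: this is what makes the graph acyclic.
      cut    : ∀ {a b} → NegAdj a b → Σ (V → Bool) λ σ → σ a ≢ σ b ×
                 (∀ {c d} → NegAdj c d → ¬ (a , b) ~ᵉ (c , d) → σ c ≡ σ d)

  -- For `u ≢ v` and `a ≢ b` this says that both pairs determine the same weak block.
  SameBlock : V → V → V → V → Set
  SameBlock u v a b = (Insep u a × Insep u b) × (Insep v a × Insep v b)

  -- The value 0 of `col` means that the pair has no colour, and `suc j` stands for colour `j`.
  -- Pairs are coloured instead of trees because one tree of the whole graph may meet many blocks
  -- and gets a colour in each of them.
  record Colouring (F : Forest) : Set where
    open Forest F
    field
      col  : V → V → ℕ
      K    : ℕ
      some : ∀ {u v} → u ≢ v → lab u ≡ lab v → Insep u v → ∃[ j ] col u v ≡ suc j × j < K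
      pair : ∀ {u v j} → col u v ≡ suc j → u ≢ v × lab u ≡ lab v × Insep u v
      same : ∀ {u v a b i j} → col u v ≡ suc i → col a b ≡ suc j → SameBlock u v a b → lab u ≡ lab a → i ≡ j
      diff : ∀ {u v a b j} → col u v ≡ suc j → col a b ≡ suc j → SameBlock u v a b → lab u ≡ lab a

  ν : V × V → Carrier
  ν (a , b) = -ᵣ (fromMaybe 0# (edge a b))

  mass : List (V × V) → Carrier
  mass []      = 0#
  mass (e ∷ l) = ν e +ᵣ mass l

  mass-++ : ∀ l k → mass (l ++ k) ≡ mass l +ᵣ mass k
  mass-++ []      k = sym (+ᵣ-identityˡ _)
  mass-++ (e ∷ l) k = trans (cong (ν e +ᵣ_) (mass-++ l k)) (sym (+ᵣ-assoc _ _ _))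

  ν-sym : ∀ a b → ν (a , b) ≡ ν (b , a)
  ν-sym a b = cong (λ m → -ᵣ (fromMaybe 0# m)) (edge-sym a b)

  IsNeg : V × V → Set
  IsNeg (a , b) = NegAdj a b

  ν-nonneg : ∀ {e} → IsNeg e → 0# ≤ᵣ ν e
  ν-nonneg (w , eq , (w≤0 , _)) rewrite eq = neg-nonneg w≤0

  -- Each element of `l` is matched with its reversal in `k`, which is then removed. As the elements
  -- of `l` are different edges, no other reversal is lost; what remains of `k` has nonnegative
  -- mass.
  mass-≤ : ∀ l k → Distinct l → (∀ {a b} → (a , b) ∈ˡ l → (b , a) ∈ˡ k) → (∀ {e} → e ∈ˡ k → IsNeg e) → mass l ≤ᵣ mass k
  mass-≤ []            k d h ng = nonneg k ng
    where nonneg : ∀ k → (∀ {e} → e ∈ˡ k → IsNeg e) → 0# ≤ᵣ mass k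
          nonneg []      ng = ≤ᵣ-refl
          nonneg (e ∷ k) ng = +ᵣ-nonneg (ν-nonneg {e} (ng (here refl))) (nonneg k (λ m → ng (there m)))
  mass-≤ ((a , b) ∷ l) k (hd ∷ d) h ng with ∈-∃++ (h (here refl))
  ... | k₁ , k₂ , refl = ≤ᵣ-trans
      (+ᵣ-mono-≤ (≤ᵣ-reflexive (ν-sym a b)) (mass-≤ l (k₁ ++ k₂) d h' (λ m → ng (weaken (∈-++⁻ k₁ m)))))
      (≤ᵣ-reflexive (trans (cong (ν (b , a) +ᵣ_) (mass-++ k₁ k₂)) (trans (sym (+ᵣ-assoc _ _ _))
        (trans (cong (_+ᵣ mass k₂) (+ᵣ-comm _ _)) (trans (+ᵣ-assoc _ _ _) (sym (mass-++ k₁ _)))))))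
    where
    weaken : ∀ {e} → e ∈ˡ k₁ ⊎ e ∈ˡ k₂ → e ∈ˡ k₁ ++ (b , a) ∷ k₂
    weaken (inj₁ m) = ∈-++⁺ˡ m
    weaken (inj₂ m) = ∈-++⁺ʳ k₁ (there m)
    h' : ∀ {c d} → (c , d) ∈ˡ l → (d , c) ∈ˡ k₁ ++ k₂
    h' {c} {d} m with ∈-++⁻ k₁ (h (there m))
    ... | inj₁ k = ∈-++⁺ˡ k
    ... | inj₂ (there k) = ∈-++⁺ʳ k₁ k
    ... | inj₂ (here refl) = ⊥-elim (All′.lookup hd m (inj₁ (refl , refl)))

  data Chain : V → V → List (V × V) → Set where
    []  : ∀ {x} → Chain x x []
    _∷_ : ∀ {x y z l} → NegAdj x y → Chain y z l → Chain x z ((x , y) ∷ l)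

  chain-++ : ∀ {x y z l k} → Chain x y l → Chain y z k → Chain x z (l ++ k)
  chain-++ []      d = d
  chain-++ (e ∷ c) d = e ∷ chain-++ c d

  chain-neg : ∀ {x y l e} → Chain x y l → e ∈ˡ l → IsNeg e
  chain-neg (e ∷ c) (here refl) = e
  chain-neg (e ∷ c) (there m)   = chain-neg c m

  ~ᵉ? : ∀ e f → Dec (e ~ᵉ f)
  ~ᵉ? (a , b) (c , d) = ((a Finₚ.≟ c) ×-dec (b Finₚ.≟ d)) ⊎-dec ((a Finₚ.≟ d) ×-dec (b Finₚ.≟ c))

  module _ (F : Forest) where
    open Forest F

    -- Only the edge `ab` crosses its cut, so without a step from `b` to `a` the side of `b` is
    -- never left.
    stays : ∀ {a b x y l} (e : NegAdj a b) → Chain x y l → ¬ (b , a) ∈ˡ l →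
            proj₁ (cut e) x ≡ proj₁ (cut e) b → proj₁ (cut e) y ≡ proj₁ (cut e) b
    stays e [] nin h = h
    stays {a} {b} e (_∷_ {x} {y} g c) nin h with ~ᵉ? (a , b) (x , y)
    ... | no ne = stays e c (λ m → nin (there m)) (trans (sym (proj₂ (proj₂ (cut e)) g ne)) h)
    ... | yes (inj₁ (refl , refl)) = stays e c (λ m → nin (there m)) refl
    ... | yes (inj₂ (refl , refl)) = ⊥-elim(nin (here refl))

    -- Suppose there is no step from `b` to `a`. After the step from `a` to `b` the walk stays on
    -- the side of `b`, so its common start and end `x` is there. Then the walk is still on that
    -- side when it arrives in `a`, which the cut forbids.
    closed-reverses : ∀ {a b x l} → Chain x x l → (a , b) ∈ˡ l → (b , a) ∈ˡ l
    closed-reverses {a} {b} {x} {l} c m with any? (λ f → ≡-dec Finₚ._≟_ Finₚ._≟_ (b , a) f) l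
    ... | yes k = k
    ... | no nk = ⊥-elim (proj₁ (proj₂ (cut e)) (go c m nk))
      where
      e = chain-neg c m
      after : ∀ {y z l} → Chain y z l → (a , b) ∈ˡ l → ¬ (b , a) ∈ˡ l → proj₁ (cut e) z ≡ proj₁ (cut e) b
      after (_ ∷ c) (here refl) nin = stays e c (λ m → nin (there m)) refl
      after (_ ∷ c) (there m)   nin = after c m (λ k → nin (there k))
      before : ∀ {y z l} → Chain y z l → (a , b) ∈ˡ l → ¬ (b , a) ∈ˡ l → proj₁ (cut e) y ≡ proj₁ (cut e) b → proj₁ (cut e) a ≡ proj₁ (cut e) b
      before (_ ∷ c) (here refl) nin h = h
      before (_∷_ {y} g c) (there m) nin h with ~ᵉ? (a , b) (y , _)
      ... | no ne = before c m (λ k → nin (there k)) (trans (sym (proj₂ (proj₂ (cut e)) g ne)) h)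
      ... | yes (inj₁ (refl , _)) = h
      ... | yes (inj₂ (refl , refl)) = ⊥-elim(nin (here refl))
      go : ∀ {l} → Chain x x l → (a , b) ∈ˡ l → ¬ (b , a) ∈ˡ l → proj₁ (cut e) a ≡ proj₁ (cut e) b
      go c m nin = before c m nin (after c m nin)

    private
      step-weight : ∀ {u v} (e : Step G u v) → negStep e ≡ (u , v) ∷ [] → NegAdj u v × stepWeight G e ≡ -ᵣ (ν (u , v))
      step-weight e h with negStep e | negView e
      step-weight _ refl | _ | is-neg eq w<0 = (_ , eq , w<0) ,
        sym (trans (cong (λ m → -ᵣ (-ᵣ (fromMaybe 0# m))) eq) (neg-involutive _))

    tree-chain : ∀ {s t} (p : s ⟶* t) → AllNeg p → Chain s t (negs p) × wt p ≡ -ᵣ (mass (negs p))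
    tree-chain ε       h = [] , sym neg-zero
    tree-chain (e ◅ p) (h , hs) rewrite h =
      let (a , b) = step-weight e h ; (c , d) = tree-chain p hs
      in a ∷ c , trans (cong₂ _+ᵣ_ b d) (sym (neg-+ _ _))

-- Walks inside a block and their excursions from a tree

module Blocks {ℝ : Reals} {n : ℕ} (G : MixedGraph ℝ n) where
  open Real ℝ
  open MixedGraph G
  open Walks G
  open Forests G
  open Bits

  record LastAt (P : V → Set) {s t} (p : s ⟶* t) : Set where
    constructor last
    field
      {mid}  : V
      before : s ⟶* mid
      after  : mid ⟶* t
      joined : p ≡ before ◅◅ after
      at     : P mid
      none   : ∀ {x y} → (x , y) ∈ˡ negs after → ¬ P y

  splitLast : ∀ {P : V → Set} → (∀ x → Dec (P x)) → ∀ {s t} (p : s ⟶* t) → LastAt P p ⊎ All (λ x → ¬ P x) (vs p)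
  splitLast P? {s} ε with P? s
  ... | yes h = inj₁ (last ε ε refl h λ ())
  ... | no nh = inj₂ (nh ∷ [])
  splitLast {P} P? {s} (e ◅ p) with splitLast P? p
  ... | inj₁ (last a b eq h f) = inj₁ (last (e ◅ a) b (cong (e ◅_) eq) h f)
  ... | inj₂ none with P? s
  ...   | no nh = inj₂ (nh ∷ none)
  ...   | yes h = inj₁ (last ε (e ◅ p) refl h λ m → All′.lookup none (head∈ m))
    where
    head∈ : ∀ {x y} → (x , y) ∈ˡ negs (e ◅ p) → y ∈ˡ vs p
    head∈ m with ∈-++⁻ (negStep e) m
    ... | inj₂ k = proj₁ (proj₂ (negs-ends p k))
    ... | inj₁ k with negStep e | negView e
    head∈ m | inj₁ (here refl) | _ | is-neg _ _ = start∈vs p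

  record FirstNeg {s t} (p : s ⟶* t) : Set where
    constructor firstNeg
    field
      {a b}    : V
      before   : s ⟶* a
      step     : Step G a b
      after    : b ⟶* t
      joined   : p ≡ before ◅◅ (step ◅ after)
      none     : negs before ≡ []
      negative : negStep step ≡ (a , b) ∷ []

  splitNeg : ∀ {s t} (p : s ⟶* t) → negs p ≡ [] ⊎ FirstNeg p
  splitNeg ε = inj₁ refl
  splitNeg (e ◅ p) with negStep e in eq | negView e
  ... | _ | is-neg _ _ = inj₂ (firstNeg ε e p refl refl eq)
  ... | _ | non-neg _ with splitNeg p
  ...   | inj₁ h = inj₁ h
  ...   | inj₂ (firstNeg q f r refl no-neg ng) = inj₂ (firstNeg (e ◅ q) f r refl (trans (cong (_++ negs q) eq) no-neg) ng)

  distinct-split : ∀ l {k} → Distinct (l ++ k) → Distinct l × Distinct k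
  distinct-split []      d        = [] , d
  distinct-split (e ∷ l) (hd ∷ d) = let (a , b) = distinct-split l d in Allₚ.++⁻ˡ l hd ∷ a , b

  distinct-lookup : ∀ {l e f} → Distinct l → e ∈ˡ l → f ∈ˡ l → e ~ᵉ f → e ≡ f
  distinct-lookup (hd ∷ d) (here refl) (here refl) s = refl
  distinct-lookup (hd ∷ d) (here refl) (there m)   s = ⊥-elim (All′.lookup hd m s)
  distinct-lookup (hd ∷ d) (there m)   (here refl) s = ⊥-elim (All′.lookup hd m (flip~ s))
    where flip~ : ∀ {e f} → e ~ᵉ f → f ~ᵉ e
          flip~ (inj₁ (refl , refl)) = inj₁ (refl , refl)
          flip~ (inj₂ (refl , refl)) = inj₂ (refl , refl)
  distinct-lookup (hd ∷ d) (there m)   (there k)   s = distinct-lookup d m k s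

  module InBlock (B : V → Set) where

    record Nice {s t} (p : s ⟶* t) : Set where
      constructor nice
      field
        inB    : ∀ {x} → x ∈ˡ vs p → B x
        simple : NegSimple p
    open Nice public

    nice-split : ∀ {s t u} (p : s ⟶* t) (q : t ⟶* u) → Nice (p ◅◅ q) → Nice p × Nice q
    nice-split p q (nice i s) =
      let (a , b) = distinct-split (negs p) (subst Distinct (negs-++ p q) s)
      in nice (λ m → i (vs-∈ˡ p q m)) a , nice (λ m → i (vs-∈ʳ p q m)) b

    module Trees (F : Forest) where
      open Forest F

      -- A walk between two vertices of a tree is compared with the walk L in
      -- the tree that keeps its tree edges (K) and replaces the excursions
      -- by tree paths (J).
      record Trace {x y} (Q : x ⟶* y) : Set where
        field
          {K J L}  : List (V × V)
          chain    : Chain x y L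
          distinct : Distinct K
          K⊆negs   : ∀ {e} → e ∈ˡ K → e ∈ˡ negs Q
          K⊆L      : ∀ {e} → e ∈ˡ K → e ∈ˡ L
          L⊆KJ     : ∀ {e} → e ∈ˡ L → e ∈ˡ K ⊎ e ∈ˡ J
          J-neg    : ∀ {e} → e ∈ˡ J → IsNeg e
          bounded  : mass J ≤ᵣ wt Q +ᵣ mass K

      -- The bound on the length lets the induction in `find` supply this for walks shorter than the
      -- one under consideration.
      Excursions : ℕ → Set
      Excursions k = ∀ {x x'} (E : x ⟶* x') → len E ≤ k → Nice E → lab x ≡ lab x' →
                     (∀ {u v} → (u , v) ∈ˡ negs E → lab u ≢ lab x) → 0# ≤ᵣ wt E +ᵣ W x x'

      trace-edge : ∀ {x y z} (e : Step G x z) (Q : z ⟶* y) → negStep e ≡ (x , z) ∷ [] → NegSimple (e ◅ Q) →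
                   Trace Q → Trace (e ◅ Q)
      trace-edge {x} {z = z} e Q eqn s tr with negStep e in eqn' | negView e
      ... | _ | is-neg {w} we w<0 = record
        { K = (x , z) ∷ K ; J = J ; chain = (w , we , w<0) ∷ chain
        ; distinct = All′.tabulate (λ m → All′.lookup (hdOf s) (K⊆negs m)) ∷ distinct
        ; K⊆negs = λ { (here refl) → subst (λ l → _ ∈ˡ l ++ negs Q) (sym eqn') (here refl)
                     ; (there m) → ∈-++⁺ʳ (negStep e) (K⊆negs m) }
        ; K⊆L = λ { (here refl) → here refl ; (there m) → there (K⊆L m) }
        ; L⊆KJ = λ { (here refl) → inj₁ (here refl) ; (there m) → [ (λ h → inj₁ (there h)) , inj₂ ]′ (L⊆KJ m) }
        ; J-neg = J-neg
        ; bounded = ≤ᵣ-trans bounded (≤ᵣ-reflexive (sym (trans (+ᵣ-interchange _ _ _ _)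
            (trans (cong (_+ᵣ (wt Q +ᵣ mass K)) cancel) (+ᵣ-identityˡ _))))) }
        where
        open Trace tr
        hdOf : ∀ {e : V × V} {l} → Distinct (e ∷ l) → All (λ f → ¬ e ~ᵉ f) l
        hdOf (h ∷ _) = h
        cancel : w +ᵣ ν (x , z) ≡ 0#
        cancel = trans (cong (λ m → w +ᵣ -ᵣ (fromMaybe 0# m)) we) (-ᵣ-inverseʳ w)

      -- A negative first step stays in the tree and is kept. Any other first step opens an
      -- excursion, which ends at the first later vertex of the tree; hence it contains no edge of
      -- the tree and weighs at least minus the weight of the tree path between its ends. That path
      -- enters `L` in its place.
      trace : ∀ k → Excursions k → ∀ {x y} (Q : x ⟶* y) → len Q ≤ k → Nice Q → lab x ≡ lab y → Trace Q
      trace k exc ε le ni eq = record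
        { K = [] ; J = [] ; chain = [] ; distinct = [] ; K⊆negs = λ () ; K⊆L = λ () ; L⊆KJ = λ () ; J-neg = λ ()
        ; bounded = ≤ᵣ-reflexive (sym (+ᵣ-identityʳ _)) }
      trace (suc k) exc {x} (e ◅ Q) (s≤s le) ni eq with negStep e in eqn | negView e
      ... | _ | is-neg we w<0 = trace-edge e Q eqn (subst (λ l → Distinct (l ++ negs Q)) (sym eqn) (subst (λ l → Distinct (l ++ negs Q)) eqn (simple ni)))
        (trace k (λ E l → exc E (ℕₚ.≤-trans l (ℕₚ.n≤1+n k))) Q le
          (proj₂ (nice-split (e ◅ ε) Q ni)) (trans (sym (negLab (_ , we , w<0))) eq))
      ... | _ | non-neg _ with splitFirst (λ v → lab x ≟ lab v) Q
      ...   | inj₂ h = ⊥-elim (All′.lookup h (end∈vs Q) eq)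
      ...   | inj₁ (first E Q' refl at none) = record
        { K = K ; J = negs p ++ J ; chain = chain-++ (proj₁ pc) chain ; distinct = distinct
        ; K⊆negs = λ m → ∈-++⁺ʳ (negStep e) (negs-⊆ʳ E Q' (K⊆negs m))
        ; K⊆L = λ m → ∈-++⁺ʳ (negs p) (K⊆L m)
        ; L⊆KJ = λ m → [ (λ h → inj₂ (∈-++⁺ˡ h)) , (λ h → [ inj₁ , (λ g → inj₂ (∈-++⁺ʳ (negs p) g)) ]′ (L⊆KJ h)) ]′ (∈-++⁻ (negs p) m)
        ; J-neg = λ m → [ chain-neg (proj₁ pc) , J-neg ]′ (∈-++⁻ (negs p) m)
        ; bounded = ≤ᵣ-trans (≤ᵣ-reflexive (mass-++ (negs p) J)) (≤ᵣ-trans (+ᵣ-mono-≤ excess bounded)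
            (≤ᵣ-reflexive (trans (sym (+ᵣ-assoc _ _ _)) (cong (_+ᵣ mass K)
              (sym (wt-++ (e ◅ E) Q')))))) }
        where
        ni' = nice-split (e ◅ E) Q' ni
        lenQ' : len Q' ≤ k
        lenQ' = ℕₚ.≤-trans (ℕₚ.m≤n+m _ (len E)) (ℕₚ.≤-trans (ℕₚ.≤-reflexive (sym (len-++ E Q'))) le)
        lenE : len E ≤ k
        lenE = ℕₚ.≤-trans (ℕₚ.m≤m+n _ (len Q')) (ℕₚ.≤-trans (ℕₚ.≤-reflexive (sym (len-++ E Q'))) le)
        open Trace (trace k (λ E l → exc E (ℕₚ.≤-trans l (ℕₚ.n≤1+n k))) Q' lenQ' (proj₂ ni') (trans (sym at) eq))
        tr = tree at
        p = proj₁ tr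
        pc = tree-chain F p (proj₁ (proj₂ (proj₂ tr)))
        excess : mass (negs p) ≤ᵣ wt (e ◅ E)
        excess = subst (_≤ᵣ wt (e ◅ E)) (trans (cong -ᵣ_ (trans (sym (proj₂ (proj₂ (proj₂ tr)))) (proj₂ pc))) (neg-involutive _))
          (neg-≤ (subst (0# ≤ᵣ_) (+ᵣ-comm _ _) (exc (e ◅ E) (s≤s lenE) (proj₁ ni') at outside)))
          where
          outside : ∀ {u v} → (u , v) ∈ˡ negs (e ◅ E) → lab u ≢ lab x
          outside m with ∈-++⁻ (negStep e) m
          ... | inj₁ h = case subst (_ ∈ˡ_) eqn h of λ ()
          ... | inj₂ h = λ q → All′.lookup none (proj₁ (negs-ends E h)) (sym q)

      -- Let `p` be the tree path from `y` to `x`. It closes `L`, so every edge of `K` is passed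
      -- backwards in `L` or `p`. It is not passed backwards in `K`, whose edges are distinct, so
      -- `mass K` is at most `mass J` plus the mass of `p`. With `bounded` the mass of `J` cancels,
      -- and the weight of `Q` plus the mass of `p` is nonnegative; the mass of `p` is minus the
      -- tree distance.
      tree-shortest : ∀ {x y} (Q : x ⟶* y) → Trace Q → lab x ≡ lab y → W x y ≤ᵣ wt Q
      tree-shortest {x} {y} Q traced eq =
        subst (_≤ᵣ wt Q) (trans (cong -ᵣ_ massP) (trans (neg-involutive _) (W-sym (sym eq))))
          (neg-≤ {mass (negs p)} (subst (0# ≤ᵣ_) (+ᵣ-comm _ _)
            (+ᵣ-cancelˡ-≤ (mass J) (subst₂ _≤ᵣ_ (sym (+ᵣ-identityʳ _)) regroup
              (≤ᵣ-trans bounded (+ᵣ-monoʳ-≤ _ covered))))))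
        where
        open Trace traced
        tr = tree (sym eq)
        p = proj₁ tr
        pc = tree-chain F p (proj₁ (proj₂ (proj₂ tr)))
        massP : mass (negs p) ≡ -ᵣ (W y x)
        massP = trans (sym (neg-involutive _)) (cong -ᵣ_ (trans (sym (proj₂ pc)) (proj₂ (proj₂ (proj₂ tr)))))
        regroup : wt Q +ᵣ (mass J +ᵣ mass (negs p)) ≡ mass J +ᵣ (wt Q +ᵣ mass (negs p))
        regroup = trans (sym (+ᵣ-assoc _ _ _)) (trans (cong (_+ᵣ mass (negs p)) (+ᵣ-comm _ _)) (+ᵣ-assoc _ _ _))
        covered : mass K ≤ᵣ mass J +ᵣ mass (negs p)
        covered = ≤ᵣ-trans (mass-≤ K (J ++ negs p) distinct swap
            (λ m → [ J-neg , chain-neg (proj₁ pc) ]′ (∈-++⁻ J m))) (≤ᵣ-reflexive (mass-++ J (negs p)))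
          where
          swap : ∀ {a b} → (a , b) ∈ˡ K → (b , a) ∈ˡ J ++ negs p
          swap {a} {b} m with ∈-++⁻ L (closed-reverses F (chain-++ chain (proj₁ pc)) (∈-++⁺ˡ (K⊆L m)))
          ... | inj₂ h = ∈-++⁺ʳ J h
          ... | inj₁ h with L⊆KJ h
          ...   | inj₂ g = ∈-++⁺ˡ g
          ...   | inj₁ g with distinct-lookup distinct m g (inj₂ (refl , refl))
          ...     | refl with chain-neg chain h
          ...       | (w , eqw , _) = case trans (sym (edge-loop a)) eqw of λ ()

-- Combinations of the dynamic program as lower bounds

module Derivations {ℝ : Reals} {n : ℕ} (G : MixedGraph ℝ n) (F : Forests.Forest G) (Cl : Forests.Colouring G F)
                   (D₀ : Fin n → Fin n → Reals.Carrier ℝ → Set) where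
  open Real ℝ
  open MixedGraph G
  open Walks G
  open Forests G
  open Blocks G
  open Bits
  open Forest F
  open Colouring Cl

  -- DerF m u t x: the dynamic program finds a walk of weight x from u to t
  -- that starts with a tree path and uses the set m of colours.
  data DerF : ℕ → V → V → Carrier → Set where
    nil : ∀ {t} → DerF 0 t t 0#
    ext : ∀ {u v u' t j m x y} → col u v ≡ suc j → bit m j ≡ false → D₀ v u' y → DerF m u' t x →
          DerF (m + 2 ^ j) u t (W u v +ᵣ (y +ᵣ x))

  -- `D₀` is left open because derivations are later read off a table, where `D₀ s t y` says that an
  -- entry is at most `y`.
  data Der (m : ℕ) (s t : V) : Carrier → Set where
    der : ∀ {u y z} → D₀ s u y → DerF m u t z → Der m s t (y +ᵣ z)

  -- `used` ties the colours of the derivation to negative edges of `P`. It is what shows a colour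
  -- to be free before another tree path is put in front.
  record Found {s t} (P : s ⟶* t) : Set where
    constructor found
    field
      {m}     : ℕ
      {x}     : Carrier
      derived : Der m s t x
      below   : x ≤ᵣ wt P
      m<      : m < 2 ^ K
      used    : ∀ i → bit m i ≡ true → ∃[ a ] ∃[ b ] (a , b) ∈ˡ negs P × col a b ≡ suc i

  private
    1≤2^ : ∀ k → 1 ≤ 2 ^ k
    1≤2^ zero    = ℕₚ.≤-refl
    1≤2^ (suc k) = ℕₚ.≤-trans (1≤2^ k) (ℕₚ.m≤m+n _ _)

  module _ (d₀-walk : ∀ {s t} (P : s ⟶* t) → negs P ≡ [] → D₀ s t (wt P))
           (check : ∀ {m s x} → m < 2 ^ K → Der m s s x → 0# ≤ᵣ x) where

    W-loop : ∀ u → W u u ≡ 0#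
    W-loop u = let (p , h , _ , e) = tree {u} refl in trans (sym e) (path-closed p h)

    module _ {c d : V} (c≢d : c ≢ d) where
      B : V → Set
      B x = Insep x c × Insep x d

      open InBlock B
      open Trees F

      join : ∀ {x y} → B x → B y → Insep x y
      join (xc , xd) (yc , yd) = insep-join c≢d xc xd (insep-sym yc) (insep-sym yd)

      block : ∀ {u v a b} → B u → B v → B a → B b → SameBlock u v a b
      block u v a b = (join u a , join u b) , (join v a , join v b)

      neg≢ : ∀ {a b} → NegAdj a b → a ≢ b
      neg≢ {a} (w , eq , _) refl = case trans (sym (edge-loop a)) eq of λ ()

      -- If the colour were in use, some negative edge of `E` would carry it. Within one block a
      -- colour belongs to one tree, so this edge would lie in the tree of `p`, which `E` does not
      -- touch with negative edges.
      avoids : ∀ {s t p q j} {E : s ⟶* t} → Nice E → (f : Found E) → B p → B q → col p q ≡ suc j →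
               (∀ {u v} → (u , v) ∈ˡ negs E → lab u ≢ lab p) → bit (Found.m f) j ≡ false
      avoids {j = j} {E} ni f bp bq cpq av with bit (Found.m f) j in eq
      ... | false = refl
      ... | true =
        let (a , b , m , cab) = Found.used f j eq
            (a∈ , b∈ , ng) = negs-ends E m
        in ⊥-elim (av m (sym (diff cpq cab (block bp bq (inB ni (inits⊆vs E a∈)) (inB ni b∈)))))

      record Extended {v t} {E : v ⟶* t} (f : Found E) (u : V) : Set where
        field
          {j}      : ℕ
          colour   : col u v ≡ suc j
          derivedF : DerF (Found.m f + 2 ^ j) u t (W u v +ᵣ Found.x f)
          m<       : Found.m f + 2 ^ j < 2 ^ K
          used     : ∀ i → bit (Found.m f + 2 ^ j) i ≡ true → i ≡ j ⊎ bit (Found.m f) i ≡ true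

      extend : ∀ {u v t} {E : v ⟶* t} → Nice E → (f : Found E) → B u → u ≢ v → lab u ≡ lab v →
               (∀ {a b} → (a , b) ∈ˡ negs E → lab a ≢ lab u) → Extended f u
      extend {u} {v} {E = E} ni f@(found (der d₀ df) _ m< used) bu u≢v eq av =
        record { colour = cj ; derivedF = ext cj free d₀ df ; m< = add-bit-< j K _ free j<K m< ; used = used' }
        where
        bv = inB ni (start∈vs E)
        sj = some u≢v eq (join bu bv)
        j = proj₁ sj
        cj = proj₁ (proj₂ sj)
        j<K = proj₂ (proj₂ sj)
        free = avoids ni f bu bv cj av
        used' : ∀ i → bit (Found.m f + 2 ^ j) i ≡ true → i ≡ j ⊎ bit (Found.m f) i ≡ true
        used' i h with i ≟ j
        ... | yes e = inj₁ e
        ... | no ne = inj₂ (trans (sym (trans (bit-add j _ i free) (cong (λ b → if b then true else bit (Found.m f) i) (≢⇒≡ᵇ-false ne)))) h)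

      -- Induction on the length. The walk is cut at its first negative edge, which starts in `a`,
      -- and at its last vertex `v` in the tree of `a`. The middle part is replaced by the tree
      -- path, and the rest has no edge of this tree, so the colour stays free. That the tree path
      -- is no heavier depends on the excursions of the middle part, which are shorter walks.
      find : ∀ k {s t} (P : s ⟶* t) → len P < k → Nice P → Found P
      find (suc k) {s} {t} P (s≤s le) ni with splitNeg P
      ... | inj₁ h = found (der (d₀-walk P h) nil) (≤ᵣ-reflexive (+ᵣ-identityʳ _)) (1≤2^ K)
                       (λ i h → case trans (sym (bit-zero i)) h of λ ())
      ... | inj₂ (firstNeg {a} {b} P₀ e P₁ refl no-neg neg-e) with splitLast (λ v → lab a ≟ lab v) P₁
      ...   | inj₂ h = ⊥-elim (All′.lookup h (start∈vs P₁) (negLab (proj₂ (proj₂ (negs-ends (e ◅ P₁) (subst (λ l → _ ∈ˡ l ++ negs P₁) (sym neg-e) (here refl)))))))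
      ...   | inj₁ (last {v} Q P₂ refl at none) = result
        where
        ab∈ : (a , b) ∈ˡ negs (e ◅ Q)
        ab∈ = subst (λ l → _ ∈ˡ l ++ negs Q) (sym neg-e) (here refl)
        adj : NegAdj a b
        adj = proj₂ (proj₂ (negs-ends (e ◅ Q) ab∈))
        ni₀ = nice-split P₀ (e ◅ (Q ◅◅ P₂)) ni
        ni₁ = nice-split (e ◅ Q) P₂ (proj₂ ni₀)
        lens : len P₀ + (suc (len Q) + len P₂) ≤ k
        lens = ℕₚ.≤-trans (ℕₚ.≤-reflexive (sym (trans (len-++ P₀ (e ◅ (Q ◅◅ P₂))) (cong (len P₀ +_) (len-++ (e ◅ Q) P₂))))) le
        lens₁ : suc (len Q) + len P₂ ≤ k
        lens₁ = ℕₚ.≤-trans (ℕₚ.m≤n+m _ (len P₀)) lens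
        lenP₂ : len P₂ < k
        lenP₂ = ℕₚ.≤-trans (s≤s (ℕₚ.m≤n+m _ (len Q))) lens₁
        lenQ : len Q < k
        lenQ = ℕₚ.≤-trans (s≤s (ℕₚ.m≤m+n _ (len P₂))) lens₁
        -- A combination for the excursion, preceded by the tree path that leads from its end back
        -- to its start, is closed, and `check` makes it nonnegative.
        excursions : Excursions (len Q)
        excursions {x} {x'} E l niE eq av with find k E (ℕₚ.≤-<-trans l lenQ) niE
        ... | f with x' Finₚ.≟ x
        ...   | yes refl = ≤ᵣ-trans (check (Found.m< f) (Found.derived f)) (≤ᵣ-trans (Found.below f)
                             (≤ᵣ-reflexive (sym (trans (cong (wt E +ᵣ_) (W-loop x)) (+ᵣ-identityʳ _)))))
        ...   | no ne = ≤ᵣ-trans (check (Extended.m< ex) (der (d₀-walk (ε {x = x'}) refl) (Extended.derivedF ex)))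
                  (≤ᵣ-trans (≤ᵣ-reflexive (trans (+ᵣ-identityˡ _) (trans (cong (_+ᵣ Found.x f) (W-sym (sym eq))) (+ᵣ-comm _ _))))
                    (+ᵣ-monoˡ-≤ _ (Found.below f)))
          where ex = extend niE f (inB niE (end∈vs E)) ne (sym eq) (λ m q → av m (trans q (sym eq)))
        ni₁Q = proj₂ (nice-split (e ◅ ε) Q (proj₁ ni₁))
        Q-bound : W a v ≤ᵣ wt (e ◅ Q)
        Q-bound = tree-shortest (e ◅ Q) (trace-edge e Q neg-e (simple (proj₁ ni₁))
          (trace (len Q) excursions Q ℕₚ.≤-refl ni₁Q (trans (sym (negLab adj)) at))) at
        total : wt P₀ +ᵣ (W a v +ᵣ wt P₂) ≤ᵣ wt (P₀ ◅◅ (e ◅ (Q ◅◅ P₂)))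
        total = ≤ᵣ-trans (+ᵣ-monoʳ-≤ _ (+ᵣ-monoˡ-≤ _ Q-bound))
          (≤ᵣ-reflexive (sym (trans (wt-++ P₀ (e ◅ (Q ◅◅ P₂))) (cong (wt P₀ +ᵣ_) (wt-++ (e ◅ Q) P₂)))))
        lift₀ : ∀ {f} → f ∈ˡ negs (e ◅ (Q ◅◅ P₂)) → f ∈ˡ negs (P₀ ◅◅ (e ◅ (Q ◅◅ P₂)))
        lift₀ = negs-⊆ʳ P₀ (e ◅ (Q ◅◅ P₂))
        lift₂ : ∀ {f} → f ∈ˡ negs P₂ → f ∈ˡ negs (P₀ ◅◅ (e ◅ (Q ◅◅ P₂)))
        lift₂ m = lift₀ (negs-⊆ʳ (e ◅ Q) P₂ m)
        result : Found (P₀ ◅◅ (e ◅ (Q ◅◅ P₂)))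
        result with a Finₚ.≟ v
        -- If the last vertex of the tree is `a` itself, the middle part is closed and weighs at
        -- least 0. It is cut out, and no colour is spent.
        ... | yes refl with find k (P₀ ◅◅ P₂)
                              (ℕₚ.≤-trans (ℕₚ.≤-reflexive (trans (cong suc (len-++ P₀ P₂)) (sym (ℕₚ.+-suc _ _))))
                                (ℕₚ.≤-trans (ℕₚ.+-monoʳ-≤ (len P₀) (s≤s (ℕₚ.m≤n+m _ (len Q)))) lens))
                              (nice (λ m → inB₀₂ (∈-++⁻ (inits P₀) (subst (_ ∈ˡ_) (vs-++ P₀ P₂) m)))
                                (subst Distinct (sym (trans (negs-++ P₀ P₂) (cong (_++ negs P₂) no-neg))) (simple (proj₂ ni₁))))
          where
          inB₀₂ : ∀ {x} → x ∈ˡ inits P₀ ⊎ x ∈ˡ vs P₂ → B x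
          inB₀₂ (inj₁ m) = inB (proj₁ ni₀) (inits⊆vs P₀ m)
          inB₀₂ (inj₂ m) = inB (proj₂ ni₁) m
        ...   | found dr le' m< us = found dr
                (≤ᵣ-trans le' (≤ᵣ-trans (≤ᵣ-reflexive (trans (wt-++ P₀ P₂) (cong (wt P₀ +ᵣ_)
                  (sym (trans (cong (_+ᵣ wt P₂) (W-loop a)) (+ᵣ-identityˡ _)))))) total)) m<
                (λ i h → let (x , y , m , cx) = us i h in x , y ,
                  lift₂ (subst (_ ∈ˡ_) (trans (negs-++ P₀ P₂) (cong (_++ negs P₂) no-neg)) m) , cx)
        result | no a≢v with find k P₂ lenP₂ (proj₂ ni₁)
        ... | f = found (der (d₀-walk P₀ no-neg) (Extended.derivedF ex))
                (≤ᵣ-trans (+ᵣ-monoʳ-≤ _ (+ᵣ-monoʳ-≤ _ (Found.below f))) total) (Extended.m< ex) used′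
          where
          ba = inB (proj₁ ni₁) (here refl)
          ex = extend (proj₂ ni₁) f ba a≢v at
                 (λ {x} {y} m q → none m (trans (sym q) (negLab (proj₂ (proj₂ (negs-ends P₂ m))))))
          used′ : ∀ i → bit (Found.m f + 2 ^ Extended.j ex) i ≡ true → _
          used′ i h with Extended.used ex i h
          ... | inj₂ g = let (x , y , m , cx) = Found.used f i g in x , y , lift₂ m , cx
          -- The new colour is that of the pair `a`, `v`. The edge `ab` of the walk lies in the same
          -- tree and block, so it has this colour too.
          ... | inj₁ refl = a , b , lift₀ (negs-⊆ˡ (e ◅ Q) P₂ ab∈) ,
            (let bb = inB (proj₁ ni₁) (there (start∈vs Q))
                 bv = inB (proj₁ ni₁) (end∈vs (e ◅ Q))
                 (j' , cj' , _) = some (neg≢ adj) (negLab adj) (join ba bb)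
             in trans cj' (cong suc (same cj' (Extended.colour ex) (block ba bb ba bv) refl)))

-- Weak blocks and the number of colours

∉-minus : ∀ {n} (p : Subset n) y → ¬ y ∈ p - y
∉-minus (s ∷ᵛ p) zero    ()
∉-minus (s ∷ᵛ p) (suc y) (there[]= m) = ∉-minus p y m

module Subsets {n : ℕ} where
  fromDec : {P : Fin n → Set} → (∀ x → Dec (P x)) → Subset n
  fromDec P? = tabulate (λ x → does (P? x))

  fromDec⁺ : ∀ {P : Fin n → Set} (P? : ∀ x → Dec (P x)) {x} → P x → x ∈ fromDec P?
  fromDec⁺ P? {x} px = lookup⇒[]= x _ (trans (lookup∘tabulate _ x) (dec-true (P? x) px))

  fromDec⁻ : ∀ {P : Fin n → Set} (P? : ∀ x → Dec (P x)) {x} → x ∈ fromDec P? → P x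
  fromDec⁻ P? {x} m = holds (P? x) (trans (sym (lookup∘tabulate (λ x → does (P? x)) x)) ([]=⇒lookup m))
    where holds : ∀ {A : Set} (d : Dec A) → does d ≡ true → A
          holds (yes a) _ = a

  unique-length : ∀ {l : List (Fin n)} → Unique l → length l ≤ n
  unique-length {l} u = Finₚ.injective⇒≤ {f = lookupˡ l} (injective u)
    where
    at∈ : ∀ (l : List (Fin n)) i → lookupˡ l i ∈ˡ l
    at∈ (x ∷ l) zero    = here refl
    at∈ (x ∷ l) (suc i) = there (at∈ l i)
    injective : ∀ {l : List (Fin n)} → Unique l → ∀ {i j} → lookupˡ l i ≡ lookupˡ l j → i ≡ j
    injective {x ∷ l} (h ∷ u) {zero}  {zero}  e = refl
    injective {x ∷ l} (h ∷ u) {zero}  {suc j} e = ⊥-elim (All′.lookup h (at∈ l j) e)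
    injective {x ∷ l} (h ∷ u) {suc i} {zero}  e = ⊥-elim (All′.lookup h (at∈ l i) (sym e))
    injective {x ∷ l} (h ∷ u) {suc i} {suc j} e = cong suc (injective u e)

module WeakBlocks {ℝ : Reals} {n : ℕ} (G : MixedGraph ℝ n)
                  (≋? : ∀ u v → Dec (Walks._≋_ G u v)) (insep? : ∀ u v → Dec (Walks.Insep G u v)) where
  open Real ℝ
  open MixedGraph G
  open Walks G
  open Forests G
  open Subsets

  toPath : ∀ {s t} (p : s ⟶* t) → Σ (s ⟶* t) Path
  toPath ε = ε , [] ∷ []
  toPath {s} (e ◅ p) with toPath p
  ... | q , hq with splitFirst (s Finₚ.≟_) q
  ...   | inj₂ h = e ◅ q , h ∷ hq
  ...   | inj₁ (first a b refl refl _) = b , proj₁ (proj₂ (path-split a b hq))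

  component : V → Subset n
  component a = fromDec (λ v → ≋? v a)

  component-strong : ∀ a → IsStrongComponent G (component a)
  component-strong a = a , λ v → mk⇔
    (λ m → let (x , y) = fromDec⁻ (λ v → ≋? v a) m in toPath y , toPath x)
    (λ ((x , _) , (y , _)) → fromDec⁺ (λ v → ≋? v a) (y , x))

  within-walk : ∀ {X : Subset n} {s t} (p : s ⟶* t) → (∀ {x} → x ∈ˡ vs p → x ∈ X) → Star (Within G X (Adjacent G)) s t
  within-walk ε       h = ε
  within-walk (e ◅ p) h = (h (here refl) , h (there (start∈vs p)) , inj₁ e) ◅ within-walk p (λ m → h (there m))

  module _ {a b : V} (a≢b : a ≢ b) (ab : Insep a b) where
    InBlk : V → Set
    InBlk x = Insep x a × Insep x b

    inBlk? : ∀ x → Dec (InBlk x)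
    inBlk? x = insep? x a ×-dec insep? x b

    blk : Subset n
    blk = fromDec inBlk?

    blk-insep : ∀ {x y} → InBlk x → InBlk y → Insep x y
    blk-insep (xa , xb) (ya , yb) = insep-join a≢b xa xb (insep-sym ya) (insep-sym yb)

    blk-closed : ∀ {x u v} → u ≢ v → InBlk u → InBlk v → Insep x u → Insep x v → InBlk x
    blk-closed u≢v (ua , ub) (va , vb) xu xv = insep-join u≢v xu xv ua va , insep-join u≢v xu xv ub vb

    starlen : ∀ {R : V → V → Set} {x y} → Star R x y → ℕ
    starlen ε       = 0
    starlen (_ ◅ p) = suc (starlen p)

    record Return (c z y : V) (N : ℕ) : Set where
      field
        {k}     : V
        inside  : InBlk k
        rest    : Conn c k y
        short   : starlen rest ≤ N
        outside : ∀ {d} → InBlk d → d ≢ k → Conn d z k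

    -- Before its first vertex `k` in the block the walk meets only vertices outside, so this part
    -- avoids every vertex of the block other than `k`.
    return : ∀ {c z y} (p : Conn c z y) → ¬ InBlk z → InBlk y → Return c z y (starlen p)
    return ε nz by = ⊥-elim (nz by)
    return (_◅_ {_} {z'} (x , x' , e , adj) p) nz by with inBlk? z'
    ... | yes bz' = record { inside = bz' ; rest = p ; short = ℕₚ.n≤1+n _ ;
            outside = λ { bd d≢k → ((λ { refl → nz bd }) , (λ { refl → d≢k refl }) , e , adj) ◅ ε } }
    ... | no nz' = record { inside = R.inside ; rest = R.rest ; short = ℕₚ.≤-trans R.short (ℕₚ.n≤1+n _) ;
            outside = λ { bd d≢k → ((λ { refl → nz bd }) , (λ { refl → nz' bd }) , e , adj) ◅ R.outside bd d≢k } }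
      where module R = Return (return p nz' by)

    -- A walk that leaves the block returns at the vertex where it left, since
    -- the first vertex outside is inseparable from both.
    detour-free : ∀ {c} N {x y} (p : Conn c x y) → starlen p ≤ N → InBlk x → InBlk y → x ≢ c →
                  Star (Within G (blk - c) (Adjacent G)) x y
    detour-free N       ε _ bx by x≢c = ε
    detour-free {c} (suc N) {x} (_◅_ {_} {z} (_ , z≢c , e , adj) p) (s≤s le) bx by x≢c with inBlk? z
    ... | yes bz = (keep bx x≢c , keep bz z≢c , adj) ◅ detour-free N p le bz by z≢c
      where
      keep : ∀ {v} → InBlk v → v ≢ c → v ∈ blk - c
      keep bv v≢c = x∈p∧x≢y⇒x∈p-y (fromDec⁺ inBlk? bv) v≢c
    ... | no nz with return p nz by
    ...   | r with Return.k r Finₚ.≟ x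
    ...     | yes refl = detour-free N (Return.rest r) (ℕₚ.≤-trans (Return.short r) le) bx by x≢c
    ...     | no k≢x = ⊥-elim (nz (blk-closed (λ q → k≢x (sym q)) bx (Return.inside r) zx zk))
      where
      zx : Insep z x
      zx = insep-sym (insep-step e adj)
      zk : Insep z (Return.k r)
      zk = insep (≋-trans (≋-sym e) (strong (blk-insep bx (Return.inside r)))) go
        where
        go : ∀ d → d ≢ z → d ≢ Return.k r → Conn d z (Return.k r)
        go d dz dk with inBlk? d
        -- A vertex `d` of the block is avoided by the part outside the block. Any other `d` is
        -- avoided on the way through `x`, which is adjacent to `z` and inseparable from `k`.
        ... | yes bd = Return.outside r bd dk
        ... | no nd  = conn zx d dz (λ { refl → nd bx }) ◅◅ conn (blk-insep bx (Return.inside r)) d (λ { refl → nd bx }) dk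

    a∈ : InBlk a
    a∈ = insep-refl , ab
    b∈ : InBlk b
    b∈ = insep-sym ab , insep-refl

    path-inside : ∀ {u v} → InBlk u → InBlk v → u ≢ v → (p : u ⟶* v) → Path p → ∀ {x} → x ∈ˡ vs p → InBlk x
    path-inside bu bv u≢v p hp m =
      let (xu , xv) = path-insep p hp (blk-insep bu bv) m in blk-closed u≢v bu bv xu xv

    blk-connected : IsConnected G blk
    blk-connected {u} {v} mu mv with u Finₚ.≟ v
    ... | yes refl = ε
    ... | no u≢v =
      let bu = fromDec⁻ inBlk? mu ; bv = fromDec⁻ inBlk? mv
          (p , hp) = toPath (proj₁ (strong (blk-insep bu bv)))
      in within-walk p (λ m → fromDec⁺ inBlk? (path-inside bu bv u≢v p hp m))

    minus⁻ : ∀ {X : Subset n} {c x} → x ∈ X - c → x ∈ X × x ≢ c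
    minus⁻ {X} {c} m = p─q⊆p X ⁅ c ⁆ m , λ { refl → ∉-minus X c m }

    blk-2connected : Is2Connected G blk
    blk-2connected = (a , fromDec⁺ inBlk? a∈) , blk-connected , λ c _ {u} {v} mu mv →
      let (mu' , u≢c) = minus⁻ mu ; (mv' , v≢c) = minus⁻ mv
          bu = fromDec⁻ inBlk? mu' ; bv = fromDec⁻ inBlk? mv'
      in detour-free _ (conn (blk-insep bu bv) c (λ q → u≢c (sym q)) (λ q → v≢c (sym q))) ℕₚ.≤-refl bu bv u≢c

    -- For maximality: in a 2-connected set inside the component any two vertices are inseparable,
    -- since deleting a third one leaves the set connected. If the set contains `a` and `b`, all its
    -- vertices are therefore in the block.
    blk-weak : IsWeakBlockOf G (component a) blk
    blk-weak = (λ m → fromDec⁺ (λ v → ≋? v a) (strong (proj₁ (fromDec⁻ inBlk? m)))) , blk-2connected , maximal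
      where
      maximal : ∀ {X} → X ⊆ component a → Is2Connected G X → blk ⊆ X → X ⊆ blk
      maximal {X} X⊆S (_ , con , con-) B⊆X {x} mx =
        fromDec⁺ inBlk? (related (B⊆X (fromDec⁺ inBlk? a∈)) , related (B⊆X (fromDec⁺ inBlk? b∈)))
        where
        inS : ∀ {v} → v ∈ X → v ≋ a
        inS m = fromDec⁻ (λ v → ≋? v a) (X⊆S m)
        convert : ∀ {c u v} {Y : Subset n} → (∀ {w} → w ∈ Y → w ∈ X × w ≢ c) → Star (Within G Y (Adjacent G)) u v → Conn c u v
        convert h ε = ε
        convert h ((mu , mv , adj) ◅ p) = (proj₂ (h mu) , proj₂ (h mv) , ≋-trans (inS (proj₁ (h mu))) (≋-sym (inS (proj₁ (h mv)))) , adj) ◅ convert h p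
        related : ∀ {y} → y ∈ X → Insep x y
        related {y} my = insep (≋-trans (inS mx) (≋-sym (inS my))) go
          where
          go : ∀ c → c ≢ x → c ≢ y → Conn c x y
          go c cx cy with c ∈? X
          ... | yes mc = convert (minus⁻ {X} {c}) (con- c mc (x∈p∧x≢y⇒x∈p-y mx (λ q → cx (sym q))) (x∈p∧x≢y⇒x∈p-y my (λ q → cy (sym q))))
          ... | no nc  = convert (λ m → m , λ { refl → nc m }) (con mx my)

    module _ (F : Forest) where
      open Forest F

      inTree? : ∀ r v → Dec (InBlk v × lab v ≡ lab r)
      inTree? r v = inBlk? v ×-dec (lab v ≟ lab r)

      treeOf : V → Subset n
      treeOf r = fromDec (inTree? r)

      within-neg : ∀ {s t} (p : s ⟶* t) → AllNeg p → (∀ {x} → x ∈ˡ vs p → InBlk x) → Star (Within G blk NegAdj) s t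
      within-neg ε       _        h = ε
      within-neg (e ◅ p) (ng , g) h =
        (fromDec⁺ inBlk? (h (here refl)) , fromDec⁺ inBlk? (h (there (start∈vs p))) ,
         proj₂ (proj₂ (negs-ends (e ◅ p) (subst (λ l → _ ∈ˡ l ++ negs p) (sym ng) (here refl))))) ◅
        within-neg p g (λ m → h (there m))

      -- The tree path between two vertices of the block is a path between inseparable vertices, so
      -- it stays in the block. Hence a tree of the graph meets the block in at most one negative
      -- tree, and labels tell the trees of a block apart.
      to-star : ∀ {u v} → InBlk u → InBlk v → lab u ≡ lab v → Star (Within G blk NegAdj) u v
      to-star {u} {v} bu bv eq with u Finₚ.≟ v
      ... | yes refl = ε
      ... | no u≢v = let (p , hp , ng , _) = tree eq in within-neg p ng (path-inside bu bv u≢v p hp)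

      from-star : ∀ {u v} → InBlk u → Star (Within G blk NegAdj) u v → InBlk v × lab v ≡ lab u
      from-star bu ε = bu , refl
      from-star bu ((_ , mv , adj) ◅ p) =
        let (bv , eq) = from-star (fromDec⁻ inBlk? mv) p in bv , trans eq (sym (negLab adj))

      treeOf-negative : ∀ {u v} → InBlk u → InBlk v → u ≢ v → lab u ≡ lab v → IsNegativeTreeOf G blk (treeOf u)
      treeOf-negative {u} {v} bu bv u≢v eq = u , neighbour (to-star bu bv eq) , λ x → mk⇔
        (λ m → let (bx , e) = fromDec⁻ (inTree? u) m in to-star bu bx (sym e))
        (λ st → fromDec⁺ (inTree? u) (from-star bu st))
        where
        neighbour : Star (Within G blk NegAdj) u v → ∃[ x ] Within G blk NegAdj u x
        neighbour ε       = ⊥-elim (u≢v refl)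
        neighbour (s ◅ _) = _ , s

  module _ (F : Forest) (C : Colouring F) where
    open Forest F
    open Colouring C

    -- Since no colour is skipped inside a block, a pair of colour j has j trees
    -- in its block.
    Tight : Set
    Tight = (∀ {u v j} → col u v ≡ suc (suc j) → ∃[ a ] ∃[ b ] col a b ≡ suc j × SameBlock u v a b)
          × (K ≡ 0 ⊎ ∃[ u ] ∃[ v ] col u v ≡ K)

    module _ (tight : Tight) where

      module _ {a b : V} (a≢b : a ≢ b) (ab : Insep a b) where
        record Listed (j : ℕ) : Set where
          field
            roots    : List V
            size     : length roots ≡ suc j
            coloured : ∀ {r} → r ∈ˡ roots → InBlk a≢b ab r × ∃[ v ] ∃[ i ] InBlk a≢b ab v × col r v ≡ suc i × i ≤ j
            apart    : AllPairs (λ r r' → lab r ≢ lab r') roots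

        collect : ∀ j {u v} → InBlk a≢b ab u → InBlk a≢b ab v → col u v ≡ suc j → Listed j
        collect zero {u} {v} bu bv e = record
          { roots = u ∷ [] ; size = refl ; coloured = λ { (here refl) → bu , v , 0 , bv , e , z≤n } ; apart = [] ∷ [] }
        collect (suc j) {u} {v} bu bv e with proj₁ tight e
        ... | u' , v' , e' , ((uu' , uv') , (vu' , vv')) = record
          { roots = u ∷ roots ; size = cong suc size
          ; coloured = λ { (here refl) → bu , v , suc j , bv , e , ℕₚ.≤-refl
                         ; (there m) → let (br , x , i , bx , ex , le) = coloured m in br , x , i , bx , ex , ℕₚ.≤-trans le (ℕₚ.n≤1+n j) }
          ; apart = All′.tabulate different ∷ apart }
          where
          u≢v = proj₁ (pair e)
          bu' = blk-closed a≢b ab u≢v bu bv (insep-sym uu') (insep-sym vu')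
          bv' = blk-closed a≢b ab u≢v bu bv (insep-sym uv') (insep-sym vv')
          open Listed (collect j bu' bv' e')
          different : ∀ {r} → r ∈ˡ roots → lab u ≢ lab r
          different m eq with coloured m
          ... | br , x , i , bx , ex , le with same e ex ((blk-insep a≢b ab bu br , blk-insep a≢b ab bu bx) ,
                                                         (blk-insep a≢b ab bv br , blk-insep a≢b ab bv bx)) eq
          ...   | refl = ℕₚ.<-irrefl refl le

        listed-≤n : ∀ {j} → Listed j → suc j ≤ n
        listed-≤n l = subst (_≤ n) size (unique-length (AllPairs′.map (λ ne e → ne (cong lab e)) apart))
          where open Listed l

        listed-≤k : ∀ {j k} → Listed j → WeakBlocksHaveAtMost_NegativeTrees G k → suc j ≤ k
        listed-≤k {j} {k} l h = subst (_≤ k) (trans (length-map (treeOf a≢b ab F) roots) size)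
          (h (component-strong a) (blk-weak a≢b ab) (map (treeOf a≢b ab F) roots) (uniq roots apart (λ m → proj₁ (coloured m)))
            (Allₚ.map⁺ (All′.tabulate λ m → let (br , v , i , bv , ev , _) = coloured m in
              treeOf-negative a≢b ab F br bv (proj₁ (pair ev)) (proj₁ (proj₂ (pair ev))))))
          where
          open Listed l
          uniq : ∀ rs → AllPairs (λ r r' → lab r ≢ lab r') rs → (∀ {r} → r ∈ˡ rs → InBlk a≢b ab r) → Unique (map (treeOf a≢b ab F) rs)
          uniq [] [] _ = []
          uniq (r ∷ rs) (h ∷ hs) ib = Allₚ.map⁺ (All′.tabulate λ {r'} m e → All′.lookup h m
              (proj₂ (fromDec⁻ (inTree? a≢b ab F r') (subst (r ∈_) e (fromDec⁺ (inTree? a≢b ab F r) (ib (here refl) , refl)))))) ∷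
            uniq rs hs (λ m → ib (there m))

      private
        listed : ∀ {u v j} → col u v ≡ suc j → Σ (u ≢ v) λ ne → Σ (Insep u v) λ is → Listed ne is j
        listed {u} {v} {j} e = let (ne , _ , is) = pair e in ne , is , collect ne is j (a∈ ne is) (b∈ ne is) e

        K-cases : ∀ {k} → (∀ {u v j} → col u v ≡ suc j → suc j ≤ k) → K ≤ k
        K-cases {k} h with K in eq | proj₂ tight
        ... | zero  | _ = z≤n
        ... | suc j | inj₂ (u , v , e) = h e
        ... | suc j | inj₁ ()

      -- The collected roots have different labels, so they are distinct vertices. Loops over
      -- colours thereby count as loops over vertices in the time bound.
      colours-≤-vertices : K ≤ n
      colours-≤-vertices = K-cases λ e → let (ne , is , l) = listed e in listed-≤n ne is l

      colours-≤-trees : ∀ {k} → WeakBlocksHaveAtMost_NegativeTrees G k → K ≤ k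
      colours-≤-trees h = K-cases λ e → let (ne , is , l) = listed e in listed-≤k ne is l h

-- Separating vertices and arcs between strong components

module Combine {ℝ : Reals} {n : ℕ} (G : MixedGraph ℝ n) where
  open Real ℝ
  open MixedGraph G
  open Walks G

  -- A common vertex other than `c` would be joined to `s` by the beginning of `p` and to `t` by the
  -- end of `q`. Both avoid `c`, so `c` would not separate `s` from `t`.
  separated-path : ∀ {s c t} (p : s ⟶* c) (q : c ⟶* t) → Path p → Path q → t ⟶* s → ¬ Conn c s t → Path (p ◅◅ q)
  separated-path {s} {c} {t} p q hp hq r sep = path-join p q hp hq disjoint
    where
    disjoint : ∀ {x} → x ∈ˡ inits p → ¬ x ∈ˡ vs q
    disjoint {x} mp mq with splitAtVertex p (inits⊆vs p mp) | splitAtVertex q mq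
    ... | a , b , refl , none | a' , b' , refl , none' = sep
      (conn-walk a (All′.tabulate λ m e → avoid-c m e) (b ◅◅ (a' ◅◅ b' ◅◅ r)) ◅◅
       conn-walk b' (All′.tabulate λ m e → avoid-c' m e) (r ◅◅ (a ◅◅ b) ◅◅ a'))
      where
      inits-++ : ∀ {s t u y} (p : s ⟶* t) (q : t ⟶* u) → y ∈ˡ inits p → y ∈ˡ inits (p ◅◅ q)
      inits-++ (e ◅ p) q (here refl) = here refl
      inits-++ (e ◅ p) q (there m) = there (inits-++ p q m)
      x≢c : x ≢ c
      x≢c refl = end∉inits (a ◅◅ b) hp mp
      avoid-c : ∀ {y} → y ∈ˡ vs a → c ≢ y
      avoid-c m refl with ∈-++⁻ (inits a) m
      ... | inj₁ k = end∉inits (a ◅◅ b) hp (inits-++ a b k)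
      ... | inj₂ (here e) = x≢c (sym e)
      left-behind : ∀ {c x t} (a : c ⟶* x) (b : x ⟶* t) → Path (a ◅◅ b) → x ≢ c → ¬ c ∈ˡ vs b
      left-behind ε       b h        ne m = ne refl
      left-behind (e ◅ a) b (hd ∷ _) ne m = All′.lookup hd (vs-∈ʳ a b m) refl
      avoid-c' : ∀ {y} → y ∈ˡ vs b' → c ≢ y
      avoid-c' m refl = left-behind a' b' hq x≢c m

  Entries : Set₁
  Entries = V → V → Carrier → Set

  -- The Floyd-Warshall invariant for separating vertices: here `k` restricts those that separate
  -- the two ends, not all inner vertices of the path.
  SeparatedBelow : ℕ → Entries → Set
  SeparatedBelow k E = ∀ {s t} (p : s ⟶* t) → Path p → t ⟶* s →
    (∀ c → c ≢ s → c ≢ t → ¬ Conn c s t → toℕ c < k) → E s t (wt p)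

  -- If `c` separates `s` from `t`, it lies on the path. A vertex that separates `s` from `c` is not
  -- on the part behind `c`, so it also separates `s` from `t`; likewise for `c` and `t`. Both parts
  -- thus have their separators below `c` and are known from earlier rounds.
  separate : ∀ {E E' : Entries} (c : V) → (∀ {s t x} → E s t x → E' s t x) → (∀ s t → Dec (Conn c s t)) →
    (∀ {s t x y} → s ≋ t → c ≢ s → c ≢ t → ¬ Conn c s t → E s c x → E c t y → E' s t (x +ᵣ y)) →
    SeparatedBelow (toℕ c) E → SeparatedBelow (suc (toℕ c)) E'
  separate {E} {E'} c mono conn? hit old {s} {t} p hp r seps with c Finₚ.≟ s | c Finₚ.≟ t | conn? s t
  ... | yes refl | _ | _ = mono (old p hp r λ d ds dt nc → ℕₚ.≤∧≢⇒< (ℕₚ.≤-pred (seps d ds dt nc)) (λ e → ds (toℕ-injective e)))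
  ... | no _ | yes refl | _ = mono (old p hp r λ d ds dt nc → ℕₚ.≤∧≢⇒< (ℕₚ.≤-pred (seps d ds dt nc)) (λ e → dt (toℕ-injective e)))
  ... | no _ | no _ | yes con = mono (old p hp r λ d ds dt nc →
          ℕₚ.≤∧≢⇒< (ℕₚ.≤-pred (seps d ds dt nc)) (λ e → nc (subst (λ z → Conn z s t) (sym (toℕ-injective e)) con)))
  ... | no cs | no ct | no ncon with ∈vs? c p
  ...   | inj₂ h = ⊥-elim (ncon (conn-walk p h r))
  ...   | inj₁ m with splitAtVertex p m
  ...     | a , b , refl , _ with path-split a b hp
  ...       | ha , hb , disj = subst (E' s t) (sym (wt-++ a b))
              (hit (a ◅◅ b , r) cs ct ncon (old a ha (b ◅◅ r) left) (old b hb (r ◅◅ a) right))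
    where
    left : ∀ d → d ≢ s → d ≢ c → ¬ Conn d s c → toℕ d < toℕ c
    left d ds dc nc = ℕₚ.≤∧≢⇒< (ℕₚ.≤-pred (seps d ds dt (λ sep → nc (sep ◅◅ conn-sym ct')))) (λ e → dc (toℕ-injective e))
      where
      d∉b : All (d ≢_) (vs b)
      d∉b with ∈vs? d b | ∈vs? d a
      ... | inj₂ h | _ = h
      ... | inj₁ k | inj₂ h = ⊥-elim (nc (conn-walk a h (b ◅◅ r)))
      ... | inj₁ k | inj₁ k' with ∈-++⁻ (inits a) k'
      ...   | inj₁ k'' = ⊥-elim (disj k'' k)
      ...   | inj₂ (here e) = ⊥-elim (dc e)
      dt : d ≢ t
      dt = All′.lookup d∉b (end∈vs b)
      ct' : Conn d c t
      ct' = conn-walk b d∉b (r ◅◅ a)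
    right : ∀ d → d ≢ c → d ≢ t → ¬ Conn d c t → toℕ d < toℕ c
    right d dc dt nc = ℕₚ.≤∧≢⇒< (ℕₚ.≤-pred (seps d ds dt (λ sep → nc (conn-sym sc' ◅◅ sep)))) (λ e → dc (toℕ-injective e))
      where
      d∉a : All (d ≢_) (vs a)
      d∉a with ∈vs? d a | ∈vs? d b
      ... | inj₂ h | _ = h
      ... | inj₁ k | inj₂ h = ⊥-elim (nc (conn-walk b h (r ◅◅ a)))
      ... | inj₁ k | inj₁ k' with ∈-++⁻ (inits a) k
      ...   | inj₁ k'' = ⊥-elim (disj k'' k')
      ...   | inj₂ (here e) = ⊥-elim (dc e)
      ds : d ≢ s
      ds = All′.lookup d∉a (start∈vs a)
      sc' : Conn d s c
      sc' = conn-walk a d∉a (b ◅◅ r)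

  -- A step whose head can reach its tail lies inside a strong component. All other steps must start
  -- in one of the first `k` vertices, whose arcs have been treated.
  Low : ℕ → ∀ {s t} → s ⟶* t → Set
  Low k ε = ⊤
  Low k (_◅_ {u} {v} e p) = (v ⟶* u ⊎ toℕ u < k) × Low k p

  low-++ : ∀ {k s t u} (p : s ⟶* t) (q : t ⟶* u) → Low k (p ◅◅ q) → Low k p × Low k q
  low-++ ε       q h       = tt , h
  low-++ (e ◅ p) q (l , h) = let (a , b) = low-++ p q h in (l , a) , b

  low-lower : ∀ (c : V) {s t} (p : s ⟶* t) → ¬ c ∈ˡ inits p → Low (suc (toℕ c)) p → Low (toℕ c) p
  low-lower c ε       _  _       = tt
  low-lower c (e ◅ p) ni (l , h) = [ inj₁ , (λ lt → inj₂ (ℕₚ.≤∧≢⇒< (ℕₚ.≤-pred lt) λ q → ni (here (sym (toℕ-injective q))))) ]′ l ,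
                                   low-lower c p (λ m → ni (there m)) h

  low-strong : ∀ {s t} (p : s ⟶* t) → Low 0 p → t ⟶* s
  low-strong ε       h              = ε
  low-strong (e ◅ p) (inj₁ r , h)   = low-strong p h ◅◅ r

  low-all : ∀ {s t} (p : s ⟶* t) → Low n p
  low-all ε       = tt
  low-all (e ◅ p) = inj₂ (toℕ<n _) , low-all p

  LowBelow : ℕ → Entries → Set
  LowBelow k E = ∀ {s t} (p : s ⟶* t) → Path p → Low k p → E s t (wt p)

  leave : ∀ {E E' : Entries} (c : V) → (∀ {s t x} → E s t x → E' s t x) → (∀ v → Dec (v ⟶* c)) →
    (∀ {s v t w x y} → arc c v ≡ just w → ¬ v ⟶* c → E s c x → E v t y → E' s t (x +ᵣ (w +ᵣ y))) →
    LowBelow (toℕ c) E → LowBelow (suc (toℕ c)) E'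
  leave {E} {E'} c mono reach? hit old {s} {t} p hp low with splitFirst (c Finₚ.≟_) p
  ... | inj₂ none = mono (old p hp (low-lower c p (λ m → All′.lookup none (inits⊆vs p m) refl) low))
  ... | inj₁ (first a ε refl refl none) = mono (old (a ◅◅ ε) hp (low-lower c (a ◅◅ ε) (notin a none) low))
    where
    notin : ∀ {s} (a : s ⟶* c) → All (λ y → ¬ c ≡ y) (inits a) → ¬ c ∈ˡ inits (a ◅◅ ε)
    notin (e ◅ a) (h ∷ hs) (here refl) = h refl
    notin (e ◅ a) (h ∷ hs) (there m) = notin a hs m
  ... | inj₁ (first a (_◅_ {j = v} e b) refl refl none) with path-split a (e ◅ b) hp | low-++ a (e ◅ b) low
  ...   | ha , hb@(hd ∷ hb') , disj | la , (_ , lb) with reach? v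
  -- The path leaves `c` inside its component, so it already satisfies the earlier condition as a
  -- whole.
  ...     | yes r = mono (old (a ◅◅ (e ◅ b)) hp (low-glue (low-lower c a (λ m → All′.lookup none m refl) la)
                      (inj₁ r , low-lower c b (λ m → All′.lookup hd (inits⊆vs b m) refl) lb)))
    where
    low-glue : ∀ {k s t u} {p : s ⟶* t} {q : t ⟶* u} → Low k p → Low k q → Low k (p ◅◅ q)
    low-glue {p = ε}     _       h = h
    low-glue {p = e ◅ p} (l , g) h = l , low-glue {p = p} g h
  ...     | no nr with e
  ...       | along-edge w eq = ⊥-elim (nr (along-edge w (trans (edge-sym v c) eq) ◅ ε))
  ...       | along-arc w eq = subst (E' s t) (sym (wt-++ a (along-arc w eq ◅ b)))
                (hit eq nr (old a ha (low-lower c a (λ m → All′.lookup none m refl) la))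
                           (old b hb' (low-lower c b (λ m → All′.lookup hd (inits⊆vs b m) refl) lb)))

  edges-negs : ∀ {s t} (p : s ⟶* t) {e} → e ∈ˡ negs p → e ∈ˡ edges p
  edges-negs (along-edge w eq ◅ p) m with negStep (along-edge w eq) | negView (along-edge w eq) | ∈-++⁻ (negStep (along-edge w eq)) m
  ... | _ | is-neg _ _ | inj₁ (here refl) = here refl
  ... | _ | is-neg _ _ | inj₂ k = there (edges-negs p k)
  ... | _ | non-neg _  | inj₂ k = there (edges-negs p k)
  edges-negs (along-arc w eq ◅ p) m = edges-negs p m

  distinct-negs : ∀ {s t} (p : s ⟶* t) → Distinct (edges p) → NegSimple p
  distinct-negs ε d = []
  distinct-negs (along-edge w eq ◅ p) (hd ∷ d) with negStep (along-edge w eq) | negView (along-edge w eq)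
  ... | _ | is-neg _ _ = All′.tabulate (λ m → All′.lookup hd (edges-negs p m)) ∷ distinct-negs p d
  ... | _ | non-neg _  = distinct-negs p d
  distinct-negs (along-arc w eq ◅ p) d = distinct-negs p d

  module Checked (F : Forests.Forest G) (Cl : Forests.Colouring G F) (D₀ : Entries)
                 (d₀-walk : ∀ {s t} (P : s ⟶* t) → negs P ≡ [] → D₀ s t (wt P))
                 (check : ∀ {m s x} → m < 2 ^ Forests.Colouring.K Cl → Derivations.Der G F Cl D₀ m s s x → 0# ≤ᵣ x) where
    open Derivations G F Cl D₀
    open Blocks G

    in-block : ∀ {s t} → s ≢ t → Insep s t → (p : s ⟶* t) → Path p → Found p
    in-block s≢t st p hp = find d₀-walk check s≢t _ p ℕₚ.≤-refl
      (InBlock.nice (λ m → path-insep p hp st m) (path-negSimple p hp))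

    -- Behind its first step a cycle is a path between two adjacent vertices of one strong
    -- component, so it lies in their block. The combination found for it is closed and bounds its
    -- weight from below.
    conservative : Conservative G
    conservative ε (ne , _ , _) _ = ne refl
    conservative {u} (_◅_ {j = v} e p) (_ , (hd ∷ uq) , d) neg = <ᵣ⇒≱ neg (≤ᵣ-trans (check (Found.m< f) (Found.derived f)) (Found.below f))
      where
      path : ∀ {s t} (p : s ⟶* t) → All (t ≢_) (inits p) → Unique (inits p) → Path p
      path ε _ _ = [] ∷ []
      path (e ◅ p) (h ∷ hs) (g ∷ gs) = All′.tabulate (λ m → fresh (∈-++⁻ (inits p) m)) ∷ path p hs gs
        where fresh : ∀ {x} → x ∈ˡ inits p ⊎ x ∈ˡ _ ∷ [] → _ ≢ x
              fresh (inj₁ m) = All′.lookup g m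
              fresh (inj₂ (here refl)) q = h (sym q)
      hp = path p hd uq
      v≢u : v ≢ u
      v≢u refl = no-loop-step e
      vu : Insep v u
      vu = insep-step (p , e ◅ ε) (inj₂ e)
      f = find d₀-walk check v≢u _ (e ◅ p) ℕₚ.≤-refl
            (InBlock.nice (λ { (here refl) → path-insep p hp vu (end∈vs p) ; (there m) → path-insep p hp vu m })
              (distinct-negs (e ◅ p) d))

-- The stages of the program

quotient-unique : ∀ {d} a a' {r r'} → r < d → r' < d → a * d + r ≡ a' * d + r' → a ≡ a' × r ≡ r'
quotient-unique zero    zero     _  _  e = refl , e
quotient-unique {d} zero (suc a') {r} {r'} r< _ e = ⊥-elim (ℕₚ.<-irrefl refl (ℕₚ.<-≤-trans r<
  (ℕₚ.≤-trans (ℕₚ.≤-trans (ℕₚ.m≤m+n d (a' * d)) (ℕₚ.m≤m+n _ r')) (ℕₚ.≤-reflexive (sym e)))))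
quotient-unique {d} (suc a) zero {r} {r'} _ r'< e = ⊥-elim (ℕₚ.<-irrefl refl (ℕₚ.<-≤-trans r'<
  (ℕₚ.≤-trans (ℕₚ.≤-trans (ℕₚ.m≤m+n d (a * d)) (ℕₚ.m≤m+n _ r)) (ℕₚ.≤-reflexive e))))
quotient-unique {d} (suc a) (suc a') {r} {r'} p q e =
  let (x , y) = quotient-unique a a' p q (ℕₚ.+-cancelˡ-≡ d _ _
        (trans (sym (ℕₚ.+-assoc d (a * d) r)) (trans e (ℕₚ.+-assoc d (a' * d) r'))))
  in cong suc x , y

-- Tables are indexed by triples: ix m s t is entry (s , t) of the m-th n × n
-- matrix.
ix : ∀ {n} → ℕ → Fin n → Fin n → ℕ
ix {n} m s t = (m * (n * n) + toℕ s * n) + toℕ t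

ix-injective : ∀ {n} {m m'} {s s' t t' : Fin n} → ix m s t ≡ ix m' s' t' → m ≡ m' × s ≡ s' × t ≡ t'
ix-injective {n} {m} {m'} {s} {s'} {t} {t'} e =
  let (p , q)   = quotient-unique (m * n + toℕ s) (m' * n + toℕ s') (toℕ<n t) (toℕ<n t')
                    (trans (sym (regroup m s t)) (trans e (regroup m' s' t')))
      (p' , q') = quotient-unique m m' (toℕ<n s) (toℕ<n s') p
  in p' , toℕ-injective q' , toℕ-injective q
  where
  regroup : ∀ m (s t : Fin n) → ix m s t ≡ (m * n + toℕ s) * n + toℕ t
  regroup m s t = cong (_+ toℕ t) (trans (cong (_+ toℕ s * n) (sym (ℕₚ.*-assoc m n n))) (sym (ℕₚ.*-distribʳ-+ n (m * n) (toℕ s))))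

-- Rows are located through the stored multiples of n because natural expressions have no
-- multiplication.
at : NatExp → ℕ → ℕ → NatExp
at b x y = (b ⊕ (10 [ # x ])) ⊕ # y

keepsInput : Command → Bool
keepsInput p = not (writesN 0 p ∨ writesN 1 p ∨ writesN 2 p ∨ writesN 10 p ∨ writesR 0 p ∨ writesR 1 p)

-- One round of the Floyd-Warshall algorithm for each value of counter 30,
-- restricted by the tests ts, on a matrix that starts at index b.
pivotBody : ℕ → ℕ → NatExp → List Test → Command
pivotBody f r b ts = relaxWhen f r (ts ++ present f (at b 31 30) ∷ present f (at b 30 32) ∷ [])
  (at b 31 32) ((r [ at b 31 30 ]ʳ) ⊕ʳ (r [ at b 30 32 ]ʳ))

pivots : ℕ → ℕ → NatExp → List Test → Command
pivots f r b ts = for 30 vertices (for 31 vertices (for 32 vertices (pivotBody f r b ts)))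

module Stages {ℝ : Reals} {n : ℕ} (G : MixedGraph ℝ n) where
  open Real ℝ
  open MixedGraph G
  open Walks G
  open Combine G using (Entries)
  open Relax {ℝ}
  open State

  record Env (σ : State ℝ) : Set where
    constructor env
    field
      size    : nats σ 0 0 ≡ n
      rows    : ∀ (s : V) → nats σ 10 (toℕ s) ≡ toℕ s * n
      edgeN   : ∀ (u v : V) → nats σ 1 (ix 0 u v) ≡ presence G (edge u v)
      edgeR   : ∀ (u v : V) → reals σ 0 (ix 0 u v) ≡ fromMaybe 0# (edge u v)
      arcN    : ∀ (u v : V) → nats σ 2 (ix 0 u v) ≡ presence G (arc u v)
      arcR    : ∀ (u v : V) → reals σ 1 (ix 0 u v) ≡ fromMaybe 0# (arc u v)
  open Env public

  env-frame : ∀ p {σ τ} → keepsInput p ≡ true → Frame p σ τ → Env σ → Env τ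
  env-frame p k fr (env a b c d e f) =
    let w0 = not-true k
        w1 = ∨-falseʳ {writesN 0 p} w0 ; w2 = ∨-falseʳ {writesN 1 p} w1
        w3 = ∨-falseʳ {writesN 2 p} w2 ; w4 = ∨-falseʳ {writesN 10 p} w3 ; w5 = ∨-falseʳ {writesR 0 p} w4
    in env (trans (frameN fr 0 (∨-falseˡ w0) _) a) (λ s → trans (frameN fr 10 (∨-falseˡ w3) _) (b s))
           (λ u v → trans (frameN fr 1 (∨-falseˡ w1) _) (c u v)) (λ u v → trans (frameR fr 0 (∨-falseˡ w4) _) (d u v))
           (λ u v → trans (frameN fr 2 (∨-falseˡ w2) _) (e u v)) (λ u v → trans (frameR fr 1 w5 _) (f u v))

  At : ℕ → V → State ℝ → Set
  At x s σ = nats σ x 0 ≡ toℕ s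

  at-eval : ∀ {σ m} b {x y} {s t : V} → Env σ → evalⁿ σ b ≡ m * (n * n) → At x s σ → At y t σ → evalⁿ σ (at b x y) ≡ ix m s t
  at-eval {σ} b {x} {y} {s} e eb ex ey = cong₂ _+_ (cong₂ _+_ eb (trans (cong (nats σ 10) ex) (rows e s))) ey

  at-eval₀ : ∀ {σ x y} {s t : V} → Env σ → At x s σ → At y t σ → evalⁿ σ (at (lit 0) x y) ≡ ix 0 s t
  at-eval₀ e = at-eval {m = 0} (lit 0) e refl

  Semantics : Set₁
  Semantics = ℕ → V → V → Carrier → Set

  -- Quantifying over all triples with index `j` avoids decoding `j`. The triple is unique by
  -- `ix-injective`, and cells that are no entry are unconstrained.
  Tab : Semantics → ℕ → Carrier → Set
  Tab S j x = ∀ m s t → j ≡ ix m s t → S m s t x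

  tab : ∀ {S : Semantics} {m s t x j} → j ≡ ix m s t → S m s t x → Tab S j x
  tab {S} {m} {s} {t} e h m' s' t' e' with ix-injective {m = m} {m'} {s} {s'} {t} {t'} (trans (sym e) e')
  ... | refl , refl , refl = h

  Ent : ℕ → ℕ → ℕ → State ℝ → Entries
  Ent f r m σ s t x = Table.AtMost f r σ (ix m s t) x

  SoundT : ℕ → ℕ → Semantics → State ℝ → Set
  SoundT f r S σ = Table.Sound f r (Tab S) σ

  record Checks (f : ℕ) (p : Command) : Set where
    constructor checks
    field
      well : wellFormed p ≡ true
      kept : keepsInput p ≡ true
      c30  : (30 ≡ᵇ f) ≡ false
      c31  : (31 ≡ᵇ f) ≡ false
      c32  : (32 ≡ᵇ f) ≡ false

  -- Shared by shortest paths, reachability, connectivity and the composition at separating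
  -- vertices. These differ in the invariant `I` and in the condition `Guard` under which two
  -- entries may be combined; the invariant is proved about abstract entries before and after a
  -- round.
  module Pivot (f r : ℕ) (b : NatExp) (ts : List Test) (m : ℕ) (S : Semantics) (σ₀ : State ℝ) where
    open Table f r
    program = pivots f r b ts

    module _ (e₀ : Env σ₀) (ch : Checks f program)
             (base : ∀ σ → Frame program σ₀ σ → evalⁿ σ b ≡ m * (n * n))
             (compose : ∀ (k s t : V) σ {x y} → At 30 k σ → At 31 s σ → At 32 t σ → Frame program σ₀ σ → Holds ts σ →
                        S m s k x → S m k t y → S m s t (x +ᵣ y))
             (Guard : V → V → V → Set)
             (guarded : ∀ (k s t : V) σ → At 30 k σ → At 31 s σ → At 32 t σ → Frame program σ₀ σ → Guard k s t → Holds ts σ)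
             (I : ℕ → Entries → Set)
             (same : ∀ {k} {E E' : Entries} → (∀ {s t x} → E s t x → E' s t x) → (∀ {s t x} → E' s t x → E s t x) → I k E → I k E')
             (step : ∀ (k : V) (E E' : Entries) → (∀ {s t x} → E s t x → E' s t x) →
                     (∀ {s t x y} → Guard k s t → E s k x → E k t y → E' s t (x +ᵣ y)) → I (toℕ k) E → I (suc (toℕ k)) E')
             where
      open Checks ch

      private
        inner = for 31 vertices (for 32 vertices (pivotBody f r b ts))

        tests = ts ++ present f (at b 31 30) ∷ present f (at b 30 32) ∷ []
        target = at b 31 32
        sum = (r [ at b 31 30 ]ʳ) ⊕ʳ (r [ at b 30 32 ]ʳ)

        Ok : State ℝ → Set
        Ok σ = Frame program σ₀ σ

        row-lemma : ∀ (k : V) σ → At 30 k σ → Ok σ → Sound (Tab S) σ →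
          Grows (Tab S) inner σ ×
          (∀ {s t x y} → Guard k s t → Ent f r m σ s k x → Ent f r m σ k t y → Ent f r m (exec inner σ) s t (x +ᵣ y))
        row-lemma k σ ek ok so =
          let (g , h) = for2-relax {31} {32} {pivotBody f r b ts} (Tab S) σ (size eσ) wf₂ c31 c32 so
                (λ s t ρ c c' gr → relaxWhen-decreasing tests target sum ρ , relaxWhen-sound (Tab S) tests target sum ρ (value s t ρ c c' gr) (Grown.sound gr))
          in g , λ {s} {t} {x} {y} gd h₁ h₂ → h s t (ix m s t) (x +ᵣ y) λ ρ c c' gr →
               let i = idx s t ρ c c' gr
                   -- The matrix is updated in place, so row and column `k` may change during the
                   -- round. They only decrease, and the bounds from its beginning remain valid.
                   hh₁ = preserve (Grown.decreasing gr) _ _ h₁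
                   hh₂ = preserve (Grown.decreasing gr) _ _ h₂
               in relaxWhen-hit tests target sum ρ
                    (Allₚ.++⁺ (guarded k s t ρ (proj₁ (proj₂ i)) c c' (proj₁ i) gd)
                      (subst (λ j → 1 ≤ nats ρ f j) (sym (proj₁ (proj₂ (proj₂ i)))) (AtMost.finite hh₁) ∷
                       subst (λ j → 1 ≤ nats ρ f j) (sym (proj₁ (proj₂ (proj₂ (proj₂ i))))) (AtMost.finite hh₂) ∷ []))
                    (proj₂ (proj₂ (proj₂ (proj₂ i))))
                    (+ᵣ-mono-≤ (subst (λ j → reals ρ r j ≤ᵣ x) (sym (proj₁ (proj₂ (proj₂ i)))) (AtMost.below hh₁))
                               (subst (λ j → reals ρ r j ≤ᵣ y) (sym (proj₁ (proj₂ (proj₂ (proj₂ i))))) (AtMost.below hh₂)))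
          where
          wf₂ : wellFormed inner ≡ true
          wf₂ = ∧-trueʳ {not (writesN 0 inner)} (∧-trueʳ {not (30 ≡ᵇ 0) ∧ not (writesN 30 inner)} well)
          w30 : writesN 30 inner ≡ false
          w30 = not-true (∧-trueʳ {not (30 ≡ᵇ 0)} (∧-trueˡ well))
          eσ : Env σ
          eσ = env-frame program kept ok e₀
          idx : ∀ (s t : V) ρ → At 31 s ρ → At 32 t ρ → Grown (Tab S) inner σ ρ →
                Ok ρ × At 30 k ρ × evalⁿ ρ (at b 31 30) ≡ ix m s k × evalⁿ ρ (at b 30 32) ≡ ix m k t × evalⁿ ρ (at b 31 32) ≡ ix m s t
          idx s t ρ c c' gr = okρ , a30 , at-eval {m = m} b eρ bρ c a30 , at-eval {m = m} b eρ bρ a30 c' , at-eval {m = m} b eρ bρ c c'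
            where
            okρ : Ok ρ
            okρ = frame-trans ok (frame-body (Grown.framed gr))
            eρ = env-frame program kept okρ e₀
            bρ = base ρ okρ
            a30 = trans (frameN (Grown.framed gr) 30 w30 0) ek
          value : ∀ (s t : V) ρ → At 31 s ρ → At 32 t ρ → Grown (Tab S) inner σ ρ →
                  Holds (ts ++ present f (at b 31 30) ∷ present f (at b 30 32) ∷ []) ρ →
                  Tab S (evalⁿ ρ (at b 31 32)) (evalʳ ρ ((r [ at b 31 30 ]ʳ) ⊕ʳ (r [ at b 30 32 ]ʳ)))
          value s t ρ c c' gr hs with Allₚ.++⁻ ts hs
          ... | hts , p₁ ∷ p₂ ∷ [] =
            let (okρ , a30 , e₁ , e₂ , e₃) = idx s t ρ c c' gr
            in tab {S} {m} {s} {t} e₃ (compose k s t ρ a30 c c' okρ hts (entry (Grown.sound gr) _ p₁ m s k e₁) (entry (Grown.sound gr) _ p₂ m k t e₂))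

      pivots-correct : Sound (Tab S) σ₀ → I 0 (Ent f r m σ₀) →
        Decreasing σ₀ (exec program σ₀) × Sound (Tab S) (exec program σ₀) × I n (Ent f r m (exec program σ₀))
      pivots-correct so i₀ = for-rule {i = 30} {vertices} {inner} σ₀ n (size e₀) well Inv
        (counter 0 σ₀ , same-sound (λ j → update-array (nats σ₀) 30 0 0 f j c30) (λ _ → refl) so ,
         same (λ h → preserve (counter 0 σ₀) _ _ h) (λ h → preserve (uncounter 0 σ₀) _ _ h) i₀) keep
        where
        counter : ∀ k σ → Decreasing σ (setCounter 30 k σ)
        counter k σ = same-table (λ j → update-array (nats σ) 30 0 k f j c30) (λ _ → refl)
        uncounter : ∀ k σ → Decreasing (setCounter 30 k σ) σ
        uncounter k σ = same-table (λ j → sym (update-array (nats σ) 30 0 k f j c30)) (λ _ → refl)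
        Inv : ℕ → State ℝ → Set
        Inv k σ = Decreasing σ₀ σ × Sound (Tab S) σ × I k (Ent f r m σ)
        keep : ∀ k σ → k < n → nats σ 30 0 ≡ k → Frame program σ₀ σ → Inv k σ → Inv (suc k) (increment 30 (exec inner σ))
        keep k σ k<n c fr (d , s , iE) =
          let (g , h) = row-lemma κ σ (trans c (sym (toℕ-fromℕ< k<n))) fr s
              cd = counter (nats (exec inner σ) 30 0 + 1) (exec inner σ)
              cu = uncounter (nats (exec inner σ) 30 0 + 1) (exec inner σ)
          in decreasing-trans d (decreasing-trans (proj₁ g) cd) ,
             same-sound (λ j → update-array (nats (exec inner σ)) 30 0 _ f j c30) (λ _ → refl) (proj₂ g) ,
             same (λ q → preserve cd _ _ q) (λ q → preserve cu _ _ q)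
               (subst (λ z → I (suc z) (Ent f r m (exec inner σ))) (toℕ-fromℕ< k<n)
                 (step κ (Ent f r m σ) (Ent f r m (exec inner σ)) (λ q → preserve (proj₁ g) _ _ q) h
                   (subst (λ z → I z (Ent f r m σ)) (sym (toℕ-fromℕ< k<n)) iE)))
          where κ = fromℕ< k<n

-- Initial entries and shortest walks

Clause : Set
Clause = List Test × RealExp

clauses : ℕ → ℕ → NatExp → List Clause → Command
clauses f r b []              = nop
clauses f r b ((ts , e) ∷ cl) = relaxWhen f r ts (at b 30 31) e ⨟ clauses f r b cl

fill : ℕ → ℕ → NatExp → List Clause → Command
fill f r b cl = for 30 vertices (for 31 vertices (clauses f r b cl))

module Fills {ℝ : Reals} {n : ℕ} (G : MixedGraph ℝ n) where
  open Real ℝ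
  open MixedGraph G
  open Walks G
  open Combine G using (Entries)
  open Relax {ℝ}
  open State
  open Stages G

  module Fill (f r : ℕ) (b : NatExp) (cl : List Clause) (m : ℕ) (S : Semantics) (σ₀ : State ℝ) where
    open Table f r
    program = fill f r b cl

    module _ (e₀ : Env σ₀) (wf : wellFormed program ≡ true) (kept : keepsInput program ≡ true)
             (c30 : (30 ≡ᵇ f) ≡ false) (c31 : (31 ≡ᵇ f) ≡ false)
             (base : ∀ σ → Frame program σ₀ σ → evalⁿ σ b ≡ m * (n * n))
             (value : ∀ {ts e} → (ts , e) ∈ˡ cl → ∀ (s t : V) σ → At 30 s σ → At 31 t σ → Frame program σ₀ σ →
                      Holds ts σ → S m s t (evalʳ σ e)) where
      private
        inner = for 31 vertices (clauses f r b cl)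
        body = clauses f r b cl

        w30' : writesN 30 inner ≡ false
        w30' = not-true (∧-trueʳ {not (30 ≡ᵇ 0)} (∧-trueˡ wf))
        w30 : writesN 30 body ≡ false
        w30 = ∨-falseʳ {31 ≡ᵇ 30} w30'
        wf-inner : wellFormed inner ≡ true
        wf-inner = ∧-trueʳ {not (writesN 0 inner)} (∧-trueʳ {not (30 ≡ᵇ 0) ∧ not (writesN 30 inner)} wf)
        w31 : writesN 31 body ≡ false
        w31 = not-true (∧-trueʳ {not (31 ≡ᵇ 0)} (∧-trueˡ wf-inner))

        record Inner (s t : V) (σ : State ℝ) : Set where
          constructor inn
          field
            a30 : At 30 s σ
            a31 : At 31 t σ
            ok  : Frame program σ₀ σ
            so  : Sound (Tab S) σ

        go : ∀ (k : List Clause) → (∀ {c} → c ∈ˡ k → c ∈ˡ cl) →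
             (∀ {σ τ : State ℝ} → Frame (clauses f r b k) σ τ → Frame body σ τ) → ∀ (s t : V) σ → Inner s t σ →
             Grows (Tab S) (clauses f r b k) σ ×
             (∀ {ts e} → (ts , e) ∈ˡ k → ∀ x → (∀ ρ → At 30 s ρ → At 31 t ρ → Frame program σ₀ ρ → Holds ts ρ × evalʳ ρ e ≤ᵣ x) →
               AtMost (exec (clauses f r b k) σ) (ix m s t) x)
        go [] sub wk s t σ (inn a a' ok so) = (decreasing-refl , so) , λ ()
        go ((ts , e) ∷ k) sub wk s t σ (inn a a' ok so) =
          let (g , h) = go k (λ q → sub (there q)) (λ fr → wk (frm (λ a w → frameN fr a (∨-falseʳ {writesN a p₁} w)) (λ a w → frameR fr a (∨-falseʳ {writesR a p₁} w))))
                         s t (exec p₁ σ) (inn (trans (frameN fr₁ 30 w30 0) a) (trans (frameN fr₁ 31 w31 0) a')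
                           (frame-trans ok (frame-body {i = 30} (frame-body {i = 31} fr₁))) so₁)
          in (decreasing-trans (relaxWhen-decreasing ts (at b 30 31) e σ) (proj₁ g) , proj₂ g) , λ
             { (here refl) x hit → preserve (proj₁ g) _ _
                 (relaxWhen-hit ts (at b 30 31) e σ (proj₁ (hit σ a a' ok)) idx (proj₂ (hit σ a a' ok)))
             ; (there q) x hit → h q x hit }
          where
          p₁ = relaxWhen f r ts (at b 30 31) e
          fr₁ : Frame body σ (exec p₁ σ)
          fr₁ = wk (frm (λ a w → frameN (frame p₁ σ) a (∨-falseˡ w)) (λ a w → frameR (frame p₁ σ) a (∨-falseˡ w)))
          idx : evalⁿ σ (at b 30 31) ≡ ix m s t
          idx = at-eval {m = m} b (env-frame program kept ok e₀) (base σ ok) a a'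
          so₁ : Sound (Tab S) (exec p₁ σ)
          so₁ = relaxWhen-sound (Tab S) ts (at b 30 31) e σ
            (λ hs → tab {S} {m} {s} {t} idx (value (sub (here refl)) s t σ a a' ok hs)) so

      fill-correct : Sound (Tab S) σ₀ → Decreasing σ₀ (exec program σ₀) × Sound (Tab S) (exec program σ₀) ×
        (∀ {ts e} → (ts , e) ∈ˡ cl → ∀ s t x →
          (∀ ρ → At 30 s ρ → At 31 t ρ → Frame program σ₀ ρ → Holds ts ρ × evalʳ ρ e ≤ᵣ x) →
          Ent f r m (exec program σ₀) s t x)
      fill-correct so =
        let (g , h) = for2-relax {30} {31} {body} (Tab S) σ₀ (size e₀) wf c30 c31 so
              (λ s t σ a a' gr → proj₁ (go cl id id s t σ (inn a a' (Grown.framed gr) (Grown.sound gr))))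
        in proj₁ g , proj₂ g , λ q s t x hit → h s t (ix m s t) x λ σ a a' gr →
             proj₂ (go cl id id s t σ (inn a a' (Grown.framed gr) (Grown.sound gr))) q x hit

  module Closure (R : V → V → Set) (cost-of : ∀ {u v} → R u v → Carrier) where
    total : ∀ {s t} → Star R s t → Carrier
    total ε       = 0#
    total (e ◅ p) = cost-of e +ᵣ total p

    data Via (k : ℕ) : V → V → Carrier → Set where
      one : ∀ {u v} (e : R u v) → Via k u v (cost-of e)
      via : ∀ {u v t x} (e : R u v) → toℕ v < k → Via k v t x → Via k u t (cost-of e +ᵣ x)

    -- Negative cycles would invalidate the usual invariant, so it is conditional on a nonnegative
    -- diagonal. Entries only decrease, hence a diagonal that is nonnegative in the end was so in
    -- every earlier round.
    Closed : ℕ → Entries → Set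
    Closed k E = (∀ {s x} → E s s x → 0# ≤ᵣ x) →
                 (∀ s → E s s 0#) × (∀ {s t x} → Via k s t x → ∃[ y ] y ≤ᵣ x × E s t y)

    closed-same : ∀ {k} {E E' : Entries} → (∀ {s t x} → E s t x → E' s t x) → (∀ {s t x} → E' s t x → E s t x) →
                  Closed k E → Closed k E'
    closed-same to from h d = let (a , b) = h (λ q → d (to q)) in (λ s → to (a s)) ,
      λ v → let (y , le , q) = b v in y , le , to q

    closed-start : ∀ {E : Entries} → (∀ s → E s s 0#) → (∀ {u v} (e : R u v) → E u v (cost-of e)) → Closed 0 E
    closed-start h₀ h₁ d = h₀ , λ { (one e) → _ , ≤ᵣ-refl , h₁ e }

    closed-step : ∀ (k : V) (E E' : Entries) → (∀ {s t x} → E s t x → E' s t x) →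
      (∀ {s t x y} → ⊤ → E s k x → E k t y → E' s t (x +ᵣ y)) → Closed (toℕ k) E → Closed (suc (toℕ k)) E'
    closed-step k E E' mono hit h d = (λ s → mono (h₀ s)) , extend
      where
      h₀ = proj₁ (h (λ q → d (mono q)))
      h₁ = proj₂ (h (λ q → d (mono q)))
      split : ∀ {s t x} → Via (suc (toℕ k)) s t x →
              Via (toℕ k) s t x ⊎ (∃[ y ] ∃[ z ] Via (toℕ k) s k y × E k t z × y +ᵣ z ≤ᵣ x)
      split (one e) = inj₁ (one e)
      split (via {v = v} e lt w) with v Finₚ.≟ k | split w
      ... | no ne | inj₁ w' = inj₁ (via e (ℕₚ.≤∧≢⇒< (ℕₚ.≤-pred lt) (λ q → ne (toℕ-injective q))) w')
      ... | no ne | inj₂ (y , z , w' , q , le) = inj₂ (_ , z ,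
              via e (ℕₚ.≤∧≢⇒< (ℕₚ.≤-pred lt) (λ q → ne (toℕ-injective q))) w' , q ,
              ≤ᵣ-trans (≤ᵣ-reflexive (+ᵣ-assoc _ y z)) (+ᵣ-monoʳ-≤ _ le))
      ... | yes refl | inj₁ w' = let (y , le , q) = h₁ w' in inj₂ (_ , y , one e , q , +ᵣ-monoʳ-≤ _ le)
      -- Between two visits to `k` there is a closed walk. It has an entry on the diagonal, which is
      -- nonnegative, and may be dropped.
      ... | yes refl | inj₂ (y , z , w' , q , le) =
              let (y' , le' , q') = h₁ w' in inj₂ (_ , z , one e , q ,
                +ᵣ-monoʳ-≤ _ (≤ᵣ-dropˡ (≤ᵣ-trans (d (mono q')) le') le))
      extend : ∀ {s t x} → Via (suc (toℕ k)) s t x → ∃[ y ] y ≤ᵣ x × E' s t y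
      extend w with split w
      ... | inj₁ w' = let (y , le , q) = h₁ w' in y , le , mono q
      ... | inj₂ (y , z , w' , q , le) = let (y' , le' , q') = h₁ w' in
              _ , ≤ᵣ-trans (+ᵣ-monoˡ-≤ z le') le , hit tt q' q

    closed-total : ∀ {E : Entries} → (∀ {s t x y} → x ≤ᵣ y → E s t x → E s t y) → Closed n E →
                   (∀ {s x} → E s s x → 0# ≤ᵣ x) → ∀ {s t} (p : Star R s t) → E s t (total p)
    closed-total weaken h d ε = proj₁ (h d) _
    closed-total weaken h d (e ◅ p) = let (y , le , q) = proj₂ (h d) (viaWalk e p) in
        weaken le q
      where
      viaWalk : ∀ {u v t} (e : R u v) (p : Star R v t) → Via n u t (cost-of e +ᵣ total p)
      viaWalk e ε       = subst (Via n _ _) (sym (+ᵣ-identityʳ _)) (one e)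
      viaWalk e (g ◅ p) = via e (toℕ<n _) (viaWalk g p)

-- Reachability, connectivity and separation

multiples : ℕ → ℕ → Command
multiples t c = for 30 vertices (setN t (# 30 ⊕ lit 1) ((t [ # 30 ]) ⊕ # c))

-- Without multiplication, n² is found as the last of the multiples of n, and is then tabulated in
-- the same way.
prelude : Command
prelude = multiples 10 0 ⨟ setN 20 (lit 0) (10 [ # 0 ]) ⨟ multiples 11 20

at₀ : ℕ → ℕ → NatExp
at₀ = at (lit 0)

-- Reachability is a shortest walk problem with all weights 0, in which only the flags carry
-- information; connectivity is treated likewise.
reachClauses : List Clause
reachClauses = (sameᵗ (# 30) (# 31) ∷ [] , zeroʳ) ∷ (present 1 (at₀ 30 31) ∷ [] , zeroʳ) ∷ (present 2 (at₀ 30 31) ∷ [] , zeroʳ) ∷ []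

reachability : Command
reachability = fill 6 6 (lit 0) reachClauses ⨟ pivots 6 6 (lit 0) []

slab : NatExp
slab = 11 [ # 33 ]

strongAvoiding : List Test
strongAvoiding = present 6 (at₀ 30 31) ∷ present 6 (at₀ 31 30) ∷ notᵗ (sameᵗ (# 30) (# 33)) ∷ notᵗ (sameᵗ (# 31) (# 33)) ∷ []

connClauses : List Clause
connClauses = (sameᵗ (# 30) (# 31) ∷ [] , zeroʳ) ∷ (present 1 (at₀ 30 31) ∷ strongAvoiding , zeroʳ)
            ∷ (present 2 (at₀ 30 31) ∷ strongAvoiding , zeroʳ) ∷ (present 2 (at₀ 31 30) ∷ strongAvoiding , zeroʳ) ∷ []

connectivityAvoiding : Command
connectivityAvoiding = fill 7 7 slab connClauses ⨟ pivots 7 7 slab []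

connectivity : Command
connectivity = for 33 vertices connectivityAvoiding

-- Flags can be set but not withdrawn, so the pairs that are not inseparable are collected: one
-- reason is enough to set the flag.
sepClauses₀ : List Clause
sepClauses₀ = (notᵗ (present 6 (at₀ 30 31)) ∷ [] , zeroʳ) ∷ (notᵗ (present 6 (at₀ 31 30)) ∷ [] , zeroʳ) ∷ []

sepClauses : List Clause
sepClauses = (notᵗ (sameᵗ (# 30) (# 33)) ∷ notᵗ (sameᵗ (# 31) (# 33)) ∷ notᵗ (present 7 (at slab 30 31)) ∷ [] , zeroʳ) ∷ []

separation : Command
separation = fill 12 12 (lit 0) sepClauses₀ ⨟ for 33 vertices (fill 12 12 (lit 0) sepClauses)

module Static {ℝ : Reals} {n : ℕ} (G : MixedGraph ℝ n) where
  open Real ℝ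
  open MixedGraph G
  open Walks G
  open Combine G using (Entries)
  open Relax {ℝ}
  open State
  open Stages G
  open Fills G

  multiples-correct : ∀ t c (σ : State ℝ) → nats σ 0 0 ≡ n → nats σ t 0 ≡ 0 → (30 ≡ᵇ t) ≡ false → (30 ≡ᵇ c) ≡ false → (t ≡ᵇ c) ≡ false →
    wellFormed (multiples t c) ≡ true → ∀ j → j ≤ n → nats (exec (multiples t c) σ) t j ≡ j * nats σ c 0
  multiples-correct t c σ₀ en e₀ it ic tc wf = for-rule {i = 30} {vertices} {setN t (# 30 ⊕ lit 1) ((t [ # 30 ]) ⊕ # c)} σ₀ n en wf
    (λ k σ → ∀ j → j ≤ k → nats σ t j ≡ j * nats σ₀ c 0)
    (λ { zero z≤n → trans (update-array (nats σ₀) 30 0 0 t 0 it) e₀ }) step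
    where
    C = nats σ₀ c 0
    wc : writesN c (multiples t c) ≡ false
    wc rewrite ic | tc = refl
    step : ∀ k σ → k < n → nats σ 30 0 ≡ k → Frame (multiples t c) σ₀ σ → (∀ j → j ≤ k → nats σ t j ≡ j * C) →
           ∀ j → j ≤ suc k → nats (increment 30 (exec (setN t (# 30 ⊕ lit 1) ((t [ # 30 ]) ⊕ # c)) σ)) t j ≡ j * C
    step k σ k<n ek fr h j le = trans (update-array (update (nats σ) t (nats σ 30 0 + 1) new) 30 0 _ t j it) (go (update-case (nats σ) t (nats σ 30 0 + 1) (nats σ t (nats σ 30 0) + nats σ c 0) j))
      where
      new = nats σ t (nats σ 30 0) + nats σ c 0
      go : (nats σ 30 0 + 1 ≡ j × update (nats σ) t (nats σ 30 0 + 1) new t j ≡ new) ⊎ (update (nats σ) t (nats σ 30 0 + 1) new t j ≡ nats σ t j) →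
           update (nats σ) t (nats σ 30 0 + 1) new t j ≡ j * C
      go (inj₁ (q , e)) = trans e (trans (cong₂ _+_ (trans (cong (nats σ t) ek) (h k ℕₚ.≤-refl)) (frameN fr c wc 0))
        (trans (ℕₚ.+-comm (k * C) C) (cong (_* C) (trans (cong suc (sym ek)) (trans (ℕₚ.+-comm 1 _) q)))))
      go (inj₂ e) with ℕₚ.m≤n⇒m<n∨m≡n le
      ... | inj₁ (s≤s lt) = trans e (h j lt)
      ... | inj₂ refl = trans (update-at (trans (ℕₚ.+-comm (nats σ 30 0) 1) (cong suc ek)))
              (trans (cong₂ _+_ (trans (cong (nats σ t) ek) (h k ℕₚ.≤-refl)) (frameN fr c wc 0)) (ℕₚ.+-comm (k * C) C))
        where update-at : ∀ {i} → i ≡ suc k → update (nats σ) t i new t (suc k) ≡ new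
              update-at refl = update-same (nats σ) t (suc k) new

  presence-just : ∀ m → 1 ≤ presence G m → ∃[ w ] m ≡ just w
  presence-just (just w) _ = w , refl

  just-presence : ∀ {m w} → m ≡ just w → 1 ≤ presence G m
  just-presence refl = s≤s z≤n

  edge-present : ∀ {σ u v} → Env σ → 1 ≤ nats σ 1 (ix 0 u v) → ∃[ w ] edge u v ≡ just w × reals σ 0 (ix 0 u v) ≡ w
  edge-present {u = u} {v} e h = let (w , q) = presence-just (edge u v) (subst (1 ≤_) (edgeN e u v) h)
    in w , q , trans (edgeR e u v) (cong (fromMaybe 0#) q)

  present-edge : ∀ {σ u v w} → Env σ → edge u v ≡ just w → 1 ≤ nats σ 1 (ix 0 u v) × reals σ 0 (ix 0 u v) ≡ w
  present-edge {u = u} {v} e q = subst (1 ≤_) (sym (edgeN e u v)) (just-presence q) , trans (edgeR e u v) (cong (fromMaybe 0#) q)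

  arc-present : ∀ {σ u v} → Env σ → 1 ≤ nats σ 2 (ix 0 u v) → ∃[ w ] arc u v ≡ just w × reals σ 1 (ix 0 u v) ≡ w
  arc-present {u = u} {v} e h = let (w , q) = presence-just (arc u v) (subst (1 ≤_) (arcN e u v) h)
    in w , q , trans (arcR e u v) (cong (fromMaybe 0#) q)

  present-arc : ∀ {σ u v w} → Env σ → arc u v ≡ just w → 1 ≤ nats σ 2 (ix 0 u v) × reals σ 1 (ix 0 u v) ≡ w
  present-arc {u = u} {v} e q = subst (1 ≤_) (sym (arcN e u v)) (just-presence q) , trans (arcR e u v) (cong (fromMaybe 0#) q)

  at-present⁻ : ∀ {σ x y} f {s t : V} → Env σ → At x s σ → At y t σ → ⟦ present f (at₀ x y) ⟧ σ → 1 ≤ nats σ f (ix 0 s t)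
  at-present⁻ {σ} f e a b h = subst (λ j → 1 ≤ nats σ f j) (at-eval₀ e a b) h

  at-present⁺ : ∀ {σ x y} f {s t : V} → Env σ → At x s σ → At y t σ → 1 ≤ nats σ f (ix 0 s t) → ⟦ present f (at₀ x y) ⟧ σ
  at-present⁺ {σ} f e a b h = subst (λ j → 1 ≤ nats σ f j) (sym (at-eval₀ e a b)) h

  same⁻ : ∀ σ {x y} {s t : V} → At x s σ → At y t σ → ⟦ sameᵗ (# x) (# y) ⟧ σ → s ≡ t
  same⁻ σ {x} {y} a b h = toℕ-injective (trans (sym a) (trans (sameᵗ-sound (# x) (# y) σ h) b))

  same⁺ : ∀ σ {x y} {s t : V} → At x s σ → At y t σ → s ≡ t → ⟦ sameᵗ (# x) (# y) ⟧ σ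
  same⁺ σ {x} {y} a b refl = sameᵗ-complete (# x) (# y) σ (trans a (sym b))

  record Reached (σ : State ℝ) : Set where
    constructor reached
    field
      reach⁺ : ∀ {u v} → u ⟶* v → 1 ≤ nats σ 6 (ix 0 u v)
      reach⁻ : ∀ {u v} → 1 ≤ nats σ 6 (ix 0 u v) → u ⟶* v
  open Reached public

  reached-frame : ∀ p {σ τ} → writesN 6 p ≡ false → Frame p σ τ → Reached σ → Reached τ
  reached-frame p w fr (reached a b) = reached (λ q → subst (1 ≤_) (sym (frameN fr 6 w _)) (a q)) (λ h → b (subst (1 ≤_) (frameN fr 6 w _) h))

  module _ (σ₀ : State ℝ) (e₀ : Env σ₀) where

    private
      S₆ : Semantics
      S₆ m s t x = x ≡ 0# × (s ⟶* t)

      module F₆ = Fill 6 6 (lit 0) reachClauses 0 S₆ σ₀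
      σ₁ = exec (fill 6 6 (lit 0) reachClauses) σ₀
      module P₆ = Pivot 6 6 (lit 0) [] 0 S₆ σ₁
      module C₆ = Closure (Step G) (λ _ → 0#)

      value₆ : ∀ {ts e} → (ts , e) ∈ˡ reachClauses → ∀ (s t : V) σ → At 30 s σ → At 31 t σ → Frame F₆.program σ₀ σ →
               Holds ts σ → S₆ 0 s t (evalʳ σ e)
      value₆ (here refl) s t σ a b fr (h ∷ []) with same⁻ σ a b h
      ... | refl = refl , ε
      value₆ (there (here refl)) s t σ a b fr (h ∷ []) =
        let e = env-frame F₆.program refl fr e₀ ; (w , q , _) = edge-present e (at-present⁻ 1 e a b h) in refl , along-edge w q ◅ ε
      value₆ (there (there (here refl))) s t σ a b fr (h ∷ []) =
        let e = env-frame F₆.program refl fr e₀ ; (w , q , _) = arc-present e (at-present⁻ 2 e a b h) in refl , along-arc w q ◅ ε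

    private
      e₁ : Env σ₁
      e₁ = env-frame F₆.program refl (frame F₆.program σ₀) e₀

      empty : (∀ j → nats σ₀ 6 j ≡ 0) → SoundT 6 6 S₆ σ₀
      empty z = Table.snd λ j p → ⊥-elim (ℕₚ.<-irrefl refl (subst (1 ≤_) (z j) p))

      f₆ = λ (z : (∀ j → nats σ₀ 6 j ≡ 0)) → F₆.fill-correct e₀ refl refl refl refl (λ _ _ → refl) value₆ (empty z)

      loops : (∀ j → nats σ₀ 6 j ≡ 0) → ∀ s → Ent 6 6 0 σ₁ s s 0#
      loops z s = proj₂ (proj₂ (f₆ z)) (here refl) s s 0# λ ρ a b fr → (same⁺ ρ a b refl ∷ []) , ≤ᵣ-refl

      steps : (∀ j → nats σ₀ 6 j ≡ 0) → ∀ {u v} → Step G u v → Ent 6 6 0 σ₁ u v 0#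
      steps z {u} {v} (along-edge w q) = proj₂ (proj₂ (f₆ z)) (there (here refl)) u v 0# λ ρ a b fr →
                     let e = env-frame F₆.program refl fr e₀ in (at-present⁺ 1 e a b (proj₁ (present-edge e q)) ∷ []) , ≤ᵣ-refl
      steps z {u} {v} (along-arc w q) = proj₂ (proj₂ (f₆ z)) (there (there (here refl))) u v 0# λ ρ a b fr →
                     let e = env-frame F₆.program refl fr e₀ in (at-present⁺ 2 e a b (proj₁ (present-arc e q)) ∷ []) , ≤ᵣ-refl

      filled : (∀ j → nats σ₀ 6 j ≡ 0) → SoundT 6 6 S₆ σ₁ × C₆.Closed 0 (Ent 6 6 0 σ₁)
      filled z = proj₁ (proj₂ (f₆ z)) , C₆.closed-start (loops z) (steps z)

      closed : (∀ j → nats σ₀ 6 j ≡ 0) → SoundT 6 6 S₆ (exec P₆.program σ₁) × C₆.Closed n (Ent 6 6 0 (exec P₆.program σ₁))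
      closed z = proj₂ (P₆.pivots-correct e₁ (checks refl refl refl refl refl) (λ _ _ → refl)
            (λ k s t σ _ _ _ _ _ (p , q) (p' , q') → trans (cong₂ _+ᵣ_ p p') (+ᵣ-identityˡ _) , q ◅◅ q')
            (λ _ _ _ → ⊤) (λ _ _ _ _ _ _ _ _ _ → []) C₆.Closed C₆.closed-same C₆.closed-step (proj₁ (filled z)) (proj₂ (filled z)))

    reachability-correct : (∀ j → nats σ₀ 6 j ≡ 0) → Reached (exec P₆.program σ₁)
    reachability-correct z = reached
      (λ {u} {v} p → Table.AtMost.finite {6} {6} (C₆.closed-total (Table.AtMost-weaken 6 6) (proj₂ (closed z))
         (λ {u} {x} q → subst (_≤ᵣ x) (proj₁ (Table.entry (proj₁ (closed z)) _ (Table.AtMost.finite q) 0 u u refl)) (Table.AtMost.below q)) p))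
      (λ {u} {v} q → proj₂ (Table.entry (proj₁ (closed z)) (ix 0 u v) q 0 u v refl))

  record Slabs (σ : State ℝ) : Set where
    constructor slabs
    field slabAt : ∀ (c : V) → nats σ 11 (toℕ c) ≡ toℕ c * (n * n)
  open Slabs public

  slabs-frame : ∀ p {σ τ} → writesN 11 p ≡ false → Frame p σ τ → Slabs σ → Slabs τ
  slabs-frame p w fr (slabs h) = slabs λ c → trans (frameN fr 11 w _) (h c)

  record Connected (σ : State ℝ) : Set where
    constructor connected
    field
      conn⁺ : ∀ {c u v} → Conn c u v → 1 ≤ nats σ 7 (ix (toℕ c) u v)
      conn⁻ : ∀ {c u v} → 1 ≤ nats σ 7 (ix (toℕ c) u v) → Conn c u v
  open Connected public

  connected-frame : ∀ p {σ τ} → writesN 7 p ≡ false → Frame p σ τ → Connected σ → Connected τ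
  connected-frame p w fr (connected a b) =
    connected (λ q → subst (1 ≤_) (sym (frameN fr 7 w _)) (a q)) (λ h → b (subst (1 ≤_) (frameN fr 7 w _) h))

  private
    S₇ : Semantics
    S₇ m s t x = x ≡ 0# × (∀ c → m ≡ toℕ c → Conn c s t)

  module _ (σ₀ : State ℝ) (e₀ : Env σ₀) (r₀ : Reached σ₀) (sl₀ : Slabs σ₀) (c : V) (c₀ : At 33 c σ₀) where
    private
      m = toℕ c
      module F₇ = Fill 7 7 slab connClauses m S₇ σ₀
      σ₁ = exec (fill 7 7 slab connClauses) σ₀
      module P₇ = Pivot 7 7 slab [] m S₇ σ₁
      module C₇ = Closure (HStep c) (λ _ → 0#)

      slab-at : ∀ {σ} → Slabs σ → At 33 c σ → evalⁿ σ slab ≡ m * (n * n)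
      slab-at {σ} sl a = trans (cong (nats σ 11) a) (slabAt sl c)

      avoiding⁻ : ∀ {s t : V} {σ} → At 30 s σ → At 31 t σ → Frame F₇.program σ₀ σ → Holds strongAvoiding σ → s ≢ c × t ≢ c × s ≋ t
      avoiding⁻ {σ = σ} a b fr (h₁ ∷ h₂ ∷ h₃ ∷ h₄ ∷ []) =
        let e = env-frame F₇.program refl fr e₀ ; r = reached-frame F₇.program refl fr r₀ ; c' = trans (frameN fr 33 refl 0) c₀
        in (λ q → h₃ (same⁺ σ a c' q)) , (λ q → h₄ (same⁺ σ b c' q)) , reach⁻ r (at-present⁻ 6 e a b h₁) , reach⁻ r (at-present⁻ 6 e b a h₂)

      avoiding⁺ : ∀ {s t : V} {σ} → At 30 s σ → At 31 t σ → Frame F₇.program σ₀ σ → s ≢ c → t ≢ c → s ≋ t → Holds strongAvoiding σ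
      avoiding⁺ {σ = σ} a b fr sc tc (p , q) =
        let e = env-frame F₇.program refl fr e₀ ; r = reached-frame F₇.program refl fr r₀ ; c' = trans (frameN fr 33 refl 0) c₀
        in at-present⁺ 6 e a b (reach⁺ r p) ∷ at-present⁺ 6 e b a (reach⁺ r q) ∷ (λ h → sc (same⁻ σ a c' h)) ∷ (λ h → tc (same⁻ σ b c' h)) ∷ []

      value₇ : ∀ {ts e} → (ts , e) ∈ˡ connClauses → ∀ (s t : V) σ → At 30 s σ → At 31 t σ → Frame F₇.program σ₀ σ →
               Holds ts σ → S₇ m s t (evalʳ σ e)
      single : ∀ {s t} → s ≢ c × t ≢ c × s ≋ t → Adjacent G s t → S₇ m s t 0#
      single (a , b , q) adj = refl , λ c' e → subst (λ z → Conn z _ _) (toℕ-injective e) ((a , b , q , adj) ◅ ε)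
      value₇ (here refl) s t σ a b fr (h ∷ []) with same⁻ σ a b h
      ... | refl = refl , λ _ _ → ε
      value₇ (there (here refl)) s t σ a b fr (h ∷ hs) =
        let e = env-frame F₇.program refl fr e₀ ; (w , q , _) = edge-present e (at-present⁻ 1 e a b h)
        in single (avoiding⁻ a b fr hs) (inj₁ (along-edge w q))
      value₇ (there (there (here refl))) s t σ a b fr (h ∷ hs) =
        let e = env-frame F₇.program refl fr e₀ ; (w , q , _) = arc-present e (at-present⁻ 2 e a b h)
        in single (avoiding⁻ a b fr hs) (inj₁ (along-arc w q))
      value₇ (there (there (there (here refl)))) s t σ a b fr (h ∷ hs) =
        let e = env-frame F₇.program refl fr e₀ ; (w , q , _) = arc-present e (at-present⁻ 2 e b a h)
        in single (avoiding⁻ a b fr hs) (inj₂ (along-arc w q))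

    connectivityAvoiding-correct : Table.Sound 7 7 (Tab S₇) σ₀ →
      Table.Grows 7 7 (Tab S₇) connectivityAvoiding σ₀ ×
      (∀ {s t} → Conn c s t → Table.AtMost 7 7 (exec connectivityAvoiding σ₀) (ix m s t) 0#)
    connectivityAvoiding-correct so =
      let (d , s , h) = F₇.fill-correct e₀ refl refl refl refl
                          (λ σ fr → slab-at (slabs-frame F₇.program refl fr sl₀) (trans (frameN fr 33 refl 0) c₀)) value₇ so
          fr₁ = frame F₇.program σ₀
          e₁ = env-frame F₇.program refl fr₁ e₀
          edge-hit = λ {u v : V} (uc : u ≢ c) (vc : v ≢ c) (uv : u ≋ v) {w} (q : edge u v ≡ just w) →
            h (there (here refl)) u v 0# λ ρ a b fr →
              let e = env-frame F₇.program refl fr e₀ in (at-present⁺ 1 e a b (proj₁ (present-edge e q)) ∷ avoiding⁺ a b fr uc vc uv) , ≤ᵣ-refl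
          (d' , s' , cl) = P₇.pivots-correct e₁ (checks refl refl refl refl refl)
            (λ σ fr → slab-at (slabs-frame P₇.program refl fr (slabs-frame F₇.program refl fr₁ sl₀))
                        (trans (frameN fr 33 refl 0) (trans (frameN fr₁ 33 refl 0) c₀)))
            (λ k s t σ _ _ _ _ _ (p , q) (p' , q') → trans (cong₂ _+ᵣ_ p p') (+ᵣ-identityˡ _) , λ c' e → q c' e ◅◅ q' c' e)
            (λ _ _ _ → ⊤) (λ _ _ _ _ _ _ _ _ _ → []) C₇.Closed C₇.closed-same C₇.closed-step s
            (C₇.closed-start
              (λ s → h (here refl) s s 0# λ ρ a b fr → (same⁺ ρ a b refl ∷ []) , ≤ᵣ-refl)
              (λ { {u} {v} (uc , vc , uv , inj₁ (along-edge w q)) → edge-hit uc vc uv q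
                 ; {u} {v} (uc , vc , uv , inj₂ (along-edge w q)) → edge-hit uc vc uv (trans (edge-sym u v) q)
                 ; {u} {v} (uc , vc , uv , inj₁ (along-arc w q)) → h (there (there (here refl))) u v 0# λ ρ a b fr →
                     let e = env-frame F₇.program refl fr e₀ in (at-present⁺ 2 e a b (proj₁ (present-arc e q)) ∷ avoiding⁺ a b fr uc vc uv) , ≤ᵣ-refl
                 ; {u} {v} (uc , vc , uv , inj₂ (along-arc w q)) → h (there (there (there (here refl)))) u v 0# λ ρ a b fr →
                     let e = env-frame F₇.program refl fr e₀ in (at-present⁺ 2 e b a (proj₁ (present-arc e q)) ∷ avoiding⁺ a b fr uc vc uv) , ≤ᵣ-refl }))
      in (Table.decreasing-trans 7 7 d d' , s') , λ {s} {t} p → 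
           let p' = Table.AtMost.finite (C₇.closed-total (Table.AtMost-weaken 7 7) cl
                      (λ {u} {x} q → subst (_≤ᵣ x) (proj₁ (Table.entry s' _ (Table.AtMost.finite q) m u u refl)) (Table.AtMost.below q)) p)
           in p' Table., ≤ᵣ-reflexive (proj₁ (Table.entry s' _ p' m s t refl))

  connectivity-correct : ∀ σ₀ → Env σ₀ → Reached σ₀ → Slabs σ₀ → (∀ j → nats σ₀ 7 j ≡ 0) → Connected (exec connectivity σ₀)
  connectivity-correct σ₀ e₀ r₀ sl₀ z = connected
    (λ {c} {u} {v} p → Table.AtMost.finite {7} {7} (proj₂ result c (ix (toℕ c) u v) 0# λ σ a gr → proj₂ (body c σ a gr) p))
    (λ {c} {u} {v} q → proj₂ (Table.entry (proj₂ (proj₁ result)) (ix (toℕ c) u v) q (toℕ c) u v refl) c refl)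
    where
    open Table 7 7
    body : ∀ (c : V) σ → At 33 c σ → Grown (Tab S₇) connectivity σ₀ σ → Grows (Tab S₇) connectivityAvoiding σ ×
           (∀ {s t} → Conn c s t → AtMost (exec connectivityAvoiding σ) (ix (toℕ c) s t) 0#)
    body c σ a gr = let fr = Grown.framed gr in
      connectivityAvoiding-correct σ (env-frame connectivity refl fr e₀) (reached-frame connectivity refl fr r₀)
        (slabs-frame connectivity refl fr sl₀) c a (Grown.sound gr)
    result = for-vertices {33} {connectivityAvoiding} {n} (Tab S₇) σ₀ (size e₀) refl refl
               (snd λ j p → ⊥-elim (ℕₚ.<-irrefl refl (subst (1 ≤_) (z j) p))) (λ c σ a gr → proj₁ (body c σ a gr))

  record Separated (σ : State ℝ) : Set where
    constructor separated
    field
      sep⁺ : ∀ {u v} → 1 ≤ nats σ 12 (ix 0 u v) → ¬ Insep u v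
      sep⁻ : ∀ {u v} → ¬ (1 ≤ nats σ 12 (ix 0 u v)) → Insep u v
  open Separated public

  separated-frame : ∀ p {σ τ} → writesN 12 p ≡ false → Frame p σ τ → Separated σ → Separated τ
  separated-frame p w fr (separated a b) =
    separated (λ q → a (subst (1 ≤_) (frameN fr 12 w _) q)) (λ h → b (λ q → h (subst (1 ≤_) (sym (frameN fr 12 w _)) q)))

  module _ (σ₀ : State ℝ) (e₀ : Env σ₀) (r₀ : Reached σ₀) (sl₀ : Slabs σ₀) (c₀ : Connected σ₀) (z : ∀ j → nats σ₀ 12 j ≡ 0) where
    private
      open Table 12 12

      S₁₂ : Semantics
      S₁₂ m s t x = ¬ Insep s t

      module F = Fill 12 12 (lit 0) sepClauses₀ 0 S₁₂ σ₀
      σ₁ = exec F.program σ₀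

      value : ∀ {ts e} → (ts , e) ∈ˡ sepClauses₀ → ∀ (s t : V) σ → At 30 s σ → At 31 t σ → Frame F.program σ₀ σ →
              Holds ts σ → S₁₂ 0 s t (evalʳ σ e)
      value (here refl) s t σ a b fr (h ∷ []) i = h (at-present⁺ 6 (env-frame F.program refl fr e₀) a b
        (reach⁺ (reached-frame F.program refl fr r₀) (proj₁ (strong i))))
      value (there (here refl)) s t σ a b fr (h ∷ []) i = h (at-present⁺ 6 (env-frame F.program refl fr e₀) b a
        (reach⁺ (reached-frame F.program refl fr r₀) (proj₂ (strong i))))

      result₀ = F.fill-correct e₀ refl refl refl refl (λ _ _ → refl) value
                  (snd λ j p → ⊥-elim (ℕₚ.<-irrefl refl (subst (1 ≤_) (z j) p)))

      weak-hit : ∀ (s t : V) → ¬ (1 ≤ nats σ₀ 6 (ix 0 s t)) → Ent 12 12 0 σ₁ s t 0#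
      weak-hit s t h = proj₂ (proj₂ result₀) (here refl) s t 0# λ ρ a b fr →
        (λ q → h (subst (1 ≤_) (frameN fr 6 refl _) (at-present⁻ 6 (env-frame F.program refl fr e₀) a b q))) ∷ [] , ≤ᵣ-refl

      weak-hit' : ∀ (s t : V) → ¬ (1 ≤ nats σ₀ 6 (ix 0 t s)) → Ent 12 12 0 σ₁ s t 0#
      weak-hit' s t h = proj₂ (proj₂ result₀) (there (here refl)) s t 0# λ ρ a b fr →
        (λ q → h (subst (1 ≤_) (frameN fr 6 refl _) (at-present⁻ 6 (env-frame F.program refl fr e₀) b a q))) ∷ [] , ≤ᵣ-refl

      rest = fill 12 12 (lit 0) sepClauses
      loop₁ = for 33 vertices rest
      fr₀ = frame F.program σ₀
      e₁ = env-frame F.program refl fr₀ e₀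
      c₁ = connected-frame F.program refl fr₀ c₀
      sl₁ = slabs-frame F.program refl fr₀ sl₀

      module Round (c : V) (σ : State ℝ) (ac : At 33 c σ) (gr : Grown (Tab S₁₂) loop₁ σ₁ σ) where
        module F' = Fill 12 12 (lit 0) sepClauses 0 S₁₂ σ
        e₂ = env-frame loop₁ refl (Grown.framed gr) e₁
        c₂ = connected-frame loop₁ refl (Grown.framed gr) c₁
        sl₂ = slabs-frame loop₁ refl (Grown.framed gr) sl₁

        slab-index : ∀ {s t : V} ρ → At 30 s ρ → At 31 t ρ → Frame F'.program σ ρ → evalⁿ ρ (at slab 30 31) ≡ ix (toℕ c) s t
        slab-index ρ a b fr = at-eval {m = toℕ c} slab (env-frame F'.program refl fr e₂)
          (trans (cong (nats ρ 11) (trans (frameN fr 33 refl 0) ac)) (slabAt (slabs-frame F'.program refl fr sl₂) c)) a b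

        value' : ∀ {ts e} → (ts , e) ∈ˡ sepClauses → ∀ (s t : V) ρ → At 30 s ρ → At 31 t ρ → Frame F'.program σ ρ →
                 Holds ts ρ → S₁₂ 0 s t (evalʳ ρ e)
        value' (here refl) s t ρ a b fr (h₁ ∷ h₂ ∷ h₃ ∷ []) i =
          let ac' = trans (frameN fr 33 refl 0) ac
          in h₃ (subst (λ j → 1 ≤ nats ρ 7 j) (sym (slab-index ρ a b fr)) (conn⁺ (connected-frame F'.program refl fr c₂)
               (conn i c (λ q → h₁ (same⁺ ρ a ac' (sym q))) (λ q → h₂ (same⁺ ρ b ac' (sym q))))))

        result = F'.fill-correct e₂ refl refl refl refl (λ _ _ → refl) value' (Grown.sound gr)

        hit : ∀ s t → s ≢ c → t ≢ c → ¬ (1 ≤ nats σ₁ 7 (ix (toℕ c) s t)) → AtMost (exec rest σ) (ix 0 s t) 0#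
        hit s t sc tc nc = proj₂ (proj₂ result) (here refl) s t 0# λ ρ a b fr →
          let ac' = trans (frameN fr 33 refl 0) ac in
          ((λ h → sc (same⁻ ρ a ac' h)) ∷ (λ h → tc (same⁻ ρ b ac' h)) ∷
           (λ h → nc (subst (1 ≤_) (trans (frameN fr 7 refl _) (frameN (Grown.framed gr) 7 refl _))
              (subst (λ j → 1 ≤ nats ρ 7 j) (slab-index ρ a b fr) h))) ∷ []) , ≤ᵣ-refl

      result₁ = for-vertices {33} {rest} {n} (Tab S₁₂) σ₁ (size e₁) refl refl (proj₁ (proj₂ result₀))
                  (λ c σ a gr → let r = Round.result c σ a gr in proj₁ r , proj₁ (proj₂ r))

      sep-hit : ∀ c s t → s ≢ c → t ≢ c → ¬ (1 ≤ nats σ₁ 7 (ix (toℕ c) s t)) → AtMost (exec loop₁ σ₁) (ix 0 s t) 0#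
      sep-hit c s t sc tc nc = proj₂ result₁ c (ix 0 s t) 0# λ σ a gr → Round.hit c σ a gr s t sc tc nc

      inseparable : ∀ {u v : V} → ¬ (1 ≤ nats (exec loop₁ σ₁) 12 (ix 0 u v)) → Insep u v
      inseparable {u} {v} h = insep (reach (weak-hit u v) , reach (weak-hit' u v)) go
        where
        keep : ∀ {s t} → Ent 12 12 0 σ₁ s t 0# → Ent 12 12 0 (exec loop₁ σ₁) s t 0#
        keep = preserve (proj₁ (proj₁ result₁)) _ _
        reach : ∀ {s t} → (¬ (1 ≤ nats σ₀ 6 (ix 0 s t)) → Ent 12 12 0 σ₁ u v 0#) → s ⟶* t
        reach {s} {t} f with 1 ≤? nats σ₀ 6 (ix 0 s t)
        ... | yes q = reach⁻ r₀ q
        ... | no nq = ⊥-elim (h (AtMost.finite (keep {u} {v} (f nq))))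
        go : ∀ c → c ≢ u → c ≢ v → Conn c u v
        go c cu cv with 1 ≤? nats σ₁ 7 (ix (toℕ c) u v)
        ... | yes q = conn⁻ c₁ q
        ... | no nq = ⊥-elim (h (AtMost.finite (sep-hit c u v (λ e → cu (sym e)) (λ e → cv (sym e)) nq)))

    separation-correct : Separated (exec separation σ₀)
    separation-correct = separated (λ {u} {v} q → Table.entry (proj₂ (proj₁ result₁)) (ix 0 u v) q 0 u v refl) inseparable

-- The negative forest

module Kruskal {ℝ : Reals} {n : ℕ} (G : MixedGraph ℝ n) where
  open Real ℝ
  open MixedGraph G
  open Walks G
  open Forests G

  AllIn : (V → V → Set) → ∀ {s t} → s ⟶* t → Set
  AllIn P ε = ⊤
  AllIn P (_◅_ {u} {v} e p) = (negStep e ≡ (u , v) ∷ [] × P u v) × AllIn P p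

  -- `P` consists of the negative edges treated so far, and the other fields make them a forest with
  -- labels and path weights.
  record Partial (P : V → V → Set) (lab : V → ℕ) (W : V → V → Carrier) : Set where
    field
      P-neg  : ∀ {u v} → P u v → NegAdj u v
      P-sym  : ∀ {u v} → P u v → P v u
      W-sym  : ∀ {u v} → lab u ≡ lab v → W u v ≡ W v u
      tree   : ∀ {u v} → lab u ≡ lab v → Σ (u ⟶* v) λ p → Path p × AllIn P p × wt p ≡ W u v
      P-lab  : ∀ {u v} → P u v → lab u ≡ lab v
      cut    : ∀ {a b} → P a b → Σ (V → Bool) λ σ → σ a ≢ σ b × (∀ {c d} → P c d → ¬ (a , b) ~ᵉ (c , d) → σ c ≡ σ d)

  allIn-map : ∀ {P P' : V → V → Set} → (∀ {u v} → P u v → P' u v) → ∀ {s t} (p : s ⟶* t) → AllIn P p → AllIn P' p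
  allIn-map f ε       h             = tt
  allIn-map f (e ◅ p) ((a , b) , h) = (a , f b) , allIn-map f p h

  allIn-++ : ∀ {P : V → V → Set} {s t u} (p : s ⟶* t) (q : t ⟶* u) → AllIn P p → AllIn P q → AllIn P (p ◅◅ q)
  allIn-++ ε       q h       g = g
  allIn-++ (e ◅ p) q (a , h) g = a , allIn-++ p q h g

  allIn-neg : ∀ {P : V → V → Set} {s t} (p : s ⟶* t) → AllIn P p → AllNeg p
  allIn-neg ε       h             = tt
  allIn-neg (e ◅ p) ((a , _) , h) = a , allIn-neg p h

  allIn-negs : ∀ {P : V → V → Set} {s t u v} (p : s ⟶* t) → AllIn P p → (u , v) ∈ˡ negs p → P u v
  allIn-negs (e ◅ p) ((a , b) , h) m with ∈-++⁻ (negStep e) m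
  ... | inj₂ k = allIn-negs p h k
  ... | inj₁ k with subst (_ ∈ˡ_) a k
  ...   | here refl = b

  partial-map : ∀ {P P' lab W} → (∀ {u v} → P u v → P' u v) → (∀ {u v} → P' u v → P u v) → Partial P lab W → Partial P' lab W
  partial-map to from A = record
    { P-neg = λ h → P-neg (from h) ; P-sym = λ h → to (P-sym (from h)) ; W-sym = W-sym
    ; tree = λ e → let (p , a , b , c) = tree e in p , a , allIn-map to p b , c
    ; P-lab = λ h → P-lab (from h)
    ; cut = λ h → let (σ , a , b) = cut (from h) in σ , a , λ g ne → b (from g) ne }
    where open Partial A

  partial-start : Partial (λ _ _ → ⊥) toℕ (λ _ _ → 0#)
  partial-start = record
    { P-neg = ⊥-elim ; P-sym = id ; W-sym = λ _ → refl
    ; tree = λ e → case toℕ-injective e of λ { refl → ε , [] ∷ [] , tt , refl }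
    ; P-lab = ⊥-elim ; cut = ⊥-elim }

  neg-edge-step : ∀ {a b} → ((w , eq , _) : NegAdj a b) → Σ (Step G a b) λ e → negStep e ≡ (a , b) ∷ [] × stepWeight G e ≡ w
  neg-edge-step {a} {b} (w , eq , w<0) = e , lem , refl
    where
    e : Step G a b
    e = along-edge w eq
    lem : negStep e ≡ (a , b) ∷ []
    lem with 0# ≤ᵣ? w
    ... | yes h = ⊥-elim (<ᵣ⇒≱ w<0 h)
    ... | no _  = refl

  walk-lab : ∀ {P lab W} → Partial P lab W → ∀ {s t x} (p : s ⟶* t) → AllIn P p → x ∈ˡ vs p → lab x ≡ lab s
  walk-lab A ε       h             (here refl) = refl
  walk-lab A (e ◅ p) h             (here refl) = refl
  walk-lab A (e ◅ p) ((_ , g) , h) (there m)   = trans (walk-lab A p h m) (sym (Partial.P-lab A g))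

  -- The tree path from `b` to `a` does not contain the untreated edge `ab`, so together they use
  -- each negative edge at most once. Conservative weights would make the sum nonnegative, yet the
  -- edge is negative and the path weighs at most 0.
  closes : ∀ {P lab W} → Partial P lab W → ∀ {a b} → NegAdj a b → lab a ≡ lab b → ¬ P a b → ¬ Conservative G
  closes {P} A {a} {b} adj@(w , eq , (w≤0 , w≢0)) le np cons = w≢0 (≤ᵣ-antisym w≤0 (≤ᵣ-trans sum≥0 (≤ᵣ-trans
      (+ᵣ-monoʳ-≤ w (neg-weight p (proj₁ (proj₂ (proj₂ tr))))) (≤ᵣ-reflexive (+ᵣ-identityʳ w)))))
    where
    open Partial A
    tr = tree (sym le)
    p = proj₁ tr
    st = neg-edge-step adj
    e = proj₁ st
    neg-weight : ∀ {s t} (p : s ⟶* t) → AllIn P p → wt p ≤ᵣ 0#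
    neg-weight ε _ = ≤ᵣ-refl
    neg-weight (e ◅ p) ((h , _) , hs) = ≤ᵣ-trans (+ᵣ-mono-≤ (step≤ e h) (neg-weight p hs)) (≤ᵣ-reflexive (+ᵣ-identityˡ _))
      where step≤ : ∀ {u v} (e : Step G u v) → negStep e ≡ (u , v) ∷ [] → stepWeight G e ≤ᵣ 0#
            step≤ e h with negStep e | negView e
            step≤ _ refl | _ | is-neg _ (le , _) = le
    sum≥0 : 0# ≤ᵣ w +ᵣ wt p
    sum≥0 = subst (λ z → 0# ≤ᵣ z +ᵣ wt p) (proj₂ (proj₂ st))
      (closed-nonneg cons e p (proj₁ (proj₂ tr)) (All′.tabulate λ { m refl → end∉inits p (proj₁ (proj₂ tr)) m })
        (subst (λ l → Distinct (l ++ negs p)) (sym (proj₁ (proj₂ st)))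
          (All′.tabulate (λ { m (inj₁ (refl , refl)) → np (allIn-negs p (proj₁ (proj₂ (proj₂ tr))) m)
                            ; m (inj₂ (refl , refl)) → np (P-sym (allIn-negs p (proj₁ (proj₂ (proj₂ tr))) m)) })
           ∷ path-negSimple p (proj₁ (proj₂ tr)))))

  module Merge {P lab W} (A : Partial P lab W) {a b : V} (adj : NegAdj a b) (l≢ : lab a ≢ lab b)
               {lab' : V → ℕ} {W' : V → V → Carrier} {P' : V → V → Set}
               (lab'-b : ∀ {x} → lab x ≡ lab b → lab' x ≡ lab a) (lab'-else : ∀ {x} → lab x ≢ lab b → lab' x ≡ lab x)
               (W'-cross : ∀ {x y} → lab x ≡ lab a → lab y ≡ lab b →
                  W' x y ≡ W x a +ᵣ (proj₁ adj +ᵣ W b y) × W' y x ≡ W x a +ᵣ (proj₁ adj +ᵣ W b y))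
               (W'-else : ∀ {x y} → lab x ≡ lab y → W' x y ≡ W x y)
               (P⇒P' : ∀ {u v} → P u v → P' u v) (ab' : P' a b) (P'-sym : ∀ {u v} → P' u v → P' v u)
               (P'⇒P : ∀ {u v} → P' u v → P u v ⊎ (a , b) ~ᵉ (u , v)) where
    open Partial A
    private
      data Kind (x y : V) : Set where
        within : lab x ≡ lab y → Kind x y
        ab     : lab x ≡ lab a → lab y ≡ lab b → Kind x y
        ba     : lab x ≡ lab b → lab y ≡ lab a → Kind x y

      kind : ∀ {x y} → lab' x ≡ lab' y → Kind x y
      kind {x} {y} e with lab x ≟ lab b | lab y ≟ lab b
      ... | yes p | yes q = within (trans p (sym q))
      ... | yes p | no q  = ba p (trans (sym (lab'-else q)) (trans (sym e) (lab'-b p)))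
      ... | no p  | yes q = ab (trans (sym (lab'-else p)) (trans e (lab'-b q))) q
      ... | no p  | no q  = within (trans (sym (lab'-else p)) (trans e (lab'-else q)))

      join : ∀ {x y c d w} (e : Step G c d) → stepWeight G e ≡ w → negStep e ≡ (c , d) ∷ [] → P' c d →
             lab x ≡ lab c → lab y ≡ lab d → lab c ≢ lab d →
             Σ (x ⟶* y) λ p → Path p × AllIn P' p × wt p ≡ W x c +ᵣ (w +ᵣ W d y)
      join {x} {y} {c} {d} e ew en pcd xc yd c≢d =
        let (p , hp , ip , wp) = tree xc ; (q , hq , iq , wq) = tree (sym yd)
            labp = λ {z} (m : z ∈ˡ vs p) → trans (walk-lab A p ip m) xc
            labq = λ {z} (m : z ∈ˡ vs q) → walk-lab A q iq m
        in p ◅◅ (e ◅ q) ,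
           path-join p (e ◅ q) hp (All′.tabulate (λ m r → c≢d (trans (cong lab r) (labq m))) ∷ hq)
             (λ { m (here refl) → end∉inits p hp m
                ; m (there k) → c≢d (trans (sym (labp (inits⊆vs p m))) (labq k)) }) ,
           allIn-++ p (e ◅ q) (allIn-map P⇒P' p ip) ((en , pcd) , allIn-map P⇒P' q iq) ,
           trans (wt-++ p (e ◅ q)) (cong₂ _+ᵣ_ wp (cong₂ _+ᵣ_ ew wq))

    merged : Partial P' lab' W'
    merged = record
      { P-neg = neg ; P-sym = P'-sym ; W-sym = λ e → symW (kind e) ; tree = λ e → tree' (kind e) ; P-lab = lab-edge ; cut = cut' }
      where
      neg : ∀ {u v} → P' u v → NegAdj u v
      neg h with P'⇒P h
      ... | inj₁ g = P-neg g
      ... | inj₂ (inj₁ (refl , refl)) = adj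
      ... | inj₂ (inj₂ (refl , refl)) = reversed adj
      symW : ∀ {x y} → Kind x y → W' x y ≡ W' y x
      symW (within e) = trans (W'-else e) (trans (W-sym e) (sym (W'-else (sym e))))
      symW (ab p q) = trans (proj₁ (W'-cross p q)) (sym (proj₂ (W'-cross p q)))
      symW (ba p q) = trans (proj₂ (W'-cross q p)) (sym (proj₁ (W'-cross q p)))
      tree' : ∀ {x y} → Kind x y → Σ (x ⟶* y) λ p → Path p × AllIn P' p × wt p ≡ W' x y
      tree' (within e) = let (p , a , b , c) = tree e in p , a , allIn-map P⇒P' p b , trans c (sym (W'-else e))
      tree' (ab p q) =
        let (e , en , ew) = neg-edge-step adj ; (r , x , y , z) = join e ew en ab' p q l≢
        in r , x , y , trans z (sym (proj₁ (W'-cross p q)))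
      tree' {x} {y} (ba p q) =
        let (e , en , ew) = neg-edge-step (reversed adj)
            (r , h , i , z) = join e ew en (P'-sym ab') p q (λ s → l≢ (sym s))
        in r , h , i , trans z (trans (cong₂ (λ s t → s +ᵣ (proj₁ adj +ᵣ t)) (W-sym p) (W-sym (sym q)))
             (trans (reassoc (W b x) (proj₁ adj) (W y a)) (sym (proj₂ (W'-cross q p)))))
        where reassoc : ∀ s t u → s +ᵣ (t +ᵣ u) ≡ u +ᵣ (t +ᵣ s)
              reassoc s t u = trans (sym (+ᵣ-assoc s t u)) (trans (+ᵣ-comm _ u) (cong (u +ᵣ_) (+ᵣ-comm s t)))
      lab-a : lab' a ≡ lab a
      lab-a = lab'-else l≢
      lab-edge : ∀ {u v} → P' u v → lab' u ≡ lab' v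
      lab-edge {u} {v} h with P'⇒P h
      ... | inj₂ (inj₁ (refl , refl)) = trans lab-a (sym (lab'-b refl))
      ... | inj₂ (inj₂ (refl , refl)) = trans (lab'-b refl) (sym lab-a)
      ... | inj₁ g with lab u ≟ lab b
      ...   | yes p = trans (lab'-b p) (sym (lab'-b (trans (sym (P-lab g)) p)))
      ...   | no p  = trans (lab'-else p) (trans (P-lab g) (sym (lab'-else (λ q → p (trans (P-lab g) q)))))
      side : V → Bool
      side x = does (lab x ≟ lab b)
      side-P : ∀ {u v} → P u v → side u ≡ side v
      side-P g = cong (λ z → does (z ≟ lab b)) (P-lab g)
      side-a : side a ≡ false
      side-a = dec-false (lab a ≟ lab b) l≢
      side-b : side b ≡ true
      side-b = dec-true (lab b ≟ lab b) refl
      cut' : ∀ {c d} → P' c d → Σ (V → Bool) λ σ → σ c ≢ σ d × (∀ {u v} → P' u v → ¬ (c , d) ~ᵉ (u , v) → σ u ≡ σ v)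
      cut' {c} {d} h with P'⇒P h
      ... | inj₂ s = side , apart s , λ g ne → other (P'⇒P g) s ne
        where
        apart : (a , b) ~ᵉ (c , d) → side c ≢ side d
        apart (inj₁ (refl , refl)) e = case trans (sym side-a) (trans e side-b) of λ ()
        apart (inj₂ (refl , refl)) e = case trans (sym side-a) (trans (sym e) side-b) of λ ()
        other : ∀ {u v} → P u v ⊎ (a , b) ~ᵉ (u , v) → (a , b) ~ᵉ (c , d) → ¬ (c , d) ~ᵉ (u , v) → side u ≡ side v
        other (inj₁ g) _ _ = side-P g
        other (inj₂ (inj₁ (refl , refl))) (inj₁ (refl , refl)) ne = ⊥-elim (ne (inj₁ (refl , refl)))
        other (inj₂ (inj₁ (refl , refl))) (inj₂ (refl , refl)) ne = ⊥-elim (ne (inj₂ (refl , refl)))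
        other (inj₂ (inj₂ (refl , refl))) (inj₁ (refl , refl)) ne = ⊥-elim (ne (inj₂ (refl , refl)))
        other (inj₂ (inj₂ (refl , refl))) (inj₂ (refl , refl)) ne = ⊥-elim (ne (inj₁ (refl , refl)))
      ... | inj₁ g with cut g
      -- The cut of an older edge has to be constant along the new edge `ab`. If it separates `a`
      -- from `b`, it is complemented on the tree of `b`; older edges do not leave a tree, so
      -- nothing changes along them.
      ...   | σ , σc≢σd , const with σ a xor σ b in ab≡
      ...     | false = σ , σc≢σd , λ h ne → keep (P'⇒P h) ne
        where
        xor-false : ∀ x y → x xor y ≡ false → x ≡ y
        xor-false false false _ = refl
        xor-false true true _ = refl
        keep : ∀ {u v} → P u v ⊎ (a , b) ~ᵉ (u , v) → ¬ (c , d) ~ᵉ (u , v) → σ u ≡ σ v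
        keep (inj₁ g') ne = const g' ne
        keep (inj₂ (inj₁ (refl , refl))) ne = xor-false _ _ ab≡
        keep (inj₂ (inj₂ (refl , refl))) ne = sym (xor-false _ _ ab≡)
      ...     | true = (λ x → side x xor σ x) ,
                  (λ e → σc≢σd (xor-cancel (side c) (trans e (cong (_xor σ d) (sym (side-P g)))))) ,
                  λ h ne → keep (P'⇒P h) ne
        where
        xor-cancel : ∀ x {y z} → x xor y ≡ x xor z → y ≡ z
        xor-cancel false e = e
        xor-cancel true {false} {false} _ = refl
        xor-cancel true {true}  {true}  _ = refl
        flip : side a xor σ a ≡ side b xor σ b
        flip = trans (cong (_xor σ a) side-a) (trans (xor-true (σ a) (σ b) ab≡) (sym (cong (_xor σ b) side-b)))
          where xor-true : ∀ x y → x xor y ≡ true → false xor x ≡ true xor y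
                xor-true true  false _ = refl
                xor-true false true  _ = refl
        keep : ∀ {u v} → P u v ⊎ (a , b) ~ᵉ (u , v) → ¬ (c , d) ~ᵉ (u , v) → side u xor σ u ≡ side v xor σ v
        keep (inj₁ g') ne = cong₂ _xor_ (side-P g') (const g' ne)
        keep (inj₂ (inj₁ (refl , refl))) ne = flip
        keep (inj₂ (inj₂ (refl , refl))) ne = sym flip

  toForest : ∀ {P lab W} → Partial P lab W → (∀ {u v} → NegAdj u v → P u v) → Forest
  toForest {lab = lab} {W} A all = record
    { lab = lab ; W = W ; W-sym = W-sym
    ; tree = λ e → let (p , a , b , c) = tree e in p , a , allIn-neg p b , c
    ; negLab = λ h → P-lab (all h)
    ; cut = λ h → let (σ , a , b) = cut (all h) in σ , a , λ g ne → b (all g) ne }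
    where open Partial A

initialLabels : Command
initialLabels = for 30 vertices (setN 13 (# 30) (# 30))

pathSum : RealExp
pathSum = (22 [ at₀ 30 33 ]ʳ) ⊕ʳ ((0 [ at₀ 33 34 ]ʳ) ⊕ʳ (22 [ at₀ 34 31 ]ʳ))

crossTests : List Test
crossTests = sameᵗ (13 [ # 30 ]) (# 26) ∷ sameᵗ (13 [ # 31 ]) (# 27) ∷ []

setBoth : Command
setBoth = setR 22 (at₀ 30 31) pathSum ⨟ setR 22 (at₀ 31 30) (22 [ at₀ 30 31 ]ʳ)

crossings : Command
crossings = for2 30 31 (whenAll crossTests setBoth)

relabel : Command
relabel = for 30 vertices (whenAll (sameᵗ (13 [ # 30 ]) (# 27) ∷ []) (setN 13 (# 30) (# 26)))

-- The two labels are saved because `relabel` overwrites the label of the second tree. The weights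
-- of the new paths come first, while the labels still tell the trees apart.
mergeTrees : Command
mergeTrees = setN 26 (lit 0) (13 [ # 33 ]) ⨟ setN 27 (lit 0) (13 [ # 34 ]) ⨟ crossings ⨟ relabel

negativeTests : List Test
negativeTests = present 1 (at₀ 33 34) ∷ notᵗ (zeroʳ ≤ʳ (0 [ at₀ 33 34 ]ʳ)) ∷ ((# 33 ⊕ lit 1) ≤ⁿ # 34) ∷ []

closingTest : Test
closingTest = sameᵗ (13 [ # 33 ]) (13 [ # 34 ])

treatEdge : Command
treatEdge = whenAll negativeTests (cond closingTest (setN 21 (lit 0) (lit 1)) mergeTrees)

kruskal : Command
kruskal = initialLabels ⨟ for2 33 34 treatEdge

module ForAll {ℝ : Reals} {n : ℕ} where
  open State

  -- A property won in one round might be destroyed by a later one, so every round must also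
  -- preserve what was won before.
  for-all : ∀ {i p} (σ₀ : State ℝ) → nats σ₀ 0 0 ≡ n → wellFormed (for i vertices p) ≡ true →
    (Q : State ℝ → Set) (P : Fin n → State ℝ → Set) →
    (∀ k {σ} → Q σ → Q (setCounter i k σ)) → (∀ s k {σ} → P s σ → P s (setCounter i k σ)) → Q σ₀ →
    (∀ s σ → nats σ i 0 ≡ toℕ s → Frame (for i vertices p) σ₀ σ → Q σ →
       Q (exec p σ) × P s (exec p σ) × (∀ s' → P s' σ → P s' (exec p σ))) →
    Q (exec (for i vertices p) σ₀) × (∀ s → P s (exec (for i vertices p) σ₀))
  for-all {i} {p} σ₀ en wf Q P cQ cP q₀ step =
    let (q , h) = for-rule {i = i} {vertices} {p} σ₀ n en wf
                    (λ k σ → Q σ × (∀ (s : Fin n) → toℕ s < k → P s σ)) (cQ 0 q₀ , λ _ ()) keep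
    in q , λ s → h s (toℕ<n s)
    where
    keep : ∀ k σ → k < n → nats σ i 0 ≡ k → Frame (for i vertices p) σ₀ σ → Q σ × (∀ s → toℕ s < k → P s σ) →
           Q (increment i (exec p σ)) × (∀ s → toℕ s < suc k → P s (increment i (exec p σ)))
    keep k σ k<n c fr (q , h) with step (fromℕ< k<n) σ (trans c (sym (toℕ-fromℕ< k<n))) fr q
    ... | q' , new , old = cQ _ q' , done
      where
      done : ∀ s → toℕ s < suc k → P s (increment i (exec p σ))
      done s (s≤s le) with ℕₚ.m≤n⇒m<n∨m≡n le
      ... | inj₁ lt = cP s _ (old s (h s lt))
      ... | inj₂ e  = cP s _ (subst (λ z → P z (exec p σ)) (sym (toℕ-injective (trans e (sym (toℕ-fromℕ< k<n))))) new)

  for-all2 : ∀ {i j p} (σ₀ : State ℝ) → nats σ₀ 0 0 ≡ n → wellFormed (for2 i j p) ≡ true →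
    (Q : State ℝ → Set) (P : Fin n → Fin n → State ℝ → Set) →
    (∀ k {σ} → Q σ → Q (setCounter i k σ)) → (∀ s t k {σ} → P s t σ → P s t (setCounter i k σ)) →
    (∀ k {σ} → Q σ → Q (setCounter j k σ)) → (∀ s t k {σ} → P s t σ → P s t (setCounter j k σ)) → Q σ₀ →
    (∀ s t σ → nats σ i 0 ≡ toℕ s → nats σ j 0 ≡ toℕ t → Frame (for2 i j p) σ₀ σ → Q σ →
       Q (exec p σ) × P s t (exec p σ) × (∀ s' t' → P s' t' σ → P s' t' (exec p σ))) →
    Q (exec (for2 i j p) σ₀) × (∀ s t → P s t (exec (for2 i j p) σ₀))
  for-all2 {i} {j} {p} σ₀ en wf Q P iQ iP jQ jP q₀ step =
    for-all {i} {for j vertices p} σ₀ en wf Q (λ s σ → ∀ t → P s t σ) iQ (λ s k h t → iP s t k (h t)) q₀ outer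
    where
    inner = for j vertices p
    wi : writesN i inner ≡ false
    wi = not-true (∧-trueʳ {not (i ≡ᵇ 0)} (∧-trueˡ wf))
    w0 : writesN 0 inner ≡ false
    w0 = not-true (∧-trueˡ (∧-trueʳ {not (i ≡ᵇ 0) ∧ not (writesN i inner)} wf))
    wp : wellFormed inner ≡ true
    wp = ∧-trueʳ {not (writesN 0 inner)} (∧-trueʳ {not (i ≡ᵇ 0) ∧ not (writesN i inner)} wf)
    w0' : writesN 0 (for2 i j p) ≡ false
    w0' rewrite not-true (∧-trueˡ {not (i ≡ᵇ 0)} (∧-trueˡ wf)) = w0
    outer : ∀ s σ → nats σ i 0 ≡ toℕ s → Frame (for2 i j p) σ₀ σ → Q σ →
      Q (exec inner σ) × (∀ t → P s t (exec inner σ)) × (∀ s' → (∀ t → P s' t σ) → ∀ t → P s' t (exec inner σ))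
    outer s σ c fr q =
      let (q' , new) = for-all {j} {p} σ (trans (frameN fr 0 w0' 0) en) wp
            (λ ρ → Q ρ × (∀ s' t' → P s' t' σ → P s' t' ρ)) (P s)
            (λ k (a , b) → jQ k a , λ s' t' h → jP s' t' k (b s' t' h)) (λ t k h → jP s t k h) (q , λ _ _ h → h)
            (λ t ρ c' fr' (q , keep) →
              let (a , b , d) = step s t ρ (trans (frameN fr' i wi 0) c) c' (frame-trans fr (frame-body fr')) q
              in (a , λ s' t' h → d s' t' (keep s' t' h)) , b , (λ t' h → d s t' h))
      in proj₁ q' , new , λ s' h t → proj₂ q' s' t (h t)

module KruskalProgram {ℝ : Reals} {n : ℕ} (G : MixedGraph ℝ n) where
  open Real ℝ
  open MixedGraph G
  open Walks G
  open Relax {ℝ}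
  open State
  open Stages G
  open Static G
  open Kruskal G
  open ForAll {ℝ} {n}

  labelOf : State ℝ → V → ℕ
  labelOf σ x = nats σ 13 (toℕ x)

  treeWeight : State ℝ → V → V → Carrier
  treeWeight σ x y = reals σ 22 (ix 0 x y)

  initialLabels-correct : ∀ σ → Env σ → ∀ x → labelOf (exec initialLabels σ) x ≡ toℕ x
  initialLabels-correct σ e = proj₂ (for-all {30} {setN 13 (# 30) (# 30)} σ (size e) refl (λ _ → ⊤) (λ x ρ → labelOf ρ x ≡ toℕ x)
    (λ _ _ → tt) (λ _ _ h → h) tt
    λ x ρ c fr _ → tt , trans (cong (λ i → update (nats ρ) 13 i i 13 (toℕ x)) c) (update-same (nats ρ) 13 (toℕ x) (toℕ x)) ,
      λ y h → [ (λ (q , u) → trans u q) , (λ u → trans u h) ]′ (update-case (nats ρ) 13 (nats ρ 30 0) (nats ρ 30 0) (toℕ y)))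

  relabel-correct : ∀ σ → Env σ → ∀ x →
    (labelOf σ x ≡ nats σ 27 0 → labelOf (exec relabel σ) x ≡ nats σ 26 0) ×
    (labelOf σ x ≢ nats σ 27 0 → labelOf (exec relabel σ) x ≡ labelOf σ x)
  relabel-correct σ e = proj₂ (for-all {30} {body} σ (size e) refl Q P (λ _ h → h) (λ _ _ h → h) (λ x → inj₁ refl) step)
    where
    body = whenAll (sameᵗ (13 [ # 30 ]) (# 27) ∷ []) (setN 13 (# 30) (# 26))
    Q : State ℝ → Set
    Q ρ = ∀ x → labelOf ρ x ≡ labelOf σ x ⊎ (labelOf σ x ≡ nats σ 27 0 × labelOf ρ x ≡ nats σ 26 0)
    P : V → State ℝ → Set
    P x ρ = (labelOf σ x ≡ nats σ 27 0 → labelOf ρ x ≡ nats σ 26 0) × (labelOf σ x ≢ nats σ 27 0 → labelOf ρ x ≡ labelOf σ x)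
    step : ∀ s ρ → nats ρ 30 0 ≡ toℕ s → Frame relabel σ ρ → Q ρ → Q (exec body ρ) × P s (exec body ρ) × (∀ s' → P s' ρ → P s' (exec body ρ))
    step s ρ c fr q = whenAll-rule (sameᵗ (13 [ # 30 ]) (# 27) ∷ []) (setN 13 (# 30) (# 26))
      (λ τ → Q τ × P s τ × (∀ s' → P s' ρ → P s' τ)) ρ hit miss
      where
      e27 = frameN fr 27 refl 0
      e26 = frameN fr 26 refl 0
      new : ∀ x → labelOf (exec (setN 13 (# 30) (# 26)) ρ) x ≡ labelOf ρ x ⊎
                  (x ≡ s × labelOf (exec (setN 13 (# 30) (# 26)) ρ) x ≡ nats σ 26 0)
      new x with update-case (nats ρ) 13 (nats ρ 30 0) (nats ρ 26 0) (toℕ x)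
      ... | inj₁ (p , u) = inj₂ (toℕ-injective (trans (sym p) c) , trans u e26)
      ... | inj₂ u = inj₁ u
      hit : Holds (sameᵗ (13 [ # 30 ]) (# 27) ∷ []) ρ →
            Q (exec (setN 13 (# 30) (# 26)) ρ) × P s (exec (setN 13 (# 30) (# 26)) ρ) × (∀ s' → P s' ρ → P s' (exec (setN 13 (# 30) (# 26)) ρ))
      hit (h ∷ []) = Q' , (P' , λ ne → ⊥-elim (ne old)) , keep
        where
        here-lab : labelOf ρ s ≡ nats σ 27 0
        here-lab = trans (sym (cong (nats ρ 13) c)) (trans (sameᵗ-sound (13 [ # 30 ]) (# 27) ρ h) e27)
        old : labelOf σ s ≡ nats σ 27 0
        old = [ (λ k → trans (sym k) here-lab) , proj₁ ]′ (q s)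
        P' : labelOf σ s ≡ nats σ 27 0 → labelOf (exec (setN 13 (# 30) (# 26)) ρ) s ≡ nats σ 26 0
        P' _ = trans (cong (λ i → update (nats ρ) 13 i (nats ρ 26 0) 13 (toℕ s)) c) (trans (update-same (nats ρ) 13 (toℕ s) _) e26)
        Q' : Q (exec (setN 13 (# 30) (# 26)) ρ)
        Q' x with new x
        ... | inj₂ (refl , u) = inj₂ (old , u)
        ... | inj₁ u = [ (λ k → inj₁ (trans u k)) , (λ (k , l) → inj₂ (k , trans u l)) ]′ (q x)
        keep : ∀ s' → P s' ρ → P s' (exec (setN 13 (# 30) (# 26)) ρ)
        keep s' (f , g) with new s'
        ... | inj₂ (refl , u) = P' , λ ne → ⊥-elim (ne old)
        ... | inj₁ u = (λ k → trans u (f k)) , (λ k → trans u (g k))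
      miss : ¬ Holds (sameᵗ (13 [ # 30 ]) (# 27) ∷ []) ρ → Q ρ × P s ρ × (∀ s' → P s' ρ → P s' ρ)
      miss nh = q , ((λ k → [ (λ l → ⊥-elim (nh (sameᵗ-complete (13 [ # 30 ]) (# 27) ρ
                  (trans (cong (nats ρ 13) c) (trans l (trans k (sym e27)))) ∷ []))) , proj₂ ]′ (q s)) ,
                  (λ ne → [ id , (λ (k , _) → ⊥-elim (ne k)) ]′ (q s))) , λ _ h → h

  module _ (σ : State ℝ) (e : Env σ) {a b : V} (aa : At 33 a σ) (ab : At 34 b σ)
           (ea : nats σ 26 0 ≡ labelOf σ a) (eb : nats σ 27 0 ≡ labelOf σ b) (l≢ : labelOf σ a ≢ labelOf σ b) where
    private
      lab = labelOf σ
      W = treeWeight σ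

      val : V → V → Carrier
      val x y = W x a +ᵣ (reals σ 0 (ix 0 a b) +ᵣ W b y)

      Q : State ℝ → Set
      Q ρ = ∀ x y → lab x ≡ lab y → treeWeight ρ x y ≡ W x y

      P : V → V → State ℝ → Set
      P x y ρ = lab x ≡ lab a → lab y ≡ lab b → treeWeight ρ x y ≡ val x y × treeWeight ρ y x ≡ val x y

      module _ (x y : V) (ρ : State ℝ) (cx : At 30 x ρ) (cy : At 31 y ρ) (fr : Frame crossings σ ρ) (q : Q ρ) where
        eρ = env-frame crossings refl fr e
        caa : At 33 a ρ
        caa = trans (frameN fr 33 refl 0) aa
        cab : At 34 b ρ
        cab = trans (frameN fr 34 refl 0) ab
        ρ₁ = exec (setR 22 (at₀ 30 31) pathSum) ρ
        ρ₂ = exec setBoth ρ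

        sum-eval : lab x ≡ lab a → lab y ≡ lab b → evalʳ ρ pathSum ≡ val x y
        sum-eval p r = cong₂ _+ᵣ_ (trans (cong (reals ρ 22) (at-eval₀ eρ cx caa)) (q x a p))
          (cong₂ _+ᵣ_ (trans (cong (reals ρ 0) (at-eval₀ eρ caa cab)) (frameR fr 0 refl _))
            (trans (cong (reals ρ 22) (at-eval₀ eρ cab cy)) (q b y (sym r))))

        ixy : evalⁿ ρ (at₀ 30 31) ≡ ix 0 x y
        ixy = at-eval₀ eρ cx cy
        iyx : evalⁿ ρ₁ (at₀ 31 30) ≡ ix 0 y x
        iyx = trans (evalⁿ-reals {nats ρ} {reals ρ₁} {reals ρ} (at₀ 31 30)) (at-eval₀ eρ cy cx)
        ixy₁ : evalⁿ ρ₁ (at₀ 30 31) ≡ ix 0 x y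
        ixy₁ = trans (evalⁿ-reals {nats ρ} {reals ρ₁} {reals ρ} (at₀ 30 31)) ixy

        ix≢ : ∀ {x y x' y' : V} → ¬ (x ≡ x' × y ≡ y') → ix 0 x y ≢ ix 0 x' y'
        ix≢ ne q = ne (proj₂ (ix-injective {m = 0} {m' = 0} q))

        first-at : lab x ≡ lab a → lab y ≡ lab b → treeWeight ρ₁ x y ≡ val x y
        first-at p r = trans (cong (λ i → update (reals ρ) 22 i (evalʳ ρ pathSum) 22 (ix 0 x y)) ixy)
          (trans (update-same (reals ρ) 22 (ix 0 x y) _) (sum-eval p r))

        second-at : lab x ≡ lab a → lab y ≡ lab b → treeWeight ρ₂ y x ≡ val x y
        second-at p r = trans (cong (λ i → update (reals ρ₁) 22 i (evalʳ ρ₁ (22 [ at₀ 30 31 ]ʳ)) 22 (ix 0 y x)) iyx)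
          (trans (update-same (reals ρ₁) 22 (ix 0 y x) _) (trans (cong (reals ρ₁ 22) ixy₁) (first-at p r)))

        other : ∀ {x' y'} → ¬ (x ≡ x' × y ≡ y') → ¬ (y ≡ x' × x ≡ y') → treeWeight ρ₂ x' y' ≡ treeWeight ρ x' y'
        other {x'} {y'} ne ne' = trans (update-cell (reals ρ₁) 22 _ _ _ (λ q → ix≢ {y} {x} {x'} {y'} ne' (trans (sym iyx) q)))
                             (update-cell (reals ρ) 22 _ _ _ (λ q → ix≢ {x} {y} {x'} {y'} ne (trans (sym ixy) q)))

        x≢y : lab x ≡ lab a → lab y ≡ lab b → x ≢ y
        x≢y p r refl = l≢ (trans (sym p) r)

        both : lab x ≡ lab a → lab y ≡ lab b → treeWeight ρ₂ x y ≡ val x y × treeWeight ρ₂ y x ≡ val x y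
        both p r = trans (update-cell (reals ρ₁) 22 _ _ _ (λ q → ix≢ {y} {x} {x} {y} (λ (u , _) → x≢y p r (sym u)) (trans (sym iyx) q))) (first-at p r) ,
                   second-at p r

        step : Q (exec (whenAll crossTests setBoth) ρ) × P x y (exec (whenAll crossTests setBoth) ρ) ×
               (∀ x' y' → P x' y' ρ → P x' y' (exec (whenAll crossTests setBoth) ρ))
        step = whenAll-rule crossTests setBoth (λ τ → Q τ × P x y τ × (∀ x' y' → P x' y' ρ → P x' y' τ)) ρ hit
          (λ nh → q , (λ p r → ⊥-elim (nh (tests p r))) , λ _ _ h → h)
          where
          lab-ρ : ∀ z → nats ρ 13 (toℕ z) ≡ lab z
          lab-ρ z = frameN fr 13 refl _
          tests : lab x ≡ lab a → lab y ≡ lab b → Holds crossTests ρ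
          tests p r = sameᵗ-complete (13 [ # 30 ]) (# 26) ρ (trans (cong (nats ρ 13) cx) (trans (lab-ρ x) (trans p (trans (sym ea) (sym (frameN fr 26 refl 0)))))) ∷
                      sameᵗ-complete (13 [ # 31 ]) (# 27) ρ (trans (cong (nats ρ 13) cy) (trans (lab-ρ y) (trans r (trans (sym eb) (sym (frameN fr 27 refl 0)))))) ∷ []
          hit : Holds crossTests ρ → Q ρ₂ × P x y ρ₂ × (∀ x' y' → P x' y' ρ → P x' y' ρ₂)
          hit (h₁ ∷ h₂ ∷ []) = Q' , both , keep
            where
            p : lab x ≡ lab a
            p = trans (sym (trans (cong (nats ρ 13) cx) (lab-ρ x))) (trans (sameᵗ-sound (13 [ # 30 ]) (# 26) ρ h₁) (trans (frameN fr 26 refl 0) ea))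
            r : lab y ≡ lab b
            r = trans (sym (trans (cong (nats ρ 13) cy) (lab-ρ y))) (trans (sameᵗ-sound (13 [ # 31 ]) (# 27) ρ h₂) (trans (frameN fr 27 refl 0) eb))
            lx≢ly : lab x ≢ lab y
            lx≢ly k = l≢ (trans (sym p) (trans k r))
            Q' : Q ρ₂
            Q' x' y' k = trans (other {x'} {y'} (λ { (refl , refl) → lx≢ly k }) (λ { (refl , refl) → lx≢ly (sym k) })) (q x' y' k)
            keep : ∀ x' y' → P x' y' ρ → P x' y' ρ₂
            keep x' y' h p' r' with x Finₚ.≟ x' | y Finₚ.≟ y'
            ... | yes refl | yes refl = both p r
            ... | no ne | _ = trans (other {x'} {y'} (λ (u , _) → ne u) (λ { (refl , refl) → lx≢ly (trans p (trans (sym p') (trans refl refl))) })) (proj₁ (h p' r')) ,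
                              trans (other {y'} {x'} (λ { (refl , refl) → lx≢ly (trans p (trans (sym p') refl)) }) (λ (_ , u) → ne u)) (proj₂ (h p' r'))
            ... | yes refl | no ne = trans (other {x'} {y'} (λ (_ , u) → ne u) (λ { (refl , refl) → lx≢ly (trans p (sym p')) })) (proj₁ (h p' r')) ,
                              trans (other {y'} {x'} (λ { (refl , refl) → lx≢ly (trans p (sym p')) }) (λ (u , _) → ne u)) (proj₂ (h p' r'))

    -- The sums read only entries for pairs inside one of the two old trees, while the loop writes
    -- only entries for pairs across them. Hence every sum is formed from the weights before the
    -- merge.
    crossings-correct : (∀ x y → lab x ≡ lab y → treeWeight (exec crossings σ) x y ≡ W x y) ×
      (∀ x y → lab x ≡ lab a → lab y ≡ lab b → treeWeight (exec crossings σ) x y ≡ val x y × treeWeight (exec crossings σ) y x ≡ val x y)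
    crossings-correct = for-all2 {30} {31} {whenAll crossTests setBoth} σ (size e) refl Q P
      (λ _ h → h) (λ _ _ _ h → h) (λ _ h → h) (λ _ _ _ h → h) (λ _ _ _ → refl) step

module KruskalCorrect {ℝ : Reals} {n : ℕ} (G : MixedGraph ℝ n) where
  open Real ℝ
  open MixedGraph G
  open Walks G
  open Forests G
  open Relax {ℝ}
  open State
  open Stages G
  open Static G
  open Kruskal G
  open KruskalProgram G

  -- Each undirected edge is treated once, from its smaller end, in lexicographic order; `α` and `β`
  -- are the current counters.
  Before : ℕ → ℕ → V → V → Set
  Before α β u v = toℕ u < toℕ v × (toℕ u < α ⊎ (toℕ u ≡ α × toℕ v < β))

  Processed : ℕ → ℕ → V → V → Set
  Processed α β u v = NegAdj u v × (Before α β u v ⊎ Before α β v u)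

  Progress : ℕ → ℕ → State ℝ → Set
  Progress α β σ = (1 ≤ nats σ 21 0 × ¬ Conservative G)
                 ⊎ (nats σ 21 0 ≡ 0 × Partial (Processed α β) (labelOf σ) (treeWeight σ))

  private
    before-suc : ∀ {α β u v} → Before α β u v → Before α (suc β) u v
    before-suc (lt , inj₁ p)       = lt , inj₁ p
    before-suc (lt , inj₂ (p , q)) = lt , inj₂ (p , ℕₚ.≤-trans q (ℕₚ.n≤1+n _))

    processed-suc : ∀ {α β u v} → Processed α β u v → Processed α (suc β) u v
    processed-suc (ng , inj₁ p) = ng , inj₁ (before-suc p)
    processed-suc (ng , inj₂ p) = ng , inj₂ (before-suc p)

    before-pred : ∀ {a b u v : V} → Before (toℕ a) (suc (toℕ b)) u v → Before (toℕ a) (toℕ b) u v ⊎ (u ≡ a × v ≡ b)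
    before-pred (lt , inj₁ p) = inj₁ (lt , inj₁ p)
    before-pred (lt , inj₂ (p , s≤s q)) with ℕₚ.m≤n⇒m<n∨m≡n q
    ... | inj₁ q' = inj₁ (lt , inj₂ (p , q'))
    ... | inj₂ e  = inj₂ (toℕ-injective p , toℕ-injective e)

    processed-sym : ∀ {α β u v} → Processed α β u v → Processed α β v u
    processed-sym (ng , h) = reversed ng , [ inj₂ , inj₁ ]′ h

    processed-pred : ∀ {a b u v : V} → Processed (toℕ a) (suc (toℕ b)) u v → Processed (toℕ a) (toℕ b) u v ⊎ (a , b) ~ᵉ (u , v)
    processed-pred (ng , inj₁ p) with before-pred p
    ... | inj₁ q = inj₁ (ng , inj₁ q)
    ... | inj₂ (refl , refl) = inj₂ (inj₁ (refl , refl))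
    processed-pred (ng , inj₂ p) with before-pred p
    ... | inj₁ q = inj₁ (ng , inj₂ q)
    ... | inj₂ (refl , refl) = inj₂ (inj₂ (refl , refl))

    not-before : ∀ {a b : V} → ¬ Before (toℕ a) (toℕ b) a b
    not-before (_ , inj₁ p) = ℕₚ.<-irrefl refl p
    not-before (_ , inj₂ (_ , p)) = ℕₚ.<-irrefl refl p

  module _ {a b : V} (σ : State ℝ) (e : Env σ) (aa : At 33 a σ) (ab : At 34 b σ) where
    private
      α = toℕ a
      β = toℕ b

      negative⁻ : Holds negativeTests σ → NegAdj a b × α < β
      negative⁻ (h₁ ∷ h₂ ∷ h₃ ∷ []) =
        let (w , q , r) = edge-present e (at-present⁻ 1 e aa ab h₁)
        in (w , q , ≱⇒<ᵣ (subst (λ z → ¬ 0# ≤ᵣ z) (trans (cong (reals σ 0) (at-eval₀ e aa ab)) r) h₂)) ,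
           subst₂ _≤_ (trans (ℕₚ.+-comm (nats σ 33 0) 1) (cong suc aa)) ab h₃

      negative⁺ : NegAdj a b → α < β → Holds negativeTests σ
      negative⁺ (w , q , w<0) lt = at-present⁺ 1 e aa ab (proj₁ (present-edge e q)) ∷
        (λ h → <ᵣ⇒≱ w<0 (subst (0# ≤ᵣ_) (trans (cong (reals σ 0) (at-eval₀ e aa ab)) (proj₂ (present-edge e q))) h)) ∷
        subst₂ _≤_ (sym (trans (ℕₚ.+-comm (nats σ 33 0) 1) (cong suc aa))) (sym ab) lt ∷ []

      skipped : ¬ Holds negativeTests σ → Progress α β σ → Progress α (suc β) σ
      skipped nh (inj₁ bad) = inj₁ bad
      skipped nh (inj₂ (z , A)) = inj₂ (z , partial-map processed-suc from A)
        where
        from : ∀ {u v} → Processed α (suc β) u v → Processed α β u v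
        from h with processed-pred h
        ... | inj₁ p = p
        from (ng , inj₁ (lt , _)) | inj₂ (inj₁ (refl , refl)) = ⊥-elim (nh (negative⁺ ng lt))
        from (ng , inj₂ (lt , inj₁ p)) | inj₂ (inj₁ (refl , refl)) = ng , inj₂ (lt , inj₁ p)
        from (ng , inj₂ (lt , inj₂ (p , q))) | inj₂ (inj₁ (refl , refl)) = ⊥-elim (ℕₚ.<-irrefl p lt)
        from (ng , inj₁ (lt , inj₁ p)) | inj₂ (inj₂ (refl , refl)) = ng , inj₁ (lt , inj₁ p)
        from (ng , inj₁ (lt , inj₂ (p , q))) | inj₂ (inj₂ (refl , refl)) = ⊥-elim (ℕₚ.<-irrefl p lt)
        from (ng , inj₂ (lt , _)) | inj₂ (inj₂ (refl , refl)) = ⊥-elim (nh (negative⁺ (reversed ng) lt))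

      not-processed : α < β → ¬ Processed α β a b
      not-processed lt (_ , inj₁ p) = not-before p
      not-processed lt (_ , inj₂ (lt' , _)) = ℕₚ.<-asym lt lt'

      lab-a : nats σ 13 (nats σ 33 0) ≡ labelOf σ a
      lab-a = cong (nats σ 13) aa
      lab-b : nats σ 13 (nats σ 34 0) ≡ labelOf σ b
      lab-b = cong (nats σ 13) ab

      closing : NegAdj a b → α < β → ⟦ closingTest ⟧ σ → Progress α β σ → Progress α (suc β) (exec (setN 21 (lit 0) (lit 1)) σ)
      closing adj lt h (inj₁ (_ , bad)) = inj₁ (s≤s z≤n , bad)
      closing adj lt h (inj₂ (_ , A)) = inj₁ (s≤s z≤n , closes A adj
        (trans (sym lab-a) (trans (sameᵗ-sound (13 [ # 33 ]) (13 [ # 34 ]) σ h) lab-b)) (not-processed lt))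

      σ₁ = exec (setN 26 (lit 0) (13 [ # 33 ])) σ
      σ₂ = exec (setN 27 (lit 0) (13 [ # 34 ])) σ₁
      σ₃ = exec crossings σ₂
      σ₄ = exec relabel σ₃

      e₂ : Env σ₂
      e₂ = env-frame (setN 27 (lit 0) (13 [ # 34 ])) refl (frame (setN 27 (lit 0) (13 [ # 34 ])) σ₁)
             (env-frame (setN 26 (lit 0) (13 [ # 33 ])) refl (frame (setN 26 (lit 0) (13 [ # 33 ])) σ) e)
      e₃ : Env σ₃
      e₃ = env-frame crossings refl (frame crossings σ₂) e₂

      module _ (l≢ : labelOf σ a ≢ labelOf σ b) where
        cr = crossings-correct σ₂ e₂ {a} {b} aa ab lab-a lab-b l≢
        rl = relabel-correct σ₃ e₃

        lab₃ : ∀ x → labelOf σ₃ x ≡ labelOf σ x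
        lab₃ x = frameN (frame crossings σ₂) 13 refl (toℕ x)
        c27 : nats σ₃ 27 0 ≡ labelOf σ b
        c27 = trans (frameN (frame crossings σ₂) 27 refl 0) lab-b
        c26 : nats σ₃ 26 0 ≡ labelOf σ a
        c26 = trans (frameN (frame crossings σ₂) 26 refl 0) lab-a

        relabelled : ∀ {x} → labelOf σ x ≡ labelOf σ b → labelOf σ₄ x ≡ labelOf σ a
        relabelled {x} h = trans (proj₁ (rl x) (trans (lab₃ x) (trans h (sym c27)))) c26
        kept : ∀ {x} → labelOf σ x ≢ labelOf σ b → labelOf σ₄ x ≡ labelOf σ x
        kept {x} h = trans (proj₂ (rl x) (λ q → h (trans (sym (lab₃ x)) (trans q c27)))) (lab₃ x)
        W₄ : ∀ x y → treeWeight σ₄ x y ≡ treeWeight σ₃ x y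
        W₄ x y = frameR (frame relabel σ₃) 22 refl (ix 0 x y)
        cross : (adj : NegAdj a b) → ∀ {x y} → labelOf σ x ≡ labelOf σ a → labelOf σ y ≡ labelOf σ b →
          treeWeight σ₄ x y ≡ treeWeight σ x a +ᵣ (proj₁ adj +ᵣ treeWeight σ b y) ×
          treeWeight σ₄ y x ≡ treeWeight σ x a +ᵣ (proj₁ adj +ᵣ treeWeight σ b y)
        cross (w , q , _) {x} {y} p r =
          let (h₁ , h₂) = proj₂ cr x y p r
              ew = cong (λ z → treeWeight σ x a +ᵣ (z +ᵣ treeWeight σ b y)) (proj₂ (present-edge e q))
          in trans (W₄ x y) (trans h₁ ew) , trans (W₄ y x) (trans h₂ ew)
        within : ∀ {x y} → labelOf σ x ≡ labelOf σ y → treeWeight σ₄ x y ≡ treeWeight σ x y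
        within {x} {y} p = trans (W₄ x y) (proj₁ cr x y p)

      flag₄ : nats σ₄ 21 0 ≡ nats σ 21 0
      flag₄ = trans (frameN (frame relabel σ₃) 21 refl 0) (frameN (frame crossings σ₂) 21 refl 0)

      merging : NegAdj a b → α < β → ¬ ⟦ closingTest ⟧ σ → Progress α β σ → Progress α (suc β) σ₄
      merging adj lt nh (inj₁ (bad , nc)) = inj₁ (subst (1 ≤_) (sym flag₄) bad , nc)
      merging adj lt nh (inj₂ (z , A)) = inj₂ (trans flag₄ z ,
        Merge.merged A adj l≢ (relabelled l≢) (kept l≢) (cross l≢ adj) (within l≢) processed-suc
          (adj , inj₁ (lt , inj₂ (refl , ℕₚ.≤-refl))) processed-sym processed-pred)
        where
        l≢ : labelOf σ a ≢ labelOf σ b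
        l≢ q = nh (sameᵗ-complete (13 [ # 33 ]) (13 [ # 34 ]) σ (trans lab-a (trans q (sym lab-b))))

    treatEdge-correct : Progress α β σ → Progress α (suc β) (exec treatEdge σ)
    treatEdge-correct pr = whenAll-rule negativeTests (cond closingTest (setN 21 (lit 0) (lit 1)) mergeTrees) (Progress α (suc β)) σ
      (λ h → let (adj , lt) = negative⁻ h in
        cond-rule closingTest (setN 21 (lit 0) (lit 1)) mergeTrees (Progress α (suc β)) σ
          (λ c → closing adj lt c pr) (λ nc → merging adj lt nc pr))
      (λ nh → skipped nh pr)

  kruskal-correct : ∀ σ → Env σ → nats σ 21 0 ≡ 0 → (∀ j → reals σ 22 j ≡ 0#) →
    (1 ≤ nats (exec kruskal σ) 21 0 × ¬ Conservative G) ⊎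
    (nats (exec kruskal σ) 21 0 ≡ 0 × Σ Forest λ F → (∀ u → Forest.lab F u ≡ labelOf (exec kruskal σ) u) ×
                                                      (∀ u v → Forest.W F u v ≡ treeWeight (exec kruskal σ) u v))
  kruskal-correct σ e z21 z22 = finish final
    where
    σ₀ = exec initialLabels σ
    fr₀ = frame initialLabels σ
    e₀ = env-frame initialLabels refl fr₀ e
    edges-loop = for2 33 34 treatEdge

    start : Progress 0 0 σ₀
    start = inj₂ (trans (frameN fr₀ 21 refl 0) z21 , partial-start'')
      where
      relabel-partial : ∀ {lab lab' W W'} → (∀ x → lab x ≡ lab' x) → (∀ x y → W x y ≡ W' x y) →
                        Partial (λ _ _ → ⊥) lab W → Partial (λ _ _ → ⊥) lab' W'
      relabel-partial el eW A = record
        { P-neg = ⊥-elim ; P-sym = id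
        ; W-sym = λ {u} {v} q → trans (sym (eW u v)) (trans (W-sym (trans (el u) (trans q (sym (el v))))) (eW v u))
        ; tree = λ {u} {v} q → let (p , h , i , w) = tree (trans (el u) (trans q (sym (el v)))) in p , h , i , trans w (eW u v)
        ; P-lab = ⊥-elim ; cut = ⊥-elim }
        where open Partial A
      partial-start'' : Partial (Processed 0 0) (labelOf σ₀) (treeWeight σ₀)
      partial-start'' = partial-map ⊥-elim
        (λ { (_ , inj₁ (_ , inj₂ (_ , ()))) ; (_ , inj₂ (_ , inj₂ (_ , ()))) })
        (relabel-partial (λ x → sym (initialLabels-correct σ e x)) (λ x y → sym (trans (frameR fr₀ 22 refl _) (z22 _))) partial-start)

    row : ∀ (a : V) ρ → Env ρ → At 33 a ρ → Progress (toℕ a) 0 ρ → Progress (suc (toℕ a)) 0 (exec (for 34 vertices treatEdge) ρ)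
    row a ρ eρ c pr = next (exec (for 34 vertices treatEdge) ρ) (for-rule {i = 34} {vertices} {treatEdge} ρ n (size eρ) refl (Progress (toℕ a)) pr
      (λ k τ k<n ck fr pk →
        subst (λ z → Progress (toℕ a) (suc z) (increment 34 (exec treatEdge τ))) (toℕ-fromℕ< k<n)
          (treatEdge-correct {a} {fromℕ< k<n} τ (env-frame (for 34 vertices treatEdge) refl fr eρ)
            (trans (frameN fr 33 refl 0) c) (trans ck (sym (toℕ-fromℕ< k<n)))
            (subst (λ z → Progress (toℕ a) z τ) (sym (toℕ-fromℕ< k<n)) pk))))
      where
      b⇒ : ∀ {u v} → Before (toℕ a) n u v → Before (suc (toℕ a)) 0 u v
      b⇒ (lt , inj₁ p) = lt , inj₁ (ℕₚ.≤-trans p (ℕₚ.n≤1+n _))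
      b⇒ (lt , inj₂ (p , _)) = lt , inj₁ (s≤s (ℕₚ.≤-reflexive p))
      b⇐ : ∀ {u v} → Before (suc (toℕ a)) 0 u v → Before (toℕ a) n u v
      b⇐ {v = v} (lt , inj₁ (s≤s p)) with ℕₚ.m≤n⇒m<n∨m≡n p
      ... | inj₁ q = lt , inj₁ q
      ... | inj₂ q = lt , inj₂ (q , toℕ<n v)
      next : ∀ τ → Progress (toℕ a) n τ → Progress (suc (toℕ a)) 0 τ
      next τ (inj₁ bad) = inj₁ bad
      next τ (inj₂ (z , A)) = inj₂ (z , partial-map
        (λ (ng , h) → ng , [ (λ p → inj₁ (b⇒ p)) , (λ p → inj₂ (b⇒ p)) ]′ h)
        (λ (ng , h) → ng , [ (λ p → inj₁ (b⇐ p)) , (λ p → inj₂ (b⇐ p)) ]′ h) A)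

    final : Progress n 0 (exec edges-loop σ₀)
    final = for-rule {i = 33} {vertices} {for 34 vertices treatEdge} σ₀ n (size e₀) refl (λ k → Progress k 0) start
      (λ k τ k<n ck fr pk → subst (λ z → Progress (suc z) 0 (increment 33 (exec (for 34 vertices treatEdge) τ))) (toℕ-fromℕ< k<n)
        (row (fromℕ< k<n) τ (env-frame edges-loop refl fr e₀) (trans ck (sym (toℕ-fromℕ< k<n)))
          (subst (λ z → Progress z 0 τ) (sym (toℕ-fromℕ< k<n)) pk)))

    finish : Progress n 0 (exec edges-loop σ₀) → _
    finish (inj₁ bad) = inj₁ bad
    finish (inj₂ (z , A)) = inj₂ (z , toForest A all , (λ _ → refl) , λ _ _ → refl)
      where
      all : ∀ {u v} → NegAdj u v → Processed n 0 u v
      all {u} {v} ng with ℕₚ.<-cmp (toℕ u) (toℕ v)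
      ... | tri< lt _ _ = ng , inj₁ (lt , inj₁ (toℕ<n u))
      ... | tri> _ _ gt = ng , inj₂ (gt , inj₁ (toℕ<n v))
      ... | tri≈ _ q _ with toℕ-injective q
      ...   | refl = case trans (sym (edge-loop u)) (proj₁ (proj₂ ng)) of λ ()

-- Colouring the trees of the blocks

sameBlockTests : List Test
sameBlockTests = notᵗ (present 12 (at₀ 33 30)) ∷ notᵗ (present 12 (at₀ 33 31)) ∷ notᵗ (present 12 (at₀ 34 30)) ∷ notᵗ (present 12 (at₀ 34 31)) ∷ []

scanTests : List Test
scanTests = present 14 (at₀ 30 31) ∷ sameBlockTests

scanTree : Test
scanTree = sameᵗ (13 [ # 33 ]) (13 [ # 30 ])

raise : Command
raise = cond ((14 [ at₀ 30 31 ]) ≤ⁿ # 24) nop (setN 24 (lit 0) (14 [ at₀ 30 31 ]))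

scanBody : Command
scanBody = cond scanTree (setN 25 (lit 0) (14 [ at₀ 30 31 ])) raise

scan : Command
scan = for2 30 31 (whenAll scanTests scanBody)

pairTests : List Test
pairTests = notᵗ (sameᵗ (# 33) (# 34)) ∷ sameᵗ (13 [ # 33 ]) (13 [ # 34 ]) ∷ notᵗ (present 12 (at₀ 33 34)) ∷ []

assign : Command
assign = cond (lit 1 ≤ⁿ # 25) (setN 14 (at₀ 33 34) (# 25)) (setN 14 (at₀ 33 34) (# 24 ⊕ lit 1))

bump : Command
bump = cond ((14 [ at₀ 33 34 ]) ≤ⁿ # 17) nop (setN 17 (lit 0) (14 [ at₀ 33 34 ]))

resetScan : Command
resetScan = setN 24 (lit 0) (lit 0) ⨟ setN 25 (lit 0) (lit 0)

colourPair : Command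
colourPair = resetScan ⨟ scan ⨟ assign ⨟ bump

colourPairs : Command
colourPairs = for2 33 34 (whenAll pairTests colourPair)

module Colours {ℝ : Reals} {n : ℕ} (G : MixedGraph ℝ n) (lab : Fin n → ℕ) where
  open Real ℝ
  open MixedGraph G
  open Walks G
  open Forests G
  open Relax {ℝ}
  open State
  open Stages G
  open Static G
  open KruskalProgram G using (labelOf)
  open ForAll {ℝ} {n}

  TreePair : V → V → Set
  TreePair u v = u ≢ v × lab u ≡ lab v × Insep u v

  -- The pair in the middle consists of two distinct vertices, so it passes inseparability on, as in
  -- `insep-join`.
  sb-trans : ∀ {u v a b c d} → a ≢ b → SameBlock u v a b → SameBlock a b c d → SameBlock u v c d
  sb-trans ne ((ua , ub) , (va , vb)) ((ac , ad) , (bc , bd)) =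
    (insep-join ne ua ub ac bc , insep-join ne ua ub ad bd) , (insep-join ne va vb ac bc , insep-join ne va vb ad bd)

  sb-sym : ∀ {u v a b} → SameBlock u v a b → SameBlock a b u v
  sb-sym ((ua , ub) , (va , vb)) = (insep-sym ua , insep-sym va) , (insep-sym ub , insep-sym vb)

  sb-self : ∀ {u v} → Insep u v → SameBlock u v u v
  sb-self uv = (insep-refl , uv) , (insep-sym uv , insep-refl)

  -- Besides a proper colouring this records that no colour is skipped in a block and that the last
  -- colour occurs. These two facts bound the number of colours by the number of trees of a single
  -- block.
  record Good (col : V → V → ℕ) (K : ℕ) : Set where
    field
      pair  : ∀ {u v j} → col u v ≡ suc j → TreePair u v
      same  : ∀ {u v a b i j} → col u v ≡ suc i → col a b ≡ suc j → SameBlock u v a b → lab u ≡ lab a → i ≡ j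
      diff  : ∀ {u v a b j} → col u v ≡ suc j → col a b ≡ suc j → SameBlock u v a b → lab u ≡ lab a
      below : ∀ {u v j} → col u v ≡ suc (suc j) → ∃[ a ] ∃[ b ] col a b ≡ suc j × SameBlock u v a b
      max   : ∀ u v → col u v ≤ K
      top   : K ≡ 0 ⊎ ∃[ u ] ∃[ v ] col u v ≡ K

  good-start : Good (λ _ _ → 0) 0
  good-start = record { pair = λ () ; same = λ () ; diff = λ () ; below = λ () ; max = λ _ _ → z≤n ; top = inj₁ refl }

  good-cong : ∀ {col col' K K'} → (∀ u v → col u v ≡ col' u v) → K ≡ K' → Good col K → Good col' K'
  good-cong {col} {col'} eq refl g = record
    { pair = λ h → pair (trans (eq _ _) h)
    ; same = λ h k → same (trans (eq _ _) h) (trans (eq _ _) k)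
    ; diff = λ h k → diff (trans (eq _ _) h) (trans (eq _ _) k)
    ; below = λ h → let (a , b , k , s) = below (trans (eq _ _) h) in a , b , trans (sym (eq a b)) k , s
    ; max = λ u v → subst (_≤ _) (eq u v) (max u v)
    ; top = [ inj₁ , (λ (u , v , h) → inj₂ (u , v , trans (sym (eq u v)) h)) ]′ top }
    where open Good g

  module Extend {col K} (g : Good col K) {u v : V} (tp : TreePair u v) {c : ℕ}
                (S : ∀ {a b j} → col a b ≡ suc j → SameBlock u v a b → (lab u ≡ lab a → c ≡ j) × (c ≡ j → lab u ≡ lab a))
                (T' : ∀ {c'} → c ≡ suc c' → ∃[ a ] ∃[ b ] col a b ≡ suc c' × SameBlock u v a b)
                {col' : V → V → ℕ} {K' : ℕ} (new : col' u v ≡ suc c) (old : ∀ {x y} → ¬ (u ≡ x × v ≡ y) → col' x y ≡ col x y)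
                (K'-max : K ≤ K' × suc c ≤ K') (K'-top : K' ≡ K ⊎ K' ≡ suc c) where
    open Good g
    private
      self : ∀ {j} → col u v ≡ suc j → c ≡ j
      self h = proj₁ (S h (sb-self (proj₂ (proj₂ tp)))) refl

      keep : ∀ {x y j} → col x y ≡ suc j → col' x y ≡ suc j
      keep {x} {y} h with (u Finₚ.≟ x) ×-dec (v Finₚ.≟ y)
      ... | yes (refl , refl) = trans new (cong suc (self h))
      ... | no ne = trans (old ne) h

      view : ∀ {x y j} → col' x y ≡ suc j → ((u ≡ x × v ≡ y) × c ≡ j) ⊎ col x y ≡ suc j
      view {x} {y} h with (u Finₚ.≟ x) ×-dec (v Finₚ.≟ y)
      ... | yes (refl , refl) = inj₁ ((refl , refl) , ℕₚ.suc-injective (trans (sym new) h))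
      ... | no ne = inj₂ (trans (sym (old ne)) h)

    extended : Good col' K'
    extended = record
      { pair = λ h → case view h of λ { (inj₁ ((refl , refl) , _)) → tp ; (inj₂ k) → pair k }
      ; same = same'
      ; diff = diff'
      ; below = below'
      ; max = max'
      ; top = top' K'-top }
      where
      same' : ∀ {x y a b i j} → col' x y ≡ suc i → col' a b ≡ suc j → SameBlock x y a b → lab x ≡ lab a → i ≡ j
      same' h k s e with view h | view k
      ... | inj₂ h' | inj₂ k' = same h' k' s e
      ... | inj₁ ((refl , refl) , refl) | inj₂ k' = proj₁ (S k' s) e
      ... | inj₂ h' | inj₁ ((refl , refl) , refl) = sym (proj₁ (S h' (sb-sym s)) (sym e))
      ... | inj₁ (_ , refl) | inj₁ (_ , refl) = refl
      diff' : ∀ {x y a b j} → col' x y ≡ suc j → col' a b ≡ suc j → SameBlock x y a b → lab x ≡ lab a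
      diff' h k s with view h | view k
      ... | inj₂ h' | inj₂ k' = diff h' k' s
      ... | inj₁ ((refl , refl) , e) | inj₂ k' = proj₂ (S k' s) e
      ... | inj₂ h' | inj₁ ((refl , refl) , e) = sym (proj₂ (S h' (sb-sym s)) e)
      ... | inj₁ ((refl , refl) , _) | inj₁ ((refl , refl) , _) = refl
      below' : ∀ {x y j} → col' x y ≡ suc (suc j) → ∃[ a ] ∃[ b ] col' a b ≡ suc j × SameBlock x y a b
      below' h with view h
      ... | inj₁ ((refl , refl) , e) = let (a , b , k , s) = T' e in a , b , keep k , s
      ... | inj₂ h' = let (a , b , k , s) = below h' in a , b , keep k , s
      max' : ∀ x y → col' x y ≤ K'
      max' x y with (u Finₚ.≟ x) ×-dec (v Finₚ.≟ y)
      ... | yes (refl , refl) = subst (_≤ K') (sym new) (proj₂ K'-max)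
      ... | no ne = subst (_≤ K') (sym (old ne)) (ℕₚ.≤-trans (max x y) (proj₁ K'-max))
      top' : K' ≡ K ⊎ K' ≡ suc c → K' ≡ 0 ⊎ ∃[ x ] ∃[ y ] col' x y ≡ K'
      top' (inj₂ e) = inj₂ (u , v , trans new (sym e))
      top' (inj₁ e) = [ (λ z → inj₁ (trans e z)) , (λ (x , y , h) → positive x y h K refl) ]′ top
        where
        positive : ∀ x y → col x y ≡ K → ∀ k → K ≡ k → K' ≡ 0 ⊎ ∃[ x ] ∃[ y ] col' x y ≡ K'
        positive x y h zero    q = inj₁ (trans e q)
        positive x y h (suc k) q = inj₂ (x , y , trans (keep (trans h q)) (sym (trans e q)))

  colourOf : State ℝ → V → V → ℕ
  colourOf σ x y = nats σ 14 (ix 0 x y)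

  at-sep⁻ : ∀ {σ x y} {s t : V} → Env σ → Separated σ → At x s σ → At y t σ → ⟦ notᵗ (present 12 (at₀ x y)) ⟧ σ → Insep s t
  at-sep⁻ e sp a b h = sep⁻ sp (λ q → h (at-present⁺ 12 e a b q))

  at-sep⁺ : ∀ {σ x y} {s t : V} → Env σ → Separated σ → At x s σ → At y t σ → Insep s t → ⟦ notᵗ (present 12 (at₀ x y)) ⟧ σ
  at-sep⁺ e sp a b h q = sep⁺ sp (at-present⁻ 12 e a b q) h

  module Scan (σ : State ℝ) (e : Env σ) (sp : Separated σ) (lb : ∀ x → labelOf σ x ≡ lab x)
              {u v : V} (au : At 33 u σ) (av : At 34 v σ) (z24 : nats σ 24 0 ≡ 0) (z25 : nats σ 25 0 ≡ 0) where
    private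
      col = colourOf σ
      τ = exec scan σ

    record Scanned (ρ : State ℝ) : Set where
      field
        hit   : nats ρ 25 0 ≡ 0 ⊎ (∃[ a ] ∃[ b ] col a b ≡ nats ρ 25 0 × SameBlock u v a b × lab u ≡ lab a)
        count : nats ρ 24 0 ≡ 0 ⊎ (∃[ a ] ∃[ b ] col a b ≡ nats ρ 24 0 × SameBlock u v a b)

    Seen : V → V → State ℝ → Set
    Seen a b ρ = 1 ≤ col a b → SameBlock u v a b → (lab u ≡ lab a → 1 ≤ nats ρ 25 0) × (lab u ≢ lab a → col a b ≤ nats ρ 24 0)

    scan-correct : Scanned τ × (∀ a b → Seen a b τ)
    scan-correct = for-all2 {30} {31} {whenAll scanTests scanBody} σ (size e) refl Scanned Seen
      (λ _ h → record { Scanned h }) (λ _ _ _ h → h) (λ _ h → record { Scanned h }) (λ _ _ _ h → h)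
      (record { hit = inj₁ z25 ; count = inj₁ z24 }) step
      where
      step : ∀ a b ρ → nats ρ 30 0 ≡ toℕ a → nats ρ 31 0 ≡ toℕ b → Frame scan σ ρ → Scanned ρ →
        Scanned (exec (whenAll scanTests scanBody) ρ) × Seen a b (exec (whenAll scanTests scanBody) ρ) ×
        (∀ a' b' → Seen a' b' ρ → Seen a' b' (exec (whenAll scanTests scanBody) ρ))
      step a b ρ ca cb fr q = whenAll-rule scanTests scanBody Goal ρ
        (λ hs → cond-rule scanTree (setN 25 (lit 0) (14 [ at₀ 30 31 ])) raise Goal ρ (tree hs)
          (λ nt → cond-rule ((14 [ at₀ 30 31 ]) ≤ⁿ # 24) nop (setN 24 (lit 0) (14 [ at₀ 30 31 ])) Goal ρ (low hs nt) (high hs nt)))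
        (λ nh → q , (λ h s → ⊥-elim (nh (tests h s))) , λ _ _ h → h)
        where
        Goal : State ℝ → Set
        Goal τ = Scanned τ × Seen a b τ × (∀ a' b' → Seen a' b' ρ → Seen a' b' τ)
        eρ = env-frame scan refl fr e
        spρ = separated-frame scan refl fr sp
        cu : At 33 u ρ
        cu = trans (frameN fr 33 refl 0) au
        cv : At 34 v ρ
        cv = trans (frameN fr 34 refl 0) av
        cell : nats ρ 14 (evalⁿ ρ (at₀ 30 31)) ≡ col a b
        cell = trans (cong (nats ρ 14) (at-eval₀ eρ ca cb)) (frameN fr 14 refl _)
        lu : nats ρ 13 (nats ρ 33 0) ≡ lab u
        lu = trans (cong (nats ρ 13) cu) (trans (frameN fr 13 refl _) (lb u))
        la : nats ρ 13 (nats ρ 30 0) ≡ lab a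
        la = trans (cong (nats ρ 13) ca) (trans (frameN fr 13 refl _) (lb a))
        tests : 1 ≤ col a b → SameBlock u v a b → Holds scanTests ρ
        tests h ((ua , ub) , (va , vb)) = subst (1 ≤_) (sym cell) h ∷ at-sep⁺ eρ spρ cu ca ua ∷ at-sep⁺ eρ spρ cu cb ub ∷
          at-sep⁺ eρ spρ cv ca va ∷ at-sep⁺ eρ spρ cv cb vb ∷ []
        untests : Holds scanTests ρ → 1 ≤ col a b × SameBlock u v a b
        untests (h ∷ h₁ ∷ h₂ ∷ h₃ ∷ h₄ ∷ []) = subst (1 ≤_) cell h ,
          (at-sep⁻ eρ spρ cu ca h₁ , at-sep⁻ eρ spρ cu cb h₂) , (at-sep⁻ eρ spρ cv ca h₃ , at-sep⁻ eρ spρ cv cb h₄)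
        tree : Holds scanTests ρ → ⟦ scanTree ⟧ ρ → Goal (exec (setN 25 (lit 0) (14 [ at₀ 30 31 ])) ρ)
        tree hs t = let (pos , sb) = untests hs
                        eq = trans (sym lu) (trans (sameᵗ-sound (13 [ # 33 ]) (13 [ # 30 ]) ρ t) la)
                        pos' = subst (1 ≤_) (sym cell) pos
          in record { hit = inj₂ (a , b , sym cell , sb , eq) ; count = Scanned.count q } ,
             (λ _ _ → (λ _ → pos') , λ ne → ⊥-elim (ne eq)) ,
             λ a' b' h p s → (λ _ → pos') , proj₂ (h p s)
        not-tree : ¬ ⟦ scanTree ⟧ ρ → lab u ≢ lab a
        not-tree nt eq = nt (sameᵗ-complete (13 [ # 33 ]) (13 [ # 30 ]) ρ (trans lu (trans eq (sym la))))
        low : Holds scanTests ρ → ¬ ⟦ scanTree ⟧ ρ → ⟦ (14 [ at₀ 30 31 ]) ≤ⁿ # 24 ⟧ ρ → Goal ρ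
        low hs nt le = q , (λ _ _ → (λ eq → ⊥-elim (not-tree nt eq)) , λ _ → subst (_≤ nats ρ 24 0) cell le) , λ _ _ h → h
        high : Holds scanTests ρ → ¬ ⟦ scanTree ⟧ ρ → ¬ ⟦ (14 [ at₀ 30 31 ]) ≤ⁿ # 24 ⟧ ρ → Goal (exec (setN 24 (lit 0) (14 [ at₀ 30 31 ])) ρ)
        high hs nt nle = let (pos , sb) = untests hs in
          record { hit = Scanned.hit q ; count = inj₂ (a , b , sym cell , sb) } ,
          (λ _ _ → (λ eq → ⊥-elim (not-tree nt eq)) , λ _ → ℕₚ.≤-reflexive (sym cell)) ,
          λ a' b' h p s → proj₁ (h p s) , λ ne → ℕₚ.≤-trans (proj₂ (h p s) ne) (ℕₚ.<⇒≤ (ℕₚ.≰⇒> nle))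

  module PairStep (σ : State ℝ) (e : Env σ) (sp : Separated σ) (lb : ∀ x → labelOf σ x ≡ lab x)
                  {u v : V} (au : At 33 u σ) (av : At 34 v σ) (g : Good (colourOf σ) (nats σ 17 0)) (tp : TreePair u v) where
    private
      col = colourOf σ
      σ₁ = exec resetScan σ
      σ₂ = exec scan σ₁
      fr₁ = frame resetScan σ
      fr₂ = frame scan σ₁
      e₁ = env-frame resetScan refl fr₁ e
      e₂ = env-frame scan refl fr₂ e₁
      open Scan σ₁ e₁ (separated-frame resetScan refl fr₁ sp) lb {u} {v} au av refl refl
      scanned = proj₁ scan-correct
      seen = proj₂ scan-correct
      H = nats σ₂ 25 0
      C = nats σ₂ 24 0
      au₂ : At 33 u σ₂
      au₂ = trans (frameN fr₂ 33 refl 0) au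
      av₂ : At 34 v σ₂
      av₂ = trans (frameN fr₂ 34 refl 0) av
      idx₂ : evalⁿ σ₂ (at₀ 33 34) ≡ ix 0 u v
      idx₂ = at-eval₀ e₂ au₂ av₂
      open Good g

      record Chosen (c : ℕ) : Set where
        field
          S  : ∀ {a b j} → col a b ≡ suc j → SameBlock u v a b → (lab u ≡ lab a → c ≡ j) × (c ≡ j → lab u ≡ lab a)
          T' : ∀ {c'} → c ≡ suc c' → ∃[ a ] ∃[ b ] col a b ≡ suc c' × SameBlock u v a b

      -- A coloured pair of the same tree and block exists, and its colour is taken over. What is
      -- known about that pair carries over because both pairs determine the same block.
      chosen-hit : ∀ {c} → H ≡ suc c → Chosen c
      chosen-hit {c} h = [ (λ z → case trans (sym z) h of λ ()) , (λ (a₀ , b₀ , k , s , l) → from-mate a₀ b₀ (trans k h) s l) ]′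
                         (Scanned.hit scanned)
        where
        from-mate : ∀ a₀ b₀ → col a₀ b₀ ≡ suc c → SameBlock u v a₀ b₀ → lab u ≡ lab a₀ → Chosen c
        from-mate a₀ b₀ kh s l = record
          { S = λ q sb → (λ le → same kh q (between sb) (trans (sym l) le)) ,
                         (λ e → trans l (diff kh (trans q (cong suc (sym e))) (between sb)))
          ; T' = λ e → let (a , b , q , sb) = below (trans kh (cong suc e)) in a , b , q , sb-trans (proj₁ (pair kh)) s sb }
          where
          between : ∀ {a b} → SameBlock u v a b → SameBlock a₀ b₀ a b
          between sb = sb-trans (proj₁ tp) (sb-sym s) sb

      -- The tree is new in the block. Its colour follows the largest one there, so no other tree of
      -- the block has it, and the pair that attains the maximum shows that no colour is skipped.
      chosen-new : H ≡ 0 → Chosen C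
      chosen-new h = record
        { S = λ {a} {b} {j} q sb →
            let seen-ab = seen a b (subst (1 ≤_) (sym q) (s≤s z≤n)) sb
                no-tree : lab u ≢ lab a
                no-tree le = ℕₚ.<-irrefl refl (subst (1 ≤_) h (proj₁ seen-ab le))
            in (λ le → ⊥-elim (no-tree le)) ,
               λ e → ⊥-elim (ℕₚ.<-irrefl (sym e) (subst (_≤ C) q (proj₂ seen-ab no-tree)))
        ; T' = λ {c'} q → [ (λ z → case trans (sym z) q of λ ()) , (λ (a , b , k , sb) → a , b , trans k q , sb) ]′ (Scanned.count scanned) }

      coloured : ∀ (x : ℕ) → State ℝ
      coloured x = ⟨ update (nats σ₂) 14 (evalⁿ σ₂ (at₀ 33 34)) x , reals σ₂ ⟩

      K₂ : nats σ₂ 17 0 ≡ nats σ 17 0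
      K₂ = trans (frameN fr₂ 17 refl 0) (frameN fr₁ 17 refl 0)

      new-col : ∀ x → colourOf (coloured x) u v ≡ x
      new-col x = trans (cong (λ i → update (nats σ₂) 14 i x 14 (ix 0 u v)) idx₂) (update-same (nats σ₂) 14 (ix 0 u v) x)

      old-col : ∀ x {a b} → ¬ (u ≡ a × v ≡ b) → colourOf (coloured x) a b ≡ col a b
      old-col x {a} {b} ne = trans (update-cell (nats σ₂) 14 (evalⁿ σ₂ (at₀ 33 34)) x (ix 0 a b)
          (λ q → ne (proj₂ (ix-injective {m = 0} {m' = 0} {u} {a} {v} {b} (trans (sym idx₂) q)))))
        (trans (frameN fr₂ 14 refl (ix 0 a b)) (frameN fr₁ 14 refl (ix 0 a b)))

      Result : State ℝ → Set
      Result τ = Good (colourOf τ) (nats τ 17 0) × 1 ≤ colourOf τ u v × (∀ a b → 1 ≤ col a b → 1 ≤ colourOf τ a b)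

      bumped : ∀ c → Chosen c → Result (exec bump (coloured (suc c)))
      bumped c ch = cond-rule ((14 [ at₀ 33 34 ]) ≤ⁿ # 17) nop (setN 17 (lit 0) (14 [ at₀ 33 34 ])) Result ρ
        (λ le → Extend.extended g tp (Chosen.S ch) (Chosen.T' ch) (new-col (suc c)) (old-col (suc c))
           (ℕₚ.≤-reflexive (sym K₂) , subst (_≤ nats σ₂ 17 0) cell le) (inj₁ K₂) , pos , stays′)
        (λ nle → Extend.extended g tp (Chosen.S ch) (Chosen.T' ch) (new-col (suc c)) (old-col (suc c))
           (ℕₚ.≤-trans (ℕₚ.≤-reflexive (sym K₂)) (ℕₚ.<⇒≤ (ℕₚ.≰⇒> nle)) , ℕₚ.≤-reflexive (sym cell)) (inj₂ cell) , pos , stays′)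
        where
        ρ = coloured (suc c)
        cell : nats ρ 14 (evalⁿ ρ (at₀ 33 34)) ≡ suc c
        cell = update-same (nats σ₂) 14 (evalⁿ σ₂ (at₀ 33 34)) (suc c)
        pos : 1 ≤ colourOf ρ u v
        pos = subst (1 ≤_) (sym (new-col (suc c))) (s≤s z≤n)
        stays′ : ∀ a b → 1 ≤ col a b → 1 ≤ colourOf ρ a b
        stays′ a b h with (u Finₚ.≟ a) ×-dec (v Finₚ.≟ b)
        ... | yes (refl , refl) = pos
        ... | no ne = subst (1 ≤_) (sym (old-col (suc c) ne)) h

    colourPair-correct : Good (colourOf (exec colourPair σ)) (nats (exec colourPair σ) 17 0) × 1 ≤ colourOf (exec colourPair σ) u v ×
                         (∀ a b → 1 ≤ colourOf σ a b → 1 ≤ colourOf (exec colourPair σ) a b)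
    colourPair-correct = cond-rule (lit 1 ≤ⁿ # 25) (setN 14 (at₀ 33 34) (# 25)) (setN 14 (at₀ 33 34) (# 24 ⊕ lit 1))
      (λ ρ → Result (exec bump ρ)) σ₂ hit new
      where
      hit : 1 ≤ H → Result (exec bump (coloured H))
      hit p with H in eq
      ... | suc c = bumped c (chosen-hit eq)
      new : ¬ 1 ≤ H → Result (exec bump (coloured (C + 1)))
      new np = subst (λ x → Result (exec bump (coloured x))) (ℕₚ.+-comm 1 C) (bumped C (chosen-new (ℕₚ.n<1⇒n≡0 (ℕₚ.≰⇒> np))))

  colourPairs-correct : ∀ σ → Env σ → Separated σ → (∀ x → labelOf σ x ≡ lab x) → (∀ j → nats σ 14 j ≡ 0) → nats σ 17 0 ≡ 0 →
    Good (colourOf (exec colourPairs σ)) (nats (exec colourPairs σ) 17 0) ×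
    (∀ u v → TreePair u v → 1 ≤ colourOf (exec colourPairs σ) u v)
  colourPairs-correct σ e sp lb z14 z17 = for-all2 {33} {34} {whenAll pairTests colourPair} σ (size e) refl
    (λ ρ → Good (colourOf ρ) (nats ρ 17 0)) (λ u v ρ → TreePair u v → 1 ≤ colourOf ρ u v)
    (λ _ h → h) (λ _ _ _ h → h) (λ _ h → h) (λ _ _ _ h → h)
    (good-cong (λ u v → sym (z14 _)) (sym z17) good-start) step
    where
    step : ∀ u v ρ → nats ρ 33 0 ≡ toℕ u → nats ρ 34 0 ≡ toℕ v → Frame colourPairs σ ρ → Good (colourOf ρ) (nats ρ 17 0) →
      Good (colourOf (exec (whenAll pairTests colourPair) ρ)) (nats (exec (whenAll pairTests colourPair) ρ) 17 0) ×
      (TreePair u v → 1 ≤ colourOf (exec (whenAll pairTests colourPair) ρ) u v) ×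
      (∀ u' v' → (TreePair u' v' → 1 ≤ colourOf ρ u' v') → TreePair u' v' → 1 ≤ colourOf (exec (whenAll pairTests colourPair) ρ) u' v')
    step u v ρ cu cv fr g = whenAll-rule pairTests colourPair
      (λ τ → Good (colourOf τ) (nats τ 17 0) × (TreePair u v → 1 ≤ colourOf τ u v) ×
             (∀ u' v' → (TreePair u' v' → 1 ≤ colourOf ρ u' v') → TreePair u' v' → 1 ≤ colourOf τ u' v')) ρ
      (λ h → let (a , b , c) = PairStep.colourPair-correct ρ eρ spρ lbρ cu cv g (untests h) in a , (λ _ → b) , λ u' v' f t → c u' v' (f t))
      (λ nh → g , (λ t → ⊥-elim (nh (tests t))) , λ _ _ f t → f t)
      where
      eρ = env-frame colourPairs refl fr e
      spρ = separated-frame colourPairs refl fr sp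
      lbρ : ∀ x → labelOf ρ x ≡ lab x
      lbρ x = trans (frameN fr 13 refl _) (lb x)
      lu : nats ρ 13 (nats ρ 33 0) ≡ lab u
      lu = trans (cong (nats ρ 13) cu) (lbρ u)
      lv : nats ρ 13 (nats ρ 34 0) ≡ lab v
      lv = trans (cong (nats ρ 13) cv) (lbρ v)
      tests : TreePair u v → Holds pairTests ρ
      tests (ne , l , is) = (λ h → ne (same⁻ ρ cu cv h)) ∷
        sameᵗ-complete (13 [ # 33 ]) (13 [ # 34 ]) ρ (trans lu (trans l (sym lv))) ∷ at-sep⁺ eρ spρ cu cv is ∷ []
      untests : Holds pairTests ρ → TreePair u v
      untests (h₁ ∷ h₂ ∷ h₃ ∷ []) = (λ q → h₁ (same⁺ ρ cu cv q)) ,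
        trans (sym lu) (trans (sameᵗ-sound (13 [ # 33 ]) (13 [ # 34 ]) ρ h₂) lv) , at-sep⁻ eρ spρ cu cv h₃

-- The dynamic program

directClauses : List Clause
directClauses = (sameᵗ (# 30) (# 31) ∷ [] , zeroʳ) ∷ (present 2 (at₀ 30 31) ∷ [] , 1 [ at₀ 30 31 ]ʳ)
              ∷ (present 1 (at₀ 30 31) ∷ (zeroʳ ≤ʳ (0 [ at₀ 30 31 ]ʳ)) ∷ [] , 0 [ at₀ 30 31 ]ʳ) ∷ []

direct : Command
direct = fill 5 5 (lit 0) directClauses ⨟ pivots 5 5 (lit 0) []

doubleUp : Command
doubleUp = setN 16 (# 30 ⊕ lit 1) ((16 [ # 30 ]) ⊕ (16 [ # 30 ])) ⨟ setN 18 (lit 0) (# 18 ⊕ # 18)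

-- A set gains colour `j` by adding `2 ^ j`, so its matrix lies `2 ^ j` times n² cells further on.
-- Doubling supplies these offsets and the number of masks.
powers : Command
powers = setN 16 (lit 0) (# 20) ⨟ setN 18 (lit 0) (lit 1) ⨟ for 30 colours doubleUp

module Direct {ℝ : Reals} {n : ℕ} (G : MixedGraph ℝ n) where
  open Real ℝ
  open MixedGraph G
  open Walks G
  open Combine G using (Entries)
  open Relax {ℝ}
  open State
  open Stages G
  open Fills G
  open Static G

  S₅ : Semantics
  S₅ m s t x = Σ (s ⟶* t) λ p → negs p ≡ [] × wt p ≡ x

  NonNegStep : V → V → Set
  NonNegStep u v = Σ (Step G u v) λ e → negStep e ≡ []

  module _ (σ₀ : State ℝ) (e₀ : Env σ₀) (z : ∀ j → nats σ₀ 5 j ≡ 0) where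
    private
      module F₅ = Fill 5 5 (lit 0) directClauses 0 S₅ σ₀
      σ₁ = exec F₅.program σ₀
      module P₅ = Pivot 5 5 (lit 0) [] 0 S₅ σ₁
      module C₅ = Closure NonNegStep (λ (e , _) → stepWeight G e)
      open Table 5 5

      single : ∀ {s t x} (e : Step G s t) → negStep e ≡ [] → x ≡ stepWeight G e → S₅ 0 s t x
      single e h refl = e ◅ ε , trans (++-identityʳ _) h , +ᵣ-identityʳ _

      nonneg-edge : ∀ {u v w} (q : edge u v ≡ just w) → 0# ≤ᵣ w → negStep (along-edge w q) ≡ []
      nonneg-edge {w = w} q h with 0# ≤ᵣ? w
      ... | yes _ = refl
      ... | no nh = ⊥-elim (nh h)

      edge-nonneg : ∀ {u v w} (q : edge u v ≡ just w) → negStep (along-edge w q) ≡ [] → 0# ≤ᵣ w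
      edge-nonneg {w = w} q h with 0# ≤ᵣ? w
      ... | yes k = k

      value : ∀ {ts e} → (ts , e) ∈ˡ directClauses → ∀ (s t : V) σ → At 30 s σ → At 31 t σ → Frame F₅.program σ₀ σ →
              Holds ts σ → S₅ 0 s t (evalʳ σ e)
      value (here refl) s t σ a b fr (h ∷ []) with same⁻ σ a b h
      ... | refl = ε , refl , refl
      value (there (here refl)) s t σ a b fr (h ∷ []) =
        let e = env-frame F₅.program refl fr e₀ ; (w , q , r) = arc-present e (at-present⁻ 2 e a b h)
        in single (along-arc w q) refl (trans (cong (reals σ 1) (at-eval₀ e a b)) r)
      value (there (there (here refl))) s t σ a b fr (h ∷ k ∷ []) =
        let e = env-frame F₅.program refl fr e₀ ; (w , q , r) = edge-present e (at-present⁻ 1 e a b h)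
            r' = trans (cong (reals σ 0) (at-eval₀ e a b)) r
        in single (along-edge w q) (nonneg-edge q (subst (0# ≤ᵣ_) r' k)) r'

      filled = F₅.fill-correct e₀ refl refl refl refl (λ _ _ → refl) value
                 (snd λ j p → ⊥-elim (ℕₚ.<-irrefl refl (subst (1 ≤_) (z j) p)))

      loops : ∀ s → Ent 5 5 0 σ₁ s s 0#
      loops s = proj₂ (proj₂ filled) (here refl) s s 0# λ ρ a b fr → (same⁺ ρ a b refl ∷ []) , ≤ᵣ-refl

      steps : ∀ {u v} (e : NonNegStep u v) → Ent 5 5 0 σ₁ u v (stepWeight G (proj₁ e))
      steps {u} {v} (along-arc w q , _) = proj₂ (proj₂ filled) (there (here refl)) u v w λ ρ a b fr →
        let e = env-frame F₅.program refl fr e₀ in (at-present⁺ 2 e a b (proj₁ (present-arc e q)) ∷ []) ,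
          ≤ᵣ-reflexive (trans (cong (reals ρ 1) (at-eval₀ e a b)) (proj₂ (present-arc e q)))
      steps {u} {v} (along-edge w q , h) = proj₂ (proj₂ filled) (there (there (here refl))) u v w λ ρ a b fr →
        let e = env-frame F₅.program refl fr e₀ ; r = trans (cong (reals ρ 0) (at-eval₀ e a b)) (proj₂ (present-edge e q))
        in (at-present⁺ 1 e a b (proj₁ (present-edge e q)) ∷ subst (0# ≤ᵣ_) (sym r) (edge-nonneg q h) ∷ []) , ≤ᵣ-reflexive r

      closed : SoundT 5 5 S₅ (exec P₅.program σ₁) × C₅.Closed n (Ent 5 5 0 (exec P₅.program σ₁))
      closed = proj₂ (P₅.pivots-correct (env-frame F₅.program refl (frame F₅.program σ₀) e₀) (checks refl refl refl refl refl) (λ _ _ → refl)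
        (λ k s t σ _ _ _ _ _ (p , a , b) (q , c , d) → p ◅◅ q , trans (negs-++ p q) (cong₂ _++_ a c) , trans (wt-++ p q) (cong₂ _+ᵣ_ b d))
        (λ _ _ _ → ⊤) (λ _ _ _ _ _ _ _ _ _ → []) C₅.Closed C₅.closed-same C₅.closed-step (proj₁ (proj₂ filled))
        (C₅.closed-start loops steps))

    direct-sound : SoundT 5 5 S₅ (exec direct σ₀)
    direct-sound = proj₁ closed

    -- Arcs may be negative, so cycles without negative edges can have negative weight. Their
    -- absence is assumed here and is supplied by the later check of the diagonal.
    direct-complete : (∀ {s x} → Ent 5 5 0 (exec direct σ₀) s s x → 0# ≤ᵣ x) →
                      ∀ {s t} (p : s ⟶* t) → negs p ≡ [] → Ent 5 5 0 (exec direct σ₀) s t (wt p)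
    direct-complete d {s} {t} p h = subst (Ent 5 5 0 (exec direct σ₀) s t) (convert-total p h)
      (C₅.closed-total {Ent 5 5 0 (exec direct σ₀)} AtMost-weaken (proj₂ closed) (λ {s} → d {s}) (convert p h))
      where
      ++-nilˡ : ∀ (l : List (V × V)) {k} → l ++ k ≡ [] → l ≡ []
      ++-nilˡ [] _ = refl
      ++-nilʳ : ∀ (l : List (V × V)) {k} → l ++ k ≡ [] → k ≡ []
      ++-nilʳ [] e = e
      convert : ∀ {s t} (p : s ⟶* t) → negs p ≡ [] → Star NonNegStep s t
      convert ε       h = ε
      convert (e ◅ p) h = (e , ++-nilˡ (negStep e) h) ◅ convert p (++-nilʳ (negStep e) h)
      convert-total : ∀ {s t} (p : s ⟶* t) (h : negs p ≡ []) → C₅.total (convert p h) ≡ wt p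
      convert-total ε       h = refl
      convert-total (e ◅ p) h = cong (stepWeight G e +ᵣ_) (convert-total p (++-nilʳ (negStep e) h))

  powers-correct : ∀ σ → nats (exec powers σ) 18 0 ≡ 2 ^ nats σ 17 0 ×
                   (∀ j → j ≤ nats σ 17 0 → nats (exec powers σ) 16 j ≡ 2 ^ j * nats σ 20 0)
  powers-correct σ = for-rule {i = 30} {colours} {doubleUp} σ₁ K refl refl Inv
      (refl , λ { zero z≤n → sym (ℕₚ.+-identityʳ _) }) step
    where
    K = nats σ 17 0
    N = nats σ 20 0
    σ₁ = exec (setN 18 (lit 0) (lit 1)) (exec (setN 16 (lit 0) (# 20)) σ)
    Inv : ℕ → State ℝ → Set
    Inv k ρ = nats ρ 18 0 ≡ 2 ^ k × (∀ j → j ≤ k → nats ρ 16 j ≡ 2 ^ j * N)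
    twice : ∀ x → x + x ≡ 2 * x
    twice x = cong (x +_) (sym (ℕₚ.+-identityʳ x))
    step : ∀ k ρ → k < K → nats ρ 30 0 ≡ k → Frame (for 30 colours doubleUp) σ₁ ρ → Inv k ρ → Inv (suc k) (increment 30 (exec doubleUp ρ))
    step k ρ k<K c fr (m , h) = trans (cong₂ _+_ m m) (twice (2 ^ k)) , go
      where
      go : ∀ j → j ≤ suc k → update (nats ρ) 16 (nats ρ 30 0 + 1) (nats ρ 16 (nats ρ 30 0) + nats ρ 16 (nats ρ 30 0)) 16 j ≡ 2 ^ j * N
      go j le with ℕₚ.m≤n⇒m<n∨m≡n le
      ... | inj₁ (s≤s lt) = trans (update-cell (nats ρ) 16 (nats ρ 30 0 + 1) _ j
              (λ q → ℕₚ.<-irrefl (sym (trans (sym (trans (ℕₚ.+-comm (nats ρ 30 0) 1) (cong suc c))) q)) (s≤s lt))) (h j lt)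
      ... | inj₂ refl = trans (cong (λ i → update (nats ρ) 16 i (nats ρ 16 (nats ρ 30 0) + nats ρ 16 (nats ρ 30 0)) 16 (suc k))
                (trans (ℕₚ.+-comm (nats ρ 30 0) 1) (cong suc c)))
              (trans (update-same (nats ρ) 16 (suc k) _) (trans (cong₂ _+_ cell cell) (trans (twice (2 ^ k * N)) (sym (ℕₚ.*-assoc 2 (2 ^ k) N)))))
        where cell : nats ρ 16 (nats ρ 30 0) ≡ 2 ^ k * N
              cell = trans (cong (nats ρ 16) c) (h k ℕₚ.≤-refl)

module MaskSound {ℝ : Reals} {n : ℕ} (G : MixedGraph ℝ n) (F : Forests.Forest G) (Cl : Forests.Colouring G F) where
  open Real ℝ
  open MixedGraph G
  open Walks G
  open Forests G
  open Blocks G using (distinct-split)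
  open Bits
  open Forest F
  open Colouring Cl

  -- It suffices that `m` contains the colours that occur: a free colour then belongs to no negative
  -- edge of the walk.
  Coloured : ℕ → V → V → Carrier → Set
  Coloured m s t x = Σ (s ⟶* t) λ p → wt p ≡ x × NegSimple p ×
                     (∀ {a b} → (a , b) ∈ˡ negs p → ∃[ i ] col a b ≡ suc i × bit m i ≡ true)

  -- Conservativity is still undecided when the entry is written, and without it a walk cannot be
  -- cut down to a path of no larger weight.
  Realized : V → V → Carrier → Set
  Realized s t x = Conservative G → Σ (s ⟶* t) λ p → Path p × wt p ≤ᵣ x

  coloured-realized : ∀ {m s t x} → Coloured m s t x → Realized s t x
  coloured-realized (p , refl , s , _) cons = let (q , a , b , _) = reduce cons p s in q , a , b

  prepend : ∀ {m s u t x y} (p : s ⟶* u) → negs p ≡ [] → wt p ≡ y → Coloured m u t x → Coloured m s t (y +ᵣ x)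
  prepend p h refl (q , refl , s , c) = p ◅◅ q , wt-++ p q , subst Distinct (sym eq) s , λ m → c (subst (_ ∈ˡ_) eq m)
    where eq : negs (p ◅◅ q) ≡ negs q
          eq = trans (negs-++ p q) (cong (_++ negs q) h)

  insep-adj : ∀ {a b} → NegAdj a b → Insep a b
  insep-adj {a} {b} (w , q , _) =
    insep-step (along-edge w q ◅ ε , along-edge w (trans (edge-sym b a) q) ◅ ε) (inj₁ (along-edge w q))

  neg-≢ : ∀ {a b} → NegAdj a b → a ≢ b
  neg-≢ {a} (w , q , _) refl = case trans (sym (edge-loop a)) q of λ ()

  -- The path joins inseparable vertices, so each of its edges lies in their block. It also lies in
  -- their tree, and a tree has only one colour in a block.
  tree-colour : ∀ {u v j} (c : col u v ≡ suc j) → ∀ {a b} → (a , b) ∈ˡ negs (proj₁ (tree (proj₁ (proj₂ (pair c))))) → col a b ≡ suc j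
  tree-colour {u} {v} {j} c {a} {b} m =
    let (a≢ , l , is) = pair c
        (p , hp , ng , _) = tree l
        (a∈ , b∈ , adj) = negs-ends p m
        (au , av) = path-insep p hp is (inits⊆vs p a∈)
        (bu , bv) = path-insep p hp is b∈
        (j' , c' , _) = some (neg-≢ adj) (negLab adj) (insep-adj adj)
    in trans c' (cong suc (same c' c ((au , av) , (bu , bv)) (lab-on p ng (inits⊆vs p a∈))))
    where
    lab-on : ∀ {s t x} (p : s ⟶* t) → AllNeg p → x ∈ˡ vs p → lab x ≡ lab s
    lab-on ε _ (here refl) = refl
    lab-on (e ◅ p) _ (here refl) = refl
    lab-on (e ◅ p) (h , hs) (there m) = trans (lab-on p hs m)
      (sym (negLab (proj₂ (proj₂ (negs-ends (e ◅ p) (subst (λ l → _ ∈ˡ l ++ negs p) (sym h) (here refl)))))))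

  same-edge-colour : ∀ {e f i j} → NegAdj (proj₁ e) (proj₂ e) → col (proj₁ e) (proj₂ e) ≡ suc i → col (proj₁ f) (proj₂ f) ≡ suc j → e ~ᵉ f → i ≡ j
  same-edge-colour adj c d (inj₁ (refl , refl)) = ℕₚ.suc-injective (trans (sym c) d)
  same-edge-colour adj c d (inj₂ (refl , refl)) = same c d ((insep-adj adj , insep-refl) , (insep-refl , insep-adj (reversed adj))) (negLab adj)

  -- All edges of the tree path have colour `j`, and no negative edge of the remaining walk has it,
  -- because `j` is free. So the composed walk repeats no negative edge.
  through-tree : ∀ {m u v t j x} → col u v ≡ suc j → bit m j ≡ false → Coloured m v t x → Coloured (m + 2 ^ j) u t (W u v +ᵣ x)
  through-tree {m} {u} {v} {t} {j} c free (q , refl , s , cq) =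
    p ◅◅ q , trans (wt-++ p q) (cong (_+ᵣ wt q) (proj₂ (proj₂ (proj₂ tr)))) ,
    subst Distinct (sym (negs-++ p q)) (AllPairsₚ.++⁺ (path-negSimple p (proj₁ (proj₂ tr))) s
      (All′.tabulate λ {e} me → All′.tabulate λ {f} mf → apart me mf)) ,
    λ mm → colours' (∈-++⁻ (negs p) (subst (_ ∈ˡ_) (negs-++ p q) mm))
    where
    tr = tree (proj₁ (proj₂ (pair c)))
    p = proj₁ tr
    apart : ∀ {e f} → e ∈ˡ negs p → f ∈ˡ negs q → ¬ e ~ᵉ f
    apart {e} {f} me mf s =
      let (i , ci , bi) = cq mf
      in case trans (sym free) (subst (λ z → bit m z ≡ true)
           (sym (same-edge-colour {e} {f} (proj₂ (proj₂ (negs-ends p me))) (tree-colour c me) ci s)) bi) of λ ()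
    colours' : ∀ {a b} → (a , b) ∈ˡ negs p ⊎ (a , b) ∈ˡ negs q → ∃[ i ] col a b ≡ suc i × bit (m + 2 ^ j) i ≡ true
    colours' (inj₁ k) = j , tree-colour c k , trans (bit-add j m j free) (cong (λ b → if b then true else bit m j) (≡ᵇ-refl j))
    colours' (inj₂ k) = let (i , ci , bi) = cq k in i , ci , trans (bit-add j m i free) (either (i ≡ᵇ j) bi)
      where either : ∀ b {x} → x ≡ true → (if b then true else x) ≡ true
            either true  _ = refl
            either false h = h

initialF : Command
initialF = fill 8 8 (lit 0) ((sameᵗ (# 30) (# 31) ∷ [] , zeroʳ) ∷ [])

stepDTests : List Test
stepDTests = present 5 (at₀ 30 31) ∷ present 8 (at (# 19) 31 32) ∷ []

stepDSum : RealExp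
stepDSum = (5 [ at₀ 30 31 ]ʳ) ⊕ʳ (8 [ at (# 19) 31 32 ]ʳ)

stepDBody : Command
stepDBody = relaxWhen 9 9 stepDTests (at (# 19) 30 32) stepDSum

stepD : Command
stepD = for3 30 31 32 stepDBody

stepRClauses : List Clause
stepRClauses = (present 9 (at (# 19) 30 31) ∷ [] , 9 [ at (# 19) 30 31 ]ʳ) ∷ []

stepR : Command
stepR = fill 4 2 (lit 0) stepRClauses

-- The cell holds the colour plus 1, since 0 marks pairs without colour.
colourIx : NatExp
colourIx = (14 [ at₀ 30 31 ]) ⊖ lit 1

stepFTests : List Test
stepFTests = present 14 (at₀ 30 31) ∷ ((15 [ colourIx ]) ≤ⁿ lit 0) ∷ present 9 (at (# 19) 31 32) ∷ []

stepFSum : RealExp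
stepFSum = (22 [ at₀ 30 31 ]ʳ) ⊕ʳ (9 [ at (# 19) 31 32 ]ʳ)

stepFTarget : NatExp
stepFTarget = at (# 19 ⊕ (16 [ colourIx ])) 30 32

stepFBody : Command
stepFBody = relaxWhen 8 8 stepFTests stepFTarget stepFSum

stepF : Command
stepF = for3 30 31 32 stepFBody

-- The digits of the current mask are kept in an array, because extracting them from a number is no
-- single operation. After each mask they are advanced like an odometer, with the carry in cell 23.
clearBit setBit flipBit odometerBody odometer advance maskBody maskLoop : Command
clearBit = setN 15 (# 30) (lit 0)
setBit = setN 15 (# 30) (lit 1) ⨟ setN 23 (lit 0) (lit 0)
flipBit = cond (lit 1 ≤ⁿ (15 [ # 30 ])) clearBit setBit
odometerBody = cond (lit 1 ≤ⁿ # 23) flipBit nop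
odometer = setN 23 (lit 0) (lit 1) ⨟ for 30 colours odometerBody
advance = setN 19 (lit 0) (# 19 ⊕ # 20)
maskBody = stepD ⨟ stepR ⨟ stepF ⨟ odometer ⨟ advance
maskLoop = for 35 masks maskBody

module Odometer {ℝ : Reals} where
  open State
  open Relax {ℝ}
  open Bits

  bitℕ : Bool → ℕ
  bitℕ true  = 1
  bitℕ false = 0

  shift : ℕ → ℕ → ℕ
  shift zero    m = m
  shift (suc k) m = shift k ⌊ m /2⌋

  bit-shift : ∀ k m → bit m k ≡ odd (shift k m)
  bit-shift zero    m = refl
  bit-shift (suc k) m = bit-shift k ⌊ m /2⌋

  shift-half : ∀ k m → shift (suc k) m ≡ ⌊ shift k m /2⌋
  shift-half zero    m = refl
  shift-half (suc k) m = shift-half k ⌊ m /2⌋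

  HasBits : ℕ → ℕ → State ℝ → Set
  HasBits K m σ = ∀ i → i < K → nats σ 15 i ≡ bitℕ (bit m i)

  module _ (m K : ℕ) where
    -- `value` says that beyond the first `k` digits the old and the new number differ exactly by
    -- the pending carry.
    record Carrying (k : ℕ) (σ : State ℝ) : Set where
      field
        carry : Bool
        cell  : nats σ 23 0 ≡ bitℕ carry
        value : shift k (suc m) ≡ (if carry then suc (shift k m) else shift k m)
        done  : ∀ i → i < k → i < K → nats σ 15 i ≡ bitℕ (bit (suc m) i)
        todo  : ∀ i → k ≤ i → i < K → nats σ 15 i ≡ bitℕ (bit m i)

    private
      step : ∀ k σ → k < K → nats σ 30 0 ≡ k → Carrying k σ → Carrying (suc k) (increment 30 (exec odometerBody σ))
      step k σ k<K ck inv = cond-rule (lit 1 ≤ⁿ # 23) flipBit nop Goal σ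
        (λ h → cond-rule (lit 1 ≤ⁿ (15 [ # 30 ])) clearBit setBit Goal σ (clear (carrying h)) (set (carrying h)))
        (λ nh → idle (not-carrying nh))
        where
        open Carrying inv
        Goal : State ℝ → Set
        Goal τ = Carrying (suc k) (increment 30 τ)
        carrying : 1 ≤ nats σ 23 0 → carry ≡ true
        carrying h with carry | cell
        ... | true  | _ = refl
        ... | false | e = case subst (1 ≤_) e h of λ ()
        not-carrying : ¬ 1 ≤ nats σ 23 0 → carry ≡ false
        not-carrying h with carry | cell
        ... | false | _ = refl
        ... | true  | e = ⊥-elim (h (subst (1 ≤_) (sym e) ℕₚ.≤-refl))
        bit-here : nats σ 15 (nats σ 30 0) ≡ bitℕ (bit m k)
        bit-here = trans (cong (nats σ 15) ck) (todo k ℕₚ.≤-refl k<K)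
        val : ∀ {c} → carry ≡ c → shift k (suc m) ≡ (if c then suc (shift k m) else shift k m)
        val refl = value
        next-bit : ∀ {c} → carry ≡ c → bit (suc m) k ≡ odd (if c then suc (shift k m) else shift k m)
        next-bit e = trans (bit-shift k (suc m)) (cong odd (val e))
        next-shift : ∀ {c} → carry ≡ c → shift (suc k) (suc m) ≡ ⌊ (if c then suc (shift k m) else shift k m) /2⌋
        next-shift e = trans (shift-half k (suc m)) (cong ⌊_/2⌋ (val e))
        write-done : ∀ x → x ≡ bitℕ (bit (suc m) k) → ∀ i → i < suc k → i < K → update (nats σ) 15 (nats σ 30 0) x 15 i ≡ bitℕ (bit (suc m) i)
        write-done x e i (s≤s le) i<K with update-case (nats σ) 15 (nats σ 30 0) x i
        ... | inj₁ (q , u) = trans u (trans e (cong (λ z → bitℕ (bit (suc m) z)) (trans (sym ck) q)))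
        ... | inj₂ u with ℕₚ.m≤n⇒m<n∨m≡n le
        ...   | inj₁ lt = trans u (done i lt i<K)
        ...   | inj₂ refl = trans (cong (λ z → update (nats σ) 15 z x 15 k) ck) (trans (update-same (nats σ) 15 k x) e)
        write-todo : ∀ x i → suc k ≤ i → i < K → update (nats σ) 15 (nats σ 30 0) x 15 i ≡ bitℕ (bit m i)
        write-todo x i le i<K = trans (update-cell (nats σ) 15 (nats σ 30 0) x i (λ q → ℕₚ.<-irrefl (trans (sym ck) q) le))
          (todo i (ℕₚ.≤-trans (ℕₚ.n≤1+n k) le) i<K)
        odd-m : bit m k ≡ odd (shift k m)
        odd-m = bit-shift k m
        is-one : 1 ≤ nats σ 15 (nats σ 30 0) → odd (shift k m) ≡ true
        is-one h = trans (sym odd-m) (lemma (bit m k) bit-here)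
          where lemma : ∀ b → nats σ 15 (nats σ 30 0) ≡ bitℕ b → b ≡ true
                lemma true  e = refl
                lemma false e = case subst (1 ≤_) e h of λ ()
        is-zero : ¬ 1 ≤ nats σ 15 (nats σ 30 0) → odd (shift k m) ≡ false
        is-zero h = trans (sym odd-m) (lemma (bit m k) bit-here)
          where lemma : ∀ b → nats σ 15 (nats σ 30 0) ≡ bitℕ b → b ≡ false
                lemma false e = refl
                lemma true  e = ⊥-elim (h (subst (1 ≤_) (sym e) ℕₚ.≤-refl))
        clear : carry ≡ true → 1 ≤ nats σ 15 (nats σ 30 0) → Goal (exec clearBit σ)
        clear e h = record
          { carry = true ; cell = trans cell (cong bitℕ e)
          ; value = trans (next-shift e) (trans (half-step (shift k m))
              (trans (cong (λ b → if b then suc ⌊ shift k m /2⌋ else ⌊ shift k m /2⌋) (is-one h)) (cong suc (sym (shift-half k m)))))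
          ; done = write-done 0 (cong bitℕ (sym (trans (next-bit e) (cong not (is-one h)))))
          ; todo = write-todo 0 }
        set : carry ≡ true → ¬ 1 ≤ nats σ 15 (nats σ 30 0) → Goal (exec setBit σ)
        set e h = record
          { carry = false ; cell = refl
          ; value = trans (next-shift e) (trans (half-step (shift k m))
              (trans (cong (λ b → if b then suc ⌊ shift k m /2⌋ else ⌊ shift k m /2⌋) (is-zero h)) (sym (shift-half k m))))
          ; done = write-done 1 (cong bitℕ (sym (trans (next-bit e) (cong not (is-zero h)))))
          ; todo = write-todo 1 }
        idle : carry ≡ false → Goal σ
        idle e = record
          { carry = false ; cell = trans cell (cong bitℕ e)
          ; value = trans (next-shift e) (sym (shift-half k m))
          ; done = λ i le i<K → idle-done i le i<K
          ; todo = λ i le → todo i (ℕₚ.≤-trans (ℕₚ.n≤1+n k) le) }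
          where
          idle-done : ∀ i → i < suc k → i < K → nats σ 15 i ≡ bitℕ (bit (suc m) i)
          idle-done i (s≤s le) i<K with ℕₚ.m≤n⇒m<n∨m≡n le
          ... | inj₁ lt = done i lt i<K
          ... | inj₂ refl = trans (todo k ℕₚ.≤-refl k<K) (cong bitℕ (trans odd-m (sym (next-bit e))))

    odometer-correct : ∀ σ → nats σ 17 0 ≡ K → HasBits K m σ → HasBits K (suc m) (exec odometer σ)
    odometer-correct σ eK h i i<K = Carrying.done
      (for-rule {i = 30} {colours} {odometerBody} (exec (setN 23 (lit 0) (lit 1)) σ) K eK refl Carrying
        (record { carry = true ; cell = refl ; value = refl ; done = λ _ () ; todo = λ i _ → h i })
        (λ k ρ k<K c fr inv → step k ρ k<K c inv)) i i<K i<K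

module Masks {ℝ : Reals} {n : ℕ} (G : MixedGraph ℝ n) (F : Forests.Forest G) (Cl : Forests.Colouring G F) where
  open Real ℝ
  open MixedGraph G
  open Walks G
  open Combine G using (Entries)
  open Forests G
  open Relax {ℝ}
  open State
  open Stages G
  open Fills G
  open Static G
  open Direct G using (S₅)
  open MaskSound G F Cl
  open Bits
  open Odometer {ℝ}
  open Forest F
  open Colouring Cl

  record Ctx (σ : State ℝ) : Set where
    constructor ctx
    field
      environment : Env σ
      square      : nats σ 20 0 ≡ n * n
      colourCells : ∀ u v → nats σ 14 (ix 0 u v) ≡ col u v
      weightCells : ∀ u v → reals σ 22 (ix 0 u v) ≡ W u v
      powerCells  : ∀ j → j ≤ K → nats σ 16 j ≡ 2 ^ j * (n * n)
      K-cell      : nats σ 17 0 ≡ K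
      M-cell      : nats σ 18 0 ≡ 2 ^ K
      direct₅     : SoundT 5 5 S₅ σ
  open Ctx public

  keepsCtx : Command → Bool
  keepsCtx p = keepsInput p ∧ not (writesN 20 p ∨ writesN 14 p ∨ writesR 22 p ∨ writesN 16 p ∨ writesN 17 p ∨ writesN 18 p ∨ writesN 5 p ∨ writesR 5 p)

  ctx-frame : ∀ p {σ τ} → keepsCtx p ≡ true → Frame p σ τ → Ctx σ → Ctx τ
  ctx-frame p k fr (ctx e a b c d f g h) =
    let w0 = not-true (∧-trueʳ {keepsInput p} k)
        w1 = ∨-falseʳ {writesN 20 p} w0 ; w2 = ∨-falseʳ {writesN 14 p} w1 ; w3 = ∨-falseʳ {writesR 22 p} w2
        w4 = ∨-falseʳ {writesN 16 p} w3 ; w5 = ∨-falseʳ {writesN 17 p} w4 ; w6 = ∨-falseʳ {writesN 18 p} w5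
    in ctx (env-frame p (∧-trueˡ k) fr e) (trans (frameN fr 20 (∨-falseˡ w0) 0) a)
           (λ u v → trans (frameN fr 14 (∨-falseˡ w1) _) (b u v)) (λ u v → trans (frameR fr 22 (∨-falseˡ w2) _) (c u v))
           (λ j le → trans (frameN fr 16 (∨-falseˡ w3) _) (d j le)) (trans (frameN fr 17 (∨-falseˡ w4) 0) f)
           (trans (frameN fr 18 (∨-falseˡ w5) 0) g)
           (Table.sound-frame 5 5 p fr (∨-falseˡ w6) (∨-falseʳ {writesN 5 p} w6) h)

  module StepD (m : ℕ) (σ : State ℝ) (c : Ctx σ) (off : nats σ 19 0 ≡ m * (n * n)) (so8 : SoundT 8 8 Coloured σ) where
    open Table 9 9

    module _ (s u t : V) (ρ : State ℝ) (cs : At 30 s ρ) (cu : At 31 u ρ) (ct : At 32 t ρ) (fr : Frame stepD σ ρ) where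
      cρ = ctx-frame stepD refl fr c
      eρ = environment cρ
      offρ : nats ρ 19 0 ≡ m * (n * n)
      offρ = trans (frameN fr 19 refl 0) off
      i₁ : evalⁿ ρ (at₀ 30 31) ≡ ix 0 s u
      i₁ = at-eval₀ eρ cs cu
      i₂ : evalⁿ ρ (at (# 19) 31 32) ≡ ix m u t
      i₂ = at-eval {m = m} (# 19) eρ offρ cu ct
      i₃ : evalⁿ ρ (at (# 19) 30 32) ≡ ix m s t
      i₃ = at-eval {m = m} (# 19) eρ offρ cs ct
      so8ρ : SoundT 8 8 Coloured ρ
      so8ρ = Table.sound-frame 8 8 stepD fr refl refl so8

      value : Holds stepDTests ρ → Tab Coloured (evalⁿ ρ (at (# 19) 30 32)) (evalʳ ρ stepDSum)
      value (h₁ ∷ h₂ ∷ []) =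
        let (p , hp , wp) = Table.entry (direct₅ cρ) _ h₁ 0 s u i₁
        in tab {Coloured} {m} {s} {t} i₃ (prepend p hp wp (Table.entry so8ρ _ h₂ m u t i₂))

      hit : ∀ {y z} → Ent 5 5 0 σ s u y → Ent 8 8 m σ u t z → AtMost (exec stepDBody ρ) (ix m s t) (y +ᵣ z)
      hit {y} {z} h₁ h₂ = relaxWhen-hit stepDTests (at (# 19) 30 32) stepDSum ρ
        (subst (λ j → 1 ≤ nats ρ 5 j) (sym i₁) (Table.AtMost.finite k₁) ∷ subst (λ j → 1 ≤ nats ρ 8 j) (sym i₂) (Table.AtMost.finite k₂) ∷ []) i₃
        (+ᵣ-mono-≤ (subst (λ j → reals ρ 5 j ≤ᵣ y) (sym i₁) (Table.AtMost.below k₁)) (subst (λ j → reals ρ 8 j ≤ᵣ z) (sym i₂) (Table.AtMost.below k₂)))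
        where
        k₁ = Table.preserve (Table.decreasing-frame 5 5 stepD fr refl refl) _ _ h₁
        k₂ = Table.preserve (Table.decreasing-frame 8 8 stepD fr refl refl) _ _ h₂

    module _ (so9 : Sound (Tab Coloured) σ) where
      private
        result = for3-relax {30} {31} {32} {stepDBody} (Tab Coloured) σ (size (environment c)) refl refl refl refl so9
          (λ s u t ρ cs cu ct gr → relaxWhen-decreasing stepDTests (at (# 19) 30 32) stepDSum ρ ,
             relaxWhen-sound (Tab Coloured) stepDTests (at (# 19) 30 32) stepDSum ρ (value s u t ρ cs cu ct (Grown.framed gr)) (Grown.sound gr))

      stepD-sound : Sound (Tab Coloured) (exec stepD σ)
      stepD-sound = proj₂ (proj₁ result)

      stepD-hit : ∀ {s u t y z} → Ent 5 5 0 σ s u y → Ent 8 8 m σ u t z → Ent 9 9 m (exec stepD σ) s t (y +ᵣ z)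
      stepD-hit {s} {u} {t} {y} {z} h₁ h₂ = proj₂ result s u t (ix m s t) (y +ᵣ z)
        (λ ρ cs cu ct gr → hit s u t ρ cs cu ct (Grown.framed gr) h₁ h₂)

  module StepR (m : ℕ) (σ : State ℝ) (c : Ctx σ) (off : nats σ 19 0 ≡ m * (n * n)) (so9 : SoundT 9 9 Coloured σ) where
    open Table 4 2
    SR : Semantics
    SR _ = Realized

    private
      module F₄ = Fill 4 2 (lit 0) stepRClauses 0 SR σ

      module _ (s t : V) (ρ : State ℝ) (cs : At 30 s ρ) (ct : At 31 t ρ) (fr : Frame stepR σ ρ) where
        idx : evalⁿ ρ (at (# 19) 30 31) ≡ ix m s t
        idx = at-eval {m = m} (# 19) (environment (ctx-frame stepR refl fr c)) (trans (frameN fr 19 refl 0) off) cs ct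

      value : ∀ {ts e} → (ts , e) ∈ˡ stepRClauses → ∀ (s t : V) ρ → At 30 s ρ → At 31 t ρ → Frame stepR σ ρ → Holds ts ρ → SR 0 s t (evalʳ ρ e)
      value (here refl) s t ρ cs ct fr (h ∷ []) =
        coloured-realized (Table.entry (Table.sound-frame 9 9 stepR fr refl refl so9) _ h m s t (idx s t ρ cs ct fr))

    module _ (so4 : Sound (Tab SR) σ) where
      private result = F₄.fill-correct (environment c) refl refl refl refl (λ _ _ → refl) value so4

      stepR-decreasing : Decreasing σ (exec stepR σ)
      stepR-decreasing = proj₁ result

      stepR-sound : Sound (Tab SR) (exec stepR σ)
      stepR-sound = proj₁ (proj₂ result)

      stepR-hit : ∀ {s t x} → Ent 9 9 m σ s t x → Ent 4 2 0 (exec stepR σ) s t x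
      stepR-hit {s} {t} {x} h = proj₂ (proj₂ result) (here refl) s t x λ ρ cs ct fr →
        let i = idx s t ρ cs ct fr
            k = Table.preserve (Table.decreasing-frame 9 9 stepR fr refl refl) _ _ h
        in (subst (λ j → 1 ≤ nats ρ 9 j) (sym i) (Table.AtMost.finite k) ∷ []) , subst (λ j → reals ρ 9 j ≤ᵣ x) (sym i) (Table.AtMost.below k)

  module StepF (m : ℕ) (σ : State ℝ) (c : Ctx σ) (off : nats σ 19 0 ≡ m * (n * n)) (bits : HasBits K m σ) (so9 : SoundT 9 9 Coloured σ) where
    open Table 8 8

    module _ (u v t : V) (ρ : State ℝ) (cu : At 30 u ρ) (cv : At 31 v ρ) (ct : At 32 t ρ) (fr : Frame stepF σ ρ) where
      cρ = ctx-frame stepF refl fr c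
      eρ = environment cρ
      i₁ : evalⁿ ρ (at₀ 30 31) ≡ ix 0 u v
      i₁ = at-eval₀ eρ cu cv
      i₂ : evalⁿ ρ (at (# 19) 31 32) ≡ ix m v t
      i₂ = at-eval {m = m} (# 19) eρ (trans (frameN fr 19 refl 0) off) cv ct
      so9ρ : SoundT 9 9 Coloured ρ
      so9ρ = Table.sound-frame 9 9 stepF fr refl refl so9
      colour-cell : nats ρ 14 (evalⁿ ρ (at₀ 30 31)) ≡ col u v
      colour-cell = trans (cong (nats ρ 14) i₁) (colourCells cρ u v)
      weight-cell : reals ρ 22 (evalⁿ ρ (at₀ 30 31)) ≡ W u v
      weight-cell = trans (cong (reals ρ 22) i₁) (weightCells cρ u v)

      module _ {j : ℕ} (cj : col u v ≡ suc j) where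
        j<K : j < K
        j<K = let (a , b , d) = pair cj ; (j' , cj' , lt) = some a b d in subst (_< K) (ℕₚ.suc-injective (trans (sym cj') cj)) lt
        ixj : evalⁿ ρ colourIx ≡ j
        ixj = cong (_∸ 1) (trans colour-cell cj)
        bit-cell : nats ρ 15 (evalⁿ ρ colourIx) ≡ bitℕ (bit m j)
        bit-cell = trans (cong (nats ρ 15) ixj) (trans (frameN fr 15 refl j) (bits j j<K))
        i₃ : evalⁿ ρ stepFTarget ≡ ix (m + 2 ^ j) u t
        i₃ = at-eval {m = m + 2 ^ j} (# 19 ⊕ (16 [ colourIx ])) eρ
          (trans (cong₂ _+_ (trans (frameN fr 19 refl 0) off) (trans (cong (nats ρ 16) ixj) (powerCells cρ j (ℕₚ.<⇒≤ j<K))))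
            (sym (ℕₚ.*-distribʳ-+ (n * n) m (2 ^ j)))) cu ct
        free⁻ : nats ρ 15 (evalⁿ ρ colourIx) ≤ 0 → bit m j ≡ false
        free⁻ h = lemma (bit m j) bit-cell
          where lemma : ∀ b → nats ρ 15 (evalⁿ ρ colourIx) ≡ bitℕ b → b ≡ false
                lemma false e = refl
                lemma true  e = case subst (_≤ 0) e h of λ ()
        free⁺ : bit m j ≡ false → nats ρ 15 (evalⁿ ρ colourIx) ≤ 0
        free⁺ e = ℕₚ.≤-reflexive (trans bit-cell (cong bitℕ e))

        value : nats ρ 15 (evalⁿ ρ colourIx) ≤ 0 → 1 ≤ nats ρ 9 (evalⁿ ρ (at (# 19) 31 32)) → Tab Coloured (evalⁿ ρ stepFTarget) (evalʳ ρ stepFSum)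
        value h₂ h₃ = tab {Coloured} {m + 2 ^ j} {u} {t} i₃
          (subst (λ w → Coloured (m + 2 ^ j) u t (w +ᵣ reals ρ 9 (evalⁿ ρ (at (# 19) 31 32)))) (sym weight-cell)
            (through-tree cj (free⁻ h₂) (Table.entry so9ρ _ h₃ m v t i₂)))

        hit : bit m j ≡ false → ∀ {x} → Ent 9 9 m σ v t x → AtMost (exec stepFBody ρ) (ix (m + 2 ^ j) u t) (W u v +ᵣ x)
        hit free {x} h = relaxWhen-hit stepFTests stepFTarget stepFSum ρ
          (subst (1 ≤_) (sym (trans colour-cell cj)) (s≤s z≤n) ∷ free⁺ free ∷ subst (λ i → 1 ≤ nats ρ 9 i) (sym i₂) (Table.AtMost.finite k) ∷ []) i₃
          (+ᵣ-mono-≤ (≤ᵣ-reflexive weight-cell) (subst (λ i → reals ρ 9 i ≤ᵣ x) (sym i₂) (Table.AtMost.below k)))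
          where k = Table.preserve (Table.decreasing-frame 9 9 stepF fr refl refl) _ _ h

      value-any : Holds stepFTests ρ → Tab Coloured (evalⁿ ρ stepFTarget) (evalʳ ρ stepFSum)
      value-any (h₁ ∷ h₂ ∷ h₃ ∷ []) = go (col u v) refl (subst (1 ≤_) colour-cell h₁)
        where go : ∀ x → col u v ≡ x → 1 ≤ x → Tab Coloured (evalⁿ ρ stepFTarget) (evalʳ ρ stepFSum)
              go (suc j) e _ = value e h₂ h₃

    module _ (so8 : Sound (Tab Coloured) σ) where
      private
        result = for3-relax {30} {31} {32} {stepFBody} (Tab Coloured) σ (size (environment c)) refl refl refl refl so8
          (λ u v t ρ cu cv ct gr → relaxWhen-decreasing stepFTests stepFTarget stepFSum ρ ,
             relaxWhen-sound (Tab Coloured) stepFTests stepFTarget stepFSum ρ (value-any u v t ρ cu cv ct (Grown.framed gr)) (Grown.sound gr))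

      stepF-decreasing : Decreasing σ (exec stepF σ)
      stepF-decreasing = proj₁ (proj₁ result)

      stepF-sound : Sound (Tab Coloured) (exec stepF σ)
      stepF-sound = proj₂ (proj₁ result)

      stepF-hit : ∀ {u v t j x} → col u v ≡ suc j → bit m j ≡ false → Ent 9 9 m σ v t x → Ent 8 8 (m + 2 ^ j) (exec stepF σ) u t (W u v +ᵣ x)
      stepF-hit {u} {v} {t} {j} {x} cj free h = proj₂ result u v t (ix (m + 2 ^ j) u t) (W u v +ᵣ x)
        (λ ρ cu cv ct gr → hit u v t ρ cu cv ct (Grown.framed gr) cj free h)

checkTests : List Test
checkTests = present 4 (at₀ 30 30) ∷ notᵗ (zeroʳ ≤ʳ (2 [ at₀ 30 30 ]ʳ)) ∷ []

flagBad check : Command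
flagBad = setN 21 (lit 0) (lit 1)
check = for 30 vertices (whenAll checkTests flagBad)

separatorTests : List Test
separatorTests = present 6 (at₀ 31 32) ∷ present 6 (at₀ 32 31) ∷ notᵗ (sameᵗ (# 30) (# 31)) ∷ notᵗ (sameᵗ (# 30) (# 32))
               ∷ notᵗ (present 7 (at (11 [ # 30 ]) 31 32)) ∷ []

throughSeparators : Command
throughSeparators = pivots 4 2 (lit 0) separatorTests

arcTests : List Test
arcTests = present 2 (at₀ 33 30) ∷ notᵗ (present 6 (at₀ 30 33)) ∷ present 4 (at₀ 31 33) ∷ present 4 (at₀ 30 32) ∷ []

arcSum : RealExp
arcSum = (2 [ at₀ 31 33 ]ʳ) ⊕ʳ ((1 [ at₀ 33 30 ]ʳ) ⊕ʳ (2 [ at₀ 30 32 ]ʳ))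

arcBody arcRow throughArcs : Command
arcBody = relaxWhen 4 2 arcTests (at₀ 31 32) arcSum
arcRow = for3 30 31 32 arcBody
throughArcs = for 33 vertices arcRow

module MaskLoop {ℝ : Reals} {n : ℕ} (G : MixedGraph ℝ n) (F : Forests.Forest G) (Cl : Forests.Colouring G F)
                (σ₀ : State ℝ) (c₀ : Masks.Ctx G F Cl σ₀) where
  open Real ℝ
  open MixedGraph G
  open Walks G
  open Relax {ℝ}
  open State
  open Stages G
  open Fills G
  open Static G
  open MaskSound G F Cl
  open Masks G F Cl
  open Bits
  open Odometer {ℝ}
  open Forests.Forest F
  open Forests.Colouring Cl
  open Derivations G F Cl (Ent 5 5 0 σ₀) using (DerF; nil; ext; Der; der)

  SR : Semantics
  SR _ = Realized

  -- The program pushes forward: the round for `m'` writes entries of table 8 for larger sets. So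
  -- `done` records these besides the entries of the result, and they are complete when the larger
  -- set has its turn.
  record Inv (m : ℕ) (σ : State ℝ) : Set where
    field
      off  : nats σ 19 0 ≡ m * (n * n)
      bits : HasBits K m σ
      so8  : SoundT 8 8 Coloured σ
      so9  : SoundT 9 9 Coloured σ
      so4  : SoundT 4 2 SR σ
      base : ∀ t → Ent 8 8 0 σ t t 0#
      done : ∀ {m' v t x} → m' < m → Der m' v t x → Ent 4 2 0 σ v t x ×
             (∀ {u j} → col u v ≡ suc j → bit m' j ≡ false → Ent 8 8 (m' + 2 ^ j) σ u t (W u v +ᵣ x))

  module Round (m : ℕ) (σ : State ℝ) (fr : Frame maskLoop σ₀ σ) (inv : Inv m σ) where
    open Inv inv
    cσ : Ctx σ
    cσ = ctx-frame maskLoop refl fr c₀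
    σ₁ = exec stepD σ
    σ₂ = exec stepR σ₁
    σ₃ = exec stepF σ₂
    σ₄ = exec odometer σ₃
    σ₅ = exec advance σ₄
    τ = increment 35 σ₅

    fr₁ = frame stepD σ
    fr₂ = frame stepR σ₁
    fr₃ = frame stepF σ₂
    fr₄ = frame odometer σ₃
    c₁ = ctx-frame stepD refl fr₁ cσ
    c₂ = ctx-frame stepR refl fr₂ c₁
    c₃ = ctx-frame stepF refl fr₃ c₂
    off₁ : nats σ₁ 19 0 ≡ m * (n * n)
    off₁ = trans (frameN fr₁ 19 refl 0) off
    off₂ : nats σ₂ 19 0 ≡ m * (n * n)
    off₂ = trans (frameN fr₂ 19 refl 0) off₁

    module D = StepD m σ cσ off so8
    so9₁ = D.stepD-sound so9
    module R = StepR m σ₁ c₁ off₁ so9₁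
    so4₁ = Table.sound-frame 4 2 stepD fr₁ refl refl so4
    so4₂ = R.stepR-sound so4₁
    so9₂ = Table.sound-frame 9 9 stepR fr₂ refl refl so9₁
    bits₂ : HasBits K m σ₂
    bits₂ i lt = trans (frameN fr₂ 15 refl i) (trans (frameN fr₁ 15 refl i) (bits i lt))
    module FF = StepF m σ₂ c₂ off₂ bits₂ so9₂
    so8₂ = Table.sound-frame 8 8 stepR fr₂ refl refl (Table.sound-frame 8 8 stepD fr₁ refl refl so8)
    so8₃ = FF.stepF-sound so8₂
    so9₃ = Table.sound-frame 9 9 stepF fr₃ refl refl so9₂
    so4₃ = Table.sound-frame 4 2 stepF fr₃ refl refl so4₂

    end : ∀ f r → (35 ≡ᵇ f) ≡ false → writesN f (odometer ⨟ advance) ≡ false → writesR r (odometer ⨟ advance) ≡ false → Table.Decreasing f r σ₃ τ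
    end f r ne wn wr = Table.decreasing-trans f r (Table.decreasing-frame f r (odometer ⨟ advance) (frame (odometer ⨟ advance) σ₃) wn wr)
      (Table.same-table f r (λ j → update-array (nats σ₅) 35 0 (nats σ₅ 35 0 + 1) f j ne) (λ _ → refl))

    end-sound : ∀ {S} f r → (35 ≡ᵇ f) ≡ false → writesN f (odometer ⨟ advance) ≡ false → writesR r (odometer ⨟ advance) ≡ false →
                Table.Sound f r S σ₃ → Table.Sound f r S τ
    end-sound f r ne wn wr s = Table.same-sound f r {σ = σ₅} (λ j → update-array (nats σ₅) 35 0 (nats σ₅ 35 0 + 1) f j ne) (λ _ → refl)
      (Table.sound-frame f r (odometer ⨟ advance) (frame (odometer ⨟ advance) σ₃) wn wr s)

    mono4 : Table.Decreasing 4 2 σ τ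
    mono4 = Table.decreasing-trans 4 2 (Table.decreasing-frame 4 2 stepD fr₁ refl refl)
      (Table.decreasing-trans 4 2 (R.stepR-decreasing so4₁)
        (Table.decreasing-trans 4 2 (Table.decreasing-frame 4 2 stepF fr₃ refl refl) (end 4 2 refl refl refl)))

    mono4' : Table.Decreasing 4 2 σ₂ τ
    mono4' = Table.decreasing-trans 4 2 (Table.decreasing-frame 4 2 stepF fr₃ refl refl) (end 4 2 refl refl refl)

    mono8 : Table.Decreasing 8 8 σ τ
    mono8 = Table.decreasing-trans 8 8 (Table.decreasing-frame 8 8 stepD fr₁ refl refl)
      (Table.decreasing-trans 8 8 (Table.decreasing-frame 8 8 stepR fr₂ refl refl)
        (Table.decreasing-trans 8 8 (FF.stepF-decreasing so8₂) (end 8 8 refl refl refl)))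

    -- Adding a colour makes the number of the set larger, so the smaller set was treated in an
    -- earlier round.
    F-complete : ∀ {k u t z} → DerF k u t z → k ≡ m → Ent 8 8 k σ u t z
    F-complete {u = u} nil _ = base u
    F-complete (ext {j = j} {m = m'} c free d df) refl = proj₂ (done (ℕₚ.m<m+n m' (ℕₚ.m^n>0 2 ⦃ _ ⦄ j)) (der d df)) c free

    D-complete : ∀ {s t x} → Der m s t x → Ent 9 9 m σ₁ s t x
    D-complete {s} {t} (der {u = u} d df) = D.stepD-hit so9 {s} {u} {t} (Table.preserve (Table.decreasing-frame 5 5 maskLoop fr refl refl) _ _ d) (F-complete {m} {u} {t} df refl)

    D-complete₂ : ∀ {s t x} → Der m s t x → Ent 9 9 m σ₂ s t x
    D-complete₂ {s} {t} h = Table.preserve (Table.decreasing-frame 9 9 stepR fr₂ refl refl) _ _ (D-complete {s} {t} h)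

    done′ : ∀ {m' v t x} → m' < suc m → Der m' v t x → Ent 4 2 0 τ v t x ×
            (∀ {u j} → col u v ≡ suc j → bit m' j ≡ false → Ent 8 8 (m' + 2 ^ j) τ u t (W u v +ᵣ x))
    done′ {m'} {v} {t} {x} (s≤s le) h = by-cases (ℕₚ.m≤n⇒m<n∨m≡n le)
      where
      by-cases : m' < m ⊎ m' ≡ m → Ent 4 2 0 τ v t x ×
                 (∀ {u j} → col u v ≡ suc j → bit m' j ≡ false → Ent 8 8 (m' + 2 ^ j) τ u t (W u v +ᵣ x))
      by-cases (inj₁ lt) = let (a , b) = done {m'} {v} {t} lt h in Table.preserve mono4 _ _ a , λ {u} c f → Table.preserve mono8 _ _ (b {u} c f)
      by-cases (inj₂ refl) = Table.preserve mono4' _ _ (R.stepR-hit so4₁ {v} {t} (D-complete {v} {t} h)) ,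
            λ {u} c f → Table.preserve (end 8 8 refl refl refl) _ _ (FF.stepF-hit so8₂ {u} {v} {t} c f (D-complete₂ {v} {t} h))

    next : Inv (suc m) τ
    next = record
      { off = trans (cong₂ _+_ (trans (frameN fr₄ 19 refl 0) (trans (frameN fr₃ 19 refl 0) off₂))
                               (trans (frameN fr₄ 20 refl 0) (square c₃))) (ℕₚ.+-comm (m * (n * n)) (n * n))
      ; bits = λ i lt → odometer-correct m K σ₃ (K-cell c₃) (λ i lt → trans (frameN fr₃ 15 refl i) (bits₂ i lt)) i lt
      ; so8 = end-sound 8 8 refl refl refl so8₃
      ; so9 = end-sound 9 9 refl refl refl so9₃
      ; so4 = end-sound 4 2 refl refl refl so4₃
      ; base = λ t → Table.preserve mono8 _ _ (base t)
      ; done = done′ }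

  maskLoop-correct : Inv 0 σ₀ → Inv (2 ^ K) (exec maskLoop σ₀)
  maskLoop-correct inv = for-rule {i = 35} {masks} {maskBody} σ₀ (2 ^ K) (M-cell c₀) refl Inv start
    (λ m σ _ _ fr i → Round.next m σ fr i)
    where
    open Inv inv
    keep : ∀ f r → (35 ≡ᵇ f) ≡ false → Table.Decreasing f r σ₀ (setCounter 35 0 σ₀)
    keep f r ne = Table.same-table f r (λ j → update-array (nats σ₀) 35 0 0 f j ne) (λ _ → refl)
    keep-sound : ∀ {S} f r → (35 ≡ᵇ f) ≡ false → Table.Sound f r S σ₀ → Table.Sound f r S (setCounter 35 0 σ₀)
    keep-sound f r ne = Table.same-sound f r {σ = σ₀} (λ j → update-array (nats σ₀) 35 0 0 f j ne) (λ _ → refl)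
    start : Inv 0 (setCounter 35 0 σ₀)
    start = record { off = off ; bits = bits ; so8 = keep-sound 8 8 refl so8 ; so9 = keep-sound 9 9 refl so9 ; so4 = keep-sound 4 2 refl so4
                   ; base = λ t → Table.preserve (keep 8 8 refl) _ _ (base t) ; done = λ () }

-- Check of the diagonal, separators and arcs

module FinalStages {ℝ : Reals} {n : ℕ} (G : MixedGraph ℝ n) where
  open Real ℝ
  open MixedGraph G
  open Walks G
  open Combine G
  open Relax {ℝ}
  open State
  open Stages G
  open Static G
  open ForAll {ℝ} {n}

  Realizes : Semantics
  Realizes _ s t x = Conservative G → Σ (s ⟶* t) λ p → Path p × wt p ≤ᵣ x

  NegativeEntry : State ℝ → Set
  NegativeEntry σ = Σ V λ s → 1 ≤ nats σ 4 (ix 0 s s) × ¬ 0# ≤ᵣ reals σ 2 (ix 0 s s)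

  check-correct : ∀ σ → Env σ → nats σ 21 0 ≡ 0 →
    (1 ≤ nats (exec check σ) 21 0 × NegativeEntry σ) ⊎
    (nats (exec check σ) 21 0 ≡ 0 × (∀ (s : V) → 1 ≤ nats σ 4 (ix 0 s s) → 0# ≤ᵣ reals σ 2 (ix 0 s s)))
  check-correct σ e z = finish (for-all {30} {body} σ (size e) refl Q P (λ _ h → h) (λ _ _ h → h) (inj₂ z) step)
    where
    body = whenAll checkTests flagBad
    Q : State ℝ → Set
    Q ρ = (1 ≤ nats ρ 21 0 × NegativeEntry σ) ⊎ nats ρ 21 0 ≡ 0
    P : V → State ℝ → Set
    P s ρ = nats ρ 21 0 ≡ 0 → 1 ≤ nats σ 4 (ix 0 s s) → 0# ≤ᵣ reals σ 2 (ix 0 s s)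
    finish : Q (exec check σ) × (∀ s → P s (exec check σ)) → _
    finish (inj₁ bad , _) = inj₁ bad
    finish (inj₂ ok , h)  = inj₂ (ok , λ s → h s ok)
    step : ∀ s ρ → nats ρ 30 0 ≡ toℕ s → Frame check σ ρ → Q ρ → Q (exec body ρ) × P s (exec body ρ) × (∀ s' → P s' ρ → P s' (exec body ρ))
    step s ρ c fr q = whenAll-rule checkTests flagBad (λ τ → Q τ × P s τ × (∀ s' → P s' ρ → P s' τ)) ρ
      (λ { (h₁ ∷ h₂ ∷ []) → inj₁ (s≤s z≤n , s , subst (1 ≤_) (cell4) h₁ , subst (λ x → ¬ 0# ≤ᵣ x) cell2 h₂) , (λ ()) , λ _ _ () })
      (λ nh → q , (λ _ p → nonneg nh p) , λ _ h → h)
      where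
      i : evalⁿ ρ (at₀ 30 30) ≡ ix 0 s s
      i = at-eval₀ (env-frame check refl fr e) c c
      cell4 : nats ρ 4 (evalⁿ ρ (at₀ 30 30)) ≡ nats σ 4 (ix 0 s s)
      cell4 = trans (cong (nats ρ 4) i) (frameN fr 4 refl _)
      cell2 : reals ρ 2 (evalⁿ ρ (at₀ 30 30)) ≡ reals σ 2 (ix 0 s s)
      cell2 = trans (cong (reals ρ 2) i) (frameR fr 2 refl _)
      nonneg : ¬ Holds checkTests ρ → 1 ≤ nats σ 4 (ix 0 s s) → 0# ≤ᵣ reals σ 2 (ix 0 s s)
      nonneg nh p with 0# ≤ᵣ? reals σ 2 (ix 0 s s)
      ... | yes h = h
      ... | no h = ⊥-elim (nh (subst (1 ≤_) (sym cell4) p ∷ subst (λ x → ¬ 0# ≤ᵣ x) (sym cell2) h ∷ []))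

  module ThroughSeparators (σ : State ℝ) (e : Env σ) (r : Reached σ) (sl : Slabs σ) (cn : Connected σ) where
    private
      module P = Pivot 4 2 (lit 0) separatorTests 0 Realizes σ
      open Table 4 2

      Guard : V → V → V → Set
      Guard c s t = s ≋ t × c ≢ s × c ≢ t × ¬ Conn c s t

      module _ (c s t : V) (ρ : State ℝ) (cc : At 30 c ρ) (cs : At 31 s ρ) (ct : At 32 t ρ) (fr : Frame throughSeparators σ ρ) where
        eρ = env-frame throughSeparators refl fr e
        rρ = reached-frame throughSeparators refl fr r
        cnρ = connected-frame throughSeparators refl fr cn
        slab-ix : evalⁿ ρ (at (11 [ # 30 ]) 31 32) ≡ ix (toℕ c) s t
        slab-ix = at-eval {m = toℕ c} (11 [ # 30 ]) eρ (trans (cong (nats ρ 11) cc) (slabAt (slabs-frame throughSeparators refl fr sl) c)) cs ct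

        guard⁻ : Holds separatorTests ρ → Guard c s t
        guard⁻ (h₁ ∷ h₂ ∷ h₃ ∷ h₄ ∷ h₅ ∷ []) =
          (reach⁻ rρ (at-present⁻ 6 eρ cs ct h₁) , reach⁻ rρ (at-present⁻ 6 eρ ct cs h₂)) ,
          (λ q → h₃ (same⁺ ρ cc cs q)) , (λ q → h₄ (same⁺ ρ cc ct q)) ,
          (λ q → h₅ (subst (λ j → 1 ≤ nats ρ 7 j) (sym slab-ix) (conn⁺ cnρ q)))

        guard⁺ : Guard c s t → Holds separatorTests ρ
        guard⁺ ((p , q) , a , b , d) = at-present⁺ 6 eρ cs ct (reach⁺ rρ p) ∷ at-present⁺ 6 eρ ct cs (reach⁺ rρ q) ∷
          (λ h → a (same⁻ ρ cc cs h)) ∷ (λ h → b (same⁻ ρ cc ct h)) ∷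
          (λ h → d (conn⁻ cnρ (subst (λ j → 1 ≤ nats ρ 7 j) slab-ix h))) ∷ []

        compose : ∀ {x y} → Holds separatorTests ρ → Realizes 0 s c x → Realizes 0 c t y → Realizes 0 s t (x +ᵣ y)
        compose hs f g cons =
          let ((_ , back) , _ , _ , sep) = guard⁻ hs ; (p , hp , lp) = f cons ; (q , hq , lq) = g cons
          in p ◅◅ q , separated-path p q hp hq back sep , ≤ᵣ-trans (≤ᵣ-reflexive (wt-++ p q)) (+ᵣ-mono-≤ lp lq)

    conn? : ∀ c s t → Dec (Conn c s t)
    conn? c s t with 1 ≤? nats σ 7 (ix (toℕ c) s t)
    ... | yes h = yes (conn⁻ cn h)
    ... | no h  = no (λ q → h (conn⁺ cn q))

    separators-correct : SoundT 4 2 Realizes σ → SeparatedBelow 0 (Ent 4 2 0 σ) →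
      SoundT 4 2 Realizes (exec throughSeparators σ) × SeparatedBelow n (Ent 4 2 0 (exec throughSeparators σ))
    separators-correct so i₀ = proj₂ (P.pivots-correct e (checks refl refl refl refl refl) (λ _ _ → refl)
      (λ c s t ρ cc cs ct fr hs f g → compose c s t ρ cc cs ct fr hs f g) Guard (λ c s t ρ cc cs ct fr g → guard⁺ c s t ρ cc cs ct fr g)
      SeparatedBelow (λ to _ h p hp b q → to (h p hp b q))
      (λ c E E' mono hit h → separate {E} {E'} c mono (conn? c) (λ a b d f → hit (a , b , d , f)) h) so i₀)

  module ThroughArcs (σ₀ : State ℝ) (e : Env σ₀) (r : Reached σ₀) where
    open Table 4 2

    module _ (u : V) (σ : State ℝ) (cu : At 33 u σ) (fr₀ : Frame throughArcs σ₀ σ) where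
      private
        eσ = env-frame throughArcs refl fr₀ e
        rσ = reached-frame throughArcs refl fr₀ r

        module _ (v s t : V) (ρ : State ℝ) (cv : At 30 v ρ) (cs : At 31 s ρ) (ct : At 32 t ρ) (gr : Grown (Tab Realizes) arcRow σ ρ) where
          fr = Grown.framed gr
          eρ = env-frame arcRow refl fr eσ
          rρ = reached-frame arcRow refl fr rσ
          cuρ : At 33 u ρ
          cuρ = trans (frameN fr 33 refl 0) cu
          i₁ : evalⁿ ρ (at₀ 31 33) ≡ ix 0 s u
          i₁ = at-eval₀ eρ cs cuρ
          i₂ : evalⁿ ρ (at₀ 30 32) ≡ ix 0 v t
          i₂ = at-eval₀ eρ cv ct
          i₃ : evalⁿ ρ (at₀ 31 32) ≡ ix 0 s t
          i₃ = at-eval₀ eρ cs ct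
          i₄ : evalⁿ ρ (at₀ 33 30) ≡ ix 0 u v
          i₄ = at-eval₀ eρ cuρ cv

          value : Holds arcTests ρ → Tab Realizes (evalⁿ ρ (at₀ 31 32)) (evalʳ ρ arcSum)
          value (h₁ ∷ h₂ ∷ h₃ ∷ h₄ ∷ []) = tab {Realizes} {0} {s} {t} i₃ real
            where
            arc-uv = arc-present eρ (at-present⁻ 2 eρ cuρ cv h₁)
            w = proj₁ arc-uv
            q = proj₁ (proj₂ arc-uv)
            wcell : reals ρ 1 (evalⁿ ρ (at₀ 33 30)) ≡ w
            wcell = trans (cong (reals ρ 1) i₄) (proj₂ (proj₂ arc-uv))
            no-return : ¬ v ⟶* u
            no-return p = h₂ (at-present⁺ 6 eρ cv cuρ (reach⁺ rρ p))
            real : Realizes 0 s t (evalʳ ρ arcSum)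
            real cons =
              let (p , hp , lp) = entry (Grown.sound gr) _ h₃ 0 s u i₁ cons
                  (p' , hp' , lp') = entry (Grown.sound gr) _ h₄ 0 v t i₂ cons
                  a = along-arc w q
                  -- A common vertex would be reachable from `v` and would reach `u`, but the arc is
                  -- one without return.
                  disjoint : ∀ {x} → x ∈ˡ vs p → ¬ x ∈ˡ vs p'
                  disjoint m m' = let (_ , b , _) = splitAtVertex p m ; (b' , _) = splitAtVertex p' m' in no-return (b' ◅◅ b)
              in p ◅◅ (a ◅ p') ,
                 path-join p (a ◅ p') hp (All′.tabulate (λ m e → disjoint (end∈vs p) (subst (_∈ˡ vs p') (sym e) m)) ∷ hp')
                   (λ { m (here refl) → end∉inits p hp m ; m (there k) → disjoint (inits⊆vs p m) k }) ,
                 ≤ᵣ-trans (≤ᵣ-reflexive (wt-++ p (a ◅ p'))) (+ᵣ-mono-≤ lp (+ᵣ-mono-≤ (≤ᵣ-reflexive (sym wcell)) lp'))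

          hit : ∀ {w x y} → arc u v ≡ just w → ¬ v ⟶* u → Ent 4 2 0 σ s u x → Ent 4 2 0 σ v t y → AtMost (exec arcBody ρ) (ix 0 s t) (x +ᵣ (w +ᵣ y))
          hit {w} {x} {y} q nr h₁ h₂ = relaxWhen-hit arcTests (at₀ 31 32) arcSum ρ
            (at-present⁺ 2 eρ cuρ cv (proj₁ (present-arc eρ q)) ∷ (λ h → nr (reach⁻ rρ (at-present⁻ 6 eρ cv cuρ h))) ∷
             subst (λ j → 1 ≤ nats ρ 4 j) (sym i₁) (AtMost.finite k₁) ∷ subst (λ j → 1 ≤ nats ρ 4 j) (sym i₂) (AtMost.finite k₂) ∷ []) i₃
            (+ᵣ-mono-≤ (subst (λ j → reals ρ 2 j ≤ᵣ x) (sym i₁) (AtMost.below k₁))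
              (+ᵣ-mono-≤ (≤ᵣ-reflexive (trans (cong (reals ρ 1) i₄) (proj₂ (present-arc eρ q)))) (subst (λ j → reals ρ 2 j ≤ᵣ y) (sym i₂) (AtMost.below k₂))))
            where
            k₁ = preserve (Grown.decreasing gr) _ _ h₁
            k₂ = preserve (Grown.decreasing gr) _ _ h₂

        reach? : ∀ v → Dec (v ⟶* u)
        reach? v with 1 ≤? nats σ 6 (ix 0 v u)
        ... | yes h = yes (reach⁻ rσ h)
        ... | no h  = no (λ q → h (reach⁺ rσ q))

      arcRow-correct : SoundT 4 2 Realizes σ → LowBelow (toℕ u) (Ent 4 2 0 σ) →
        SoundT 4 2 Realizes (exec arcRow σ) × LowBelow (suc (toℕ u)) (Ent 4 2 0 (exec arcRow σ))
      arcRow-correct so low = proj₂ (proj₁ result) ,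
        leave {Ent 4 2 0 σ} {Ent 4 2 0 (exec arcRow σ)} u (λ h → preserve (proj₁ (proj₁ result)) _ _ h) reach?
          (λ {s} {v} {t} q nr h₁ h₂ → proj₂ result v s t (ix 0 s t) _ (λ ρ cv cs ct gr → hit v s t ρ cv cs ct gr q nr h₁ h₂)) low
        where
        result = for3-relax {30} {31} {32} {arcBody} (Tab Realizes) σ (size eσ) refl refl refl refl so
          (λ v s t ρ cv cs ct gr → relaxWhen-decreasing arcTests (at₀ 31 32) arcSum ρ ,
             relaxWhen-sound (Tab Realizes) arcTests (at₀ 31 32) arcSum ρ (value v s t ρ cv cs ct gr) (Grown.sound gr))

    arcs-correct : SoundT 4 2 Realizes σ₀ → LowBelow 0 (Ent 4 2 0 σ₀) →
      SoundT 4 2 Realizes (exec throughArcs σ₀) × LowBelow n (Ent 4 2 0 (exec throughArcs σ₀))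
    arcs-correct so low = for-rule {i = 33} {vertices} {arcRow} σ₀ n (size e) refl (λ k σ → SoundT 4 2 Realizes σ × LowBelow k (Ent 4 2 0 σ))
      (same-sound {σ = σ₀} (λ _ → refl) (λ _ → refl) so , λ p hp l → preserve (moved σ₀ 0) _ _ (low p hp l))
      (λ k σ k<n c fr (s , l) →
        let (s' , l') = arcRow-correct (fromℕ< k<n) σ (trans c (sym (toℕ-fromℕ< k<n))) fr s
                          (subst (λ z → LowBelow z (Ent 4 2 0 σ)) (sym (toℕ-fromℕ< k<n)) l)
        in same-sound {σ = exec arcRow σ} (λ _ → refl) (λ _ → refl) s' ,
           λ p hp low' → preserve (moved (exec arcRow σ) (nats (exec arcRow σ) 33 0 + 1)) _ _
             (subst (λ z → LowBelow (suc z) (Ent 4 2 0 (exec arcRow σ))) (toℕ-fromℕ< k<n) l' p hp low'))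
      where
      moved : ∀ σ k → Decreasing σ (setCounter 33 k σ)
      moved σ k = same-table (λ _ → refl) (λ _ → refl)

-- The whole program

decide afterMasks afterColours main : Command
-- Truncated subtraction turns a flag of at least 1 into the verdict 0 and the flag 0 into the
-- verdict 1.
decide = setN 3 (lit 0) (lit 1 ⊖ # 21)
afterMasks = check ⨟ throughSeparators ⨟ throughArcs ⨟ decide
afterColours = direct ⨟ powers ⨟ initialF ⨟ maskLoop ⨟ afterMasks
main = prelude ⨟ reachability ⨟ connectivity ⨟ separation ⨟ kruskal ⨟ cond (lit 1 ≤ⁿ # 21) decide (colourPairs ⨟ afterColours)

module Correct {ℝ : Reals} {n : ℕ} (G : MixedGraph ℝ n) where
  open Real ℝ
  open MixedGraph G
  open Walks G
  open Combine G
  open Forests G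
  open Relax {ℝ}
  open State
  open Stages G
  open Fills G
  open Static G
  open KruskalProgram G using (labelOf; treeWeight)
  open Direct G

  -- For n = 0 the fourth power vanishes, while every program takes at least one step; hence the
  -- restriction to `1 ≤ n`.
  InTime : Command → State ℝ → Set
  InTime p σ = ∀ k → 1 ≤ n → WeakBlocksHaveAtMost_NegativeTrees G k → cost p σ ≤ coefficient p * (2 ^ k * n ^ 4)

  Outcome : Command → State ℝ → Set
  Outcome p σ = SolvesAPSP G (exec p σ) × InTime p σ

  in-time-seq : ∀ p q σ → InTime p σ → InTime q (exec p σ) → InTime (p ⨟ q) σ
  in-time-seq p q σ f g k 1≤n w = ℕₚ.≤-trans (ℕₚ.+-mono-≤ (f k 1≤n w) (g k 1≤n w))
    (ℕₚ.≤-reflexive (sym (ℕₚ.*-distribʳ-+ (2 ^ k * n ^ 4) (coefficient p) (coefficient q))))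

  outcome-seq : ∀ p q σ → InTime p σ → Outcome q (exec p σ) → Outcome (p ⨟ q) σ
  outcome-seq p q σ f (s , g) = s , in-time-seq p q σ f g

  private
    1≤X : ∀ k → 1 ≤ n → 1 ≤ 2 ^ k * n ^ 4
    1≤X k 1≤n = ℕₚ.*-mono-≤ {1} {_} {1} (positive k) (power 4)
      where
      positive : ∀ k → 1 ≤ 2 ^ k
      positive zero    = ℕₚ.≤-refl
      positive (suc k) = ℕₚ.≤-trans (positive k) (ℕₚ.m≤m+n _ _)
      power : ∀ j → 1 ≤ n ^ j
      power zero    = ℕₚ.≤-refl
      power (suc j) = ℕₚ.*-mono-≤ {1} {_} {1} 1≤n (power j)

    branch-≤ : ∀ k → 1 ≤ n → ∀ c d {x} → x ≤ d * (2 ^ k * n ^ 4) → suc (c + x) ≤ (suc c + d) * (2 ^ k * n ^ 4)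
    branch-≤ k 1≤n c d {x} le = ℕₚ.≤-trans
      (ℕₚ.+-mono-≤ (subst (_≤ suc c * (2 ^ k * n ^ 4)) (ℕₚ.*-identityʳ _) (ℕₚ.*-monoʳ-≤ (suc c) (1≤X k 1≤n))) le)
      (ℕₚ.≤-reflexive (sym (ℕₚ.*-distribʳ-+ (2 ^ k * n ^ 4) (suc c) d)))

  outcome-cond : ∀ t p q σ → (⟦ t ⟧ σ → Outcome p σ) → (¬ ⟦ t ⟧ σ → Outcome q σ) → Outcome (cond t p q) σ
  outcome-cond t p q σ f g with test-correct t σ
  ... | inj₁ (h , e) rewrite e = proj₁ (f h) , λ k 1≤n w → branch-≤ k 1≤n (costᵗ t) (coefficient p + coefficient q)
          (ℕₚ.≤-trans (proj₂ (f h) k 1≤n w) (ℕₚ.*-monoˡ-≤ (2 ^ k * n ^ 4) (ℕₚ.m≤m+n (coefficient p) (coefficient q))))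
  ... | inj₂ (h , e) rewrite e = proj₁ (g h) , λ k 1≤n w → branch-≤ k 1≤n (costᵗ t) (coefficient p + coefficient q)
          (ℕₚ.≤-trans (proj₂ (g h) k 1≤n w) (ℕₚ.*-monoˡ-≤ (2 ^ k * n ^ 4) (ℕₚ.m≤n+m (coefficient q) (coefficient p))))

  -- Bounding the cost requires size cells that are not written, but the numbers of colours and
  -- masks are computed on the way. So the bound is shown for each stage separately and the
  -- coefficients are added.
  cheap : ∀ p σ → nats σ 0 0 ≡ n → writesN 0 p ≡ false →
    (∀ k → WeakBlocksHaveAtMost_NegativeTrees G k → uses colours p ≡ true → writesN 17 p ≡ false × nats σ 17 0 ≤ n) →
    (∀ k → WeakBlocksHaveAtMost_NegativeTrees G k → uses masks p ≡ true → writesN 18 p ≡ false × nats σ 18 0 ≤ 2 ^ k) →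
    (degree vertices p + degree colours p ≤ᵇ 4) ≡ true → (degree masks p ≤ᵇ 1) ≡ true → InTime p σ
  cheap p σ en w0 hc hm d₁ d₂ k 1≤n w = ℕₚ.≤-trans (cost-≤ v p σ bounded) (ℕₚ.≤-trans (bound-≤ v 1≤v p) (ℕₚ.*-monoʳ-≤ (coefficient p) small))
    where
    v : Size → ℕ
    v vertices = n
    v colours  = n
    v masks    = 2 ^ k
    1≤v : ∀ z → 1 ≤ v z
    1≤v vertices = 1≤n
    1≤v colours  = 1≤n
    1≤v masks    = ℕₚ.m^n>0 2 ⦃ _ ⦄ k
    bounded : Bounded v p σ
    bounded vertices _ = w0 , ℕₚ.≤-reflexive en
    bounded colours u  = hc k w u
    bounded masks u    = hm k w u
    a = degree vertices p
    b = degree colours p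
    c = degree masks p
    small : n ^ a * (n ^ b * (2 ^ k) ^ c) ≤ 2 ^ k * n ^ 4
    small = ℕₚ.≤-trans (ℕₚ.≤-reflexive (trans (sym (ℕₚ.*-assoc (n ^ a) (n ^ b) _)) (trans (cong (_* (2 ^ k) ^ c) (sym (ℕₚ.^-distribˡ-+-* n a b)))
              (ℕₚ.*-comm (n ^ (a + b)) ((2 ^ k) ^ c)))))
      (ℕₚ.*-mono-≤ {(2 ^ k) ^ c} {2 ^ k} {n ^ (a + b)} {n ^ 4}
        (ℕₚ.≤-trans (ℕₚ.^-monoʳ-≤ (2 ^ k) ⦃ >-nonZero (1≤v masks) ⦄ (ℕₚ.≤ᵇ⇒≤ c 1 (subst T (sym d₂) tt))) (ℕₚ.≤-reflexive (ℕₚ.^-identityʳ (2 ^ k))))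
        (ℕₚ.^-monoʳ-≤ n ⦃ >-nonZero 1≤n ⦄ (ℕₚ.≤ᵇ⇒≤ (a + b) 4 (subst T (sym d₁) tt))))

  record Known (σ : State ℝ) : Set where
    constructor known
    field
      environment : Env σ
      reach       : Reached σ
      slab′       : Slabs σ
      connect     : Connected σ
      separate′   : Separated σ
      square      : nats σ 20 0 ≡ n * n
  open Known

  keepsKnown : Command → Bool
  keepsKnown p = keepsInput p ∧ not (writesN 6 p ∨ writesN 11 p ∨ writesN 7 p ∨ writesN 12 p ∨ writesN 20 p)

  known-frame : ∀ p {σ τ} → keepsKnown p ≡ true → Frame p σ τ → Known σ → Known τ
  known-frame p k fr (known a b c d e f) =
    let w0 = not-true (∧-trueʳ {keepsInput p} k)
        w1 = ∨-falseʳ {writesN 6 p} w0 ; w2 = ∨-falseʳ {writesN 11 p} w1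
        w3 = ∨-falseʳ {writesN 7 p} w2 ; w4 = ∨-falseʳ {writesN 12 p} w3
    in known (env-frame p (∧-trueˡ k) fr a) (reached-frame p (∨-falseˡ w0) fr b) (slabs-frame p (∨-falseˡ w1) fr c)
             (connected-frame p (∨-falseˡ w2) fr d) (separated-frame p (∨-falseˡ w3) fr e) (trans (frameN fr 20 w4 0) f)

  Blank : List ℕ → State ℝ → Set
  Blank as σ = All (λ a → ∀ j → nats σ a j ≡ 0) as

  blank-frame : ∀ p {σ τ as} → All (λ a → writesN a p ≡ false) as → Frame p σ τ → Blank as σ → Blank as τ
  blank-frame p []       fr []       = []
  blank-frame p (w ∷ ws) fr (z ∷ zs) = (λ j → trans (frameN fr _ w j) (z j)) ∷ blank-frame p ws fr zs

  no-entries : ∀ {S f r} (σ : State ℝ) → (∀ j → nats σ f j ≡ 0) → Table.Sound f r S σ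
  no-entries σ z = Table.snd λ j p → ⊥-elim (ℕₚ.<-irrefl refl (subst (1 ≤_) (z j) p))

  module WithColours (F : Forest) (Cl : Colouring F) where
    open Forest F using (lab; W)
    open Colouring Cl using (col; K)
    open Masks G F Cl using (Ctx; ctx)
    open MaskSound G F Cl
    open FinalStages G using (Realizes; NegativeEntry; check-correct; module ThroughSeparators; module ThroughArcs)

    record Finished (σ : State ℝ) : Set₁ where
      field
        facts  : Known σ
        flag   : nats σ 21 0 ≡ 0
        sound₄ : SoundT 4 2 Realizes σ
        D₀     : Entries
        d₀     : (∀ {s x} → D₀ s s x → 0# ≤ᵣ x) → ∀ {s t} (p : s ⟶* t) → negs p ≡ [] → D₀ s t (wt p)
        total  : ∀ {m s t x} → m < 2 ^ K → Derivations.Der G F Cl D₀ m s t x → Ent 4 2 0 σ s t x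

    module AfterMasks (σe : State ℝ) (fin : Finished σe) where
      open Finished fin
      open Derivations G F Cl D₀ using (Der; der; nil; found; Found)

      private
        σf σg σh τ : State ℝ
        σf = exec check σe
        σg = exec throughSeparators σf
        σh = exec throughArcs σg
        τ = exec decide σh

        knownf : Known σf
        knownf = known-frame check refl (frame check σe) facts
        knowng : Known σg
        knowng = known-frame throughSeparators refl (frame throughSeparators σf) knownf

        flag-end : nats σh 21 0 ≡ nats σf 21 0
        flag-end = trans (frameN (frame throughArcs σg) 21 refl 0) (frameN (frame throughSeparators σf) 21 refl 0)

      -- With conservative weights the entry would be at least the weight of a path from `s` to
      -- itself, which is 0.
      negative-entry : NegativeEntry σe → ¬ Conservative G
      negative-entry (s , h , nle) cons =
        let (p , hp , le) = Table.entry sound₄ _ h 0 s s refl cons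
        in nle (subst (_≤ᵣ _) (path-closed p hp) le)

      module Nonneg (nonneg : ∀ (s : V) → 1 ≤ nats σe 4 (ix 0 s s) → 0# ≤ᵣ reals σe 2 (ix 0 s s)) where
        checked : ∀ {m s x} → m < 2 ^ K → Der m s s x → 0# ≤ᵣ x
        checked {m} {s} {x} lt d = ≤ᵣ-trans (nonneg s (Table.AtMost.finite e)) (Table.AtMost.below e)
          where e = total {m} {s} {s} lt d

        -- A walk without negative edges is a combination with the empty set of colours. Thus the
        -- check of the result also discharges the assumption under which the table without negative
        -- edges is complete.
        diagonal : ∀ {s x} → D₀ s s x → 0# ≤ᵣ x
        diagonal {s} {x} h = subst (0# ≤ᵣ_) (+ᵣ-identityʳ x) (checked {0} {s} (ℕₚ.m^n>0 2 ⦃ _ ⦄ K) (der h nil))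

        d₀-walk : ∀ {s t} (p : s ⟶* t) → negs p ≡ [] → D₀ s t (wt p)
        d₀-walk = d₀ (λ {s} → diagonal {s})

        open Checked F Cl D₀ d₀-walk checked using (conservative; in-block)

        private
          entry-f : ∀ {s t x} → Ent 4 2 0 σe s t x → Ent 4 2 0 σf s t x
          entry-f = Table.preserve (Table.decreasing-frame 4 2 check (frame check σe) refl refl) _ _

          module TS = ThroughSeparators σf (environment knownf) (reach knownf) (slab′ knownf) (connect knownf)
          module TA = ThroughArcs σg (environment knowng) (reach knowng)

          so4f : SoundT 4 2 Realizes σf
          so4f = Table.sound-frame 4 2 check (frame check σe) refl refl sound₄

          all-conn : ∀ {s t} → (∀ c → c ≢ s → c ≢ t → ¬ Conn c s t → toℕ c < 0) → ∀ c → c ≢ s → c ≢ t → Conn c s t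
          all-conn {s} {t} noseps c cs ct with TS.conn? c s t
          ... | yes h = h
          ... | no h  = case noseps c cs ct h of λ ()

          -- With no separating vertex the two ends are inseparable, so the path lies in one block
          -- and the combination found for it is in the result. For equal ends the trivial
          -- combination of weight 0 does.
          unseparated : SeparatedBelow 0 (Ent 4 2 0 σf)
          unseparated {s} {t} p hp back noseps = by-cases (s Finₚ.≟ t)
            where
            by-cases : Dec (s ≡ t) → Ent 4 2 0 σf s t (wt p)
            by-cases (yes refl) = entry-f {s} {s} (subst (Ent 4 2 0 σe s s) (trans (+ᵣ-identityˡ 0#) (sym (path-closed p hp)))
              (total {0} {s} {s} (ℕₚ.m^n>0 2 ⦃ _ ⦄ K) (der (d₀-walk (ε {x = s}) refl) nil)))
            by-cases (no s≢t) =
              let found d le lt _ = in-block s≢t (insep (p , back) (all-conn noseps)) p hp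
              in entry-f {s} {t} (Table.AtMost-weaken 4 2 le (total {s = s} {t} lt d))

          after-separators : SoundT 4 2 Realizes σg × SeparatedBelow n (Ent 4 2 0 σg)
          after-separators = TS.separators-correct so4f unseparated

          -- Without arcs between components the end of the path reaches its start, so both lie in
          -- one component, and all separators have been treated.
          low-start : LowBelow 0 (Ent 4 2 0 σg)
          low-start p hp low = proj₂ after-separators p hp (low-strong p low) (λ c _ _ _ → toℕ<n c)

          after-arcs : SoundT 4 2 Realizes σh × LowBelow n (Ent 4 2 0 σh)
          after-arcs = TA.arcs-correct (proj₁ after-separators) low-start

          complete : ∀ {s t} (p : s ⟶* t) → Path p → Ent 4 2 0 σh s t (wt p)
          complete p hp = proj₂ after-arcs p hp (low-all p)

          index-swap : ∀ (s t : V) → n * toℕ s + toℕ t ≡ ix 0 s t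
          index-swap s t = cong (_+ toℕ t) (ℕₚ.*-comm n (toℕ s))

        is-conservative : Conservative G
        is-conservative = conservative

        distance : ∀ s t → IsDistance G s t (outputDistance G τ s t)
        distance s t with nats τ 4 (n * toℕ s + toℕ t) in eq
        ... | zero = λ p hp → case subst (1 ≤_) (trans (cong (nats σh 4) (sym (index-swap s t))) eq) (Table.AtMost.finite (complete p hp)) of λ ()
        ... | suc k = (let (p , hp , le) = realized in p , hp , ≤ᵣ-antisym le (bounded p hp)) , bounded
          where
          bounded : ∀ (p : s ⟶* t) → Path p → reals σh 2 (n * toℕ s + toℕ t) ≤ᵣ wt p
          bounded p hp = subst (λ i → reals σh 2 i ≤ᵣ wt p) (sym (index-swap s t)) (Table.AtMost.below (complete p hp))
          realized : Σ (s ⟶* t) λ p → Path p × wt p ≤ᵣ reals σh 2 (n * toℕ s + toℕ t)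
          realized = Table.entry (proj₁ after-arcs) (n * toℕ s + toℕ t) (subst (1 ≤_) (sym eq) (s≤s z≤n)) 0 s t (index-swap s t) conservative

      afterMasks-solves : SolvesAPSP G τ
      afterMasks-solves = by-cases (check-correct σe (environment facts) flag)
        where
        by-cases : _ → SolvesAPSP G τ
        by-cases (inj₁ (bad , ne)) = inj₂ (ℕₚ.m≤n⇒m∸n≡0 (subst (1 ≤_) (sym flag-end) bad) , negative-entry ne)
        by-cases (inj₂ (good , nonneg)) = inj₁ (cong (1 ∸_) (trans flag-end good) , Nonneg.is-conservative nonneg , λ s t _ → Nonneg.distance nonneg s t)

    afterMasks-outcome : ∀ σ → Finished σ → Outcome afterMasks σ
    afterMasks-outcome σ fin = AfterMasks.afterMasks-solves σ fin ,
      cheap afterMasks σ (size (environment (Finished.facts fin))) refl (λ _ _ ()) (λ _ _ ()) refl refl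

    Bounds : Set
    Bounds = K ≤ n × (∀ {k} → WeakBlocksHaveAtMost_NegativeTrees G k → K ≤ k)

    Diagonal : State ℝ → Set
    Diagonal σ = ∀ {s x} → Ent 5 5 0 σ s s x → 0# ≤ᵣ x

    record Ready (as : List ℕ) (σ : State ℝ) : Set where
      field
        facts       : Known σ
        flag        : nats σ 21 0 ≡ 0
        colourCells : ∀ u v → nats σ 14 (ix 0 u v) ≡ col u v
        weightCells : ∀ u v → reals σ 22 (ix 0 u v) ≡ W u v
        K-cell      : nats σ 17 0 ≡ K
        blank       : Blank as σ

    keepsReady : Command → Bool
    keepsReady p = keepsKnown p ∧ not (writesN 21 p ∨ writesN 14 p ∨ writesR 22 p ∨ writesN 17 p)

    ready-frame : ∀ p {as bs σ τ} → keepsReady p ≡ true → Frame p σ τ → (Blank as σ → Blank bs τ) → Ready as σ → Ready bs τ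
    ready-frame p k fr bl r =
      let w0 = not-true (∧-trueʳ {keepsKnown p} k)
          w1 = ∨-falseʳ {writesN 21 p} w0 ; w2 = ∨-falseʳ {writesN 14 p} w1 ; w3 = ∨-falseʳ {writesR 22 p} w2
      in record { facts = known-frame p (∧-trueˡ k) fr facts ; flag = trans (frameN fr 21 (∨-falseˡ w0) 0) flag
                ; colourCells = λ u v → trans (frameN fr 14 (∨-falseˡ w1) _) (colourCells u v)
                ; weightCells = λ u v → trans (frameR fr 22 (∨-falseˡ w2) _) (weightCells u v)
                ; K-cell = trans (frameN fr 17 w3 0) K-cell ; blank = bl blank }
      where open Ready r

    record DirectDone (σ : State ℝ) : Set where
      field
        sound₅    : SoundT 5 5 S₅ σ
        complete₅ : Diagonal σ → ∀ {s t} (p : s ⟶* t) → negs p ≡ [] → Ent 5 5 0 σ s t (wt p)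

    direct-frame : ∀ p {σ τ} → writesN 5 p ≡ false → writesR 5 p ≡ false → Frame p σ τ → DirectDone σ → DirectDone τ
    direct-frame p {σ} {τ} wn wr fr d = record
      { sound₅ = Table.sound-frame 5 5 p fr wn wr sound₅
      ; complete₅ = λ dg {s} {t} q h → forth {s} {t} (complete₅ (λ {s} e → dg {s} (forth {s} {s} e)) q h) }
      where
      open DirectDone d
      forth : ∀ {s t x} → Ent 5 5 0 σ s t x → Ent 5 5 0 τ s t x
      forth = Table.preserve (Table.decreasing-frame 5 5 p fr wn wr) _ _

    Powers : State ℝ → Set
    Powers σ = nats σ 18 0 ≡ 2 ^ K × (∀ j → j ≤ K → nats σ 16 j ≡ 2 ^ j * (n * n))

    powers-frame : ∀ p {σ τ} → writesN 16 p ≡ false → writesN 18 p ≡ false → Frame p σ τ → Powers σ → Powers τ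
    powers-frame p w w' fr (a , b) = trans (frameN fr 18 w' 0) a , λ j le → trans (frameN fr 16 w j) (b j le)

    SoundF : State ℝ → Set
    SoundF σ = SoundT 8 8 Coloured σ × (∀ t → Ent 8 8 0 σ t t 0#)

    toCtx : ∀ {as σ} → Ready as σ → DirectDone σ → Powers σ → Ctx σ
    toCtx r d (m , p) = ctx (environment facts) (square facts) colourCells weightCells p K-cell m (DirectDone.sound₅ d)
      where open Ready r

    from-masks : ∀ σ → Bounds → Ready (9 ∷ 4 ∷ 15 ∷ 19 ∷ []) σ → DirectDone σ → Powers σ → SoundF σ → Outcome (maskLoop ⨟ afterMasks) σ
    from-masks σ (K≤n , K≤k) r d pw (so8 , base) = outcome-seq maskLoop afterMasks σ
      (cheap maskLoop σ (size (environment facts)) refl (λ _ _ _ → refl , subst (_≤ n) (sym K-cell) K≤n)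
        (λ k w _ → refl , ℕₚ.≤-trans (ℕₚ.≤-reflexive (proj₁ pw)) (ℕₚ.^-monoʳ-≤ 2 ⦃ _ ⦄ (K≤k w))) refl refl)
      (afterMasks-outcome (exec maskLoop σ) record
        { facts = known-frame maskLoop refl (frame maskLoop σ) facts
        ; flag = trans (frameN (frame maskLoop σ) 21 refl 0) flag
        ; sound₄ = Inv.so4 inv
        ; D₀ = Ent 5 5 0 σ
        ; d₀ = λ dg p h → DirectDone.complete₅ d (λ {s} → dg {s}) p h
        ; total = λ {m} {s} {t} lt h → proj₁ (Inv.done inv {m} {s} {t} lt h) })
      where
      open Ready r
      open MaskLoop G F Cl σ (toCtx r d pw) using (Inv; maskLoop-correct)
      inv : Inv (2 ^ K) (exec maskLoop σ)
      inv = maskLoop-correct (start blank)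
        where
        start : Blank (9 ∷ 4 ∷ 15 ∷ 19 ∷ []) σ → Inv 0 σ
        start (z9 ∷ z4 ∷ z15 ∷ z19 ∷ []) = record
          { off = z19 0 ; bits = λ i _ → trans (z15 i) (cong (Odometer.bitℕ {ℝ}) (sym (Bits.bit-zero i)))
          ; so8 = so8 ; so9 = no-entries σ z9 ; so4 = no-entries σ z4 ; base = base ; done = λ () }

    private
      clausesF : List Clause
      clausesF = (sameᵗ (# 30) (# 31) ∷ [] , zeroʳ) ∷ []

    from-F : ∀ σ → Bounds → Ready (8 ∷ 9 ∷ 4 ∷ 15 ∷ 19 ∷ []) σ → DirectDone σ → Powers σ → Outcome (initialF ⨟ maskLoop ⨟ afterMasks) σ
    from-F σ bd r d pw = outcome-seq initialF (maskLoop ⨟ afterMasks) σ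
      (cheap initialF σ (size (environment facts)) refl (λ _ _ ()) (λ _ _ ()) refl refl)
      (from-masks (exec initialF σ) bd
        (ready-frame initialF refl fr (λ { (_ ∷ zs) → blank-frame initialF (refl ∷ refl ∷ refl ∷ refl ∷ []) fr zs }) r)
        (direct-frame initialF refl refl fr d) (powers-frame initialF refl refl fr pw)
        (proj₁ (proj₂ filled) , λ t → proj₂ (proj₂ filled) (here refl) t t 0# λ ρ a b fr → (same⁺ ρ a b refl ∷ []) , ≤ᵣ-refl))
      where
      open Ready r
      fr = frame initialF σ
      module F₈ = Fill 8 8 (lit 0) clausesF 0 Coloured σ
      value : ∀ {ts e} → (ts , e) ∈ˡ clausesF → ∀ (s t : V) ρ → At 30 s ρ → At 31 t ρ → Frame initialF σ ρ → Holds ts ρ → Coloured 0 s t (evalʳ ρ e)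
      value (here refl) s t ρ a b fr (h ∷ []) with same⁻ ρ a b h
      ... | refl = ε , refl , [] , λ ()
      first-blank : ∀ {a as} → Blank (a ∷ as) σ → ∀ j → nats σ a j ≡ 0
      first-blank (z ∷ _) = z
      filled = F₈.fill-correct (environment facts) refl refl refl refl (λ _ _ → refl) value (no-entries σ (first-blank blank))

    from-powers : ∀ σ → Bounds → Ready (8 ∷ 9 ∷ 4 ∷ 15 ∷ 19 ∷ []) σ → DirectDone σ → Outcome (powers ⨟ initialF ⨟ maskLoop ⨟ afterMasks) σ
    from-powers σ bd r d = outcome-seq powers (initialF ⨟ maskLoop ⨟ afterMasks) σ
      (cheap powers σ (size (environment facts)) refl (λ _ _ _ → refl , subst (_≤ n) (sym K-cell) (proj₁ bd)) (λ _ _ ()) refl refl)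
      (from-F (exec powers σ) bd
        (ready-frame powers refl fr (blank-frame powers (refl ∷ refl ∷ refl ∷ refl ∷ refl ∷ []) fr) r)
        (direct-frame powers refl refl fr d)
        (trans (proj₁ (powers-correct σ)) (cong (2 ^_) K-cell) ,
         λ j le → trans (proj₂ (powers-correct σ) j (subst (j ≤_) (sym K-cell) le)) (cong (2 ^ j *_) (square facts))))
      where
      open Ready r
      fr = frame powers σ

    from-direct : ∀ σ → Bounds → Ready (5 ∷ 8 ∷ 9 ∷ 4 ∷ 15 ∷ 19 ∷ []) σ → Outcome afterColours σ
    from-direct σ bd r = outcome-seq direct (powers ⨟ initialF ⨟ maskLoop ⨟ afterMasks) σ
      (cheap direct σ (size (environment facts)) refl (λ _ _ ()) (λ _ _ ()) refl refl)
      (from-powers (exec direct σ) bd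
        (ready-frame direct refl fr (λ { (_ ∷ zs) → blank-frame direct (refl ∷ refl ∷ refl ∷ refl ∷ refl ∷ []) fr zs }) r)
        (record { sound₅ = direct-sound σ (environment facts) (first-blank blank)
                ; complete₅ = λ dg {s} {t} p h → direct-complete σ (environment facts) (first-blank blank) (λ {s} → dg {s}) p h }))
      where
      open Ready r
      fr = frame direct σ
      first-blank : ∀ {a as} → Blank (a ∷ as) σ → ∀ j → nats σ a j ≡ 0
      first-blank (z ∷ _) = z

module Total {ℝ : Reals} {n : ℕ} (G : MixedGraph ℝ n) where
  open Real ℝ
  open MixedGraph G
  open Walks G
  open Forests G
  open Relax {ℝ}
  open State
  open Stages G
  open Static G
  open KruskalProgram G using (labelOf; treeWeight)
  open Correct G

  work : List ℕ
  work = 5 ∷ 8 ∷ 9 ∷ 4 ∷ 15 ∷ 19 ∷ []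

  vertices-only : ∀ p σ → Env σ → writesN 0 p ≡ false → uses colours p ≡ false → uses masks p ≡ false →
    (degree vertices p + degree colours p ≤ᵇ 4) ≡ true → (degree masks p ≤ᵇ 1) ≡ true → InTime p σ
  vertices-only p σ e w nc nm = cheap p σ (size e) w (λ _ _ u → case trans (sym nc) u of λ ()) (λ _ _ u → case trans (sym nm) u of λ ())

  module AfterForest (σ : State ℝ) (kn : Known σ) (z21 : nats σ 21 0 ≡ 0) (F : Forest)
                     (labF : ∀ u → Forest.lab F u ≡ labelOf σ u) (WF : ∀ u v → Forest.W F u v ≡ treeWeight σ u v)
                     (z14 : ∀ j → nats σ 14 j ≡ 0) (z17 : ∀ j → nats σ 17 j ≡ 0) (bl : Blank work σ) where
    open Forest F using (lab)
    open Colours G lab using (colourPairs-correct; colourOf; Good)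

    τ : State ℝ
    τ = exec colourPairs σ

    coloured : Good (colourOf τ) (nats τ 17 0) × (∀ u v → Colours.TreePair G lab u v → 1 ≤ colourOf τ u v)
    coloured = colourPairs-correct σ (Known.environment kn) (Known.separate′ kn) (λ x → sym (labF x)) z14 (z17 0)

    colouring : Colouring F
    colouring = record
      { col = colourOf τ ; K = nats τ 17 0
      ; some = λ {u} {v} a b c → positive u v (proj₂ coloured u v (a , b , c))
      ; pair = Good.pair (proj₁ coloured) ; same = Good.same (proj₁ coloured) ; diff = Good.diff (proj₁ coloured) }
      where
      positive : ∀ u v → 1 ≤ colourOf τ u v → ∃[ j ] colourOf τ u v ≡ suc j × j < nats τ 17 0
      positive u v h = cases (colourOf τ u v) refl h
        where
        cases : ∀ x → colourOf τ u v ≡ x → 1 ≤ x → ∃[ j ] colourOf τ u v ≡ suc j × j < nats τ 17 0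
        cases (suc j) eq _ = j , eq , subst (_≤ nats τ 17 0) eq (Good.max (proj₁ coloured) u v)

    ≋? : ∀ u v → Dec (u ≋ v)
    ≋? u v = walk? u v ×-dec walk? v u
      where
      walk? : ∀ u v → Dec (u ⟶* v)
      walk? u v with 1 ≤? nats σ 6 (ix 0 u v)
      ... | yes h = yes (reach⁻ (Known.reach kn) h)
      ... | no h  = no (λ q → h (reach⁺ (Known.reach kn) q))

    insep? : ∀ u v → Dec (Insep u v)
    insep? u v with 1 ≤? nats σ 12 (ix 0 u v)
    ... | yes h = no (sep⁺ (Known.separate′ kn) h)
    ... | no h  = yes (sep⁻ (Known.separate′ kn) h)

    tight : WeakBlocks.Tight G ≋? insep? F colouring
    tight = Good.below (proj₁ coloured) , Good.top (proj₁ coloured)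

    open WithColours F colouring using (Ready; from-direct)

    ready : Ready work τ
    ready = record
      { facts = known-frame colourPairs refl fr kn
      ; flag = trans (frameN fr 21 refl 0) z21
      ; colourCells = λ _ _ → refl
      ; weightCells = λ u v → trans (frameR fr 22 refl _) (sym (WF u v))
      ; K-cell = refl
      ; blank = blank-frame colourPairs (refl ∷ refl ∷ refl ∷ refl ∷ refl ∷ refl ∷ []) fr bl }
      where fr = frame colourPairs σ

    outcome : Outcome (colourPairs ⨟ afterColours) σ
    outcome = outcome-seq colourPairs afterColours σ
      (vertices-only colourPairs σ (Known.environment kn) refl refl refl refl refl)
      (from-direct τ (WeakBlocks.colours-≤-vertices G ≋? insep? F colouring tight ,
                      WeakBlocks.colours-≤-trees G ≋? insep? F colouring tight) ready)

  branch : Command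
  branch = cond (lit 1 ≤ⁿ # 21) decide (colourPairs ⨟ afterColours)

  from-branch : ∀ σ → Known σ →
    ((1 ≤ nats σ 21 0 × ¬ Conservative G) ⊎
     (nats σ 21 0 ≡ 0 × Σ Forest λ F → (∀ u → Forest.lab F u ≡ labelOf σ u) × (∀ u v → Forest.W F u v ≡ treeWeight σ u v))) →
    Blank (14 ∷ 17 ∷ work) σ → Outcome branch σ
  from-branch σ kn (inj₁ (bad , nc)) _ = outcome-cond (lit 1 ≤ⁿ # 21) decide (colourPairs ⨟ afterColours) σ
    (λ _ → inj₂ (ℕₚ.m≤n⇒m∸n≡0 bad , nc) , vertices-only decide σ (Known.environment kn) refl refl refl refl refl)
    (λ h → ⊥-elim (h bad))
  from-branch σ kn (inj₂ (z , F , labF , WF)) (z14 ∷ z17 ∷ bl) = outcome-cond (lit 1 ≤ⁿ # 21) decide (colourPairs ⨟ afterColours) σ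
    (λ h → ⊥-elim (ℕₚ.<-irrefl refl (subst (1 ≤_) z h)))
    (λ _ → AfterForest.outcome σ kn z F labF WF z14 z17 bl)

  from-kruskal : ∀ σ → Known σ → (∀ j → reals σ 22 j ≡ 0#) → Blank (21 ∷ 14 ∷ 17 ∷ work) σ → Outcome (kruskal ⨟ branch) σ
  from-kruskal σ kn z22 (z21 ∷ bl) = outcome-seq kruskal branch σ
    (vertices-only kruskal σ (Known.environment kn) refl refl refl refl refl)
    (from-branch (exec kruskal σ) (known-frame kruskal refl fr kn)
      (KruskalCorrect.kruskal-correct G σ (Known.environment kn) (z21 0) z22)
      (blank-frame kruskal (refl ∷ refl ∷ refl ∷ refl ∷ refl ∷ refl ∷ refl ∷ refl ∷ []) fr bl))
    where fr = frame kruskal σ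

  from-separation : ∀ σ → Env σ → Reached σ → Slabs σ → Connected σ → nats σ 20 0 ≡ n * n → (∀ j → reals σ 22 j ≡ 0#) →
    Blank (12 ∷ 21 ∷ 14 ∷ 17 ∷ work) σ → Outcome (separation ⨟ kruskal ⨟ branch) σ
  from-separation σ e r sl c sq z22 (z12 ∷ bl) = outcome-seq separation (kruskal ⨟ branch) σ
    (vertices-only separation σ e refl refl refl refl refl)
    (from-kruskal (exec separation σ)
      (known (env-frame separation refl fr e) (reached-frame separation refl fr r) (slabs-frame separation refl fr sl)
        (connected-frame separation refl fr c) (separation-correct σ e r sl c z12) (trans (frameN fr 20 refl 0) sq))
      (λ j → trans (frameR fr 22 refl j) (z22 j))
      (blank-frame separation (refl ∷ refl ∷ refl ∷ refl ∷ refl ∷ refl ∷ refl ∷ refl ∷ refl ∷ []) fr bl))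
    where fr = frame separation σ

  from-connectivity : ∀ σ → Env σ → Reached σ → Slabs σ → nats σ 20 0 ≡ n * n → (∀ j → reals σ 22 j ≡ 0#) →
    Blank (7 ∷ 12 ∷ 21 ∷ 14 ∷ 17 ∷ work) σ → Outcome (connectivity ⨟ separation ⨟ kruskal ⨟ branch) σ
  from-connectivity σ e r sl sq z22 (z7 ∷ bl) = outcome-seq connectivity (separation ⨟ kruskal ⨟ branch) σ
    (vertices-only connectivity σ e refl refl refl refl refl)
    (from-separation (exec connectivity σ)
      (env-frame connectivity refl fr e) (reached-frame connectivity refl fr r) (slabs-frame connectivity refl fr sl)
      (connectivity-correct σ e r sl z7) (trans (frameN fr 20 refl 0) sq)
      (λ j → trans (frameR fr 22 refl j) (z22 j))
      (blank-frame connectivity (refl ∷ refl ∷ refl ∷ refl ∷ refl ∷ refl ∷ refl ∷ refl ∷ refl ∷ refl ∷ []) fr bl))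
    where fr = frame connectivity σ

  from-reachability : ∀ σ → Env σ → Slabs σ → nats σ 20 0 ≡ n * n → (∀ j → reals σ 22 j ≡ 0#) →
    Blank (6 ∷ 7 ∷ 12 ∷ 21 ∷ 14 ∷ 17 ∷ work) σ → Outcome (reachability ⨟ connectivity ⨟ separation ⨟ kruskal ⨟ branch) σ
  from-reachability σ e sl sq z22 (z6 ∷ bl) = outcome-seq reachability (connectivity ⨟ separation ⨟ kruskal ⨟ branch) σ
    (vertices-only reachability σ e refl refl refl refl refl)
    (from-connectivity (exec reachability σ)
      (env-frame reachability refl fr e) (reachability-correct σ e z6) (slabs-frame reachability refl fr sl)
      (trans (frameN fr 20 refl 0) sq)
      (λ j → trans (frameR fr 22 refl j) (z22 j))
      (blank-frame reachability (refl ∷ refl ∷ refl ∷ refl ∷ refl ∷ refl ∷ refl ∷ refl ∷ refl ∷ refl ∷ refl ∷ []) fr bl))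
    where fr = frame reachability σ

  matrixCell-ix : ∀ {A : Set} (M : V → V → Maybe A) u v → matrixCell M (ix 0 u v) ≡ M u v
  matrixCell-ix M u v with ix 0 u v <? n * n
  ... | yes lt = trans (cong (λ i → uncurry M (remQuot n i)) index) (cong (uncurry M) (Finₚ.remQuot-combine u v))
    where
    index : fromℕ< lt ≡ combine u v
    index = toℕ-injective (trans (toℕ-fromℕ< lt) (trans (cong (_+ toℕ v) (ℕₚ.*-comm (toℕ u) n)) (sym (Finₚ.toℕ-combine u v))))
  ... | no nlt = ⊥-elim (nlt (subst (_< n * n) (trans (Finₚ.toℕ-combine u v) (cong (_+ toℕ v) (ℕₚ.*-comm n (toℕ u)))) (toℕ<n (combine u v))))

  private
    σ₀ σ₁ σ₂ σ₃ : State ℝ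
    σ₀ = input G
    σ₁ = exec (multiples 10 0) σ₀
    σ₂ = exec (setN 20 (lit 0) (10 [ # 0 ])) σ₁
    σ₃ = exec prelude σ₀

    fr : Frame prelude σ₀ σ₃
    fr = frame prelude σ₀

    rows₁ : ∀ j → j ≤ n → nats σ₁ 10 j ≡ j * n
    rows₁ = multiples-correct 10 0 σ₀ refl refl refl refl refl refl

    size₁ : nats σ₁ 0 0 ≡ n
    size₁ = frameN (frame (multiples 10 0) σ₀) 0 refl 0

    square₂ : nats σ₂ 20 0 ≡ n * n
    square₂ = trans (cong (nats σ₁ 10) size₁) (rows₁ n ℕₚ.≤-refl)

    slabs₃ : ∀ j → j ≤ n → nats σ₃ 11 j ≡ j * (n * n)
    slabs₃ j le = trans (multiples-correct 11 20 σ₂ size₁ (frameN (frame (multiples 10 0) σ₀) 11 refl 0) refl refl refl refl j le)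
                        (cong (j *_) square₂)

    env₃ : Env σ₃
    env₃ = env (frameN fr 0 refl 0)
      (λ s → trans (frameN (frame (multiples 11 20) σ₂) 10 refl (toℕ s)) (rows₁ (toℕ s) (ℕₚ.<⇒≤ (toℕ<n s))))
      (λ u v → trans (frameN fr 1 refl _) (cong (presence G) (matrixCell-ix edge u v)))
      (λ u v → trans (frameR fr 0 refl _) (cong (fromMaybe 0#) (matrixCell-ix edge u v)))
      (λ u v → trans (frameN fr 2 refl _) (cong (presence G) (matrixCell-ix arc u v)))
      (λ u v → trans (frameR fr 1 refl _) (cong (fromMaybe 0#) (matrixCell-ix arc u v)))

  main-outcome : Outcome main (input G)
  main-outcome = outcome-seq prelude (reachability ⨟ connectivity ⨟ separation ⨟ kruskal ⨟ branch) σ₀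
    (cheap prelude σ₀ refl refl (λ _ _ ()) (λ _ _ ()) refl refl)
    (from-reachability σ₃ env₃ (slabs λ c → slabs₃ (toℕ c) (ℕₚ.<⇒≤ (toℕ<n c)))
      (trans (frameN (frame (multiples 11 20) σ₂) 20 refl 0) square₂)
      (λ j → frameR fr 22 refl j)
      (blank-frame prelude (refl ∷ refl ∷ refl ∷ refl ∷ refl ∷ refl ∷ refl ∷ refl ∷ refl ∷ refl ∷ refl ∷ refl ∷ []) fr
        ((λ _ → refl) ∷ (λ _ → refl) ∷ (λ _ → refl) ∷ (λ _ → refl) ∷ (λ _ → refl) ∷ (λ _ → refl) ∷ (λ _ → refl) ∷
         (λ _ → refl) ∷ (λ _ → refl) ∷ (λ _ → refl) ∷ (λ _ → refl) ∷ (λ _ → refl) ∷ [])))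

corollary10 : ∃[ prog ] ∃[ C ]
    ((ℝ : Reals) (n : ℕ) (G : MixedGraph ℝ n) →
    ∃[ τ ] ∃[ t ]
    Run prog (input G) τ t
    × SolvesAPSP G τ
    × (1 ≤ n → (k₂ : ℕ) → WeakBlocksHaveAtMost_NegativeTrees G k₂ →
    t ≤ C * (2 ^ k₂ * n ^ 4)))
corollary10 = compile main , coefficient main , λ ℝ n G →
  exec main (input G) , cost main (input G) , run main refl (input G) , proj₁ (Total.main-outcome G) ,
  λ 1≤n k₂ few → proj₂ (Total.main-outcome G) k₂ 1≤n few
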